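{- Fix integers $g\ge 1$ and $n\ge 1$, and let $t=2g+n-1$. For a tuple $\beta=(\beta_1,\ldots,\beta_n)$ of positive integers with $d=\beta_1+\cdots+\beta_n$, the number $\mathsf{H}^g_{d,d}(\beta)/(t!\,d)$ is given by a symmetric polynomial in $\beta_1,\ldots,\beta_n$ of highest degree $4g+n-3$ and lowest degree $2g+n-3$. For nonnegative integers $b_1,\ldots,b_n$ with $b=b_1+\cdots+b_n\ge 2g-3$ and $b+2k=4g+n-3$ for an integer $k\ge 0$, the coefficient of $\beta_1^{b_1}\cdots\beta_n^{b_n}$ satisfies $$(-1)^{\frac{4g-3+n-b}{2}}\langle\langle\tau_{b_1}\cdots\tau_{b_n}\Lambda_{2k}\rangle\rangle'_g=\mathbf{C}_{b,g,n}\,\widehat{\mathbf{C}}_g(b_1,\ldots,b_n),$$ where $$\widehat{\mathbf{C}}_g(b_1,\ldots,b_n)=[x^{2g+n-3}]\,(2g+n-3)!\,(b+3-2g)!\prod_{i=1}^n\frac{(x+1)^{b_i+1}-(x-1)^{b_i+1}}{(b_i+1)!}.$$ In particular, if $b+n$ is even then $\langle\langle\tau_{b_1}\cdots\tau_{b_n}\Lambda_{2k}\rangle\rangle'_g=0$. Moreover, if $b_1+\cdots+b_n=2g+n-3$, then $$\langle\langle\tau_{b_1}\cdots\tau_{b_n}\Lambda_{2g}\rangle\rangle'_g=(-1)^g\binom{2g+n-3}{b_1,\ldots,b_n}\frac{1-2^{2g-1}}{2^{2g-1}(2g)!}B_{2g}.$$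
   Context: For a partition $\beta=[1^{a_1},\ldots,d^{a_d}]\vdash d$ with $n$ parts (a tuple is identified with its sorted partition), $\mathrm{Aut}(\beta)=\prod_i a_i!$, and $\mathsf{H}^g_{d,d}(\beta)=\frac{\mathrm{Aut}(\beta)}{d!}N$ where $N$ is the number of tuples $(\sigma_0,\tau_1,\ldots,\tau_t,\sigma_{t+1})$ in $\mathfrak{S}_d$, $t=2g-1+n$, with $\sigma_0$ a $d$-cycle, each $\tau_i$ a transposition, $\sigma_{t+1}$ of cycle type $\beta$, and $\sigma_0\tau_1\cdots\tau_t\sigma_{t+1}$ equal to the identity (i.e., having $d$ cycles). For $b_i\ge0$, $k\ge 0$ with $b_1+\cdots+b_n+2k=4g-3+n$, define $\langle\langle\tau_{b_1}\cdots\tau_{b_n}\Lambda_{2k}\rangle\rangle'_g=(-1)^k[\beta_1^{b_1}\cdots\beta_n^{b_n}]\frac{\mathsf{H}^g_{d,d}(\beta)}{t!\,d}$ (coefficient in the polynomial above), and set it to $0$ otherwise. $\mathbf{C}_{b,g,n}=\frac{1}{(b+3-2g)!}\sum_{k=0}^{2g+n}\frac{1}{(k+2g-b-3)!}\frac{B_{2g+n-k}}{(2g+n-k)!2^k}$ with $1/r!=0$ for $r<0$, where $B_r$ are the Bernoulli numbers, $\frac{x}{e^x-1}=\sum_r B_r\frac{x^r}{r!}$. $[x^j]$ denotes coefficient extraction. -}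

module Defs where

open import Algebra.Definitions.RawSemiring using (_^_)
open import Data.Bool using (if_then_else_)
open import Data.Fin as Fin using (Fin; toℕ; punchIn)
open import Data.Fin.Permutation as Perm using (Permutation′; _⟨$⟩ʳ_; _∘ₚ_; insert; remove; transpose)
import Data.Fin.Properties as Fin
open import Data.Integer as ℤ using (ℤ; +_; -[1+_])
open import Data.List as List using (List; []; _∷_; allFin; cartesianProduct; cartesianProductWith; filter; length; upTo)
import Data.List.Membership.Propositional.Properties as ∈
import Data.List.Membership.Setoid as SetoidMembership
import Data.List.Membership.Setoid.Properties as SetoidMembership
open import Data.List.Relation.Unary.All using ([])
open import Data.List.Relation.Unary.AllPairs using ([]; _∷_)
open import Data.List.Relation.Unary.Any using (here)
import Data.List.Relation.Unary.Unique.Propositional.Properties as Unique≡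
import Data.List.Relation.Unary.Unique.Setoid as SetoidUnique
import Data.List.Relation.Unary.Unique.Setoid.Properties as SetoidUnique
open import Data.Nat as ℕ using (ℕ; zero; suc; _+_; _*_; _∸_; _≤_; _<_; _!)
open import Data.Nat.ListAction using (product)
import Data.Nat.Properties as ℕ
open import Data.Nat.GeneralisedArithmetic using (fold)
open import Data.Product using (∃; _×_; _,_)
open import Data.Rational as ℚ using (ℚ; 0ℚ; 1ℚ)
import Data.Rational.Properties as ℚ
open import Data.Vec as Vec using (Vec; []; _∷_; sum)
open import Data.Vec.Relation.Unary.All as All using (All)
open import Level using (0ℓ)
open import Relation.Binary using (Setoid)
open import Relation.Binary.PropositionalEquality
open import Relation.Nullary using (Dec; ⌊_⌋; _×-dec_; _→-dec_; ¬?)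
open import Relation.Unary using (Decidable)

fromℕ : ℕ → ℚ
fromℕ m = + m ℚ./ 1

-- Division by 0 gives 0.  Every divisor below is positive, except sum β when
-- β is empty, which n ≥ 1 excludes.
infixl 7 _/ₙ_
_/ₙ_ : ℚ → ℕ → ℚ
q /ₙ zero  = 0ℚ
q /ₙ suc m = q ℚ.* (+ 1 ℚ./ suc m)

-1^_ : ℕ → ℚ
-1^ k = _^_ ℚ.+-*-rawSemiring (ℚ.- 1ℚ) k

-- 1/r!, with 1/r! = 0 for r < 0.
1/_! : ℤ → ℚ
1/ (+ m) !    = 1ℚ /ₙ (m !)
1/ -[1+ _ ] ! = 0ℚ

∑≤ : ℕ → (ℕ → ℚ) → ℚ
∑≤ zero    f = f 0
∑≤ (suc m) f = f 0 ℚ.+ ∑≤ m (λ j → f (suc j))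

-- Formal power series in one variable x: s j is the coefficient [xʲ] s.
-- Polynomials in x are treated as power series.

Series : Set
Series = ℕ → ℚ

1ₛ : Series
1ₛ zero    = 1ℚ
1ₛ (suc _) = 0ℚ

infixl 7 _*ₛ_
_*ₛ_ : Series → Series → Series
(s *ₛ u) m = ∑≤ m (λ j → s j ℚ.* u (m ∸ j))

infixr 8 _^ₛ_
_^ₛ_ : Series → ℕ → Series
s ^ₛ zero  = 1ₛ
s ^ₛ suc k = s *ₛ (s ^ₛ k)

x+_ : ℚ → Series
(x+ a) 0             = a
(x+ a) 1             = 1ℚ
(x+ a) (suc (suc _)) = 0ℚ

dot : ∀ {m} → Series → Vec ℚ m → ℚ
dot s []       = 0ℚ
dot s (c ∷ cs) = s 0 ℚ.* c ℚ.+ dot (λ j → s (suc j)) cs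

-- Coefficients [xᵐ], …, [x¹], [x⁰] (in this order) of the reciprocal of a
-- series with constant term 1.
recip-coeffs : Series → (m : ℕ) → Vec ℚ (suc m)
recip-coeffs s zero    = 1ℚ ∷ []
recip-coeffs s (suc m) = ℚ.- dot (λ j → s (suc j)) (recip-coeffs s m) ∷ recip-coeffs s m

recip : Series → Series
recip s m = Vec.head (recip-coeffs s m)

recip-inverse : ∀ s → s 0 ≡ 1ℚ → ∀ m → (s *ₛ recip s) m ≡ 1ₛ m
recip-inverse s s₀≡1 zero = trans (ℚ.*-identityʳ (s 0)) s₀≡1
recip-inverse s s₀≡1 (suc m) = begin
  s 0 ℚ.* (ℚ.- D) ℚ.+ ∑≤ m (λ j → s (suc j) ℚ.* recip s (m ∸ j))
    ≡⟨ cong₂ (λ a c → a ℚ.* (ℚ.- D) ℚ.+ c) s₀≡1 (sym (dot-∑ m (λ j → s (suc j)))) ⟩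
  1ℚ ℚ.* (ℚ.- D) ℚ.+ D
    ≡⟨ cong (ℚ._+ D) (ℚ.*-identityˡ (ℚ.- D)) ⟩
  (ℚ.- D) ℚ.+ D
    ≡⟨ ℚ.+-inverseˡ D ⟩
  0ℚ ∎
  where
  open ≡-Reasoning
  D = dot (λ j → s (suc j)) (recip-coeffs s m)
  dot-∑ : ∀ m u → dot u (recip-coeffs s m) ≡ ∑≤ m (λ j → u j ℚ.* recip s (m ∸ j))
  dot-∑ zero    u = ℚ.+-identityʳ _
  dot-∑ (suc m) u = cong (u 0 ℚ.* recip s (suc m) ℚ.+_) (dot-∑ m (λ j → u (suc j)))

-- (eˣ - 1)/x
expm1/x : Series
expm1/x m = 1ℚ /ₙ (suc m !)

-- x/(eˣ - 1) = ∑ᵣ Bᵣ xʳ/r!, so that B₁ = -1/2.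
bernoulli : ℕ → ℚ
bernoulli r = fromℕ (r !) ℚ.* recip expm1/x r

-- Polynomials in n variables over ℚ, as finitely supported families of
-- coefficients indexed by exponent vectors

record Polynomial (n : ℕ) : Set where
  field
    coeff   : Vec ℕ n → ℚ
    bound   : ℕ
    bounded : ∀ b → coeff b ≢ 0ℚ → All (_≤ bound) b

open Polynomial public

∑box : (n D : ℕ) → (Vec ℕ n → ℚ) → ℚ
∑box zero    D f = f []
∑box (suc n) D f = ∑≤ D (λ j → ∑box n D (λ b → f (j ∷ b)))

monomial : ∀ {n} → Vec ℕ n → Vec ℕ n → ℕ
monomial b β = Vec.foldr′ _*_ 1 (Vec.zipWith ℕ._^_ β b)

evaluate : ∀ {n} → Polynomial n → Vec ℕ n → ℚ
evaluate {n} P β = ∑box n (bound P) (λ b → coeff P b ℚ.* fromℕ (monomial b β))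

Symmetric : ∀ {n} → Polynomial n → Set
Symmetric {n} P = ∀ (π : Permutation′ n) b →
  coeff P (Vec.tabulate (λ i → Vec.lookup b (π ⟨$⟩ʳ i))) ≡ coeff P b

HasHighestDegree : ∀ {n} → Polynomial n → ℕ → Set
HasHighestDegree P h =
  (∀ b → coeff P b ≢ 0ℚ → sum b ≤ h) × (∃ λ b → sum b ≡ h × coeff P b ≢ 0ℚ)

HasLowestDegree : ∀ {n} → Polynomial n → ℕ → Set
HasLowestDegree P l =
  (∀ b → coeff P b ≢ 0ℚ → l ≤ sum b) × (∃ λ b → sum b ≡ l × coeff P b ≢ 0ℚ)

permutationSetoid : ℕ → Setoid 0ℓ 0ℓ
permutationSetoid d = record
  { Carrier       = Permutation′ d
  ; _≈_           = Perm._≈_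
  ; isEquivalence = record
    { refl  = λ _ → refl
    ; sym   = λ p i → sym (p i)
    ; trans = λ p q i → trans (p i) (q i)
    }
  }

-- Every permutation exactly once, up to pointwise equality.
perms : (d : ℕ) → List (Permutation′ d)
perms zero    = Perm.id ∷ []
perms (suc d) = cartesianProductWith (insert Fin.zero) (allFin (suc d)) (perms d)

private
  insert₀-cong : ∀ {d} {i j : Fin (suc d)} {π ρ : Permutation′ d} →
                 i ≡ j → π Perm.≈ ρ → insert Fin.zero i π Perm.≈ insert Fin.zero j ρ
  insert₀-cong i≡j p Fin.zero    = i≡j
  insert₀-cong {i = i} {π = π} {ρ} refl p (Fin.suc k) = begin
    insert Fin.zero i π ⟨$⟩ʳ Fin.suc k ≡⟨ Perm.insert-punchIn Fin.zero i π k ⟩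
    punchIn i (π ⟨$⟩ʳ k)               ≡⟨ cong (punchIn i) (p k) ⟩
    punchIn i (ρ ⟨$⟩ʳ k)               ≡⟨ Perm.insert-punchIn Fin.zero i ρ k ⟨
    insert Fin.zero i ρ ⟨$⟩ʳ Fin.suc k ∎
    where open ≡-Reasoning

  insert₀-injective : ∀ {d} {i j : Fin (suc d)} {π ρ : Permutation′ d} →
                      insert Fin.zero i π Perm.≈ insert Fin.zero j ρ → i ≡ j × π Perm.≈ ρ
  insert₀-injective {i = i} {j} {π} {ρ} p with p Fin.zero
  ... | refl = refl , λ k → Fin.punchIn-injective i _ _ (begin
    punchIn i (π ⟨$⟩ʳ k)               ≡⟨ Perm.insert-punchIn Fin.zero i π k ⟨
    insert Fin.zero i π ⟨$⟩ʳ Fin.suc k ≡⟨ p (Fin.suc k) ⟩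
    insert Fin.zero i ρ ⟨$⟩ʳ Fin.suc k ≡⟨ Perm.insert-punchIn Fin.zero i ρ k ⟩
    punchIn i (ρ ⟨$⟩ʳ k)               ∎)
    where open ≡-Reasoning

perms-complete : ∀ d (π : Permutation′ d) → SetoidMembership._∈_ (permutationSetoid d) π (perms d)
perms-complete zero    π = here (λ ())
perms-complete (suc d) π =
  SetoidMembership.∈-resp-≈ (permutationSetoid (suc d))
    {x = insert Fin.zero (π ⟨$⟩ʳ Fin.zero) (remove Fin.zero π)} {y = π} (Perm.insert-remove Fin.zero π)
    (SetoidMembership.∈-cartesianProductWith⁺
      (setoid (Fin (suc d))) (permutationSetoid d) (permutationSetoid (suc d))
      (λ {i} {j} {ρ} {ρ′} → insert₀-cong {π = ρ} {ρ′})
      (∈.∈-allFin (π ⟨$⟩ʳ Fin.zero)) (perms-complete d (remove Fin.zero π)))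

perms-unique : ∀ d → SetoidUnique.Unique (permutationSetoid d) (perms d)
perms-unique zero    = [] ∷ []
perms-unique (suc d) =
  SetoidUnique.cartesianProductWith⁺
    (setoid (Fin (suc d))) (permutationSetoid d) (permutationSetoid (suc d))
    (insert Fin.zero) (λ {i} {j} {ρ} {ρ′} → insert₀-injective {π = ρ} {ρ′})
    (Unique≡.allFin⁺ (suc d)) (perms-unique d)

multiplicity : ℕ → List ℕ → ℕ
multiplicity m β = length (filter (m ℕ.≟_) β)

module _ {d : ℕ} (π : Permutation′ d) where

  -- A cycle has at most d elements, so exponents below d reach all of it.
  SameCycle : Fin d → Fin d → Set
  SameCycle i j = ∃ λ (k : Fin d) → fold i (π ⟨$⟩ʳ_) (toℕ k) ≡ j

  sameCycle? : ∀ i j → Dec (SameCycle i j)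
  sameCycle? i j = Fin.any? (λ k → fold i (π ⟨$⟩ʳ_) (toℕ k) Fin.≟ j)

  IsLeast : Fin d → Set
  IsLeast i = ∀ j → SameCycle i j → i Fin.≤ j

  isLeast? : Decidable IsLeast
  isLeast? i = Fin.all? (λ j → sameCycle? i j →-dec (i Fin.≤? j))

  -- Each cycle, fixed points included, contributes once, through its least
  -- element.
  cycleLengths : List ℕ
  cycleLengths = List.map (λ i → length (filter (sameCycle? i) (allFin d)))
                          (filter isLeast? (allFin d))

  -- For a partition β = [1^{a₁}, …, d^{a_d}] of d: the permutation has exactly
  -- aₘ cycles of length m for each 1 ≤ m ≤ d.
  HasCycleType : List ℕ → Set
  HasCycleType β = ∀ (m : Fin d) →
    multiplicity (suc (toℕ m)) cycleLengths ≡ multiplicity (suc (toℕ m)) β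

  hasCycleType? : Decidable HasCycleType
  hasCycleType? β = Fin.all? λ m →
    multiplicity (suc (toℕ m)) cycleLengths ℕ.≟ multiplicity (suc (toℕ m)) β

  IsTransposition : Set
  IsTransposition = ∃ λ i → ∃ λ j → i ≢ j × π Perm.≈ transpose i j

  isTransposition? : Dec IsTransposition
  isTransposition? = Fin.any? λ i → Fin.any? λ j →
    ¬? (i Fin.≟ j) ×-dec Fin.all? λ k → (π ⟨$⟩ʳ k) Fin.≟ (transpose i j ⟨$⟩ʳ k)

words : ∀ {A : Set} → List A → (t : ℕ) → List (Vec A t)
words xs zero    = [] ∷ []
words xs (suc t) = cartesianProductWith _∷_ xs (words xs t)

-- (σ₀ , (τ₁ , … , τ_t) , σ_{t+1})
Tuple : ℕ → ℕ → Set
Tuple d t = Permutation′ d × Vec (Permutation′ d) t × Permutation′ d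

IsFactorisation : ∀ {d t} → List ℕ → Tuple d t → Set
IsFactorisation {d} β (σ₀ , τs , σ) =
    HasCycleType σ₀ (d ∷ [])
  × All IsTransposition τs
  × HasCycleType σ β
  × (σ₀ ∘ₚ (Vec.foldr′ _∘ₚ_ Perm.id τs ∘ₚ σ)) Perm.≈ Perm.id

isFactorisation? : ∀ {d t} β → Decidable (IsFactorisation {d} {t} β)
isFactorisation? {d} β (σ₀ , τs , σ) =
        hasCycleType? σ₀ (d ∷ [])
  ×-dec All.all? isTransposition? τs
  ×-dec hasCycleType? σ β
  ×-dec Fin.all? (λ i → ((σ₀ ∘ₚ (Vec.foldr′ _∘ₚ_ Perm.id τs ∘ₚ σ)) ⟨$⟩ʳ i) Fin.≟ i)

factorisations : (d t : ℕ) → List ℕ → ℕ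
factorisations d t β = length (filter (isFactorisation? β)
  (cartesianProduct (perms d) (cartesianProduct (words (perms d) t) (perms d))))

-- ∏ aᵢ! over 1 ≤ i ≤ d, where aᵢ is the multiplicity of i in β ⊢ d.
Aut : ∀ {n} → Vec ℕ n → ℕ
Aut β = product (List.map (λ i → multiplicity (suc i) (Vec.toList β) !) (upTo (sum β)))

-- H^g_{d,d}(β) with d = sum β
hurwitz : ∀ {n} → ℕ → Vec ℕ n → ℚ
hurwitz {n} g β =
  fromℕ (Aut β * factorisations (sum β) (2 * g + n ∸ 1) (Vec.toList β)) /ₙ (sum β !)

IsHurwitzPolynomial : ∀ {n} → ℕ → Polynomial n → Set
IsHurwitzPolynomial {n} g P = ∀ β → All (0 <_) β →
  evaluate P β ≡ hurwitz g β /ₙ ((2 * g + n ∸ 1) ! * sum β)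

-- ⟨⟨τ_{b₁} ⋯ τ_{bₙ} Λ_{2k}⟩⟩′_g, read off the polynomial P.
bracket : ∀ {n} → ℕ → Polynomial n → Vec ℕ n → ℕ → ℚ
bracket {n} g P b k =
  if ⌊ sum b + 2 * k ℕ.≟ 4 * g + n ∸ 3 ⌋
  then (-1^ k) ℚ.* coeff P b
  else 0ℚ

𝐂 : (b g n : ℕ) → ℚ
𝐂 b g n =
  1/ (+ b ℤ.+ + 3 ℤ.- + (2 * g)) ! ℚ.*
  ∑≤ (2 * g + n) (λ k →
    1/ (+ (k + 2 * g) ℤ.- + b ℤ.- + 3) ! ℚ.*
    (bernoulli (2 * g + n ∸ k) /ₙ ((2 * g + n ∸ k) ! * 2 ℕ.^ k)))

-- ((x+1)^{b+1} - (x-1)^{b+1}) / (b+1)!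
factor : ℕ → Series
factor b j = (((x+ 1ℚ) ^ₛ suc b) j ℚ.- ((x+ (ℚ.- 1ℚ)) ^ₛ suc b) j) /ₙ (suc b !)

Ĉ : ∀ {n} → ℕ → Vec ℕ n → ℚ
Ĉ {n} g b =
  fromℕ ((2 * g + n ∸ 3) ! * (sum b + 3 ∸ 2 * g) !) ℚ.*
  Vec.foldr′ _*ₛ_ 1ₛ (Vec.map factor b) (2 * g + n ∸ 3)

-- m!/(b₁! ⋯ bₙ!), a multinomial coefficient when sum b ≡ m.
multinomial : ∀ {n} → ℕ → Vec ℕ n → ℚ
multinomial m b = fromℕ (m !) /ₙ Vec.foldr′ _*_ 1 (Vec.map _! b)

{-# OPTIONS --safe #-}
-- Let ς(b) = 2 sinh(bx/2).  For a permutation π of d elements with cycle lengths λ, the number of ways to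
-- write π as a d-cycle followed by t transpositions is t! dᵗ⁻¹ [xᵗ] T(λ), where T(λ) = ∏ ς(λᵢ) / ς(1).
-- Indeed, multiplying by a transposition cuts or joins cycles, and summing T over all the results gives
-- d T′(λ), because ς(1) makes the cuts of a cycle telescope while the addition theorem handles the joins.
-- Multiplication by the sum of all transpositions is self-adjoint, and the class of β has
-- d!/(Aut(β) ∏ βᵢ) elements, so the Hurwitz number divided by t! d is
--   d²ᵍ⁺ⁿ⁻³ [x²ᵍ] ∏ 𝒮(βᵢx) / 𝒮(x),  𝒮(x) = sinh(x/2)/(x/2).
-- Expanding dᴹ = M! [yᴹ] ∏ exp(βᵢy) exhibits this as a polynomial whose coefficient of βᵇ is a product of
-- a coefficient of 1/𝒮 (zero in odd degree, and nonzero in even degree by a Riccati equation for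
-- x coth x) and of the multinomial expression Ĉ; the identity 1/𝒮(x) = eˣᐟ² x/(eˣ - 1) yields 𝐂.

module Submission where

open import Defs
open import Data.Nat using (ℕ; _+_; _*_; _∸_; _^_; _≤_; _!; _/_)
open import Data.Nat.Divisibility using (_∣_)
open import Data.Product using (∃; _×_)
open import Data.Rational as ℚ using (ℚ; 0ℚ; 1ℚ)
open import Data.Vec using (Vec; sum)
open import Relation.Binary.PropositionalEquality using (_≡_)

open import Algebra.Bundles using (CommutativeRing)
import Algebra.Definitions.RawSemiring as RawSemiring
import Algebra.Properties.CommutativeMonoid.Sum as CommutativeMonoidSum
import Algebra.Solver.Ring as Solver
import Algebra.Solver.Ring.AlmostCommutativeRing as SolverRing
open import Data.Bool using (if_then_else_)
open import Data.Empty using (⊥)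
open import Data.Fin as Fin using (Fin; toℕ)
open import Data.Fin.Permutation as Perm using (Permutation′; _⟨$⟩ʳ_; _⟨$⟩ˡ_; _∘ₚ_; transpose; lift₀; insert; remove)
import Data.Fin.Permutation.Components as PC
import Data.Fin.Permutation.Transposition.List as Transpositions
import Data.Fin.Properties as Fin
import Data.Integer as ℤ
import Data.Integer.Properties as ℤ
open import Data.List as List using (List; []; _∷_; _++_; length; allFin; filter; concat)
open import Data.List.Membership.Propositional using (_∈_)
import Data.List.Membership.Propositional.Properties as ∈
import Data.List.Properties as List
open import Data.List.Relation.Binary.Permutation.Propositional as ↭ using (_↭_; ↭-refl; ↭-sym; ↭-trans; prep; swap)
import Data.List.Relation.Binary.Permutation.Propositional.Properties as ↭
import Data.List.Relation.Binary.Permutation.Setoid.Properties as ↭ₛ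
open import Data.List.Relation.Unary.All as All using (All; []; _∷_)
import Data.List.Relation.Unary.All.Properties as All
open import Data.List.Relation.Unary.AllPairs using (AllPairs; []; _∷_)
open import Data.List.Relation.Unary.Any using (Any; here; there)
open import Data.List.Relation.Unary.Unique.Propositional using (Unique)
import Data.List.Relation.Unary.Unique.Propositional.Properties as Unique
open import Data.Maybe using (just; nothing)
open import Data.Nat as ℕ using (zero; suc; _<_; NonZero; z≤n; s≤s)
import Data.Nat.DivMod as ℕ
open import Data.Nat.Divisibility using (divides; _∣?_; ∣m+n∣m⇒∣n; m∣m*n)
open import Data.Nat.GeneralisedArithmetic using (fold)
open import Data.Nat.ListAction using (product) renaming (sum to sumᴸ)
import Data.Nat.ListAction.Properties as ℕ
import Data.Nat.Properties as ℕ
import Data.Nat.Tactic.RingSolver as ℕSolver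
open import Data.Product using (_,_; proj₁; proj₂)
open import Data.Rational using () renaming (_+_ to infixl 6 _⊕_; _*_ to infixl 7 _⊗_; -_ to infix 8 ⊖_; _-_ to infixl 6 _⊝_)
import Data.Rational.Properties as ℚ
import Data.Rational.Unnormalised as ℚᵘ
import Data.Rational.Unnormalised.Properties as ℚᵘ
open import Data.Sum using (_⊎_; inj₁; inj₂)
open import Data.Vec as Vec using ([]; _∷_)
open import Data.Vec.Relation.Unary.All as VAll using ([]; _∷_)
open import Function using (_∘_; id)
open import Level using (0ℓ)
open import Relation.Binary using (IsEquivalence; WeaklyDecidable; tri<; tri≈; tri>)
open import Relation.Binary.PropositionalEquality using (_≢_; refl; sym; trans; cong; cong₂; subst; setoid; module ≡-Reasoning)
import Relation.Binary.Reasoning.Setoid as SetoidReasoning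
open import Relation.Nullary using (Dec; yes; no; ¬_; does; contradiction; ⌊_⌋; _×-dec_)
open import Relation.Nullary.Decidable using (dec-true; dec-false; from-no)
open import Relation.Unary using (Decidable; Pred)
import Tactic.RingSolver as RingSolver
import Tactic.RingSolver.Core.AlmostCommutativeRing as ACR

-- Three obstacles shape the proof. First, ς(1) has no constant term and hence no inverse among
-- power series: the quotient T is built by dropping one coefficient of the numerator and
-- multiplying by 1/𝒮, and identities for T are proved after multiplication by ς(1) and x, both of
-- which can be cancelled. Secondly, permutations are compared only pointwise and cycle types are
-- found by a search. Explicit lists of cycles mediate; a function of permutations must respect
-- pointwise equality, a function of cycle types must respect reordering, and sums over all
-- permutations are reindexed by means of indicator functions. Thirdly, the claims concern every
-- polynomial with the right values at positive integers. One such polynomial is written down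
-- through its coefficients, and vanishing at all positive integer points is shown to force zero
-- coefficients, so that any other one agrees with it.

ℚ-ring : ACR.AlmostCommutativeRing 0ℓ 0ℓ
ℚ-ring = ACR.fromCommutativeRing ℚ.+-*-commutativeRing isZero
  where
  isZero : ∀ q → _
  isZero q with 0ℚ ℚ.≟ q
  ... | yes p = just p
  ... | no  _ = nothing

-- Rational arithmetic with natural denominators

fromℕ-+ : ∀ m n → fromℕ (m + n) ≡ fromℕ m ⊕ fromℕ n
fromℕ-+ m n = ℚ.toℚᵘ-injective (ℚᵘ.≃-trans (ℚ.toℚᵘ-fromℚᵘ (ℚᵘ.mkℚᵘ (ℤ.+ (m + n)) 0))
  (ℚᵘ.≃-trans eq
  (ℚᵘ.≃-trans (ℚᵘ.≃-sym (ℚᵘ.+-cong (ℚ.toℚᵘ-fromℚᵘ (ℚᵘ.mkℚᵘ (ℤ.+ m) 0)) (ℚ.toℚᵘ-fromℚᵘ (ℚᵘ.mkℚᵘ (ℤ.+ n) 0))))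
    (ℚᵘ.≃-sym (ℚ.toℚᵘ-homo-+ (fromℕ m) (fromℕ n))))))
  where
  eq : ℚᵘ.mkℚᵘ (ℤ.+ (m + n)) 0 ℚᵘ.≃ (ℚᵘ.mkℚᵘ (ℤ.+ m) 0 ℚᵘ.+ ℚᵘ.mkℚᵘ (ℤ.+ n) 0)
  eq = ℚᵘ.*≡* (cong (ℤ._* ℤ.+ 1) (sym (cong₂ ℤ._+_ (ℤ.*-identityʳ (ℤ.+ m)) (ℤ.*-identityʳ (ℤ.+ n)))))

fromℕ-* : ∀ m n → fromℕ (m * n) ≡ fromℕ m ⊗ fromℕ n
fromℕ-* zero    n = sym (ℚ.*-zeroˡ (fromℕ n))
fromℕ-* (suc m) n = begin
  fromℕ (n + m * n)                 ≡⟨ fromℕ-+ n (m * n) ⟩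
  fromℕ n ⊕ fromℕ (m * n)           ≡⟨ cong (fromℕ n ⊕_) (fromℕ-* m n) ⟩
  fromℕ n ⊕ fromℕ m ⊗ fromℕ n       ≡⟨ lem (fromℕ n) (fromℕ m) ⟩
  (1ℚ ⊕ fromℕ m) ⊗ fromℕ n          ≡⟨ cong (_⊗ fromℕ n) (fromℕ-+ 1 m) ⟨
  fromℕ (suc m) ⊗ fromℕ n           ∎
  where
  open ≡-Reasoning
  lem : ∀ a b → a ⊕ b ⊗ a ≡ (1ℚ ⊕ b) ⊗ a
  lem = RingSolver.solve-∀ ℚ-ring

infixr 8 _^ℚ_
-- The power behind `-1^_`, so that `-1^ k` unfolds to `(⊖ 1ℚ) ^ℚ k`.
_^ℚ_ : ℚ → ℕ → ℚ
_^ℚ_ = RawSemiring._^_ ℚ.+-*-rawSemiring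

fromℕ-^ : ∀ m k → fromℕ (m ^ k) ≡ fromℕ m ^ℚ k
fromℕ-^ m zero    = refl
fromℕ-^ m (suc k) = trans (fromℕ-* m (m ^ k)) (cong (fromℕ m ⊗_) (fromℕ-^ m k))

-- Since `/ₙ` sends division by 0 to 0, `inv 0` is `0ℚ` and `inv` is multiplicative on all of ℕ.
inv : ℕ → ℚ
inv m = 1ℚ /ₙ m

/ₙ-inv : ∀ q m → q /ₙ m ≡ q ⊗ inv m
/ₙ-inv q zero    = sym (ℚ.*-zeroʳ q)
/ₙ-inv q (suc m) = cong (q ⊗_) (sym (ℚ.*-identityˡ _))

*-inv : ∀ m .{{_ : NonZero m}} → fromℕ m ⊗ inv m ≡ 1ℚ
*-inv (suc m) = trans (cong (fromℕ (suc m) ⊗_) (ℚ.*-identityˡ _))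
  (ℚ.toℚᵘ-injective (ℚᵘ.≃-trans (ℚ.toℚᵘ-homo-* (fromℕ (suc m)) (ℤ.+ 1 ℚ./ suc m))
  (ℚᵘ.≃-trans (ℚᵘ.*-cong (ℚ.toℚᵘ-fromℚᵘ (ℚᵘ.mkℚᵘ (ℤ.+ suc m) 0)) (ℚ.toℚᵘ-fromℚᵘ (ℚᵘ.mkℚᵘ (ℤ.+ 1) m)))
    (ℚᵘ.*≡* eq))))
  where
  eq : (ℤ.+ suc m ℤ.* ℤ.+ 1) ℤ.* ℤ.+ 1 ≡ ℤ.+ 1 ℤ.* ℤ.+ (1 * suc m)
  eq rewrite ℤ.*-identityʳ (ℤ.+ suc m ℤ.* ℤ.+ 1) | ℤ.*-identityʳ (ℤ.+ suc m)
           | ℤ.*-identityˡ (ℤ.+ (1 * suc m)) = cong ℤ.+_ (sym (ℕ.*-identityˡ (suc m)))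

inv-unique : ∀ m .{{_ : NonZero m}} q → fromℕ m ⊗ q ≡ 1ℚ → q ≡ inv m
inv-unique m q eq = begin
  q                          ≡⟨ ℚ.*-identityˡ q ⟨
  1ℚ ⊗ q                     ≡⟨ cong (_⊗ q) (*-inv m) ⟨
  fromℕ m ⊗ inv m ⊗ q        ≡⟨ lem (fromℕ m) (inv m) q ⟩
  inv m ⊗ (fromℕ m ⊗ q)      ≡⟨ cong (inv m ⊗_) eq ⟩
  inv m ⊗ 1ℚ                 ≡⟨ ℚ.*-identityʳ (inv m) ⟩
  inv m                      ∎
  where
  open ≡-Reasoning
  lem : ∀ a b c → a ⊗ b ⊗ c ≡ b ⊗ (a ⊗ c)
  lem = RingSolver.solve-∀ ℚ-ring

inv-* : ∀ m n → inv (m * n) ≡ inv m ⊗ inv n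
inv-* zero    n       = sym (ℚ.*-zeroˡ (inv n))
inv-* (suc m) zero    = trans (cong inv (ℕ.*-zeroʳ m)) (sym (ℚ.*-zeroʳ (inv (suc m))))
inv-* (suc m) (suc n) = sym (inv-unique (suc m * suc n) _ (begin
  fromℕ (suc m * suc n) ⊗ (inv (suc m) ⊗ inv (suc n))
    ≡⟨ cong (_⊗ (inv (suc m) ⊗ inv (suc n))) (fromℕ-* (suc m) (suc n)) ⟩
  fromℕ (suc m) ⊗ fromℕ (suc n) ⊗ (inv (suc m) ⊗ inv (suc n))
    ≡⟨ lem (fromℕ (suc m)) (fromℕ (suc n)) (inv (suc m)) (inv (suc n)) ⟩
  (fromℕ (suc m) ⊗ inv (suc m)) ⊗ (fromℕ (suc n) ⊗ inv (suc n))
    ≡⟨ cong₂ _⊗_ (*-inv (suc m)) (*-inv (suc n)) ⟩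
  1ℚ ∎))
  where
  open ≡-Reasoning
  lem : ∀ a b c d → a ⊗ b ⊗ (c ⊗ d) ≡ (a ⊗ c) ⊗ (b ⊗ d)
  lem = RingSolver.solve-∀ ℚ-ring

inv-^ : ∀ m k → inv (m ^ k) ≡ inv m ^ℚ k
inv-^ m zero    = refl
inv-^ m (suc k) = trans (inv-* m (m ^ k)) (cong (inv m ⊗_) (inv-^ m k))

*-inv-cancel : ∀ m .{{_ : NonZero m}} q → inv m ⊗ (fromℕ m ⊗ q) ≡ q
*-inv-cancel m q = begin
  inv m ⊗ (fromℕ m ⊗ q)  ≡⟨ lem (inv m) (fromℕ m) q ⟩
  fromℕ m ⊗ inv m ⊗ q    ≡⟨ cong (_⊗ q) (*-inv m) ⟩
  1ℚ ⊗ q                 ≡⟨ ℚ.*-identityˡ q ⟩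
  q                      ∎
  where
  open ≡-Reasoning
  lem : ∀ a b c → a ⊗ (b ⊗ c) ≡ b ⊗ a ⊗ c
  lem = RingSolver.solve-∀ ℚ-ring

fromℕ-cancel : ∀ m .{{_ : NonZero m}} {p q} → fromℕ m ⊗ p ≡ fromℕ m ⊗ q → p ≡ q
fromℕ-cancel m {p} {q} eq = trans (sym (*-inv-cancel m p)) (trans (cong (inv m ⊗_) eq) (*-inv-cancel m q))

n!≢0 : ∀ m → NonZero (m !)
n!≢0 m = ℕ.>-nonZero (ℕ.1≤n! m)

inv! : ℕ → ℚ
inv! m = inv (m !)

inv!-suc : ∀ m → fromℕ (suc m) ⊗ inv! (suc m) ≡ inv! m
inv!-suc m = begin
  fromℕ (suc m) ⊗ inv (suc m * m !)             ≡⟨ cong (fromℕ (suc m) ⊗_) (inv-* (suc m) (m !)) ⟩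
  fromℕ (suc m) ⊗ (inv (suc m) ⊗ inv (m !))     ≡⟨ ℚ.*-assoc (fromℕ (suc m)) (inv (suc m)) (inv (m !)) ⟨
  fromℕ (suc m) ⊗ inv (suc m) ⊗ inv (m !)       ≡⟨ cong (_⊗ inv (m !)) (*-inv (suc m)) ⟩
  1ℚ ⊗ inv (m !)                                ≡⟨ ℚ.*-identityˡ _ ⟩
  inv! m                                        ∎
  where open ≡-Reasoning

-- Finite sums over initial segments of ℕ

∑-cong : ∀ m {f h : ℕ → ℚ} → (∀ j → j ≤ m → f j ≡ h j) → ∑≤ m f ≡ ∑≤ m h
∑-cong zero    eq = eq 0 z≤n
∑-cong (suc m) eq = cong₂ _⊕_ (eq 0 z≤n) (∑-cong m (λ j j≤m → eq (suc j) (s≤s j≤m)))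

∑-zero : ∀ m {f : ℕ → ℚ} → (∀ j → j ≤ m → f j ≡ 0ℚ) → ∑≤ m f ≡ 0ℚ
∑-zero zero    eq = eq 0 z≤n
∑-zero (suc m) eq = trans (cong₂ _⊕_ (eq 0 z≤n) (∑-zero m (λ j j≤m → eq (suc j) (s≤s j≤m)))) (ℚ.+-identityˡ 0ℚ)

⊕-interchange : ∀ a b c d → (a ⊕ b) ⊕ (c ⊕ d) ≡ (a ⊕ c) ⊕ (b ⊕ d)
⊕-interchange = RingSolver.solve-∀ ℚ-ring

∑-⊕ : ∀ m f h → ∑≤ m (λ j → f j ⊕ h j) ≡ ∑≤ m f ⊕ ∑≤ m h
∑-⊕ zero    f h = refl
∑-⊕ (suc m) f h = trans (cong (f 0 ⊕ h 0 ⊕_) (∑-⊕ m (f ∘ suc) (h ∘ suc)))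
  (⊕-interchange (f 0) (h 0) (∑≤ m (f ∘ suc)) (∑≤ m (h ∘ suc)))

∑-distribˡ : ∀ m c f → c ⊗ ∑≤ m f ≡ ∑≤ m (λ j → c ⊗ f j)
∑-distribˡ zero    c f = refl
∑-distribˡ (suc m) c f = trans (ℚ.*-distribˡ-+ c (f 0) (∑≤ m (f ∘ suc))) (cong (c ⊗ f 0 ⊕_) (∑-distribˡ m c (f ∘ suc)))

∑-distribʳ : ∀ m c f → ∑≤ m f ⊗ c ≡ ∑≤ m (λ j → f j ⊗ c)
∑-distribʳ zero    c f = refl
∑-distribʳ (suc m) c f = trans (ℚ.*-distribʳ-+ c (f 0) (∑≤ m (f ∘ suc))) (cong (f 0 ⊗ c ⊕_) (∑-distribʳ m c (f ∘ suc)))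

∑-swap : ∀ m k (f : ℕ → ℕ → ℚ) → ∑≤ m (λ i → ∑≤ k (f i)) ≡ ∑≤ k (λ j → ∑≤ m (λ i → f i j))
∑-swap zero    k f = refl
∑-swap (suc m) k f = trans (cong (∑≤ k (f 0) ⊕_) (∑-swap m k (f ∘ suc))) (sym (∑-⊕ k (f 0) _))

∑-last : ∀ m f → ∑≤ (suc m) f ≡ ∑≤ m f ⊕ f (suc m)
∑-last zero    f = refl
∑-last (suc m) f = trans (cong (f 0 ⊕_) (∑-last m (f ∘ suc))) (sym (ℚ.+-assoc (f 0) _ _))

-- Formal power series

-- A record, so that both sides can be inferred from an equality proof.
infix 4 _≈ₛ_
record _≈ₛ_ (s u : Series) : Set where
  constructor coeffs
  field at : ∀ m → s m ≡ u m
open _≈ₛ_ public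

infixl 6 _+ₛ_
_+ₛ_ : Series → Series → Series
(s +ₛ u) m = s m ⊕ u m

infix 8 -ₛ_
-ₛ_ : Series → Series
(-ₛ s) m = ⊖ s m

0ₛ : Series
0ₛ _ = 0ℚ

const : ℚ → Series
const q zero    = q
const q (suc _) = 0ℚ

infixl 7 _·_
_·_ : ℚ → Series → Series
(q · s) m = q ⊗ s m

tail : Series → Series
tail s m = s (suc m)

*ₛ-cong : ∀ {s s′ u u′} → s ≈ₛ s′ → u ≈ₛ u′ → s *ₛ u ≈ₛ s′ *ₛ u′
*ₛ-cong p q .at m = ∑-cong m (λ j _ → cong₂ _⊗_ (p .at j) (q .at (m ∸ j)))

*ₛ-distribʳ : ∀ s u v → (u +ₛ v) *ₛ s ≈ₛ u *ₛ s +ₛ v *ₛ s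
*ₛ-distribʳ s u v .at m = trans (∑-cong m (λ j _ → ℚ.*-distribʳ-+ (s (m ∸ j)) (u j) (v j))) (∑-⊕ m _ _)

·-*ₛ : ∀ q s u → (q · s) *ₛ u ≈ₛ q · (s *ₛ u)
·-*ₛ q s u .at m = trans (∑-cong m (λ j _ → ℚ.*-assoc q (s j) (u (m ∸ j)))) (sym (∑-distribˡ m q _))

-- `_*ₛ_` peels off the first coefficient of the left factor. Peeling off the last one instead gives
-- the mirror image of that recursion, from which commutativity follows by induction.
*ₛ-suc : ∀ s u m → (s *ₛ u) (suc m) ≡ (s *ₛ tail u) m ⊕ s (suc m) ⊗ u 0
*ₛ-suc s u zero    = refl
*ₛ-suc s u (suc m) = trans (cong (s 0 ⊗ u (suc (suc m)) ⊕_) (*ₛ-suc (tail s) u m)) (sym (ℚ.+-assoc (s 0 ⊗ u (suc (suc m))) ((tail s *ₛ tail u) m) (s (suc (suc m)) ⊗ u 0)))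

*ₛ-comm : ∀ s u → s *ₛ u ≈ₛ u *ₛ s
*ₛ-comm s u .at zero    = ℚ.*-comm (s 0) (u 0)
*ₛ-comm s u .at (suc m) = begin
  s 0 ⊗ u (suc m) ⊕ (tail s *ₛ u) m   ≡⟨ ℚ.+-comm (s 0 ⊗ u (suc m)) ((tail s *ₛ u) m) ⟩
  (tail s *ₛ u) m ⊕ s 0 ⊗ u (suc m)   ≡⟨ cong₂ _⊕_ (*ₛ-comm (tail s) u .at m) (ℚ.*-comm (s 0) (u (suc m))) ⟩
  (u *ₛ tail s) m ⊕ u (suc m) ⊗ s 0   ≡⟨ *ₛ-suc u s m ⟨
  (u *ₛ s) (suc m)                    ∎
  where open ≡-Reasoning

*ₛ-assoc : ∀ s u v → (s *ₛ u) *ₛ v ≈ₛ s *ₛ (u *ₛ v)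
*ₛ-assoc s u v .at zero    = ℚ.*-assoc (s 0) (u 0) (v 0)
*ₛ-assoc s u v .at (suc m) = begin
  -- By definition the tail of a product is `s 0 · tail u +ₛ tail s *ₛ u`.
  s 0 ⊗ u 0 ⊗ v (suc m) ⊕ ((s 0 · tail u +ₛ tail s *ₛ u) *ₛ v) m
    ≡⟨ cong (s 0 ⊗ u 0 ⊗ v (suc m) ⊕_) (*ₛ-distribʳ v (s 0 · tail u) (tail s *ₛ u) .at m) ⟩
  s 0 ⊗ u 0 ⊗ v (suc m) ⊕ (((s 0 · tail u) *ₛ v) m ⊕ ((tail s *ₛ u) *ₛ v) m)
    ≡⟨ cong₂ (λ a b → s 0 ⊗ u 0 ⊗ v (suc m) ⊕ (a ⊕ b)) (·-*ₛ (s 0) (tail u) v .at m) (*ₛ-assoc (tail s) u v .at m) ⟩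
  s 0 ⊗ u 0 ⊗ v (suc m) ⊕ (s 0 ⊗ (tail u *ₛ v) m ⊕ (tail s *ₛ (u *ₛ v)) m)
    ≡⟨ lem (s 0) (u 0) (v (suc m)) _ _ ⟩
  s 0 ⊗ (u 0 ⊗ v (suc m) ⊕ (tail u *ₛ v) m) ⊕ (tail s *ₛ (u *ₛ v)) m ∎
  where
  open ≡-Reasoning
  lem : ∀ a b c x y → a ⊗ b ⊗ c ⊕ (a ⊗ x ⊕ y) ≡ a ⊗ (b ⊗ c ⊕ x) ⊕ y
  lem = RingSolver.solve-∀ ℚ-ring

const-*ₛ : ∀ q s → const q *ₛ s ≈ₛ q · s
const-*ₛ q s .at zero    = refl
const-*ₛ q s .at (suc m) = trans (cong (q ⊗ s (suc m) ⊕_) (∑-zero m (λ j _ → ℚ.*-zeroˡ (s (m ∸ j))))) (ℚ.+-identityʳ _)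

1ₛ≈const : 1ₛ ≈ₛ const 1ℚ
1ₛ≈const .at zero    = refl
1ₛ≈const .at (suc _) = refl

*ₛ-identityˡ : ∀ s → 1ₛ *ₛ s ≈ₛ s
*ₛ-identityˡ s .at m = begin
  (1ₛ *ₛ s) m        ≡⟨ *ₛ-cong {u = s} 1ₛ≈const (coeffs λ _ → refl) .at m ⟩
  (const 1ℚ *ₛ s) m  ≡⟨ const-*ₛ 1ℚ s .at m ⟩
  1ℚ ⊗ s m           ≡⟨ ℚ.*-identityˡ (s m) ⟩
  s m                ∎
  where open ≡-Reasoning

≈ₛ-isEquivalence : IsEquivalence _≈ₛ_
≈ₛ-isEquivalence = record
  { refl = coeffs λ _ → refl
  ; sym = λ p → coeffs λ m → sym (p .at m)
  ; trans = λ p q → coeffs λ m → trans (p .at m) (q .at m) }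

seriesRing : CommutativeRing 0ℓ 0ℓ
seriesRing = record
  { Carrier = Series ; _≈_ = _≈ₛ_ ; _+_ = _+ₛ_ ; _*_ = _*ₛ_ ; -_ = -ₛ_ ; 0# = 0ₛ ; 1# = 1ₛ
  ; isCommutativeRing = record
    { isRing = record
      { +-isAbelianGroup = record
        { isGroup = record
          { isMonoid = record
            { isSemigroup = record
              { isMagma = record
                { isEquivalence = ≈ₛ-isEquivalence
                ; ∙-cong = λ p q → coeffs λ m → cong₂ _⊕_ (p .at m) (q .at m) }
              ; assoc = λ s u v → coeffs λ m → ℚ.+-assoc (s m) (u m) (v m) }
            ; identity = (λ s → coeffs λ m → ℚ.+-identityˡ (s m)) , (λ s → coeffs λ m → ℚ.+-identityʳ (s m)) }
          ; inverse = (λ s → coeffs λ m → ℚ.+-inverseˡ (s m)) , (λ s → coeffs λ m → ℚ.+-inverseʳ (s m))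
          ; ⁻¹-cong = λ p → coeffs λ m → cong ⊖_ (p .at m) }
        ; comm = λ s u → coeffs λ m → ℚ.+-comm (s m) (u m) }
      ; *-cong = *ₛ-cong
      ; *-assoc = *ₛ-assoc
      ; *-identity = *ₛ-identityˡ , (λ s → ≈ₛ.trans (*ₛ-comm s 1ₛ) (*ₛ-identityˡ s))
      ; distrib = (λ s u v → coeffs λ m → trans (*ₛ-comm s (u +ₛ v) .at m)
                    (trans (*ₛ-distribʳ s u v .at m) (cong₂ _⊕_ (*ₛ-comm u s .at m) (*ₛ-comm v s .at m))))
                , *ₛ-distribʳ }
    ; *-comm = *ₛ-comm } }
  where module ≈ₛ = IsEquivalence ≈ₛ-isEquivalence

module 𝕊 = CommutativeRing seriesRing
module ≈ₛ-Reasoning = SetoidReasoning 𝕊.setoid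

-- Makes rational scalars the coefficients of the ring solver, which can then compute with constants
-- such as `con ℚ.½` inside identities of series.
const-homomorphism : ℚ.+-*-rawRing SolverRing.-Raw-AlmostCommutative⟶ SolverRing.fromCommutativeRing seriesRing
const-homomorphism = record
  { ⟦_⟧ = const
  ; +-homo = λ p q → coeffs λ { zero → refl ; (suc m) → refl }
  ; *-homo = λ p q → coeffs λ { zero → refl ; (suc m) → sym (trans (const-*ₛ p (const q) .at (suc m)) (ℚ.*-zeroʳ p)) }
  ; -‿homo = λ p → coeffs λ { zero → refl ; (suc m) → refl }
  ; 0-homo = coeffs λ { zero → refl ; (suc m) → refl }
  ; 1-homo = 𝕊.sym 1ₛ≈const
  }

const-≟ : WeaklyDecidable (SolverRing.Induced-equivalence const-homomorphism)
const-≟ p q with p ℚ.≟ q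
... | yes refl = just 𝕊.refl
... | no  _    = nothing

open module SeriesSolver = Solver ℚ.+-*-rawRing (SolverRing.fromCommutativeRing seriesRing) const-homomorphism const-≟
  using (_:+_; _:*_; :-_; _:=_; con) renaming (solve to solveₛ)

const-+ : ∀ p q → const (p ⊕ q) ≈ₛ const p +ₛ const q
const-+ = SolverRing._-Raw-AlmostCommutative⟶_.+-homo const-homomorphism

const-neg : ∀ p → const (⊖ p) ≈ₛ -ₛ const p
const-neg = SolverRing._-Raw-AlmostCommutative⟶_.-‿homo const-homomorphism

*-congˡ : ∀ s {u v} → u ≈ₛ v → s *ₛ u ≈ₛ s *ₛ v
*-congˡ s p = *ₛ-cong {s} 𝕊.refl p

*-congʳ : ∀ s {u v} → u ≈ₛ v → u *ₛ s ≈ₛ v *ₛ s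
*-congʳ s p = *ₛ-cong {u = s} p 𝕊.refl

+-congˡ : ∀ s {u v} → u ≈ₛ v → s +ₛ u ≈ₛ s +ₛ v
+-congˡ s p .at m = cong (s m ⊕_) (p .at m)

+-congʳ : ∀ s {u v} → u ≈ₛ v → u +ₛ s ≈ₛ v +ₛ s
+-congʳ s p .at m = cong (_⊕ s m) (p .at m)

+-cong : ∀ {s u v w} → s ≈ₛ u → v ≈ₛ w → s +ₛ v ≈ₛ u +ₛ w
+-cong p q .at m = cong₂ _⊕_ (p .at m) (q .at m)

-‿cong : ∀ {s u} → s ≈ₛ u → -ₛ s ≈ₛ -ₛ u
-‿cong p .at m = cong ⊖_ (p .at m)

const-cong : ∀ {p q} → p ≡ q → const p ≈ₛ const q
const-cong refl = 𝕊.refl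

const-0 : const 0ℚ ≈ₛ 0ₛ
const-0 = SolverRing._-Raw-AlmostCommutative⟶_.0-homo const-homomorphism

const-* : ∀ p q → const (p ⊗ q) ≈ₛ const p *ₛ const q
const-* = SolverRing._-Raw-AlmostCommutative⟶_.*-homo const-homomorphism

-- Shifts, the Euler operator, and exponential series

shift : Series → Series
shift s zero    = 0ℚ
shift s (suc m) = s m

shift-cong : ∀ {s u} → s ≈ₛ u → shift s ≈ₛ shift u
shift-cong p .at zero    = refl
shift-cong p .at (suc m) = p .at m

shift-*ₛ : ∀ s u → shift s *ₛ u ≈ₛ shift (s *ₛ u)
shift-*ₛ s u .at zero    = ℚ.*-zeroˡ (u 0)
shift-*ₛ s u .at (suc m) = trans (cong (_⊕ (s *ₛ u) m) (ℚ.*-zeroˡ (u (suc m)))) (ℚ.+-identityˡ _)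

X : Series
X = shift 1ₛ

X-*ₛ : ∀ s → X *ₛ s ≈ₛ shift s
X-*ₛ s = 𝕊.trans (shift-*ₛ 1ₛ s) (shift-cong (𝕊.*-identityˡ s))

X-cancel : ∀ {s u} → X *ₛ s ≈ₛ X *ₛ u → s ≈ₛ u
X-cancel {s} {u} p .at m = trans (sym (X-*ₛ s .at (suc m))) (trans (p .at (suc m)) (X-*ₛ u .at (suc m)))

·≈const : ∀ q s → q · s ≈ₛ const q *ₛ s
·≈const q s = 𝕊.sym (const-*ₛ q s)

-- The Euler operator x d/dx.
θ : Series → Series
θ s m = fromℕ m ⊗ s m

θ-cong : ∀ {s u} → s ≈ₛ u → θ s ≈ₛ θ u
θ-cong p .at m = cong (fromℕ m ⊗_) (p .at m)

θ-+ : ∀ s u → θ (s +ₛ u) ≈ₛ θ s +ₛ θ u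
θ-+ s u .at m = ℚ.*-distribˡ-+ (fromℕ m) (s m) (u m)

θ-neg : ∀ s → θ (-ₛ s) ≈ₛ -ₛ θ s
θ-neg s .at m = lem (fromℕ m) (s m)
  where
  lem : ∀ a b → a ⊗ (⊖ b) ≡ ⊖ (a ⊗ b)
  lem = RingSolver.solve-∀ ℚ-ring

θ-1ₛ : θ 1ₛ ≈ₛ 0ₛ
θ-1ₛ .at zero    = refl
θ-1ₛ .at (suc m) = ℚ.*-zeroʳ (fromℕ (suc m))

θ-*ₛ : ∀ s u → θ (s *ₛ u) ≈ₛ θ s *ₛ u +ₛ s *ₛ θ u
θ-*ₛ s u .at m = begin
  fromℕ m ⊗ (s *ₛ u) m
    ≡⟨ ∑-distribˡ m (fromℕ m) _ ⟩
  ∑≤ m (λ j → fromℕ m ⊗ (s j ⊗ u (m ∸ j)))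
    ≡⟨ ∑-cong m (λ j j≤m → trans (cong (_⊗ (s j ⊗ u (m ∸ j)))
         (trans (cong fromℕ (sym (ℕ.m+[n∸m]≡n j≤m))) (fromℕ-+ j (m ∸ j))))
         (lem (fromℕ j) (fromℕ (m ∸ j)) (s j) (u (m ∸ j)))) ⟩
  ∑≤ m (λ j → θ s j ⊗ u (m ∸ j) ⊕ s j ⊗ θ u (m ∸ j))
    ≡⟨ ∑-⊕ m _ _ ⟩
  (θ s *ₛ u +ₛ s *ₛ θ u) m ∎
  where
  open ≡-Reasoning
  lem : ∀ a b x y → (a ⊕ b) ⊗ (x ⊗ y) ≡ a ⊗ x ⊗ y ⊕ x ⊗ (b ⊗ y)
  lem = RingSolver.solve-∀ ℚ-ring

E : ℚ → Series
E a m = a ^ℚ m ⊗ inv! m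

E-cong : ∀ {a b} → a ≡ b → E a ≈ₛ E b
E-cong refl = 𝕊.refl

θ-E : ∀ a → θ (E a) ≈ₛ const a *ₛ (X *ₛ E a)
θ-E a = 𝕊.trans eq (𝕊.trans (·≈const a (shift (E a))) (*-congˡ (const a) (𝕊.sym (X-*ₛ (E a)))))
  where
  lem : ∀ n a p i → n ⊗ (a ⊗ p ⊗ i) ≡ a ⊗ (p ⊗ (n ⊗ i))
  lem = RingSolver.solve-∀ ℚ-ring
  eq : θ (E a) ≈ₛ a · shift (E a)
  eq .at zero    = trans (ℚ.*-zeroˡ (E a 0)) (sym (ℚ.*-zeroʳ a))
  eq .at (suc m) = trans (lem (fromℕ (suc m)) a (a ^ℚ m) (inv! (suc m)))
                         (cong (λ z → a ⊗ (a ^ℚ m ⊗ z)) (inv!-suc m))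

-- The equation reads (m + 1) s(m + 1) = a s(m), so the constant term determines the rest. The
-- exponential law `E-+` follows from it by the Leibniz rule, in place of a binomial sum.
θ-unique : ∀ {s u} a → s 0 ≡ u 0 → θ s ≈ₛ const a *ₛ (X *ₛ s) → θ u ≈ₛ const a *ₛ (X *ₛ u) → s ≈ₛ u
θ-unique {s} {u} a s₀≡u₀ p q = coeffs go
  where
  rec : ∀ v → θ v ≈ₛ const a *ₛ (X *ₛ v) → ∀ m → fromℕ (suc m) ⊗ v (suc m) ≡ a ⊗ v m
  rec v eq m = trans (eq .at (suc m)) (trans (const-*ₛ a (X *ₛ v) .at (suc m)) (cong (a ⊗_) (X-*ₛ v .at (suc m))))
  go : ∀ m → s m ≡ u m
  go zero    = s₀≡u₀
  go (suc m) = fromℕ-cancel (suc m) (trans (rec s p m) (trans (cong (a ⊗_) (go m)) (sym (rec u q m))))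

E-+ : ∀ a b → E (a ⊕ b) ≈ₛ E a *ₛ E b
E-+ a b = θ-unique (a ⊕ b) refl (θ-E (a ⊕ b)) (begin
  θ (E a *ₛ E b)
    ≈⟨ θ-*ₛ (E a) (E b) ⟩
  θ (E a) *ₛ E b +ₛ E a *ₛ θ (E b)
    ≈⟨ +-cong (*-congʳ (E b) (θ-E a)) (*-congˡ (E a) (θ-E b)) ⟩
  const a *ₛ (X *ₛ E a) *ₛ E b +ₛ E a *ₛ (const b *ₛ (X *ₛ E b))
    ≈⟨ solveₛ 5 (λ a b x u v → a :* (x :* u) :* v :+ u :* (b :* (x :* v)) := (a :+ b) :* (x :* (u :* v))) 𝕊.refl
         (const a) (const b) X (E a) (E b) ⟩
  (const a +ₛ const b) *ₛ (X *ₛ (E a *ₛ E b))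
    ≈⟨ *-congʳ (X *ₛ (E a *ₛ E b)) (𝕊.sym (const-+ a b)) ⟩
  const (a ⊕ b) *ₛ (X *ₛ (E a *ₛ E b)) ∎)
  where open ≈ₛ-Reasoning

E-0 : E 0ℚ ≈ₛ 1ₛ
E-0 .at zero    = refl
E-0 .at (suc m) = trans (cong (_⊗ inv! (suc m)) (ℚ.*-zeroˡ (0ℚ ^ℚ m))) (ℚ.*-zeroˡ (inv! (suc m)))

-- 2 sinh(ax) and 2 cosh(ax).
sn cs : ℚ → Series
sn a = E a +ₛ -ₛ E (⊖ a)
cs a = E a +ₛ E (⊖ a)

sn-cong : ∀ {a b} → a ≡ b → sn a ≈ₛ sn b
sn-cong refl = 𝕊.refl

cs-cong : ∀ {a b} → a ≡ b → cs a ≈ₛ cs b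
cs-cong refl = 𝕊.refl

θ-sn : ∀ a → θ (sn a) ≈ₛ const a *ₛ (X *ₛ cs a)
θ-sn a = begin
  θ (sn a)                         ≈⟨ θ-+ (E a) (-ₛ E (⊖ a)) ⟩
  θ (E a) +ₛ θ (-ₛ E (⊖ a))        ≈⟨ +-congˡ (θ (E a)) (θ-neg (E (⊖ a))) ⟩
  θ (E a) +ₛ -ₛ θ (E (⊖ a))        ≈⟨ +-cong (θ-E a) (-‿cong (θ-E (⊖ a))) ⟩
  const a *ₛ (X *ₛ E a) +ₛ -ₛ (const (⊖ a) *ₛ (X *ₛ E (⊖ a)))
    ≈⟨ +-congˡ (const a *ₛ (X *ₛ E a)) (-‿cong (*-congʳ (X *ₛ E (⊖ a)) (const-neg a))) ⟩
  const a *ₛ (X *ₛ E a) +ₛ -ₛ (-ₛ const a *ₛ (X *ₛ E (⊖ a)))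
    ≈⟨ solveₛ 4 (λ a x u v → a :* (x :* u) :+ :- (:- a :* (x :* v)) := a :* (x :* (u :+ v))) 𝕊.refl
         (const a) X (E a) (E (⊖ a)) ⟩
  const a *ₛ (X *ₛ cs a) ∎
  where open ≈ₛ-Reasoning

E-neg-+ : ∀ a b → E (⊖ (a ⊕ b)) ≈ₛ E (⊖ a) *ₛ E (⊖ b)
E-neg-+ a b = 𝕊.trans (E-cong (ℚ.neg-distrib-+ a b)) (E-+ (⊖ a) (⊖ b))

sn-+ : ∀ a b → const (fromℕ 2) *ₛ sn (a ⊕ b) ≈ₛ sn a *ₛ cs b +ₛ cs a *ₛ sn b
sn-+ a b = begin
  const (fromℕ 2) *ₛ sn (a ⊕ b)
    ≈⟨ *-congˡ (const (fromℕ 2)) (+-cong (E-+ a b) (-‿cong (E-neg-+ a b))) ⟩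
  const (fromℕ 2) *ₛ (E a *ₛ E b +ₛ -ₛ (E (⊖ a) *ₛ E (⊖ b)))
    ≈⟨ solveₛ 4 (λ u u′ v v′ → con (fromℕ 2) :* (u :* v :+ :- (u′ :* v′))
          := (u :+ :- u′) :* (v :+ v′) :+ (u :+ u′) :* (v :+ :- v′)) 𝕊.refl (E a) (E (⊖ a)) (E b) (E (⊖ b)) ⟩
  sn a *ₛ cs b +ₛ cs a *ₛ sn b ∎
  where open ≈ₛ-Reasoning

E-diff : ∀ a b e → E (b ⊝ a ⊕ e) ≈ₛ E b *ₛ E (⊖ a) *ₛ E e
E-diff a b e = 𝕊.trans (E-+ (b ⊝ a) e) (*-congʳ (E e) (E-+ b (⊖ a)))

-- Product-to-sum twice: `sn a *ₛ sn b` is cs(a + b) - cs(b - a), and `sn e` times the latter is a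
-- difference of two values of `sn`. When `a` grows and `b` shrinks by `e` each, b - a drops by 2e,
-- so consecutive differences share a term.
sn-*-* : ∀ e a b → sn e *ₛ (sn a *ₛ sn b) ≈ₛ
  sn e *ₛ cs (a ⊕ b) +ₛ -ₛ sn (b ⊝ a ⊕ e) +ₛ sn (b ⊝ a ⊝ e)
sn-*-* e a b = 𝕊.sym (begin
  sn e *ₛ cs (a ⊕ b) +ₛ -ₛ sn (b ⊝ a ⊕ e) +ₛ sn (b ⊝ a ⊝ e)
    ≈⟨ +-cong (+-cong
         (*-congˡ (sn e) (+-cong (E-+ a b) (E-neg-+ a b)))
         (-‿cong (+-cong (E-diff a b e) (-‿cong (𝕊.trans (E-cong (neg₁ a b e)) (E-diff b a (⊖ e)))))))
         (+-cong (E-diff a b (⊖ e)) (-‿cong (𝕊.trans (E-cong (neg₂ a b e)) (E-diff b a e)))) ⟩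
  sn e *ₛ (A *ₛ B +ₛ A′ *ₛ B′) +ₛ -ₛ (B *ₛ A′ *ₛ F +ₛ -ₛ (A *ₛ B′ *ₛ F′)) +ₛ (B *ₛ A′ *ₛ F′ +ₛ -ₛ (A *ₛ B′ *ₛ F))
    ≈⟨ solveₛ 6 (λ f f′ a a′ b b′ →
          (f :+ :- f′) :* (a :* b :+ a′ :* b′) :+ :- (b :* a′ :* f :+ :- (a :* b′ :* f′)) :+ (b :* a′ :* f′ :+ :- (a :* b′ :* f))
          := (f :+ :- f′) :* ((a :+ :- a′) :* (b :+ :- b′))) 𝕊.refl F F′ A A′ B B′ ⟩
  sn e *ₛ (sn a *ₛ sn b) ∎)
  where
  open ≈ₛ-Reasoning
  A  = E a
  A′ = E (⊖ a)
  B  = E b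
  B′ = E (⊖ b)
  F  = E e
  F′ = E (⊖ e)
  neg₁ : ∀ a b e → ⊖ (b ⊕ (⊖ a) ⊕ e) ≡ a ⊕ (⊖ b) ⊕ (⊖ e)
  neg₁ = RingSolver.solve-∀ ℚ-ring
  neg₂ : ∀ a b e → ⊖ (b ⊕ (⊖ a) ⊕ (⊖ e)) ≡ a ⊕ (⊖ b) ⊕ e
  neg₂ = RingSolver.solve-∀ ℚ-ring

-- Sums over lists

∑ : ∀ {A : Set} → List A → (A → ℚ) → ℚ
∑ []       f = 0ℚ
∑ (x ∷ xs) f = f x ⊕ ∑ xs f

module _ {A : Set} where

  ∑L-cong∈ : ∀ (xs : List A) {f h : A → ℚ} → (∀ x → x ∈ xs → f x ≡ h x) → ∑ xs f ≡ ∑ xs h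
  ∑L-cong∈ []       eq = refl
  ∑L-cong∈ (x ∷ xs) eq = cong₂ _⊕_ (eq x (here refl)) (∑L-cong∈ xs (λ y y∈ → eq y (there y∈)))

  ∑L-cong : ∀ (xs : List A) {f h : A → ℚ} → (∀ x → f x ≡ h x) → ∑ xs f ≡ ∑ xs h
  ∑L-cong xs eq = ∑L-cong∈ xs (λ x _ → eq x)

  ∑L-zero : ∀ (xs : List A) {f : A → ℚ} → (∀ x → x ∈ xs → f x ≡ 0ℚ) → ∑ xs f ≡ 0ℚ
  ∑L-zero []       eq = refl
  ∑L-zero (x ∷ xs) eq = trans (cong₂ _⊕_ (eq x (here refl)) (∑L-zero xs (λ y y∈ → eq y (there y∈)))) (ℚ.+-identityˡ 0ℚ)

  ∑L-++ : ∀ (xs ys : List A) f → ∑ (xs ++ ys) f ≡ ∑ xs f ⊕ ∑ ys f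
  ∑L-++ []       ys f = sym (ℚ.+-identityˡ (∑ ys f))
  ∑L-++ (x ∷ xs) ys f = trans (cong (f x ⊕_) (∑L-++ xs ys f)) (sym (ℚ.+-assoc (f x) (∑ xs f) (∑ ys f)))

  ∑L-concat : ∀ (xss : List (List A)) f → ∑ (concat xss) f ≡ ∑ xss (λ xs → ∑ xs f)
  ∑L-concat []         f = refl
  ∑L-concat (xs ∷ xss) f = trans (∑L-++ xs (concat xss) f) (cong (∑ xs f ⊕_) (∑L-concat xss f))

  ∑L-⊕ : ∀ (xs : List A) f h → ∑ xs (λ x → f x ⊕ h x) ≡ ∑ xs f ⊕ ∑ xs h
  ∑L-⊕ []       f h = refl
  ∑L-⊕ (x ∷ xs) f h = trans (cong (f x ⊕ h x ⊕_) (∑L-⊕ xs f h)) (⊕-interchange (f x) (h x) (∑ xs f) (∑ xs h))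

  ∑L-distribˡ : ∀ (xs : List A) c f → c ⊗ ∑ xs f ≡ ∑ xs (λ x → c ⊗ f x)
  ∑L-distribˡ []       c f = ℚ.*-zeroʳ c
  ∑L-distribˡ (x ∷ xs) c f = trans (ℚ.*-distribˡ-+ c (f x) (∑ xs f)) (cong (c ⊗ f x ⊕_) (∑L-distribˡ xs c f))

  ∑L-const : ∀ (xs : List A) c → ∑ xs (λ _ → c) ≡ fromℕ (length xs) ⊗ c
  ∑L-const []       c = sym (ℚ.*-zeroˡ c)
  ∑L-const (x ∷ xs) c = begin
    c ⊕ ∑ xs (λ _ → c)              ≡⟨ cong (c ⊕_) (∑L-const xs c) ⟩
    c ⊕ fromℕ (length xs) ⊗ c       ≡⟨ lem c (fromℕ (length xs)) ⟩
    (1ℚ ⊕ fromℕ (length xs)) ⊗ c    ≡⟨ cong (_⊗ c) (fromℕ-+ 1 (length xs)) ⟨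
    fromℕ (suc (length xs)) ⊗ c     ∎
    where
    open ≡-Reasoning
    lem : ∀ a b → a ⊕ b ⊗ a ≡ (1ℚ ⊕ b) ⊗ a
    lem = RingSolver.solve-∀ ℚ-ring

  ∑L-↭ : ∀ {xs ys : List A} f → xs ↭ ys → ∑ xs f ≡ ∑ ys f
  ∑L-↭ f ↭.refl         = refl
  ∑L-↭ f (prep x p)     = cong (f x ⊕_) (∑L-↭ f p)
  ∑L-↭ f (swap {xs} {ys} x y p) = trans (cong (λ z → f x ⊕ (f y ⊕ z)) (∑L-↭ f p)) (lem (f x) (f y) (∑ ys f))
    where
    lem : ∀ a b c → a ⊕ (b ⊕ c) ≡ b ⊕ (a ⊕ c)
    lem = RingSolver.solve-∀ ℚ-ring
  ∑L-↭ f (↭.trans p q)  = trans (∑L-↭ f p) (∑L-↭ f q)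

module _ {A B : Set} where

  ∑L-map : ∀ (g : A → B) xs f → ∑ (List.map g xs) f ≡ ∑ xs (f ∘ g)
  ∑L-map g []       f = refl
  ∑L-map g (x ∷ xs) f = cong (f (g x) ⊕_) (∑L-map g xs f)

  ∑L-swap : ∀ (xs : List A) (ys : List B) (f : A → B → ℚ) →
            ∑ xs (λ x → ∑ ys (f x)) ≡ ∑ ys (λ y → ∑ xs (λ x → f x y))
  ∑L-swap []       ys f = sym (∑L-zero ys (λ _ _ → refl))
  ∑L-swap (x ∷ xs) ys f = trans (cong (∑ ys (f x) ⊕_) (∑L-swap xs ys f)) (sym (∑L-⊕ ys (f x) _))

∑L-cartesianProductWith : ∀ {A B C : Set} (g : A → B → C) xs ys f →
  ∑ (List.cartesianProductWith g xs ys) f ≡ ∑ xs (λ x → ∑ ys (λ y → f (g x y)))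
∑L-cartesianProductWith g []       ys f = refl
∑L-cartesianProductWith g (x ∷ xs) ys f = trans (∑L-++ (List.map (g x) ys) _ f)
  (cong₂ _⊕_ (∑L-map (g x) ys f) (∑L-cartesianProductWith g xs ys f))

-- Entries are picked by position, so that equal cycle lengths count separately, as different cycles
-- do.
picks : ∀ {A : Set} → List A → List (A × List A)
picks []       = []
picks (x ∷ xs) = (x , xs) ∷ List.map (λ (y , ys) → y , x ∷ ys) (picks xs)

picks-map : ∀ {A B : Set} (f : A → B) xs →
  picks (List.map f xs) ≡ List.map (λ (y , ys) → f y , List.map f ys) (picks xs)
picks-map f []       = refl
picks-map f (x ∷ xs) = cong ((f x , List.map f xs) ∷_) (begin
  List.map _ (picks (List.map f xs))                                  ≡⟨ cong (List.map _) (picks-map f xs) ⟩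
  List.map _ (List.map (λ (y , ys) → f y , List.map f ys) (picks xs)) ≡⟨ List.map-∘ (picks xs) ⟨
  List.map _ (picks xs)                                               ≡⟨ List.map-∘ (picks xs) ⟩
  List.map _ (List.map (λ (y , ys) → y , x ∷ ys) (picks xs))          ∎)
  where open ≡-Reasoning

∑ₚ : ∀ {A : Set} → List A → (A → List A → ℚ) → ℚ
∑ₚ xs f = ∑ (picks xs) (λ (y , ys) → f y ys)

∑ₚ-∷ : ∀ {A : Set} (x : A) xs f → ∑ₚ (x ∷ xs) f ≡ f x xs ⊕ ∑ₚ xs (λ y ys → f y (x ∷ ys))
∑ₚ-∷ x xs f = cong (f x xs ⊕_) (∑L-map _ (picks xs) _)

picks-↭ : ∀ {A : Set} (xs : List A) → All (λ (y , ys) → y ∷ ys ↭ xs) (picks xs)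
picks-↭ []       = []
picks-↭ (x ∷ xs) = ↭-refl ∷ All.map⁺ (All.map (λ {(y , ys)} p → ↭-trans (swap y x ↭-refl) (prep x p)) (picks-↭ xs))

∑ₚ-cong : ∀ {A : Set} (xs : List A) {f h : A → List A → ℚ} →
  (∀ y ys → y ∷ ys ↭ xs → f y ys ≡ h y ys) → ∑ₚ xs f ≡ ∑ₚ xs h
∑ₚ-cong xs eq = ∑L-cong∈ (picks xs) (λ (y , ys) y∈ → eq y ys (All.lookup (picks-↭ xs) y∈))

∑ₚ-map : ∀ {A B : Set} (g : A → B) xs f → ∑ₚ (List.map g xs) f ≡ ∑ₚ xs (λ y ys → f (g y) (List.map g ys))
∑ₚ-map g xs f = trans (cong (λ ps → ∑ ps _) (picks-map g xs)) (∑L-map _ (picks xs) _)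

∑ₚ-⊕ : ∀ {A : Set} (xs : List A) f h → ∑ₚ xs (λ y ys → f y ys ⊕ h y ys) ≡ ∑ₚ xs f ⊕ ∑ₚ xs h
∑ₚ-⊕ xs f h = ∑L-⊕ (picks xs) _ _

-- The remainder of a pick inherits the order of the list, hence the invariance required of `f`. In
-- the swap case the first two picks change places.
∑ₚ-↭ : ∀ {A : Set} {xs ys : List A} (f : A → List A → ℚ) → (∀ x {us vs} → us ↭ vs → f x us ≡ f x vs) →
  xs ↭ ys → ∑ₚ xs f ≡ ∑ₚ ys f
∑ₚ-↭ f inv ↭.refl = refl
∑ₚ-↭ f inv (prep {xs} {ys} x p) = trans (∑ₚ-∷ x xs f) (trans
  (cong₂ _⊕_ (inv x p) (∑ₚ-↭ (λ z zs → f z (x ∷ zs)) (λ z q → inv z (prep x q)) p))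
  (sym (∑ₚ-∷ x ys f)))
∑ₚ-↭ f inv (swap {xs} {ys} x y p) = begin
  ∑ₚ (x ∷ y ∷ xs) f
    ≡⟨ trans (∑ₚ-∷ x (y ∷ xs) f) (cong (f x (y ∷ xs) ⊕_) (∑ₚ-∷ y xs (λ z zs → f z (x ∷ zs)))) ⟩
  f x (y ∷ xs) ⊕ (f y (x ∷ xs) ⊕ ∑ₚ xs (λ z zs → f z (x ∷ y ∷ zs)))
    ≡⟨ cong₂ (λ a b → a ⊕ (b ⊕ ∑ₚ xs (λ z zs → f z (x ∷ y ∷ zs)))) (inv x (prep y p)) (inv y (prep x p)) ⟩
  f x (y ∷ ys) ⊕ (f y (x ∷ ys) ⊕ ∑ₚ xs (λ z zs → f z (x ∷ y ∷ zs)))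
    ≡⟨ cong (λ a → f x (y ∷ ys) ⊕ (f y (x ∷ ys) ⊕ a))
         (trans (∑ₚ-cong xs (λ z zs _ → inv z (swap x y ↭-refl)))
                (∑ₚ-↭ (λ z zs → f z (y ∷ x ∷ zs)) (λ z q → inv z (prep y (prep x q))) p)) ⟩
  f x (y ∷ ys) ⊕ (f y (x ∷ ys) ⊕ ∑ₚ ys (λ z zs → f z (y ∷ x ∷ zs)))
    ≡⟨ lem (f x (y ∷ ys)) (f y (x ∷ ys)) (∑ₚ ys (λ z zs → f z (y ∷ x ∷ zs))) ⟩
  f y (x ∷ ys) ⊕ (f x (y ∷ ys) ⊕ ∑ₚ ys (λ z zs → f z (y ∷ x ∷ zs)))
    ≡⟨ trans (∑ₚ-∷ y (x ∷ ys) f) (cong (f y (x ∷ ys) ⊕_) (∑ₚ-∷ x ys (λ z zs → f z (y ∷ zs)))) ⟨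
  ∑ₚ (y ∷ x ∷ ys) f ∎
  where
  open ≡-Reasoning
  lem : ∀ a b c → a ⊕ (b ⊕ c) ≡ b ⊕ (a ⊕ c)
  lem = RingSolver.solve-∀ ℚ-ring
∑ₚ-↭ f inv (↭.trans p q) = trans (∑ₚ-↭ f inv p) (∑ₚ-↭ f inv q)

-- The cut-and-join equation

half : ℕ → ℚ
half b = ℚ.½ ⊗ fromℕ b

half-+ : ∀ m n → half (m + n) ≡ half m ⊕ half n
half-+ m n = trans (cong (ℚ.½ ⊗_) (fromℕ-+ m n)) (ℚ.*-distribˡ-+ ℚ.½ (fromℕ m) (fromℕ n))

-- ς b = 2 sinh(bx/2) and χ b = 2 cosh(bx/2).
ς χ : ℕ → Series
ς b = sn (half b)
χ b = cs (half b)

⊖-involutive : ∀ a → ⊖ (⊖ a) ≡ a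
⊖-involutive = RingSolver.solve-∀ ℚ-ring

sn-neg : ∀ a → sn (⊖ a) ≈ₛ -ₛ sn a
sn-neg a = 𝕊.trans (+-congˡ (E (⊖ a)) (-‿cong (E-cong (⊖-involutive a))))
  (solveₛ 2 (λ u v → v :+ :- u := :- (u :+ :- v)) 𝕊.refl (E a) (E (⊖ a)))

cs-neg : ∀ a → cs (⊖ a) ≈ₛ cs a
cs-neg a = 𝕊.trans (+-congˡ (E (⊖ a)) (E-cong (⊖-involutive a))) (𝕊.+-comm (E (⊖ a)) (E a))

θ-ς : ∀ b → θ (ς b) ≈ₛ const (fromℕ b) *ₛ (const ℚ.½ *ₛ (X *ₛ χ b))
θ-ς b = 𝕊.trans (θ-sn (half b)) (𝕊.trans (*-congʳ (X *ₛ χ b) eq)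
  (solveₛ 3 (λ h b y → h :* b :* y := b :* (h :* y)) 𝕊.refl (const ℚ.½) (const (fromℕ b)) (X *ₛ χ b)))
  where
  eq : const (half b) ≈ₛ const ℚ.½ *ₛ const (fromℕ b)
  eq = SolverRing._-Raw-AlmostCommutative⟶_.*-homo const-homomorphism ℚ.½ (fromℕ b)

ς-+ : ∀ m n → ς (m + n) ≈ₛ const ℚ.½ *ₛ (ς m *ₛ χ n +ₛ χ m *ₛ ς n)
ς-+ m n = begin
  ς (m + n)
    ≈⟨ sn-cong (half-+ m n) ⟩
  sn (half m ⊕ half n)
    ≈⟨ solveₛ 1 (λ y → y := con ℚ.½ :* (con (fromℕ 2) :* y)) 𝕊.refl (sn (half m ⊕ half n)) ⟩
  const ℚ.½ *ₛ (const (fromℕ 2) *ₛ sn (half m ⊕ half n))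
    ≈⟨ *-congˡ (const ℚ.½) (sn-+ (half m) (half n)) ⟩
  const ℚ.½ *ₛ (ς m *ₛ χ n +ₛ χ m *ₛ ς n) ∎
  where open ≈ₛ-Reasoning

-- For p = 1 this is the total weight of the ordered ways to cut a cycle of length q + 1 in two,
-- still without the denominator ς(1).
cutₛ : ℕ → ℕ → Series
cutₛ p zero    = 0ₛ
cutₛ p (suc q) = ς p *ₛ ς (suc q) +ₛ cutₛ (suc p) q

-- ς 1 turns the sum into a telescoping one.
ς₁*cutₛ : ∀ p q → ς 1 *ₛ cutₛ p q ≈ₛ
  const (fromℕ q) *ₛ (ς 1 *ₛ χ (p + q)) +ₛ -ₛ sn (half q ⊝ half p ⊕ half 1) +ₛ sn (half 1 ⊝ half p ⊝ half q)
ς₁*cutₛ p zero = begin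
  ς 1 *ₛ 0ₛ
    ≈⟨ 𝕊.zeroʳ (ς 1) ⟩
  0ₛ
    ≈⟨ 𝕊.-‿inverseˡ (sn (half 0 ⊝ half p ⊕ half 1)) ⟨
  -ₛ sn (half 0 ⊝ half p ⊕ half 1) +ₛ sn (half 0 ⊝ half p ⊕ half 1)
    ≈⟨ +-congʳ (sn (half 0 ⊝ half p ⊕ half 1)) (solveₛ 2 (λ u v → u := con 0ℚ :* v :+ u) 𝕊.refl (-ₛ sn (half 0 ⊝ half p ⊕ half 1)) (ς 1 *ₛ χ (p + 0))) ⟩
  const (fromℕ 0) *ₛ (ς 1 *ₛ χ (p + 0)) +ₛ -ₛ sn (half 0 ⊝ half p ⊕ half 1) +ₛ sn (half 0 ⊝ half p ⊕ half 1)
    ≈⟨ +-congˡ (const (fromℕ 0) *ₛ (ς 1 *ₛ χ (p + 0)) +ₛ -ₛ sn (half 0 ⊝ half p ⊕ half 1)) (sn-cong (lem (half 0) (half p) (half 1))) ⟩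
  const (fromℕ 0) *ₛ (ς 1 *ₛ χ (p + 0)) +ₛ -ₛ sn (half 0 ⊝ half p ⊕ half 1) +ₛ sn (half 1 ⊝ half p ⊝ half 0) ∎
  where
  open ≈ₛ-Reasoning
  lem : ∀ z p e → 0ℚ ⊕ (⊖ p) ⊕ e ≡ e ⊕ (⊖ p) ⊕ 0ℚ
  lem z = RingSolver.solve-∀ ℚ-ring
ς₁*cutₛ p (suc q) = begin
  ς 1 *ₛ (ς p *ₛ ς (suc q) +ₛ cutₛ (suc p) q)
    ≈⟨ 𝕊.distribˡ (ς 1) (ς p *ₛ ς (suc q)) (cutₛ (suc p) q) ⟩
  ς 1 *ₛ (ς p *ₛ ς (suc q)) +ₛ ς 1 *ₛ cutₛ (suc p) q
    ≈⟨ +-cong (sn-*-* (half 1) (half p) (half (suc q))) (ς₁*cutₛ (suc p) q) ⟩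
  (ς 1 *ₛ cs (half p ⊕ half (suc q)) +ₛ -ₛ S₁ +ₛ sn (half (suc q) ⊝ half p ⊝ half 1))
    +ₛ (const (fromℕ q) *ₛ (ς 1 *ₛ χ (suc p + q)) +ₛ -ₛ sn (half q ⊝ half (suc p) ⊕ half 1) +ₛ sn (half 1 ⊝ half (suc p) ⊝ half q))
    ≈⟨ +-cong (+-cong (+-congʳ (-ₛ S₁) (*-congˡ (ς 1) (cs-cong (sym (half-+ p (suc q)))))) (sn-cong eq₁))
              (+-cong (+-congʳ (-ₛ sn (half q ⊝ half (suc p) ⊕ half 1)) (*-congˡ (const (fromℕ q)) (*-congˡ (ς 1)
                 (cs-cong (cong half (sym (ℕ.+-suc p q))))))) (sn-cong eq₂)) ⟩
  (ς 1 *ₛ χ (p + suc q) +ₛ -ₛ S₁ +ₛ S₂)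
    +ₛ (const (fromℕ q) *ₛ (ς 1 *ₛ χ (p + suc q)) +ₛ -ₛ S₂ +ₛ S₃)
    ≈⟨ solveₛ 5 (λ q y u v w → (y :+ :- u :+ v) :+ (q :* y :+ :- v :+ w)
          := (con 1ℚ :+ q) :* y :+ :- u :+ w) 𝕊.refl (const (fromℕ q)) (ς 1 *ₛ χ (p + suc q)) S₁ S₂ S₃ ⟩
  (const 1ℚ +ₛ const (fromℕ q)) *ₛ (ς 1 *ₛ χ (p + suc q)) +ₛ -ₛ S₁ +ₛ S₃
    ≈⟨ +-congʳ S₃ (+-congʳ (-ₛ S₁) (*-congʳ (ς 1 *ₛ χ (p + suc q))
         (𝕊.trans (𝕊.sym (const-+ 1ℚ (fromℕ q))) (const-cong (sym (fromℕ-+ 1 q)))))) ⟩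
  const (fromℕ (suc q)) *ₛ (ς 1 *ₛ χ (p + suc q)) +ₛ -ₛ S₁ +ₛ S₃ ∎
  where
  open ≈ₛ-Reasoning
  S₁ = sn (half (suc q) ⊝ half p ⊕ half 1)
  S₂ = sn (half q ⊝ half (suc p) ⊕ half 1)
  S₃ = sn (half 1 ⊝ half p ⊝ half (suc q))
  eq₁ : half (suc q) ⊝ half p ⊝ half 1 ≡ half q ⊝ half (suc p) ⊕ half 1
  eq₁ rewrite half-+ 1 q | half-+ 1 p = lem (half 1) (half p) (half q)
    where
    lem : ∀ e p q → (e ⊕ q) ⊕ (⊖ p) ⊕ (⊖ e) ≡ q ⊕ (⊖ (e ⊕ p)) ⊕ e
    lem = RingSolver.solve-∀ ℚ-ring
  eq₂ : half 1 ⊝ half (suc p) ⊝ half q ≡ half 1 ⊝ half p ⊝ half (suc q)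
  eq₂ rewrite half-+ 1 q | half-+ 1 p = lem (half 1) (half p) (half q)
    where
    lem : ∀ e p q → e ⊕ (⊖ (e ⊕ p)) ⊕ (⊖ q) ≡ e ⊕ (⊖ p) ⊕ (⊖ (e ⊕ q))
    lem = RingSolver.solve-∀ ℚ-ring

-- For p = 1 both ends of the telescoping sum equal -ς(q). Regarding ς(q) as the value of `sn` at
-- half the difference of q + 1 and 1, the addition theorem splits it into two products; one of them
-- raises the coefficient from q to q + 1.
ς₁*cutₛ₁ : ∀ q → ς 1 *ₛ cutₛ 1 q ≈ₛ
  const (fromℕ (suc q)) *ₛ (ς 1 *ₛ χ (suc q)) +ₛ -ₛ (χ 1 *ₛ ς (suc q))
ς₁*cutₛ₁ q = begin
  ς 1 *ₛ cutₛ 1 q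
    ≈⟨ ς₁*cutₛ 1 q ⟩
  const (fromℕ q) *ₛ y +ₛ -ₛ sn (half q ⊝ half 1 ⊕ half 1) +ₛ sn (half 1 ⊝ half 1 ⊝ half q)
    ≈⟨ +-cong (+-congˡ (const (fromℕ q) *ₛ y) (-‿cong (sn-cong eq₁))) (𝕊.trans (sn-cong eq₂) (sn-neg (half m ⊕ (⊖ half 1)))) ⟩
  const (fromℕ q) *ₛ y +ₛ -ₛ D +ₛ -ₛ D
    ≈⟨ solveₛ 2 (λ z d → z :+ :- d :+ :- d := z :+ :- (con (fromℕ 2) :* d)) 𝕊.refl (const (fromℕ q) *ₛ y) D ⟩
  const (fromℕ q) *ₛ y +ₛ -ₛ (const (fromℕ 2) *ₛ D)
    ≈⟨ +-congˡ (const (fromℕ q) *ₛ y) (-‿cong (𝕊.trans (sn-+ (half m) (⊖ half 1))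
         (+-cong (*-congˡ (ς m) (cs-neg (half 1))) (*-congˡ (χ m) (sn-neg (half 1)))))) ⟩
  const (fromℕ q) *ₛ (ς 1 *ₛ χ m) +ₛ -ₛ (ς m *ₛ χ 1 +ₛ χ m *ₛ -ₛ ς 1)
    ≈⟨ solveₛ 5 (λ q s c s₁ c₁ → q :* (s₁ :* c) :+ :- (s :* c₁ :+ c :* :- s₁)
          := (con 1ℚ :+ q) :* (s₁ :* c) :+ :- (c₁ :* s)) 𝕊.refl (const (fromℕ q)) (ς m) (χ m) (ς 1) (χ 1) ⟩
  (const 1ℚ +ₛ const (fromℕ q)) *ₛ (ς 1 *ₛ χ m) +ₛ -ₛ (χ 1 *ₛ ς m)
    ≈⟨ +-congʳ (-ₛ (χ 1 *ₛ ς m)) (*-congʳ (ς 1 *ₛ χ m)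
         (𝕊.trans (𝕊.sym (const-+ 1ℚ (fromℕ q))) (const-cong (sym (fromℕ-+ 1 q))))) ⟩
  const (fromℕ m) *ₛ (ς 1 *ₛ χ m) +ₛ -ₛ (χ 1 *ₛ ς m) ∎
  where
  open ≈ₛ-Reasoning
  m = suc q
  y = ς 1 *ₛ χ m
  D = sn (half m ⊕ (⊖ half 1))
  eq₁ : half q ⊝ half 1 ⊕ half 1 ≡ half m ⊕ (⊖ half 1)
  eq₁ rewrite half-+ 1 q = lem (half 1) (half q)
    where
    lem : ∀ e q → q ⊕ (⊖ e) ⊕ e ≡ e ⊕ q ⊕ (⊖ e)
    lem = RingSolver.solve-∀ ℚ-ring
  eq₂ : half 1 ⊝ half 1 ⊝ half q ≡ ⊖ (half m ⊕ (⊖ half 1))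
  eq₂ rewrite half-+ 1 q = lem (half 1) (half q)
    where
    lem : ∀ e q → e ⊕ (⊖ e) ⊕ (⊖ q) ≡ ⊖ (e ⊕ q ⊕ (⊖ e))
    lem = RingSolver.solve-∀ ℚ-ring

∏ς : List ℕ → Series
∏ς []      = 1ₛ
∏ς (b ∷ λs) = ς b *ₛ ∏ς λs

∏ς-↭ : ∀ {λs μs} → λs ↭ μs → ∏ς λs ≈ₛ ∏ς μs
∏ς-↭ ↭.refl       = 𝕊.refl
∏ς-↭ (prep b p)   = *-congˡ (ς b) (∏ς-↭ p)
∏ς-↭ (swap {λs} {μs} a b p) = 𝕊.trans (*-congˡ (ς a) (*-congˡ (ς b) (∏ς-↭ p)))
  (solveₛ 3 (λ a b r → a :* (b :* r) := b :* (a :* r)) 𝕊.refl (ς a) (ς b) (∏ς μs))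
∏ς-↭ (↭.trans p q) = 𝕊.trans (∏ς-↭ p) (∏ς-↭ q)

joinₛ : ℕ → List ℕ → Series
joinₛ m []       = 0ₛ
joinₛ m (c ∷ λs) = const (fromℕ c) *ₛ (ς (m + c) *ₛ ∏ς λs) +ₛ ς c *ₛ joinₛ m λs

-- The addition theorem splits ς(m + c) into two products. In the first, c times half of x χ(c) is
-- the Euler derivative of ς(c), and the Leibniz rule collects these terms into θ of the whole
-- product. The second gives the same series for every c, with weight c.
X*joinₛ : ∀ m λs → X *ₛ joinₛ m λs ≈ₛ
  ς m *ₛ θ (∏ς λs) +ₛ const (fromℕ (sumᴸ λs)) *ₛ (const ℚ.½ *ₛ (X *ₛ χ m)) *ₛ ∏ς λs
X*joinₛ m [] = begin
  X *ₛ 0ₛ      ≈⟨ 𝕊.zeroʳ X ⟩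
  0ₛ           ≈⟨ 𝕊.+-identityˡ 0ₛ ⟨
  0ₛ +ₛ 0ₛ     ≈⟨ +-cong (𝕊.trans (*-congˡ (ς m) θ-1ₛ) (𝕊.zeroʳ (ς m)))
                         (𝕊.trans (𝕊.*-identityʳ _) (𝕊.trans (*-congʳ Y const-0) (𝕊.zeroˡ Y))) ⟨
  ς m *ₛ θ 1ₛ +ₛ const 0ℚ *ₛ Y *ₛ 1ₛ ∎
  where
  open ≈ₛ-Reasoning
  Y = const ℚ.½ *ₛ (X *ₛ χ m)
X*joinₛ m (c ∷ λs) = begin
  X *ₛ (κ *ₛ (ς (m + c) *ₛ P) +ₛ ς c *ₛ joinₛ m λs)
    ≈⟨ solveₛ 6 (λ x k s p c j → x :* (k :* (s :* p) :+ c :* j) := x :* (k :* (s :* p)) :+ c :* (x :* j)) 𝕊.refl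
         X κ (ς (m + c)) P (ς c) (joinₛ m λs) ⟩
  X *ₛ (κ *ₛ (ς (m + c) *ₛ P)) +ₛ ς c *ₛ (X *ₛ joinₛ m λs)
    ≈⟨ +-cong (*-congˡ X (*-congˡ κ (*-congʳ P (ς-+ m c)))) (*-congˡ (ς c) (X*joinₛ m λs)) ⟩
  X *ₛ (κ *ₛ (const ℚ.½ *ₛ (ς m *ₛ χ c +ₛ χ m *ₛ ς c) *ₛ P)) +ₛ ς c *ₛ (ς m *ₛ θ P +ₛ Σκ *ₛ (const ℚ.½ *ₛ (X *ₛ χ m)) *ₛ P)
    ≈⟨ solveₛ 9 (λ x k sm cm sc cc p dp K →
          x :* (k :* (con ℚ.½ :* (sm :* cc :+ cm :* sc) :* p)) :+ sc :* (sm :* dp :+ K :* (con ℚ.½ :* (x :* cm)) :* p)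
          := sm :* (k :* (con ℚ.½ :* (x :* cc)) :* p :+ sc :* dp) :+ (k :+ K) :* (con ℚ.½ :* (x :* cm)) :* (sc :* p)) 𝕊.refl
         X κ (ς m) (χ m) (ς c) (χ c) P (θ P) Σκ ⟩
  ς m *ₛ (κ *ₛ (const ℚ.½ *ₛ (X *ₛ χ c)) *ₛ P +ₛ ς c *ₛ θ P) +ₛ (κ +ₛ Σκ) *ₛ (const ℚ.½ *ₛ (X *ₛ χ m)) *ₛ (ς c *ₛ P)
    ≈⟨ +-cong (*-congˡ (ς m) (+-congʳ (ς c *ₛ θ P) (*-congʳ P (𝕊.sym (θ-ς c)))))
              (*-congʳ (ς c *ₛ P) (*-congʳ (const ℚ.½ *ₛ (X *ₛ χ m))
                (𝕊.trans (𝕊.sym (const-+ (fromℕ c) (fromℕ (sumᴸ λs)))) (const-cong (sym (fromℕ-+ c (sumᴸ λs))))))) ⟩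
  ς m *ₛ (θ (ς c) *ₛ P +ₛ ς c *ₛ θ P) +ₛ const (fromℕ (c + sumᴸ λs)) *ₛ (const ℚ.½ *ₛ (X *ₛ χ m)) *ₛ (ς c *ₛ P)
    ≈⟨ +-congʳ _ (*-congˡ (ς m) (𝕊.sym (θ-*ₛ (ς c) P))) ⟩
  ς m *ₛ θ (ς c *ₛ P) +ₛ const (fromℕ (c + sumᴸ λs)) *ₛ (const ℚ.½ *ₛ (X *ₛ χ m)) *ₛ (ς c *ₛ P) ∎
  where
  open ≈ₛ-Reasoning
  κ = const (fromℕ c)
  P = ∏ς λs
  Σκ = const (fromℕ (sumᴸ λs))

-- 𝒮 = sinh(x/2)/(x/2)
𝒮 ρ : Series
𝒮 = tail (ς 1)
ρ = recip 𝒮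

𝒮ρ : 𝒮 *ₛ ρ ≈ₛ 1ₛ
𝒮ρ = coeffs (recip-inverse 𝒮 refl)

X*tail : ∀ s → s 0 ≡ 0ℚ → s ≈ₛ X *ₛ tail s
X*tail s s₀≡0 = 𝕊.trans eq (𝕊.sym (X-*ₛ (tail s)))
  where
  eq : s ≈ₛ shift (tail s)
  eq .at zero    = s₀≡0
  eq .at (suc m) = refl

-- ς(1) is x times the invertible series `𝒮`.
ς₁-cancel : ∀ {s u} → ς 1 *ₛ s ≈ₛ ς 1 *ₛ u → s ≈ₛ u
ς₁-cancel {s} {u} p = 𝕊.trans (𝕊.sym (undo s)) (𝕊.trans (*-congˡ ρ (X-cancel {𝒮 *ₛ s} {𝒮 *ₛ u} (𝕊.trans (𝕊.sym (split s)) (𝕊.trans p (split u))))) (undo u))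
  where
  split : ∀ v → ς 1 *ₛ v ≈ₛ X *ₛ (𝒮 *ₛ v)
  split v = 𝕊.trans (*-congʳ v (X*tail (ς 1) refl)) (𝕊.*-assoc X 𝒮 v)
  undo : ∀ v → ρ *ₛ (𝒮 *ₛ v) ≈ₛ v
  undo v = 𝕊.trans (solveₛ 3 (λ r s v → r :* (s :* v) := (s :* r) :* v) 𝕊.refl ρ 𝒮 v)
    (𝕊.trans (*-congʳ v 𝒮ρ) (𝕊.*-identityˡ v))

-- T λs = ∏ ς(λᵢ) / ς(1)
T : List ℕ → Series
T λs = tail (∏ς λs) *ₛ ρ

T-↭ : ∀ {λs μs} → λs ↭ μs → T λs ≈ₛ T μs
T-↭ p = *-congʳ ρ (coeffs λ m → ∏ς-↭ p .at (suc m))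

∏ς₀ : ∀ b λs → ∏ς (b ∷ λs) 0 ≡ 0ℚ
∏ς₀ b λs = ℚ.*-zeroˡ (∏ς λs 0)

-- A nonempty list gives `∏ς` a zero constant term, so that `tail` really divides it by x.
ς₁*T : ∀ b λs → ς 1 *ₛ T (b ∷ λs) ≈ₛ ∏ς (b ∷ λs)
ς₁*T b λs = begin
  ς 1 *ₛ (L′ *ₛ ρ)        ≈⟨ *-congʳ (L′ *ₛ ρ) (X*tail (ς 1) refl) ⟩
  X *ₛ 𝒮 *ₛ (L′ *ₛ ρ)     ≈⟨ solveₛ 4 (λ x s l r → x :* s :* (l :* r) := x :* l :* (s :* r)) 𝕊.refl X 𝒮 L′ ρ ⟩
  X *ₛ L′ *ₛ (𝒮 *ₛ ρ)     ≈⟨ *-congˡ (X *ₛ L′) 𝒮ρ ⟩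
  X *ₛ L′ *ₛ 1ₛ           ≈⟨ 𝕊.*-identityʳ (X *ₛ L′) ⟩
  X *ₛ L′                 ≈⟨ X*tail (∏ς (b ∷ λs)) (∏ς₀ b λs) ⟨
  ∏ς (b ∷ λs)             ∎
  where
  open ≈ₛ-Reasoning
  L′ = tail (∏ς (b ∷ λs))

cutSum : (List ℕ → ℚ) → ℕ → ℕ → List ℕ → ℚ
cutSum h p zero    r = 0ℚ
cutSum h p (suc q) r = h (p ∷ suc q ∷ r) ⊕ cutSum h (suc p) q r

joinSum : (List ℕ → ℚ) → ℕ → List ℕ → ℚ
joinSum h m r = ∑ₚ r (λ c r′ → fromℕ c ⊗ h (m + c ∷ r′))

-- The sum of h over the cycle types of σ(i j), j ≠ i, where i lies in a cycle of σ of length m and r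
-- consists of the lengths of the other cycles.
cutJoin : (List ℕ → ℚ) → ℕ → List ℕ → ℚ
cutJoin h m r = cutSum h 1 (m ∸ 1) r ⊕ joinSum h m r

∑ₚₛ : List ℕ → (ℕ → List ℕ → Series) → Series
∑ₚₛ λs G t = ∑ₚ λs (λ m r → G m r t)

∑ₚₛ-cong : ∀ λs {G G′} → (∀ m r → m ∷ r ↭ λs → G m r ≈ₛ G′ m r) → ∑ₚₛ λs G ≈ₛ ∑ₚₛ λs G′
∑ₚₛ-cong λs eq .at t = ∑ₚ-cong λs (λ m r p → eq m r p .at t)

∑ₚₛ-∷ : ∀ c λs G → ∑ₚₛ (c ∷ λs) G ≈ₛ G c λs +ₛ ∑ₚₛ λs (λ m r → G m (c ∷ r))
∑ₚₛ-∷ c λs G .at t = ∑ₚ-∷ c λs (λ m r → G m r t)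

∑ₚₛ-+ : ∀ λs G G′ → ∑ₚₛ λs (λ m r → G m r +ₛ G′ m r) ≈ₛ ∑ₚₛ λs G +ₛ ∑ₚₛ λs G′
∑ₚₛ-+ λs G G′ .at t = ∑ₚ-⊕ λs (λ m r → G m r t) (λ m r → G′ m r t)

*-∑ₚₛ : ∀ s λs G → s *ₛ ∑ₚₛ λs G ≈ₛ ∑ₚₛ λs (λ m r → s *ₛ G m r)
*-∑ₚₛ s []       G = 𝕊.zeroʳ s
*-∑ₚₛ s (c ∷ λs) G = begin
  s *ₛ ∑ₚₛ (c ∷ λs) G
    ≈⟨ *-congˡ s (∑ₚₛ-∷ c λs G) ⟩
  s *ₛ (G c λs +ₛ ∑ₚₛ λs (λ m r → G m (c ∷ r)))
    ≈⟨ 𝕊.distribˡ s (G c λs) (∑ₚₛ λs (λ m r → G m (c ∷ r))) ⟩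
  s *ₛ G c λs +ₛ s *ₛ ∑ₚₛ λs (λ m r → G m (c ∷ r))
    ≈⟨ +-congˡ (s *ₛ G c λs) (*-∑ₚₛ s λs (λ m r → G m (c ∷ r))) ⟩
  s *ₛ G c λs +ₛ ∑ₚₛ λs (λ m r → s *ₛ G m (c ∷ r))
    ≈⟨ ∑ₚₛ-∷ c λs (λ m r → s *ₛ G m r) ⟨
  ∑ₚₛ (c ∷ λs) (λ m r → s *ₛ G m r) ∎
  where open ≈ₛ-Reasoning

∑ₚₛ-weight : ∀ λs W → ∑ₚₛ λs (λ m r → const (fromℕ m) *ₛ W) ≈ₛ const (fromℕ (sumᴸ λs)) *ₛ W
∑ₚₛ-weight []       W = 𝕊.sym (𝕊.trans (*-congʳ W const-0) (𝕊.zeroˡ W))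
∑ₚₛ-weight (c ∷ λs) W = begin
  ∑ₚₛ (c ∷ λs) (λ m r → const (fromℕ m) *ₛ W)
    ≈⟨ ∑ₚₛ-∷ c λs (λ m r → const (fromℕ m) *ₛ W) ⟩
  const (fromℕ c) *ₛ W +ₛ ∑ₚₛ λs (λ m r → const (fromℕ m) *ₛ W)
    ≈⟨ +-congˡ (const (fromℕ c) *ₛ W) (∑ₚₛ-weight λs W) ⟩
  const (fromℕ c) *ₛ W +ₛ const (fromℕ (sumᴸ λs)) *ₛ W
    ≈⟨ 𝕊.distribʳ W (const (fromℕ c)) (const (fromℕ (sumᴸ λs))) ⟨
  (const (fromℕ c) +ₛ const (fromℕ (sumᴸ λs))) *ₛ W
    ≈⟨ *-congʳ W (𝕊.trans (𝕊.sym (const-+ (fromℕ c) (fromℕ (sumᴸ λs)))) (const-cong (sym (fromℕ-+ c (sumᴸ λs))))) ⟩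
  const (fromℕ (c + sumᴸ λs)) *ₛ W ∎
  where open ≈ₛ-Reasoning

-- The Leibniz rule for a product of several factors.
∑ₚₛ-θ : ∀ λs → ∑ₚₛ λs (λ m r → θ (ς m) *ₛ ∏ς r) ≈ₛ θ (∏ς λs)
∑ₚₛ-θ []       = 𝕊.sym θ-1ₛ
∑ₚₛ-θ (c ∷ λs) = begin
  ∑ₚₛ (c ∷ λs) (λ m r → θ (ς m) *ₛ ∏ς r)
    ≈⟨ ∑ₚₛ-∷ c λs (λ m r → θ (ς m) *ₛ ∏ς r) ⟩
  θ (ς c) *ₛ ∏ς λs +ₛ ∑ₚₛ λs (λ m r → θ (ς m) *ₛ (ς c *ₛ ∏ς r))
    ≈⟨ +-congˡ (θ (ς c) *ₛ ∏ς λs) (∑ₚₛ-cong λs (λ m r _ →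
         solveₛ 3 (λ t c p → t :* (c :* p) := c :* (t :* p)) 𝕊.refl (θ (ς m)) (ς c) (∏ς r))) ⟩
  θ (ς c) *ₛ ∏ς λs +ₛ ∑ₚₛ λs (λ m r → ς c *ₛ (θ (ς m) *ₛ ∏ς r))
    ≈⟨ +-congˡ (θ (ς c) *ₛ ∏ς λs) (𝕊.sym (*-∑ₚₛ (ς c) λs (λ m r → θ (ς m) *ₛ ∏ς r))) ⟩
  θ (ς c) *ₛ ∏ς λs +ₛ ς c *ₛ ∑ₚₛ λs (λ m r → θ (ς m) *ₛ ∏ς r)
    ≈⟨ +-congˡ (θ (ς c) *ₛ ∏ς λs) (*-congˡ (ς c) (∑ₚₛ-θ λs)) ⟩
  θ (ς c) *ₛ ∏ς λs +ₛ ς c *ₛ θ (∏ς λs)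
    ≈⟨ θ-*ₛ (ς c) (∏ς λs) ⟨
  θ (ς c *ₛ ∏ς λs) ∎
  where open ≈ₛ-Reasoning

∑ₚₛ-join : ∀ m λs → ∑ₚₛ λs (λ c r → const (fromℕ c) *ₛ (ς (m + c) *ₛ ∏ς r)) ≈ₛ joinₛ m λs
∑ₚₛ-join m []       = 𝕊.refl
∑ₚₛ-join m (c ∷ λs) = begin
  ∑ₚₛ (c ∷ λs) G
    ≈⟨ ∑ₚₛ-∷ c λs G ⟩
  G c λs +ₛ ∑ₚₛ λs (λ b r → const (fromℕ b) *ₛ (ς (m + b) *ₛ (ς c *ₛ ∏ς r)))
    ≈⟨ +-congˡ (G c λs) (∑ₚₛ-cong λs (λ b r _ →
         solveₛ 4 (λ k t c p → k :* (t :* (c :* p)) := c :* (k :* (t :* p))) 𝕊.refl (const (fromℕ b)) (ς (m + b)) (ς c) (∏ς r))) ⟩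
  G c λs +ₛ ∑ₚₛ λs (λ b r → ς c *ₛ G b r)
    ≈⟨ +-congˡ (G c λs) (𝕊.sym (*-∑ₚₛ (ς c) λs G)) ⟩
  G c λs +ₛ ς c *ₛ ∑ₚₛ λs G
    ≈⟨ +-congˡ (G c λs) (*-congˡ (ς c) (∑ₚₛ-join m λs)) ⟩
  G c λs +ₛ ς c *ₛ joinₛ m λs ∎
  where
  open ≈ₛ-Reasoning
  G : ℕ → List ℕ → Series
  G c r = const (fromℕ c) *ₛ (ς (m + c) *ₛ ∏ς r)

CJ : ℕ → List ℕ → Series
CJ m r t = cutJoin (λ μs → T μs t) m r

ς₁*cutSum : ∀ p q r → ς 1 *ₛ (λ t → cutSum (λ μs → T μs t) p q r) ≈ₛ cutₛ p q *ₛ ∏ς r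
ς₁*cutSum p zero    r = 𝕊.trans (𝕊.zeroʳ (ς 1)) (𝕊.sym (𝕊.zeroˡ (∏ς r)))
ς₁*cutSum p (suc q) r = begin
  ς 1 *ₛ (T (p ∷ suc q ∷ r) +ₛ C)
    ≈⟨ 𝕊.distribˡ (ς 1) (T (p ∷ suc q ∷ r)) C ⟩
  ς 1 *ₛ T (p ∷ suc q ∷ r) +ₛ ς 1 *ₛ C
    ≈⟨ +-cong (ς₁*T p (suc q ∷ r)) (ς₁*cutSum (suc p) q r) ⟩
  ς p *ₛ (ς (suc q) *ₛ ∏ς r) +ₛ cutₛ (suc p) q *ₛ ∏ς r
    ≈⟨ solveₛ 4 (λ a b c p → a :* (b :* p) :+ c :* p := (a :* b :+ c) :* p) 𝕊.refl (ς p) (ς (suc q)) (cutₛ (suc p) q) (∏ς r) ⟩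
  (ς p *ₛ ς (suc q) +ₛ cutₛ (suc p) q) *ₛ ∏ς r ∎
  where
  open ≈ₛ-Reasoning
  C : Series
  C t = cutSum (λ μs → T μs t) (suc p) q r

ς₁*joinSum : ∀ m r → ς 1 *ₛ (λ t → joinSum (λ μs → T μs t) m r) ≈ₛ joinₛ m r
ς₁*joinSum m r = begin
  ς 1 *ₛ (λ t → joinSum (λ μs → T μs t) m r)
    ≈⟨ *-congˡ (ς 1) (∑ₚₛ-cong r {λ c r′ → fromℕ c · T (m + c ∷ r′)} (λ c r′ _ → ·≈const (fromℕ c) (T (m + c ∷ r′)))) ⟩
  ς 1 *ₛ ∑ₚₛ r (λ c r′ → const (fromℕ c) *ₛ T (m + c ∷ r′))
    ≈⟨ *-∑ₚₛ (ς 1) r (λ c r′ → const (fromℕ c) *ₛ T (m + c ∷ r′)) ⟩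
  ∑ₚₛ r (λ c r′ → ς 1 *ₛ (const (fromℕ c) *ₛ T (m + c ∷ r′)))
    ≈⟨ ∑ₚₛ-cong r (λ c r′ _ → 𝕊.trans
         (solveₛ 3 (λ s k t → s :* (k :* t) := k :* (s :* t)) 𝕊.refl (ς 1) (const (fromℕ c)) (T (m + c ∷ r′)))
         (*-congˡ (const (fromℕ c)) (ς₁*T (m + c) r′))) ⟩
  ∑ₚₛ r (λ c r′ → const (fromℕ c) *ₛ (ς (m + c) *ₛ ∏ς r′))
    ≈⟨ ∑ₚₛ-join m r ⟩
  joinₛ m r ∎
  where open ≈ₛ-Reasoning

-- One factor ς(1) clears the denominator of `T`, the other makes the cuts telescope, and x
-- completes the derivatives of the ς. The cuts contribute the weight m and the joins the weight
-- `sumᴸ r` to the same term, so that only the total number of points remains.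
Xς₁ς₁*CJ : ∀ q r → let m = suc q ; Y = const ℚ.½ *ₛ (X *ₛ χ m) in
  X *ₛ (ς 1 *ₛ (ς 1 *ₛ CJ m r)) ≈ₛ
  ς 1 *ₛ (const (fromℕ (m + sumᴸ r)) *ₛ (Y *ₛ ∏ς r) +ₛ θ (ς m *ₛ ∏ς r)) +ₛ -ₛ (X *ₛ χ 1 *ₛ (ς m *ₛ ∏ς r))
Xς₁ς₁*CJ q r = begin
  X *ₛ (ς 1 *ₛ (ς 1 *ₛ CJ m r))
    ≈⟨ *-congˡ X (*-congˡ (ς 1) (𝕊.trans (𝕊.distribˡ (ς 1) C K) (+-cong (ς₁*cutSum 1 q r) (ς₁*joinSum m r)))) ⟩
  X *ₛ (ς 1 *ₛ (cutₛ 1 q *ₛ P +ₛ joinₛ m r))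
    ≈⟨ solveₛ 5 (λ x s c p j → x :* (s :* (c :* p :+ j)) := x :* (s :* c) :* p :+ s :* (x :* j)) 𝕊.refl
         X (ς 1) (cutₛ 1 q) P (joinₛ m r) ⟩
  X *ₛ (ς 1 *ₛ cutₛ 1 q) *ₛ P +ₛ ς 1 *ₛ (X *ₛ joinₛ m r)
    ≈⟨ +-cong (*-congʳ P (*-congˡ X (ς₁*cutₛ₁ q))) (*-congˡ (ς 1) (X*joinₛ m r)) ⟩
  X *ₛ (κ *ₛ (ς 1 *ₛ χ m) +ₛ -ₛ (χ 1 *ₛ ς m)) *ₛ P +ₛ ς 1 *ₛ (ς m *ₛ θ P +ₛ Σκ *ₛ Y *ₛ P)
    ≈⟨ solveₛ 9 (λ x k s₁ c₁ s c p dp K →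
          x :* (k :* (s₁ :* c) :+ :- (c₁ :* s)) :* p :+ s₁ :* (s :* dp :+ K :* (con ℚ.½ :* (x :* c)) :* p)
          := s₁ :* ((k :+ K) :* ((con ℚ.½ :* (x :* c)) :* p) :+ (k :* (con ℚ.½ :* (x :* c)) :* p :+ s :* dp))
             :+ :- (x :* c₁ :* (s :* p))) 𝕊.refl
         X κ (ς 1) (χ 1) (ς m) (χ m) P (θ P) Σκ ⟩
  ς 1 *ₛ ((κ +ₛ Σκ) *ₛ (Y *ₛ P) +ₛ (κ *ₛ Y *ₛ P +ₛ ς m *ₛ θ P)) +ₛ -ₛ (X *ₛ χ 1 *ₛ (ς m *ₛ P))
    ≈⟨ +-congʳ _ (*-congˡ (ς 1) (+-cong
         (*-congʳ (Y *ₛ P) (𝕊.trans (𝕊.sym (const-+ (fromℕ m) (fromℕ (sumᴸ r)))) (const-cong (sym (fromℕ-+ m (sumᴸ r))))))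
         (𝕊.trans (+-congʳ (ς m *ₛ θ P) (*-congʳ P (𝕊.sym (θ-ς m)))) (𝕊.sym (θ-*ₛ (ς m) P))))) ⟩
  ς 1 *ₛ (const (fromℕ (m + sumᴸ r)) *ₛ (Y *ₛ P) +ₛ θ (ς m *ₛ P)) +ₛ -ₛ (X *ₛ χ 1 *ₛ (ς m *ₛ P)) ∎
  where
  open ≈ₛ-Reasoning
  m = suc q
  Y = const ℚ.½ *ₛ (X *ₛ χ m)
  P = ∏ς r
  κ = const (fromℕ m)
  Σκ = const (fromℕ (sumᴸ r))
  C K : Series
  C t = cutSum (λ μs → T μs t) 1 q r
  K t = joinSum (λ μs → T μs t) m r

-- Let L be the product of all ς and d the total. The weights m turn half of x χ(m) into θ(ς m), so
-- the first parts add up to d ς(1) θL by the Leibniz rule; the other parts do not depend on the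
-- picked cycle and are multiplied by d. Together they give 2d (ς(1) θL - θ(ς 1) L), which is 2d
-- ς(1)² θ(L/ς(1)) by the quotient rule.
∑CJ : ∀ b λs → All (1 ≤_) (b ∷ λs) → ∑ₚₛ (b ∷ λs) (λ m r → const (fromℕ m) *ₛ CJ m r) *ₛ X ≈ₛ
  const (fromℕ 2 ⊗ fromℕ (sumᴸ (b ∷ λs))) *ₛ θ (T (b ∷ λs))
∑CJ b λs pos = ς₁-cancel (ς₁-cancel (begin
  ς 1 *ₛ (ς 1 *ₛ (Σ₁ *ₛ X))
    ≈⟨ solveₛ 3 (λ s y x → s :* (s :* (y :* x)) := (x :* s :* s) :* y) 𝕊.refl (ς 1) Σ₁ X ⟩
  (X *ₛ ς 1 *ₛ ς 1) *ₛ Σ₁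
    ≈⟨ *-∑ₚₛ (X *ₛ ς 1 *ₛ ς 1) μs (λ m r → const (fromℕ m) *ₛ CJ m r) ⟩
  ∑ₚₛ μs (λ m r → (X *ₛ ς 1 *ₛ ς 1) *ₛ (const (fromℕ m) *ₛ CJ m r))
    ≈⟨ ∑ₚₛ-cong μs term ⟩
  ∑ₚₛ μs (λ m r → (D *ₛ ς 1) *ₛ (θ (ς m) *ₛ ∏ς r) +ₛ const (fromℕ m) *ₛ W)
    ≈⟨ ∑ₚₛ-+ μs (λ m r → (D *ₛ ς 1) *ₛ (θ (ς m) *ₛ ∏ς r)) (λ m r → const (fromℕ m) *ₛ W) ⟩
  ∑ₚₛ μs (λ m r → (D *ₛ ς 1) *ₛ (θ (ς m) *ₛ ∏ς r)) +ₛ ∑ₚₛ μs (λ m r → const (fromℕ m) *ₛ W)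
    ≈⟨ +-cong (𝕊.trans (𝕊.sym (*-∑ₚₛ (D *ₛ ς 1) μs (λ m r → θ (ς m) *ₛ ∏ς r))) (*-congˡ (D *ₛ ς 1) (∑ₚₛ-θ μs)))
              (∑ₚₛ-weight μs W) ⟩
  (D *ₛ ς 1) *ₛ θ L +ₛ D *ₛ (ς 1 *ₛ θ L +ₛ -ₛ (X *ₛ χ 1 *ₛ L))
    ≈⟨ solveₛ 6 (λ d s t x c l → (d :* s) :* t :+ d :* (s :* t :+ :- (x :* c :* l))
          := con (fromℕ 2) :* d :* (s :* t :+ :- ((con 1ℚ :* (con ℚ.½ :* (x :* c))) :* l))) 𝕊.refl D (ς 1) (θ L) X (χ 1) L ⟩
  const (fromℕ 2) *ₛ D *ₛ (ς 1 *ₛ θ L +ₛ -ₛ ((const 1ℚ *ₛ (const ℚ.½ *ₛ (X *ₛ χ 1))) *ₛ L))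
    ≈⟨ *-congˡ (const (fromℕ 2) *ₛ D) (+-cong (*-congˡ (ς 1) (𝕊.trans (θ-cong (𝕊.sym ς₁T≈L)) (θ-*ₛ (ς 1) Tμ)))
         (-‿cong (*ₛ-cong (𝕊.sym (θ-ς 1)) (𝕊.sym ς₁T≈L)))) ⟩
  const (fromℕ 2) *ₛ D *ₛ (ς 1 *ₛ (θ (ς 1) *ₛ Tμ +ₛ ς 1 *ₛ θ Tμ) +ₛ -ₛ (θ (ς 1) *ₛ (ς 1 *ₛ Tμ)))
    ≈⟨ solveₛ 5 (λ k s ds t dt → k :* (s :* (ds :* t :+ s :* dt) :+ :- (ds :* (s :* t)))
          := s :* (s :* (k :* dt))) 𝕊.refl (const (fromℕ 2) *ₛ D) (ς 1) (θ (ς 1)) Tμ (θ Tμ) ⟩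
  ς 1 *ₛ (ς 1 *ₛ (const (fromℕ 2) *ₛ D *ₛ θ Tμ))
    ≈⟨ *-congˡ (ς 1) (*-congˡ (ς 1) (*-congʳ (θ Tμ)
         (𝕊.sym (SolverRing._-Raw-AlmostCommutative⟶_.*-homo const-homomorphism (fromℕ 2) (fromℕ (sumᴸ μs)))))) ⟩
  ς 1 *ₛ (ς 1 *ₛ (const (fromℕ 2 ⊗ fromℕ (sumᴸ μs)) *ₛ θ Tμ)) ∎))
  where
  open ≈ₛ-Reasoning
  μs = b ∷ λs
  D  = const (fromℕ (sumᴸ μs))
  L  = ∏ς μs
  Tμ = T μs
  ς₁T≈L = ς₁*T b λs
  Σ₁ = ∑ₚₛ μs (λ m r → const (fromℕ m) *ₛ CJ m r)
  W  = ς 1 *ₛ θ L +ₛ -ₛ (X *ₛ χ 1 *ₛ L)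
  term : ∀ m r → m ∷ r ↭ μs → (X *ₛ ς 1 *ₛ ς 1) *ₛ (const (fromℕ m) *ₛ CJ m r) ≈ₛ
    (D *ₛ ς 1) *ₛ (θ (ς m) *ₛ ∏ς r) +ₛ const (fromℕ m) *ₛ W
  term zero    r p = contradiction (All.head (↭.All-resp-↭ (↭-sym p) pos)) λ ()
  term (suc q) r p = begin
    (X *ₛ ς 1 *ₛ ς 1) *ₛ (κ *ₛ CJ m r)
      ≈⟨ solveₛ 4 (λ x s k c → (x :* s :* s) :* (k :* c) := k :* (x :* (s :* (s :* c)))) 𝕊.refl X (ς 1) κ (CJ m r) ⟩
    κ *ₛ (X *ₛ (ς 1 *ₛ (ς 1 *ₛ CJ m r)))
      ≈⟨ *-congˡ κ (Xς₁ς₁*CJ q r) ⟩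
    κ *ₛ (ς 1 *ₛ (const (fromℕ (m + sumᴸ r)) *ₛ (Y *ₛ ∏ς r) +ₛ θ (∏ς (m ∷ r))) +ₛ -ₛ (X *ₛ χ 1 *ₛ ∏ς (m ∷ r)))
      ≈⟨ *-congˡ κ (+-cong (*-congˡ (ς 1) (+-cong (*-congʳ (Y *ₛ ∏ς r) (const-cong (cong fromℕ (ℕ.sum-↭ p)))) (θ-cong (∏ς-↭ p))))
                           (-‿cong (*-congˡ (X *ₛ χ 1) (∏ς-↭ p)))) ⟩
    κ *ₛ (ς 1 *ₛ (D *ₛ (Y *ₛ ∏ς r) +ₛ θ L) +ₛ -ₛ (X *ₛ χ 1 *ₛ L))
      ≈⟨ solveₛ 7 (λ k s d y p t z → k :* (s :* (d :* (y :* p) :+ t) :+ :- z)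
            := (d :* s) :* (k :* y :* p) :+ k :* (s :* t :+ :- z)) 𝕊.refl κ (ς 1) D Y (∏ς r) (θ L) (X *ₛ χ 1 *ₛ L) ⟩
    (D *ₛ ς 1) *ₛ (κ *ₛ Y *ₛ ∏ς r) +ₛ κ *ₛ W
      ≈⟨ +-congʳ (κ *ₛ W) (*-congˡ (D *ₛ ς 1) (*-congʳ (∏ς r) (𝕊.sym (θ-ς m)))) ⟩
    (D *ₛ ς 1) *ₛ (θ (ς m) *ₛ ∏ς r) +ₛ κ *ₛ W ∎
    where
    m = suc q
    κ = const (fromℕ m)
    Y = const ℚ.½ *ₛ (X *ₛ χ m)

-- Comparison of the coefficients of x^(t+1) in `∑CJ`: the factor x shifts the left side to t, and θ
-- produces t + 1 on the right.
∑ₚ-cutJoin : ∀ b λs → All (1 ≤_) (b ∷ λs) → ∀ t →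
  ∑ₚ (b ∷ λs) (λ m r → fromℕ m ⊗ cutJoin (λ μs → T μs t) m r) ≡
  fromℕ 2 ⊗ fromℕ (sumᴸ (b ∷ λs)) ⊗ (fromℕ (suc t) ⊗ T (b ∷ λs) (suc t))
∑ₚ-cutJoin b λs pos t = begin
  ∑ₚₛ μs (λ m r → fromℕ m · CJ m r) t
    ≡⟨ ∑ₚₛ-cong μs {λ m r → fromℕ m · CJ m r} (λ m r _ → ·≈const (fromℕ m) (CJ m r)) .at t ⟩
  Σ₁ t
    ≡⟨ X-*ₛ Σ₁ .at (suc t) ⟨
  (X *ₛ Σ₁) (suc t)
    ≡⟨ 𝕊.*-comm X Σ₁ .at (suc t) ⟩
  (Σ₁ *ₛ X) (suc t)
    ≡⟨ ∑CJ b λs pos .at (suc t) ⟩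
  (const (fromℕ 2 ⊗ fromℕ (sumᴸ μs)) *ₛ θ (T μs)) (suc t)
    ≡⟨ const-*ₛ (fromℕ 2 ⊗ fromℕ (sumᴸ μs)) (θ (T μs)) .at (suc t) ⟩
  fromℕ 2 ⊗ fromℕ (sumᴸ μs) ⊗ (fromℕ (suc t) ⊗ T μs (suc t)) ∎
  where
  open ≡-Reasoning
  μs = b ∷ λs
  Σ₁ = ∑ₚₛ μs (λ m r → const (fromℕ m) *ₛ CJ m r)

-- Cycle decompositions

Unique-resp-↭ : ∀ {A : Set} {xs ys : List A} → xs ↭ ys → Unique xs → Unique ys
Unique-resp-↭ {A} p = ↭ₛ.Unique-resp-↭ (setoid A) (↭.↭⇒↭ₛ p)

concat-↭ : ∀ {A : Set} {xss yss : List (List A)} → xss ↭ yss → concat xss ↭ concat yss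
concat-↭ ↭.refl         = ↭-refl
concat-↭ (prep xs p)    = ↭.++⁺ˡ xs (concat-↭ p)
concat-↭ (swap xs ys p) = ↭-trans (↭.shifts xs ys) (↭.++⁺ˡ ys (↭.++⁺ˡ xs (concat-↭ p)))
concat-↭ (↭.trans p q)  = ↭-trans (concat-↭ p) (concat-↭ q)

transpose-matchˡ : ∀ {d} (a b : Fin d) → PC.transpose a b a ≡ b
transpose-matchˡ a b rewrite dec-true (a Fin.≟ a) refl = refl

transpose-matchʳ : ∀ {d} (a b : Fin d) → PC.transpose a b b ≡ a
transpose-matchʳ a b with b Fin.≟ a
... | yes b≡a = b≡a
... | no  _ rewrite dec-true (b Fin.≟ b) refl = refl

transpose-mismatch : ∀ {d} {a b k : Fin d} → k ≢ a → k ≢ b → PC.transpose a b k ≡ k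
transpose-mismatch {a = a} {b} {k} k≢a k≢b
  rewrite dec-false (k Fin.≟ a) k≢a | dec-false (k Fin.≟ b) k≢b = refl

transpose-same : ∀ {d} (a k : Fin d) → PC.transpose a a k ≡ k
transpose-same a k with k Fin.≟ a
... | yes k≡a = sym k≡a
... | no  k≢a rewrite dec-false (k Fin.≟ a) k≢a = refl

-- The end point is not listed, so that a cycle is a path from its first element back to itself and
-- every element occurs once in the list.
Path : ∀ {d} → (Fin d → Fin d) → Fin d → List (Fin d) → Fin d → Set
Path f a []       z = f a ≡ z
Path f a (y ∷ ys) z = f a ≡ y × Path f y ys z

IsCycle : ∀ {d} → (Fin d → Fin d) → List (Fin d) → Set
IsCycle f []       = ⊥
IsCycle f (x ∷ xs) = Path f x xs x

-- The single rearrangement of `allFin d` says both that the cycles cover all points and that no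
-- point is repeated.
record Cycles {d} (f : Fin d → Fin d) (cs : List (List (Fin d))) : Set where
  constructor cycles
  field
    partition : concat cs ↭ allFin d
    isCycle   : All (IsCycle f) cs
open Cycles

module _ {d} {f : Fin d → Fin d} where

  path-++ : ∀ a xs {b ys z} → Path f a xs b → Path f b ys z → Path f a (xs ++ b ∷ ys) z
  path-++ a []       p q = p , q
  path-++ a (x ∷ xs) (e , p) q = e , path-++ x xs p q

  path-split : ∀ a xs {b ys z} → Path f a (xs ++ b ∷ ys) z → Path f a xs b × Path f b ys z
  path-split a []       (e , q) = e , q
  path-split a (x ∷ xs) (e , p) with path-split x xs p
  ... | p₁ , p₂ = (e , p₁) , p₂

  rotate : ∀ us {i vs} → IsCycle f (us ++ i ∷ vs) → IsCycle f (i ∷ vs ++ us)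
  rotate []       {i} {vs} p = subst (λ xs → Path f i xs i) (sym (List.++-identityʳ vs)) p
  rotate (u ∷ us) {i} {vs} p with path-split u us p
  ... | p₁ , p₂ = path-++ i vs p₂ p₁

  cycles-↭ : ∀ {cs cs′} → cs ↭ cs′ → Cycles f cs → Cycles f cs′
  cycles-↭ p (cycles part cyc) = cycles (↭-trans (concat-↭ (↭-sym p)) part) (↭.All-resp-↭ p cyc)

  cycles-rotate : ∀ us {i vs rest} → Cycles f ((us ++ i ∷ vs) ∷ rest) → Cycles f ((i ∷ vs ++ us) ∷ rest)
  cycles-rotate us {i} {vs} {rest} (cycles part (c ∷ cyc)) =
    cycles (↭-trans (↭.++⁺ʳ (concat rest) (↭.++-comm (i ∷ vs) us)) part) (rotate us c ∷ cyc)

  cycles-unique : ∀ {cs} → Cycles f cs → Unique (concat cs)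
  cycles-unique c = Unique-resp-↭ (↭-sym (partition c)) (Unique.allFin⁺ d)

  cycles-resp : ∀ {g cs} → (∀ i → f i ≡ g i) → Cycles f cs → Cycles g cs
  cycles-resp {g} eq (cycles part cyc) = cycles part (All.map (λ {c} → go c) cyc)
    where
    path : ∀ a xs {z} → Path f a xs z → Path g a xs z
    path a []       p       = trans (sym (eq a)) p
    path a (x ∷ xs) (e , p) = trans (sym (eq a)) e , path x xs p
    go : ∀ c → IsCycle f c → IsCycle g c
    go (x ∷ xs) = path x xs

  ∈-cycles : ∀ {cs} → Cycles f cs → ∀ a → a ∈ concat cs
  ∈-cycles c a = ↭.∈-resp-↭ (↭-sym (partition c)) (∈.∈-allFin a)

extract : ∀ {A : Set} {x : A} {xs} → x ∈ xs → ∃ λ ys → x ∷ ys ↭ xs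
extract {x = x} x∈ with ∈.∈-∃++ x∈
... | us , vs , refl = us ++ vs , ↭-sym (↭.shift x us vs)

-- Rotates the cycle through `a` to begin at `a` and brings it to the front, while the cycles in
-- `cs₀`, already in position, stay intact.
focus : ∀ {d} {f : Fin d → Fin d} cs₀ {cs a} → a ∈ concat cs → Cycles f (cs₀ ++ cs) →
  ∃ λ xs → ∃ λ rest → Cycles f ((a ∷ xs) ∷ cs₀ ++ rest)
focus cs₀ {cs} {a} a∈ c with ∈.∈-concat⁻′ cs a∈
... | l , a∈l , l∈cs with extract l∈cs | ∈.∈-∃++ a∈l
...   | rest , p | us , vs , refl = vs ++ us , rest ,
  cycles-rotate us (cycles-↭ (↭-trans (↭.++⁺ˡ cs₀ (↭-sym p)) (↭.shift (us ++ a ∷ vs) cs₀ rest)) c)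

module _ {d} {f : Fin d → Fin d} (a b : Fin d) where
  private
    f′ : Fin d → Fin d
    f′ = PC.transpose a b ∘ f

    Avoids : Fin d → Set
    Avoids k = k ≢ a × k ≢ b

  -- Only the last arrow of a path avoiding a and b changes.
  path-transpose : ∀ u xs {z} → All Avoids xs → Path f u xs z → Path f′ u xs (PC.transpose a b z)
  path-transpose u []       []              p       = cong (PC.transpose a b) p
  path-transpose u (x ∷ xs) ((x≢a , x≢b) ∷ av) (e , p) =
    trans (cong (PC.transpose a b) e) (transpose-mismatch x≢a x≢b) , path-transpose x xs av p

  cycle-transpose : ∀ xs → All Avoids xs → IsCycle f xs → IsCycle f′ xs
  cycle-transpose (x ∷ xs) ((x≢a , x≢b) ∷ av) p =
    subst (Path f′ x xs) (transpose-mismatch x≢a x≢b) (path-transpose x xs av p)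

  cycles-transpose : ∀ cs → All Avoids (concat cs) → All (IsCycle f) cs → All (IsCycle f′) cs
  cycles-transpose []       av []       = []
  cycles-transpose (c ∷ cs) av (p ∷ ps) =
    cycle-transpose c (All.++⁻ˡ c av) p ∷ cycles-transpose cs (All.++⁻ʳ c av) ps

  private
    avoids : ∀ xs {zs} → Unique (a ∷ xs ++ b ∷ zs) → All Avoids xs × All Avoids zs
    avoids xs {zs} u with Unique-resp-↭ (prep a (↭.shift b xs zs)) u
    ... | (_ ∷ a∉) ∷ (b∉ ∷ _) = All.++⁻ xs (All.zipWith (λ (p , q) → p ∘ sym , q ∘ sym) (a∉ , b∉))

  -- The transposition acts after `f` and therefore redirects just two arrows: the one into `b` now
  -- ends at `a`, and the one into `a` at `b`. One closed path becomes two; read backwards, this is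
  -- `join`.
  cut : ∀ xs ys rest → Cycles f ((a ∷ xs ++ b ∷ ys) ∷ rest) → Cycles f′ ((a ∷ xs) ∷ (b ∷ ys) ∷ rest)
  cut xs ys rest c@(cycles part (p ∷ cyc))
    with avoids xs (subst Unique (List.++-assoc (a ∷ xs) (b ∷ ys) (concat rest)) (cycles-unique c)) | path-split a xs p
  ... | av-xs , av-zs | p₁ , p₂ = cycles
    (subst (_↭ allFin d) (List.++-assoc (a ∷ xs) (b ∷ ys) (concat rest)) part)
    ( subst (Path f′ a xs) (transpose-matchʳ a b) (path-transpose a xs av-xs p₁)
    ∷ subst (Path f′ b ys) (transpose-matchˡ a b) (path-transpose b ys (All.++⁻ˡ ys av-zs) p₂)
    ∷ cycles-transpose rest (All.++⁻ʳ ys av-zs) cyc)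

  join : ∀ xs ys rest → Cycles f ((a ∷ xs) ∷ (b ∷ ys) ∷ rest) → Cycles f′ ((a ∷ xs ++ b ∷ ys) ∷ rest)
  join xs ys rest c@(cycles part (p₁ ∷ p₂ ∷ cyc)) with avoids xs (cycles-unique c)
  ... | av-xs , av-zs = cycles
    (subst (_↭ allFin d) (sym (List.++-assoc (a ∷ xs) (b ∷ ys) (concat rest))) part)
    ( path-++ a xs
        (subst (Path f′ a xs) (transpose-matchˡ a b) (path-transpose a xs av-xs p₁))
        (subst (Path f′ b ys) (transpose-matchʳ a b) (path-transpose b ys (All.++⁻ˡ ys av-zs) p₂))
    ∷ cycles-transpose rest (All.++⁻ʳ ys av-zs) cyc)

  cycles-∘transpose : ∃ (Cycles f) → ∃ (Cycles f′)
  cycles-∘transpose (cs , c) with focus [] (∈-cycles c a) c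
  ... | xs , rest , c′ with ∈-cycles c′ b
  -- Here `b` is `a` and the transposition is the identity.
  ...   | here refl = (a ∷ xs) ∷ rest , cycles-resp (λ i → sym (transpose-same a (f i))) c′
  ...   | there b∈ with ∈.∈-++⁻ xs b∈
  ...     | inj₁ b∈xs with us , vs , refl ← ∈.∈-∃++ b∈xs = (a ∷ us) ∷ (b ∷ vs) ∷ rest , cut us vs rest c′
  ...     | inj₂ b∈rest with focus ((a ∷ xs) ∷ []) b∈rest c′
  ...       | ys , rest′ , c″ = (a ∷ xs ++ b ∷ ys) ∷ rest′ ,
              join xs ys rest′ (cycles-↭ (swap (b ∷ ys) (a ∷ xs) ↭-refl) c″)

concat-singletons : ∀ {A : Set} (xs : List A) → concat (List.map List.[_] xs) ≡ xs
concat-singletons []       = refl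
concat-singletons (x ∷ xs) = cong (x ∷_) (concat-singletons xs)

cycles-id : ∀ {d} → Cycles {d} id (List.map List.[_] (allFin d))
cycles-id {d} = cycles (↭.↭-reflexive (concat-singletons (allFin d))) (All.map⁺ (All.universal (λ _ → refl) (allFin d)))

-- A permutation is a product of transpositions. Starting from the fixed points of the identity,
-- each of them cuts a cycle, joins two, or does nothing, so the decomposition arises without
-- following orbits.
cycles-exist : ∀ {d} (σ : Permutation′ d) → ∃ (Cycles (σ ⟨$⟩ʳ_))
cycles-exist σ with go (Transpositions.decompose σ) (_ , cycles-id)
  where
  go : ∀ {d} {f : Fin d → Fin d} ts → ∃ (Cycles f) → ∃ (Cycles (λ i → Transpositions.eval ts ⟨$⟩ʳ f i))
  go []             c = c
  go ((a , b) ∷ ts) c = go ts (cycles-∘transpose a b c)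
... | cs , c = cs , cycles-resp (Transpositions.eval-decompose σ) c

module _ {d} {f g : Fin d → Fin d} (inverse : ∀ i → g (f i) ≡ i) where

  path-reverse : ∀ a xs {z} → Path f a xs z → Path g z (List.reverse xs) a
  path-reverse a []       refl       = inverse a
  path-reverse a (x ∷ xs) (refl , p) = subst (λ ys → Path g _ ys a) (sym (List.unfold-reverse x xs))
    (path-++ _ (List.reverse xs) (path-reverse x xs p) (inverse a))

  private
    rev : List (Fin d) → List (Fin d)
    rev []       = []
    rev (x ∷ xs) = x ∷ List.reverse xs

    rev-↭ : ∀ xs → rev xs ↭ xs
    rev-↭ []       = ↭-refl
    rev-↭ (x ∷ xs) = prep x (↭.↭-reverse xs)

    concat-rev : ∀ cs → concat (List.map rev cs) ↭ concat cs
    concat-rev []       = ↭-refl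
    concat-rev (c ∷ cs) = ↭.++⁺ (rev-↭ c) (concat-rev cs)

    rev-cycle : ∀ c → IsCycle f c → IsCycle g (rev c)
    rev-cycle (x ∷ xs) = path-reverse x xs

  cycles-inverse : ∀ {cs} → Cycles f cs → ∃ λ cs′ → Cycles g cs′ × List.map length cs′ ≡ List.map length cs
  cycles-inverse {cs} (cycles part cyc) = List.map rev cs ,
    cycles (↭-trans (concat-rev cs) part) (All.map⁺ (All.map (λ {c} → rev-cycle c) cyc)) ,
    trans (sym (List.map-∘ cs)) (List.map-cong (λ c → ↭.↭-length (rev-↭ c)) cs)

cycles-lift₀ : ∀ {d} (π : Permutation′ d) {cs} → Cycles (π ⟨$⟩ʳ_) cs →
  Cycles (lift₀ π ⟨$⟩ʳ_) ((Fin.zero ∷ []) ∷ List.map (List.map Fin.suc) cs)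
cycles-lift₀ {d} π {cs} (cycles part cyc) = cycles
  (prep Fin.zero (↭-trans (↭.↭-reflexive (List.concat-map cs))
    (↭-trans (↭.map⁺ Fin.suc part) (↭.↭-reflexive (List.map-tabulate id Fin.suc)))))
  (refl ∷ All.map⁺ (All.map (λ {c} → lift c) cyc))
  where
  path : ∀ a xs {z} → Path (π ⟨$⟩ʳ_) a xs z → Path (lift₀ π ⟨$⟩ʳ_) (Fin.suc a) (List.map Fin.suc xs) (Fin.suc z)
  path a []       p       = cong Fin.suc p
  path a (x ∷ xs) (e , p) = cong Fin.suc e , path x xs p
  lift : ∀ c → IsCycle (π ⟨$⟩ʳ_) c → IsCycle (lift₀ π ⟨$⟩ʳ_) (List.map Fin.suc c)
  lift (x ∷ xs) = path x xs

fold-suc : ∀ {A : Set} (f : A → A) a k → fold (f a) f k ≡ fold a f (suc k)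
fold-suc f a zero    = refl
fold-suc f a (suc k) = cong f (fold-suc f a k)

module _ {d} {f : Fin d → Fin d} where

  path-closed : ∀ a xs {z y} → Path f a xs z → y ∈ a ∷ xs → f y ∈ xs ⊎ f y ≡ z
  path-closed a []       p       (here refl) = inj₂ p
  path-closed a (x ∷ xs) (e , p) (here refl) = inj₁ (here e)
  path-closed a (x ∷ xs) (e , p) (there y∈)  with path-closed x xs p y∈
  ... | inj₁ fy∈ = inj₁ (there fy∈)
  ... | inj₂ eq  = inj₂ eq

  fold-closed : ∀ i xs → IsCycle f (i ∷ xs) → ∀ k → fold i f k ∈ i ∷ xs
  fold-closed i xs p zero    = here refl
  fold-closed i xs p (suc k) with path-closed i xs p (fold-closed i xs p k)
  ... | inj₁ ∈xs = there ∈xs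
  ... | inj₂ eq  = here eq

  -- The bound on `k` serves `SameCycle`, whose exponents lie below d: a cycle has at most d
  -- elements.
  path-reaches : ∀ a xs {z y} → Path f a xs z → y ∈ a ∷ xs → ∃ λ k → k ≤ length xs × fold a f k ≡ y
  path-reaches a xs       p          (here refl) = 0 , z≤n , refl
  path-reaches a (x ∷ xs) (refl , p) (there y∈)  with path-reaches x xs p y∈
  ... | k , k≤ , eq = suc k , s≤s k≤ , trans (sym (fold-suc f a k)) eq

  cycles-disjoint : ∀ {c rest j} → Cycles f (c ∷ rest) → j ∈ concat rest → ¬ j ∈ c
  cycles-disjoint {c} C j∈rest j∈c = go c (cycles-unique C) j∈c j∈rest
    where
    go : ∀ c {zs j} → Unique (c ++ zs) → j ∈ c → ¬ j ∈ zs
    go (x ∷ c) (x∉ ∷ u) (here refl) j∈zs = All.lookup (All.++⁻ʳ c x∉) j∈zs refl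
    go (x ∷ c) (x∉ ∷ u) (there j∈c) j∈zs = go c u j∈c j∈zs

  cycle-length-≤ : ∀ {c rest} → Cycles f (c ∷ rest) → length c ≤ d
  cycle-length-≤ {c} {rest} C = subst (length c ≤_)
    (trans (sym (List.length-++ c)) (trans (↭.↭-length (partition C)) (List.length-tabulate id))) (ℕ.m≤m+n (length c) _)

unique-++ˡ : ∀ {A : Set} (xs : List A) {ys} → Unique (xs ++ ys) → Unique xs
unique-++ˡ []       u        = []
unique-++ˡ (x ∷ xs) (x∉ ∷ u) = All.++⁻ˡ xs x∉ ∷ unique-++ˡ xs u

filter-singleton : ∀ {A : Set} {P : Pred A 0ℓ} (P? : Decidable P) {xs m} →
  Unique xs → m ∈ xs → P m → (∀ {i} → i ∈ xs → P i → i ≡ m) → filter P? xs ≡ List.[ m ]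
filter-singleton P? {x ∷ xs} (x∉ ∷ u) (here refl) Pm only = trans (List.filter-accept P? Pm) (cong (x ∷_)
  (List.filter-none P? (All.tabulate λ y∈ Py → All.lookup x∉ y∈ (sym (only (there y∈) Py)))))
filter-singleton P? {x ∷ xs} (x∉ ∷ u) (there m∈) Pm only = trans
  (List.filter-reject P? (λ Px → All.lookup x∉ m∈ (only (here refl) Px)))
  (filter-singleton P? u m∈ Pm (only ∘ there))

least : ∀ {d} (x : Fin d) xs → ∃ λ m → m ∈ x ∷ xs × (∀ {j} → j ∈ x ∷ xs → m Fin.≤ j)
least x []       = x , here refl , λ { (here refl) → ℕ.≤-refl }
least x (y ∷ xs) with least y xs
... | m , m∈ , m≤ with Fin.≤-total x m
...   | inj₁ x≤m = x , here refl , λ { (here refl) → ℕ.≤-refl ; (there j∈) → ℕ.≤-trans x≤m (m≤ j∈) }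
...   | inj₂ m≤x = m , there m∈ , λ { (here refl) → m≤x ; (there j∈) → m≤ j∈ }

module _ {d} (σ : Permutation′ d) where
  private
    f : Fin d → Fin d
    f = σ ⟨$⟩ʳ_

    ℓ : Fin d → ℕ
    ℓ i = length (filter (sameCycle? σ i) (allFin d))

  sameCycle⇒∈ : ∀ {i xs rest j} → Cycles f ((i ∷ xs) ∷ rest) → SameCycle σ i j → j ∈ i ∷ xs
  sameCycle⇒∈ {i} {xs} C (k , refl) = fold-closed i xs (All.head (isCycle C)) (toℕ k)

  ∈⇒sameCycle : ∀ {i xs rest j} → Cycles f ((i ∷ xs) ∷ rest) → j ∈ i ∷ xs → SameCycle σ i j
  ∈⇒sameCycle {i} {xs} C j∈ with path-reaches i xs (All.head (isCycle C)) j∈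
  ... | k , k≤ , eq = Fin.fromℕ< k<d , trans (cong (fold i f) (Fin.toℕ-fromℕ< k<d)) eq
    where k<d = ℕ.≤-trans (s≤s k≤) (cycle-length-≤ C)

  filter-sameCycle : ∀ {i xs rest} → Cycles f ((i ∷ xs) ∷ rest) → ℓ i ≡ suc (length xs)
  filter-sameCycle {i} {xs} {rest} C = begin
    length (filter P? (allFin d))
      ≡⟨ ↭.↭-length (↭.filter-↭ P? (partition C)) ⟨
    length (filter P? ((i ∷ xs) ++ concat rest))
      ≡⟨ cong length (List.filter-++ P? (i ∷ xs) (concat rest)) ⟩
    length (filter P? (i ∷ xs) ++ filter P? (concat rest))
      ≡⟨ cong₂ (λ us vs → length (us ++ vs))
           (List.filter-all P? (All.tabulate (∈⇒sameCycle C)))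
           (List.filter-none P? (All.tabulate λ j∈ same → cycles-disjoint C j∈ (sameCycle⇒∈ C same))) ⟩
    length ((i ∷ xs) ++ [])
      ≡⟨ cong length (List.++-identityʳ (i ∷ xs)) ⟩
    suc (length xs) ∎
    where
    open ≡-Reasoning
    P? = sameCycle? σ i

  private
    rotated : ∀ {c rest i} → Cycles f (c ∷ rest) → i ∈ c →
      ∃ λ xs → Cycles f ((i ∷ xs) ∷ rest) × i ∷ xs ↭ c
    rotated C i∈ with us , vs , refl ← ∈.∈-∃++ i∈ = vs ++ us , cycles-rotate us C , ↭.++-comm (_ ∷ vs) us

  -- Only the minimum of a cycle passes the test, and rotating the cycle to begin there shows that
  -- its class has the length of the cycle.
  filter-isLeast : ∀ {c rest} → Cycles f (c ∷ rest) → List.map ℓ (filter (isLeast? σ) c) ≡ List.[ length c ]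
  filter-isLeast {[]}     (cycles _ (() ∷ _))
  filter-isLeast {x ∷ xs} C with least x xs
  ... | m , m∈ , m≤ with rotated C m∈
  ...   | ms , Cm , m↭ = begin
    List.map ℓ (filter (isLeast? σ) (x ∷ xs))
      ≡⟨ cong (List.map ℓ) (filter-singleton (isLeast? σ)
           (unique-++ˡ (x ∷ xs) (cycles-unique C)) m∈
           (λ j same → m≤ (↭.∈-resp-↭ m↭ (sameCycle⇒∈ Cm same)))
           only) ⟩
    ℓ m ∷ []
      ≡⟨ cong List.[_] (trans (filter-sameCycle Cm) (↭.↭-length m↭)) ⟩
    List.[ length (x ∷ xs) ] ∎
    where
    open ≡-Reasoning
    only : ∀ {i} → i ∈ x ∷ xs → IsLeast σ i → i ≡ m
    only i∈ li with rotated C i∈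
    ... | _ , Ci , i↭ = Fin.≤-antisym (li m (∈⇒sameCycle Ci (↭.∈-resp-↭ (↭-sym i↭) m∈))) (m≤ i∈)

  -- The bridge between the cycle lengths found by search and explicit decompositions. The search
  -- orders cycles by their least elements, so the two agree only up to order.
  cycleLengths-↭ : ∀ {cs} → Cycles f cs → cycleLengths σ ↭ List.map length cs
  cycleLengths-↭ {cs} C = ↭-trans (↭.map⁺ ℓ (↭.filter-↭ (isLeast? σ) (↭-sym (partition C))))
    (↭.↭-reflexive (go cs (All.tabulate λ {c} c∈ → let rest , p = extract c∈ in
      filter-isLeast (cycles-↭ (↭-sym p) C))))
    where
    go : ∀ cs → All (λ c → List.map ℓ (filter (isLeast? σ) c) ≡ List.[ length c ]) cs →
         List.map ℓ (filter (isLeast? σ) (concat cs)) ≡ List.map length cs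
    go []       []       = refl
    go (c ∷ cs) (p ∷ ps) = trans (cong (List.map ℓ) (List.filter-++ (isLeast? σ) c (concat cs)))
      (trans (List.map-++ ℓ (filter (isLeast? σ) c) _) (cong₂ _++_ p (go cs ps)))

∑≡∑ₚ : ∀ {A : Set} (xs : List A) f → ∑ xs f ≡ ∑ₚ xs (λ y _ → f y)
∑≡∑ₚ []       f = refl
∑≡∑ₚ (x ∷ xs) f = trans (cong (f x ⊕_) (∑≡∑ₚ xs f)) (sym (∑ₚ-∷ x xs (λ y _ → f y)))

module _ {d} {f : Fin d → Fin d} (F : Fin d → ℚ) (Q : ℕ → List ℕ → ℚ) where

  -- If `F` depends only on the cycle through a point, a cycle of length m contributes m equal
  -- terms. The cycles in `cs₀` are kept aside: for joins this is the cycle containing the first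
  -- point of the transposition.
  ∑-concat-cycles : ∀ cs₀ cs → Cycles f (cs₀ ++ cs) →
    (∀ {i xs rest} → Cycles f ((i ∷ xs) ∷ cs₀ ++ rest) → F i ≡ Q (suc (length xs)) (List.map length rest)) →
    ∑ (concat cs) F ≡ ∑ₚ (List.map length cs) (λ m r → fromℕ m ⊗ Q m r)
  ∑-concat-cycles cs₀ cs C eq = begin
    ∑ (concat cs) F
      ≡⟨ trans (∑L-concat cs F) (∑≡∑ₚ cs (λ c → ∑ c F)) ⟩
    ∑ₚ cs (λ c _ → ∑ c F)
      ≡⟨ ∑ₚ-cong cs (λ c rest p → trans (∑L-cong∈ c (elem p)) (∑L-const c (Q (length c) (List.map length rest)))) ⟩
    ∑ₚ cs (λ c rest → fromℕ (length c) ⊗ Q (length c) (List.map length rest))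
      ≡⟨ ∑ₚ-map length cs (λ m r → fromℕ m ⊗ Q m r) ⟨
    ∑ₚ (List.map length cs) (λ m r → fromℕ m ⊗ Q m r) ∎
    where
    open ≡-Reasoning
    elem : ∀ {c rest} → c ∷ rest ↭ cs → ∀ i → i ∈ c → F i ≡ Q (length c) (List.map length rest)
    elem {rest = rest} p i i∈ with us , vs , refl ← ∈.∈-∃++ i∈ = trans
      (eq (cycles-rotate us (cycles-↭ (↭-trans (↭.++⁺ˡ cs₀ (↭-sym p)) (↭.shift (us ++ i ∷ vs) cs₀ rest)) C)))
      (cong (λ m → Q m (List.map length rest)) (↭.↭-length (↭.++-comm (i ∷ vs) us)))

module _ {d} (σ : Permutation′ d) (h : List ℕ → ℚ) (h-↭ : ∀ {λs μs} → λs ↭ μs → h λs ≡ h μs) where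
  private
    f : Fin d → Fin d
    f = σ ⟨$⟩ʳ_

    G : Fin d → Fin d → ℚ
    G i j = if does (i Fin.≟ j) then 0ℚ else h (cycleLengths (σ ∘ₚ transpose i j))

    G-off : ∀ {i j} → i ≢ j → G i j ≡ h (cycleLengths (σ ∘ₚ transpose i j))
    G-off {i} {j} i≢j with i Fin.≟ j
    ... | yes i≡j = contradiction i≡j i≢j
    ... | no  _   = refl

    G-diag : ∀ i → G i i ≡ 0ℚ
    G-diag i with i Fin.≟ i
    ... | yes _   = refl
    ... | no  i≢i = contradiction refl i≢i

    h-cycles : ∀ {i j cs} → Cycles (PC.transpose i j ∘ f) cs → h (cycleLengths (σ ∘ₚ transpose i j)) ≡ h (List.map length cs)
    h-cycles {i} {j} C = h-↭ (cycleLengths-↭ (σ ∘ₚ transpose i j) C)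

    -- `us` holds the points between `i` and the current one. Cutting there leaves a cycle with 1 +
    -- |us| points, the first length in `cutSum`, and the remainder of the cycle.
    cut-part : ∀ {i} us ys {rest} → Cycles f ((i ∷ us ++ ys) ∷ rest) →
      ∑ ys (G i) ≡ cutSum h (suc (length us)) (length ys) (List.map length rest)
    cut-part {i} us []       C = refl
    cut-part {i} us (y ∷ ys) {rest} C = cong₂ _⊕_
      (trans (G-off i≢y) (h-cycles (cut i y us ys rest C)))
      (trans (cut-part (us ++ List.[ y ]) ys (subst (λ c → Cycles f ((i ∷ c) ∷ rest)) (sym (List.++-assoc us List.[ y ] ys)) C))
        (cong (λ p → cutSum h (suc p) (length ys) (List.map length rest))
          (trans (List.length-++ us) (ℕ.+-comm (length us) 1))))
      where
      i≢y : i ≢ y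
      i≢y with i∉ ∷ _ ← cycles-unique C = All.lookup i∉ (∈.∈-++⁺ˡ (∈.∈-++⁺ʳ us (here refl)))

  -- A point `j` in the cycle of `i` produces a cut, and each of the c points of another cycle of
  -- length c produces the same join.
  ∑-transpose : ∀ {i xs rest} → Cycles f ((i ∷ xs) ∷ rest) →
    ∑ (allFin d) (G i) ≡ cutJoin h (suc (length xs)) (List.map length rest)
  ∑-transpose {i} {xs} {rest} C = begin
    ∑ (allFin d) (G i)
      ≡⟨ ∑L-↭ (G i) (partition C) ⟨
    G i i ⊕ ∑ (xs ++ concat rest) (G i)
      ≡⟨ cong₂ _⊕_ (G-diag i) (∑L-++ xs (concat rest) (G i)) ⟩
    0ℚ ⊕ (∑ xs (G i) ⊕ ∑ (concat rest) (G i))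
      ≡⟨ ℚ.+-identityˡ _ ⟩
    ∑ xs (G i) ⊕ ∑ (concat rest) (G i)
      ≡⟨ cong₂ _⊕_ (cut-part [] xs C) (∑-concat-cycles (G i) (λ c r → h (suc (length xs) + c ∷ r)) ((i ∷ xs) ∷ []) rest C join-term) ⟩
    cutJoin h (suc (length xs)) (List.map length rest) ∎
    where
    open ≡-Reasoning
    join-term : ∀ {j ys rest′} → Cycles f ((j ∷ ys) ∷ (i ∷ xs) ∷ rest′) →
      G i j ≡ h (suc (length xs) + suc (length ys) ∷ List.map length rest′)
    join-term {j} {ys} {rest′} C′ = trans (G-off i≢j) (trans
      (h-cycles (join i j xs ys rest′ (cycles-↭ (swap (j ∷ ys) (i ∷ xs) ↭-refl) C′)))
      (cong (λ m → h (suc m ∷ List.map length rest′)) (List.length-++ xs)))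
      where
      i≢j : i ≢ j
      i≢j refl = cycles-disjoint C′ (here refl) (here refl)

  ∑∑-transpose : ∑ (allFin d) (λ i → ∑ (allFin d) (G i)) ≡ ∑ₚ (cycleLengths σ) (λ m r → fromℕ m ⊗ cutJoin h m r)
  ∑∑-transpose with cs , C ← cycles-exist σ = begin
    ∑ (allFin d) (λ i → ∑ (allFin d) (G i))
      ≡⟨ ∑L-↭ _ (partition C) ⟨
    ∑ (concat cs) (λ i → ∑ (allFin d) (G i))
      ≡⟨ ∑-concat-cycles (λ i → ∑ (allFin d) (G i)) (cutJoin h) [] cs C ∑-transpose ⟩
    ∑ₚ (List.map length cs) (λ m r → fromℕ m ⊗ cutJoin h m r)
      ≡⟨ ∑ₚ-↭ (λ m r → fromℕ m ⊗ cutJoin h m r) (λ m p → cong (fromℕ m ⊗_) (cutJoin-↭ m p)) (cycleLengths-↭ σ C) ⟨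
    ∑ₚ (cycleLengths σ) (λ m r → fromℕ m ⊗ cutJoin h m r) ∎
    where
    open ≡-Reasoning
    cutSum-↭ : ∀ p q {r r′} → r ↭ r′ → cutSum h p q r ≡ cutSum h p q r′
    cutSum-↭ p zero    e = refl
    cutSum-↭ p (suc q) e = cong₂ _⊕_ (h-↭ (prep p (prep (suc q) e))) (cutSum-↭ (suc p) q e)
    cutJoin-↭ : ∀ m {r r′} → r ↭ r′ → cutJoin h m r ≡ cutJoin h m r′
    cutJoin-↭ m e = cong₂ _⊕_ (cutSum-↭ 1 (m ∸ 1) e)
      (∑ₚ-↭ (λ c r → fromℕ c ⊗ h (m + c ∷ r)) (λ c q → cong (fromℕ c ⊗_) (h-↭ (prep (m + c) q))) e)

-- Sums over permutations

𝟙 : {P : Set} → Dec P → ℚ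
𝟙 p = if does p then 1ℚ else 0ℚ

𝟙-yes : ∀ {P : Set} (p : Dec P) → P → 𝟙 p ≡ 1ℚ
𝟙-yes (yes _) _ = refl
𝟙-yes (no ¬p) p = contradiction p ¬p

𝟙-no : ∀ {P : Set} (p : Dec P) → ¬ P → 𝟙 p ≡ 0ℚ
𝟙-no (yes p) ¬p = contradiction p ¬p
𝟙-no (no _)  _  = refl

𝟙-⇔ : ∀ {P Q : Set} (p : Dec P) (q : Dec Q) → (P → Q) → (Q → P) → 𝟙 p ≡ 𝟙 q
𝟙-⇔ (yes p) q       to from = sym (𝟙-yes q (to p))
𝟙-⇔ (no ¬p) q       to from = sym (𝟙-no q (¬p ∘ from))

𝟙-× : ∀ {P Q : Set} (p : Dec P) (q : Dec Q) → 𝟙 (p ×-dec q) ≡ 𝟙 p ⊗ 𝟙 q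
𝟙-× (yes _) q = sym (ℚ.*-identityˡ (𝟙 q))
𝟙-× (no  _) q = sym (ℚ.*-zeroˡ (𝟙 q))

length-filter : ∀ {A : Set} {P : Pred A 0ℓ} (P? : Decidable P) xs → fromℕ (length (filter P? xs)) ≡ ∑ xs (𝟙 ∘ P?)
length-filter P? []       = refl
length-filter P? (x ∷ xs) with P? x
... | yes _ = trans (fromℕ-+ 1 (length (filter P? xs))) (cong (1ℚ ⊕_) (length-filter P? xs))
... | no  _ = trans (length-filter P? xs) (sym (ℚ.+-identityˡ _))

-- Formulated for a relation because permutations are identified only pointwise. The list has a
-- member related to `a`, and no two related members, so exactly one term survives.
∑-delta : ∀ {A : Set} {_∼_ : A → A → Set} (_∼?_ : ∀ x y → Dec (x ∼ y)) (F : A → ℚ) →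
  (∀ {x y z} → x ∼ y → x ∼ z → y ∼ z) → (∀ {x y} → x ∼ y → F x ≡ F y) →
  ∀ {a} xs → AllPairs (λ x y → ¬ x ∼ y) xs → Any (a ∼_) xs → ∑ xs (λ x → 𝟙 (a ∼? x) ⊗ F x) ≡ F a
∑-delta {A} {_∼_} _∼?_ F euclidean F-cong {a} = go
  where
  open ≡-Reasoning
  rest : ∀ xs → (∀ x → x ∈ xs → ¬ a ∼ x) → ∑ xs (λ x → 𝟙 (a ∼? x) ⊗ F x) ≡ 0ℚ
  rest xs none = ∑L-zero xs (λ x x∈ → trans (cong (_⊗ F x) (𝟙-no (a ∼? x) (none x x∈))) (ℚ.*-zeroˡ (F x)))
  go : ∀ xs → AllPairs (λ x y → ¬ x ∼ y) xs → Any (a ∼_) xs → ∑ xs (λ x → 𝟙 (a ∼? x) ⊗ F x) ≡ F a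
  go (x ∷ xs) (x∉ ∷ u) (here a∼x) = begin
    𝟙 (a ∼? x) ⊗ F x ⊕ ∑ xs (λ x → 𝟙 (a ∼? x) ⊗ F x)
      ≡⟨ cong₂ (λ p q → p ⊗ F x ⊕ q) (𝟙-yes (a ∼? x) a∼x) (rest xs (λ y y∈ a∼y → All.lookup x∉ y∈ (euclidean a∼x a∼y))) ⟩
    1ℚ ⊗ F x ⊕ 0ℚ
      ≡⟨ trans (ℚ.+-identityʳ _) (ℚ.*-identityˡ _) ⟩
    F x
      ≡⟨ F-cong a∼x ⟨
    F a ∎
  go (x ∷ xs) (x∉ ∷ u) (there a∈) = begin
    𝟙 (a ∼? x) ⊗ F x ⊕ ∑ xs (λ x → 𝟙 (a ∼? x) ⊗ F x)
      ≡⟨ cong₂ (λ p q → p ⊗ F x ⊕ q) (𝟙-no (a ∼? x) (λ a∼x → All.lookupWith (λ ¬x∼y a∼y → ¬x∼y (euclidean a∼x a∼y)) x∉ a∈)) (go xs u a∈) ⟩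
    0ℚ ⊗ F x ⊕ F a
      ≡⟨ trans (cong (_⊕ F a) (ℚ.*-zeroˡ (F x))) (ℚ.+-identityˡ _) ⟩
    F a ∎

∑-delta-Fin : ∀ {d} (a : Fin d) (F : Fin d → ℚ) → ∑ (allFin d) (λ i → 𝟙 (a Fin.≟ i) ⊗ F i) ≡ F a
∑-delta-Fin {d} a F = ∑-delta Fin._≟_ F (λ p q → trans (sym p) q) (cong F) (allFin d) (Unique.allFin⁺ d) (∈.∈-allFin a)

infix 4 _≈?_
_≈?_ : ∀ {d} (π ρ : Permutation′ d) → Dec (π Perm.≈ ρ)
π ≈? ρ = Fin.all? (λ i → (π ⟨$⟩ʳ i) Fin.≟ (ρ ⟨$⟩ʳ i))

Respects : ∀ {d} → (Permutation′ d → ℚ) → Set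
Respects F = ∀ π ρ → π Perm.≈ ρ → F π ≡ F ρ

∑-delta-perms : ∀ {d} (ρ : Permutation′ d) F → Respects F → ∑ (perms d) (λ π → 𝟙 (ρ ≈? π) ⊗ F π) ≡ F ρ
∑-delta-perms {d} ρ F resp = ∑-delta _≈?_ F (λ p q i → trans (sym (p i)) (q i)) (λ {π} {ρ} → resp π ρ)
  (perms d) (perms-unique d) (perms-complete d ρ)

-- The list of permutations contains φ(ρ) only up to pointwise equality. A double sum over the pairs
-- with φ(ρ) ≈ π is therefore evaluated in both orders; `ψ` identifies the one ρ belonging to a
-- given π.
∑-reindex : ∀ {d} (φ ψ : Permutation′ d → Permutation′ d) →
  (∀ ρ π → φ ρ Perm.≈ π → ψ π Perm.≈ ρ) → (∀ ρ π → ψ π Perm.≈ ρ → φ ρ Perm.≈ π) →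
  ∀ F → Respects F → ∑ (perms d) (F ∘ φ) ≡ ∑ (perms d) F
∑-reindex {d} φ ψ to from F resp = begin
  ∑ (perms d) (F ∘ φ)
    ≡⟨ ∑L-cong (perms d) (λ ρ → sym (∑-delta-perms (φ ρ) F resp)) ⟩
  ∑ (perms d) (λ ρ → ∑ (perms d) (λ π → 𝟙 (φ ρ ≈? π) ⊗ F π))
    ≡⟨ ∑L-swap (perms d) (perms d) _ ⟩
  ∑ (perms d) (λ π → ∑ (perms d) (λ ρ → 𝟙 (φ ρ ≈? π) ⊗ F π))
    ≡⟨ ∑L-cong (perms d) (λ π → trans
         (∑L-cong (perms d) (λ ρ → cong (_⊗ F π) (𝟙-⇔ (φ ρ ≈? π) (ψ π ≈? ρ) (to ρ π) (from ρ π))))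
         (∑-delta-perms (ψ π) (λ _ → F π) (λ _ _ _ → refl))) ⟩
  ∑ (perms d) F ∎
  where open ≡-Reasoning

∑-∘ₚ : ∀ {d} (τ : Permutation′ d) F → Respects F → ∑ (perms d) (λ ρ → F (ρ ∘ₚ τ)) ≡ ∑ (perms d) F
∑-∘ₚ τ F resp = ∑-reindex (_∘ₚ τ) (_∘ₚ Perm.flip τ)
  (λ ρ π p i → trans (cong (τ ⟨$⟩ˡ_) (sym (p i))) (Perm.inverseˡ τ))
  (λ ρ π p i → trans (cong (τ ⟨$⟩ʳ_) (sym (p i))) (Perm.inverseʳ τ)) F resp

offDiag : ∀ {d} → Fin d → Fin d → ℚ → ℚ
offDiag i j q = if does (i Fin.≟ j) then 0ℚ else q

offDiag-yes : ∀ {d} {i j : Fin d} q → i ≡ j → offDiag i j q ≡ 0ℚ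
offDiag-yes {i = i} {j} q i≡j with i Fin.≟ j
... | yes _   = refl
... | no  i≢j = contradiction i≡j i≢j

offDiag-no : ∀ {d} {i j : Fin d} q → i ≢ j → offDiag i j q ≡ q
offDiag-no {i = i} {j} q i≢j with i Fin.≟ j
... | yes i≡j = contradiction i≡j i≢j
... | no  _   = refl

offDiag-⊗ : ∀ {d} (i j : Fin d) c q → c ⊗ offDiag i j q ≡ offDiag i j (c ⊗ q)
offDiag-⊗ i j c q with i Fin.≟ j
... | yes _ = ℚ.*-zeroʳ c
... | no  _ = refl

∑∑ : ∀ {d} → (Fin d → Fin d → ℚ) → ℚ
∑∑ {d} F = ∑ (allFin d) (λ i → ∑ (allFin d) (λ j → offDiag i j (F i j)))

∑∑-cong : ∀ {d} {F G : Fin d → Fin d → ℚ} → (∀ i j → F i j ≡ G i j) → ∑∑ F ≡ ∑∑ G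
∑∑-cong {d} eq = ∑L-cong (allFin d) (λ i → ∑L-cong (allFin d) (λ j → cong (offDiag i j) (eq i j)))

∑∑-distribˡ : ∀ {d} c (F : Fin d → Fin d → ℚ) → c ⊗ ∑∑ F ≡ ∑∑ (λ i j → c ⊗ F i j)
∑∑-distribˡ {d} c F = trans (∑L-distribˡ (allFin d) c _) (∑L-cong (allFin d) (λ i →
  trans (∑L-distribˡ (allFin d) c _) (∑L-cong (allFin d) (λ j → offDiag-⊗ i j c (F i j)))))

∑-∑∑ : ∀ {d} {A : Set} (xs : List A) (F : A → Fin d → Fin d → ℚ) → ∑ xs (λ x → ∑∑ (F x)) ≡ ∑∑ (λ i j → ∑ xs (λ x → F x i j))
∑-∑∑ {d} xs F = trans (∑L-swap xs (allFin d) _) (∑L-cong (allFin d) (λ i → trans (∑L-swap xs (allFin d) _) (∑L-cong (allFin d) (λ j → pull i j))))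
  where
  pull : ∀ i j → ∑ xs (λ x → offDiag i j (F x i j)) ≡ offDiag i j (∑ xs (λ x → F x i j))
  pull i j with i Fin.≟ j
  ... | yes _ = ∑L-zero xs (λ _ _ → refl)
  ... | no  _ = refl

transpose-comm : ∀ {d} (a b : Fin d) k → PC.transpose a b k ≡ PC.transpose b a k
transpose-comm a b k = begin
  PC.transpose a b k                                       ≡⟨ cong (PC.transpose a b) (PC.transpose-inverse a b {k}) ⟨
  PC.transpose a b (PC.transpose a b (PC.transpose b a k)) ≡⟨ involutive (PC.transpose b a k) ⟩
  PC.transpose b a k                                       ∎
  where
  open ≡-Reasoning
  involutive : ∀ k → PC.transpose a b (PC.transpose a b k) ≡ k
  involutive k = by-cases (k Fin.≟ a) (k Fin.≟ b)
    where
    by-cases : Dec (k ≡ a) → Dec (k ≡ b) → PC.transpose a b (PC.transpose a b k) ≡ k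
    by-cases (yes refl) _          = trans (cong (PC.transpose a b) (transpose-matchˡ a b)) (transpose-matchʳ a b)
    by-cases (no _)     (yes refl) = trans (cong (PC.transpose a b) (transpose-matchʳ a b)) (transpose-matchˡ a b)
    by-cases (no k≢a)   (no k≢b)   = trans (cong (PC.transpose a b) (transpose-mismatch k≢a k≢b)) (transpose-mismatch k≢a k≢b)

transpose-injective : ∀ {d} {i j a b : Fin d} → i ≢ j → transpose i j Perm.≈ transpose a b → (a ≡ i × b ≡ j) ⊎ (b ≡ i × a ≡ j)
transpose-injective {i = i} {j} {a} {b} i≢j p with i Fin.≟ a | i Fin.≟ b
... | yes refl | _        = inj₁ (refl , trans (sym (transpose-matchˡ i b)) (trans (sym (p i)) (transpose-matchˡ i j)))
... | no  _    | yes refl = inj₂ (refl , trans (sym (transpose-matchʳ a i)) (trans (sym (p i)) (transpose-matchˡ i j)))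
... | no  i≢a  | no  i≢b  = contradiction (trans (sym (transpose-mismatch i≢a i≢b)) (trans (sym (p i)) (transpose-matchˡ i j))) i≢j

-- Every transposition is (i j) for exactly two ordered pairs.
∑∑-isTransposition : ∀ {d} (τ : Permutation′ d) →
  ∑∑ (λ i j → 𝟙 (transpose i j ≈? τ)) ≡ fromℕ 2 ⊗ 𝟙 (isTransposition? τ)
∑∑-isTransposition {d} τ = count (isTransposition? τ)
  where
  open ≡-Reasoning
  count : (τ? : Dec (IsTransposition τ)) → ∑∑ (λ i j → 𝟙 (transpose i j ≈? τ)) ≡ fromℕ 2 ⊗ 𝟙 τ?
  count (no ¬τ) = ∑L-zero (allFin d) (λ i _ → ∑L-zero (allFin d) (λ j _ → term i j))
    where
    term : ∀ i j → offDiag i j (𝟙 (transpose i j ≈? τ)) ≡ 0ℚ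
    term i j with i Fin.≟ j
    ... | yes _   = refl
    ... | no  i≢j = 𝟙-no (transpose i j ≈? τ) (λ p → ¬τ (i , j , i≢j , λ k → sym (p k)))
  count (yes (a , b , a≢b , τ≈)) = begin
    ∑∑ (λ i j → 𝟙 (transpose i j ≈? τ))
      ≡⟨ ∑L-cong (allFin d) (λ i → trans (∑L-cong (allFin d) (term i)) (∑L-⊕ (allFin d) _ _)) ⟩
    ∑ (allFin d) (λ i → ∑ (allFin d) (λ j → 𝟙 (b Fin.≟ j) ⊗ 𝟙 (a Fin.≟ i)) ⊕ ∑ (allFin d) (λ j → 𝟙 (a Fin.≟ j) ⊗ 𝟙 (b Fin.≟ i)))
      ≡⟨ ∑L-cong (allFin d) (λ i → cong₂ _⊕_ (∑-delta-Fin b (λ _ → 𝟙 (a Fin.≟ i))) (∑-delta-Fin a (λ _ → 𝟙 (b Fin.≟ i)))) ⟩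
    ∑ (allFin d) (λ i → 𝟙 (a Fin.≟ i) ⊕ 𝟙 (b Fin.≟ i))
      ≡⟨ ∑L-⊕ (allFin d) _ _ ⟩
    ∑ (allFin d) (λ i → 𝟙 (a Fin.≟ i)) ⊕ ∑ (allFin d) (λ i → 𝟙 (b Fin.≟ i))
      ≡⟨ cong₂ _⊕_ (one a) (one b) ⟩
    fromℕ 2 ⊗ 1ℚ ∎
    where
    one : ∀ a → ∑ (allFin d) (λ i → 𝟙 (a Fin.≟ i)) ≡ 1ℚ
    one a = trans (∑L-cong (allFin d) (λ i → sym (ℚ.*-identityʳ (𝟙 (a Fin.≟ i))))) (∑-delta-Fin a (λ _ → 1ℚ))
    𝟙𝟙-no : ∀ {P Q : Set} (p : Dec P) (q : Dec Q) → (P → Q → ⊥) → 𝟙 p ⊗ 𝟙 q ≡ 0ℚ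
    𝟙𝟙-no p q ¬pq = trans (sym (𝟙-× p q)) (𝟙-no (p ×-dec q) (λ (x , y) → ¬pq x y))
    term : ∀ i j → offDiag i j (𝟙 (transpose i j ≈? τ)) ≡ 𝟙 (b Fin.≟ j) ⊗ 𝟙 (a Fin.≟ i) ⊕ 𝟙 (a Fin.≟ j) ⊗ 𝟙 (b Fin.≟ i)
    term i j = by-cases (i Fin.≟ j) (transpose i j ≈? τ)
      where
      by-cases : Dec (i ≡ j) → Dec (transpose i j Perm.≈ τ) →
        offDiag i j (𝟙 (transpose i j ≈? τ)) ≡ 𝟙 (b Fin.≟ j) ⊗ 𝟙 (a Fin.≟ i) ⊕ 𝟙 (a Fin.≟ j) ⊗ 𝟙 (b Fin.≟ i)
      by-cases (yes refl) _ = trans (offDiag-yes {i = i} _ refl) (sym (cong₂ _⊕_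
        (𝟙𝟙-no (b Fin.≟ j) (a Fin.≟ i) (λ b≡i a≡i → a≢b (trans a≡i (sym b≡i))))
        (𝟙𝟙-no (a Fin.≟ j) (b Fin.≟ i) (λ a≡i b≡i → a≢b (trans a≡i (sym b≡i))))))
      by-cases (no i≢j) (no ¬p) = trans (offDiag-no _ i≢j) (trans (𝟙-no (transpose i j ≈? τ) ¬p) (sym (cong₂ _⊕_
        (𝟙𝟙-no (b Fin.≟ j) (a Fin.≟ i) (λ { refl refl → ¬p (λ k → sym (τ≈ k)) }))
        (𝟙𝟙-no (a Fin.≟ j) (b Fin.≟ i) (λ { refl refl → ¬p (λ k → trans (transpose-comm b a k) (sym (τ≈ k))) })))))
      by-cases (no i≢j) (yes p) with transpose-injective i≢j (λ k → trans (p k) (τ≈ k))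
      ... | inj₁ (refl , refl) = trans (offDiag-no _ i≢j) (trans (𝟙-yes (transpose i j ≈? τ) p) (sym (cong₂ _⊕_
            (cong₂ _⊗_ (𝟙-yes (b Fin.≟ b) refl) (𝟙-yes (a Fin.≟ a) refl)) (𝟙𝟙-no (a Fin.≟ b) (b Fin.≟ a) (λ a≡b _ → a≢b a≡b)))))
      ... | inj₂ (refl , refl) = trans (offDiag-no _ i≢j) (trans (𝟙-yes (transpose i j ≈? τ) p) (sym (cong₂ _⊕_
            (𝟙𝟙-no (b Fin.≟ a) (a Fin.≟ b) (λ _ a≡b → a≢b a≡b)) (cong₂ _⊗_ (𝟙-yes (a Fin.≟ a) refl) (𝟙-yes (b Fin.≟ b) refl)))))

∑-transpositions : ∀ {d} (F : Permutation′ d → ℚ) → Respects F →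
  ∑ (perms d) (λ τ → 𝟙 (isTransposition? τ) ⊗ F τ) ≡ ℚ.½ ⊗ ∑∑ (λ i j → F (transpose i j))
∑-transpositions {d} F resp = begin
  ∑ (perms d) (λ τ → 𝟙 (isTransposition? τ) ⊗ F τ)
    ≡⟨ ∑L-cong (perms d) (λ τ → trans (lem₁ (𝟙 (isTransposition? τ)) (F τ)) (cong (λ q → ℚ.½ ⊗ (F τ ⊗ q)) (sym (∑∑-isTransposition τ)))) ⟩
  ∑ (perms d) (λ τ → ℚ.½ ⊗ (F τ ⊗ ∑∑ (λ i j → 𝟙 (transpose i j ≈? τ))))
    ≡⟨ ∑L-distribˡ (perms d) ℚ.½ _ ⟨
  ℚ.½ ⊗ ∑ (perms d) (λ τ → F τ ⊗ ∑∑ (λ i j → 𝟙 (transpose i j ≈? τ)))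
    ≡⟨ cong (ℚ.½ ⊗_) (∑L-cong (perms d) (λ τ → ∑∑-distribˡ (F τ) (λ i j → 𝟙 (transpose i j ≈? τ)))) ⟩
  ℚ.½ ⊗ ∑ (perms d) (λ τ → ∑∑ (λ i j → F τ ⊗ 𝟙 (transpose i j ≈? τ)))
    ≡⟨ cong (ℚ.½ ⊗_) (∑-∑∑ (perms d) (λ τ i j → F τ ⊗ 𝟙 (transpose i j ≈? τ))) ⟩
  ℚ.½ ⊗ ∑∑ (λ i j → ∑ (perms d) (λ τ → F τ ⊗ 𝟙 (transpose i j ≈? τ)))
    ≡⟨ cong (ℚ.½ ⊗_) (∑∑-cong (λ i j → trans (∑L-cong (perms d) (λ τ → ℚ.*-comm (F τ) (𝟙 (transpose i j ≈? τ))))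
         (∑-delta-perms (transpose i j) F resp))) ⟩
  ℚ.½ ⊗ ∑∑ (λ i j → F (transpose i j)) ∎
  where
  open ≡-Reasoning
  lem₁ : ∀ a b → a ⊗ b ≡ ℚ.½ ⊗ (b ⊗ ((1ℚ ⊕ 1ℚ) ⊗ a))
  lem₁ = RingSolver.solve-∀ ℚ-ring

-- Multiplication by the sum of all transpositions.
𝔸 : ∀ {d} → (Permutation′ d → ℚ) → Permutation′ d → ℚ
𝔸 u π = ℚ.½ ⊗ ∑∑ (λ i j → u (π ∘ₚ transpose i j))

𝔸-cong : ∀ {d} {u v : Permutation′ d → ℚ} → (∀ π → u π ≡ v π) → ∀ π → 𝔸 u π ≡ 𝔸 v π
𝔸-cong eq π = cong (ℚ.½ ⊗_) (∑∑-cong (λ i j → eq (π ∘ₚ transpose i j)))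

𝔸-respects : ∀ {d} {u : Permutation′ d → ℚ} → Respects u → Respects (𝔸 u)
𝔸-respects resp π π′ p = cong (ℚ.½ ⊗_) (∑∑-cong (λ i j → resp _ _ (λ k → cong (PC.transpose i j) (p k))))

𝔸-⊗ : ∀ {d} c (u : Permutation′ d → ℚ) π → c ⊗ 𝔸 u π ≡ 𝔸 (λ ρ → c ⊗ u ρ) π
𝔸-⊗ c u π = trans (lem c ℚ.½ (∑∑ (λ i j → u (π ∘ₚ transpose i j)))) (cong (ℚ.½ ⊗_) (∑∑-distribˡ c (λ i j → u (π ∘ₚ transpose i j))))
  where
  lem : ∀ a b x → a ⊗ (b ⊗ x) ≡ b ⊗ (a ⊗ x)
  lem = RingSolver.solve-∀ ℚ-ring

-- Replacing π by π(i j) in the sum moves the transposition from `v` to `u`, since (i j) is its own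
-- inverse.
𝔸-selfAdjoint : ∀ {d} (u v : Permutation′ d → ℚ) → Respects u → Respects v →
  ∑ (perms d) (λ π → u π ⊗ 𝔸 v π) ≡ ∑ (perms d) (λ π → 𝔸 u π ⊗ v π)
𝔸-selfAdjoint {d} u v u-resp v-resp = begin
  ∑ (perms d) (λ π → u π ⊗ 𝔸 v π)
    ≡⟨ ∑L-cong (perms d) (λ π → trans (lem (u π) ℚ.½ _) (cong (ℚ.½ ⊗_) (∑∑-distribˡ (u π) (λ i j → v (π ∘ₚ transpose i j))))) ⟩
  ∑ (perms d) (λ π → ℚ.½ ⊗ ∑∑ (λ i j → u π ⊗ v (π ∘ₚ transpose i j)))
    ≡⟨ exchange (λ π i j → u π ⊗ v (π ∘ₚ transpose i j)) ⟩
  ℚ.½ ⊗ ∑∑ (λ i j → ∑ (perms d) (λ π → u π ⊗ v (π ∘ₚ transpose i j)))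
    ≡⟨ cong (ℚ.½ ⊗_) (∑∑-cong (λ i j → trans
         (sym (∑-∘ₚ (transpose i j) (λ π → u π ⊗ v (π ∘ₚ transpose i j))
           (λ π π′ p → cong₂ _⊗_ (u-resp _ _ p) (v-resp _ _ (λ k → cong (PC.transpose i j) (p k))))))
         (∑L-cong (perms d) (λ π → cong (u (π ∘ₚ transpose i j) ⊗_)
           (v-resp _ _ (λ k → trans (transpose-comm i j (PC.transpose i j (π ⟨$⟩ʳ k))) (PC.transpose-inverse j i))))))) ⟩
  ℚ.½ ⊗ ∑∑ (λ i j → ∑ (perms d) (λ π → u (π ∘ₚ transpose i j) ⊗ v π))
    ≡⟨ exchange (λ π i j → u (π ∘ₚ transpose i j) ⊗ v π) ⟨
  ∑ (perms d) (λ π → ℚ.½ ⊗ ∑∑ (λ i j → u (π ∘ₚ transpose i j) ⊗ v π))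
    ≡⟨ ∑L-cong (perms d) (λ π → trans (cong (ℚ.½ ⊗_) (trans (∑∑-cong (λ i j → ℚ.*-comm (u (π ∘ₚ transpose i j)) (v π)))
         (sym (∑∑-distribˡ (v π) (λ i j → u (π ∘ₚ transpose i j)))))) (lem₂ ℚ.½ (v π) _)) ⟩
  ∑ (perms d) (λ π → 𝔸 u π ⊗ v π) ∎
  where
  open ≡-Reasoning
  lem : ∀ a b x → a ⊗ (b ⊗ x) ≡ b ⊗ (a ⊗ x)
  lem = RingSolver.solve-∀ ℚ-ring
  lem₂ : ∀ b c x → b ⊗ (c ⊗ x) ≡ b ⊗ x ⊗ c
  lem₂ = RingSolver.solve-∀ ℚ-ring
  exchange : ∀ (F : Permutation′ d → Fin d → Fin d → ℚ) →
    ∑ (perms d) (λ π → ℚ.½ ⊗ ∑∑ (F π)) ≡ ℚ.½ ⊗ ∑∑ (λ i j → ∑ (perms d) (λ π → F π i j))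
  exchange F = trans (sym (∑L-distribˡ (perms d) ℚ.½ _)) (cong (ℚ.½ ⊗_) (∑-∑∑ (perms d) F))

-- Counting factorisations

multiplicity-↭ : ∀ m {λs μs} → λs ↭ μs → multiplicity m λs ≡ multiplicity m μs
multiplicity-↭ m p = ↭.↭-length (↭.filter-↭ (m ℕ.≟_) p)

multiplicity-∷ : ∀ m b λs → multiplicity m (b ∷ λs) ≡ multiplicity m List.[ b ] + multiplicity m λs
multiplicity-∷ m b λs = trans (cong length (List.filter-++ (m ℕ.≟_) List.[ b ] λs)) (List.length-++ (filter (m ℕ.≟_) List.[ b ]))

multiplicity-self : ∀ b λs → multiplicity b (b ∷ λs) ≡ suc (multiplicity b λs)
multiplicity-self b λs = cong length (List.filter-accept (b ℕ.≟_) {b} {λs} refl)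

multiplicity-other : ∀ {m b} λs → m ≢ b → multiplicity m (b ∷ λs) ≡ multiplicity m λs
multiplicity-other {m} {b} λs m≢b = cong length (List.filter-reject (m ℕ.≟_) {b} {λs} m≢b)

multiplicity-∉ : ∀ {m λs} → ¬ m ∈ λs → multiplicity m λs ≡ 0
multiplicity-∉ {m} {λs} m∉ = cong length (List.filter-none (m ℕ.≟_) (All.tabulate λ x∈ m≡x → m∉ (subst (_∈ λs) (sym m≡x) x∈)))

multiplicity-∈ : ∀ {m k λs} → multiplicity m λs ≡ suc k → m ∈ λs
multiplicity-∈ {m} {k} {[]} ()
multiplicity-∈ {m} {k} {b ∷ λs} eq = by-cases (m ℕ.≟ b)
  where
  by-cases : Dec (m ≡ b) → m ∈ b ∷ λs
  by-cases (yes m≡b) = here m≡b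
  by-cases (no  m≢b) = there (multiplicity-∈ {m} {k} {λs} (trans (sym (multiplicity-other λs m≢b)) eq))

multiplicity⇒↭ : ∀ λs μs → (∀ m → multiplicity m λs ≡ multiplicity m μs) → λs ↭ μs
multiplicity⇒↭ [] []       eq = ↭-refl
multiplicity⇒↭ [] (b ∷ μs) eq = contradiction (trans (eq b) (multiplicity-self b μs)) λ ()
multiplicity⇒↭ (b ∷ λs) μs eq with extract {x = b} {μs} (multiplicity-∈ {λs = μs} (trans (sym (eq b)) (multiplicity-self b λs)))
... | μs′ , p = ↭-trans (prep b (multiplicity⇒↭ λs μs′ (λ m → ℕ.+-cancelˡ-≡ (multiplicity m List.[ b ]) _ _
      (trans (sym (multiplicity-∷ m b λs)) (trans (eq m) (trans (sym (multiplicity-↭ m p)) (multiplicity-∷ m b μs′))))))) p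

InRange : ℕ → ℕ → Set
InRange d b = 1 ≤ b × b ≤ d

≤-sum : ∀ λs → All (_≤ sumᴸ λs) λs
≤-sum []       = []
≤-sum (b ∷ λs) = ℕ.m≤m+n b (sumᴸ λs) ∷ All.map (λ p → ℕ.≤-trans p (ℕ.m≤n+m (sumᴸ λs) b)) (≤-sum λs)

inRange : ∀ {λs} → All (1 ≤_) λs → All (InRange (sumᴸ λs)) λs
inRange {λs} pos = All.zip (pos , ≤-sum λs)

-- `HasCycleType` compares multiplicities only from 1 to d; the range condition makes all others
-- zero on both sides.
inRange-↭ : ∀ {d λs μs} → All (InRange d) λs → All (InRange d) μs →
  (∀ (m : Fin d) → multiplicity (suc (toℕ m)) λs ≡ multiplicity (suc (toℕ m)) μs) → λs ↭ μs
inRange-↭ {d} {λs} {μs} rλ rμ eq = multiplicity⇒↭ λs μs all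
  where
  all : ∀ m → multiplicity m λs ≡ multiplicity m μs
  all zero    = trans (multiplicity-∉ {λs = λs} (λ 0∈ → contradiction (proj₁ (All.lookup rλ 0∈)) λ ()))
                 (sym (multiplicity-∉ {λs = μs} (λ 0∈ → contradiction (proj₁ (All.lookup rμ 0∈)) λ ())))
  all (suc m) with m ℕ.<? d
  ... | yes m<d = subst (λ k → multiplicity (suc k) λs ≡ multiplicity (suc k) μs) (Fin.toℕ-fromℕ< m<d) (eq (Fin.fromℕ< m<d))
  ... | no  m≮d = trans (multiplicity-∉ {λs = λs} (λ m∈ → m≮d (proj₂ (All.lookup rλ m∈))))
                   (sym (multiplicity-∉ {λs = μs} (λ m∈ → m≮d (proj₂ (All.lookup rμ m∈)))))

length-concat : ∀ {A : Set} (xss : List (List A)) → length (concat xss) ≡ sumᴸ (List.map length xss)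
length-concat []         = refl
length-concat (xs ∷ xss) = trans (List.length-++ xs) (cong (length xs +_) (length-concat xss))

module _ {d} (σ : Permutation′ d) where

  cycleLengths-sum : sumᴸ (cycleLengths σ) ≡ d
  cycleLengths-sum with cs , C ← cycles-exist σ = begin
    sumᴸ (cycleLengths σ)        ≡⟨ ℕ.sum-↭ (cycleLengths-↭ σ C) ⟩
    sumᴸ (List.map length cs)    ≡⟨ length-concat cs ⟨
    length (concat cs)           ≡⟨ ↭.↭-length (partition C) ⟩
    length (allFin d)            ≡⟨ List.length-tabulate id ⟩
    d                            ∎
    where open ≡-Reasoning

  cycleLengths-positive : All (1 ≤_) (cycleLengths σ)
  cycleLengths-positive with cs , C ← cycles-exist σ =
    ↭.All-resp-↭ (↭-sym (cycleLengths-↭ σ C)) (All.map⁺ (All.map (λ {c} → go c) (isCycle C)))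
    where
    go : ∀ c → IsCycle (σ ⟨$⟩ʳ_) c → 1 ≤ length c
    go (x ∷ xs) _ = s≤s z≤n

  cycleLengths-inRange : All (InRange d) (cycleLengths σ)
  cycleLengths-inRange = subst (λ e → All (InRange e) (cycleLengths σ)) cycleLengths-sum (inRange cycleLengths-positive)

  cycleLengths-flip : cycleLengths (Perm.flip σ) ↭ cycleLengths σ
  cycleLengths-flip with cs , C ← cycles-exist σ with cycles-inverse {g = σ ⟨$⟩ˡ_} (λ i → Perm.inverseˡ σ) C
  ... | cs′ , C′ , eq = ↭-trans (cycleLengths-↭ (Perm.flip σ) C′) (↭-trans (↭.↭-reflexive eq) (↭-sym (cycleLengths-↭ σ C)))

  hasCycleType⇒↭ : ∀ {β} → All (1 ≤_) β → sumᴸ β ≡ d → HasCycleType σ β → cycleLengths σ ↭ β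
  hasCycleType⇒↭ {β} pos refl hc = inRange-↭ cycleLengths-inRange (inRange pos) hc

cycleLengths-resp : ∀ {d} (π ρ : Permutation′ d) → π Perm.≈ ρ → cycleLengths π ↭ cycleLengths ρ
cycleLengths-resp π ρ p with cs , C ← cycles-exist π =
  ↭-trans (cycleLengths-↭ π C) (↭-sym (cycleLengths-↭ ρ (cycles-resp p C)))

hasCycleType-resp : ∀ {d} (π ρ : Permutation′ d) β → cycleLengths π ↭ cycleLengths ρ → HasCycleType π β → HasCycleType ρ β
hasCycleType-resp π ρ β p hc m = trans (multiplicity-↭ (suc (toℕ m)) (↭-sym p)) (hc m)

ofType : ∀ {d} → List ℕ → Permutation′ d → ℚ
ofType β π = 𝟙 (hasCycleType? π β)

ofType-↭ : ∀ {d} β (π ρ : Permutation′ d) → cycleLengths π ↭ cycleLengths ρ → ofType β π ≡ ofType β ρ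
ofType-↭ β π ρ p = 𝟙-⇔ (hasCycleType? π β) (hasCycleType? ρ β) (hasCycleType-resp π ρ β p) (hasCycleType-resp ρ π β (↭-sym p))

ofType-respects : ∀ {d} β → Respects {d} (ofType β)
ofType-respects β π ρ p = ofType-↭ β π ρ (cycleLengths-resp π ρ p)

𝔸^ : ∀ {d} → ℕ → (Permutation′ d → ℚ) → Permutation′ d → ℚ
𝔸^ zero    u = u
𝔸^ (suc t) u = 𝔸 (𝔸^ t u)

𝔸^-respects : ∀ {d} t {u : Permutation′ d → ℚ} → Respects u → Respects (𝔸^ t u)
𝔸^-respects zero    resp = resp
𝔸^-respects (suc t) resp = 𝔸-respects (𝔸^-respects t resp)

𝔸^-suc : ∀ {d} t (u : Permutation′ d → ℚ) π → 𝔸^ t (𝔸 u) π ≡ 𝔸^ (suc t) u π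
𝔸^-suc zero    u π = refl
𝔸^-suc (suc t) u π = 𝔸-cong (𝔸^-suc t u) π

𝔸^-adjoint : ∀ {d} t (u v : Permutation′ d → ℚ) → Respects u → Respects v →
  ∑ (perms d) (λ π → u π ⊗ 𝔸^ t v π) ≡ ∑ (perms d) (λ π → 𝔸^ t u π ⊗ v π)
𝔸^-adjoint zero    u v u-resp v-resp = refl
𝔸^-adjoint {d} (suc t) u v u-resp v-resp = begin
  ∑ (perms d) (λ π → u π ⊗ 𝔸 (𝔸^ t v) π)   ≡⟨ 𝔸-selfAdjoint u (𝔸^ t v) u-resp (𝔸^-respects t v-resp) ⟩
  ∑ (perms d) (λ π → 𝔸 u π ⊗ 𝔸^ t v π)     ≡⟨ 𝔸^-adjoint t (𝔸 u) v (𝔸-respects u-resp) v-resp ⟩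
  ∑ (perms d) (λ π → 𝔸^ t (𝔸 u) π ⊗ v π)   ≡⟨ ∑L-cong (perms d) (λ π → cong (_⊗ v π) (𝔸^-suc t u π)) ⟩
  ∑ (perms d) (λ π → 𝔸^ (suc t) u π ⊗ v π) ∎
  where open ≡-Reasoning

-- The outermost `𝔸` accounts for the first transposition of the word, the inner power for the rest.
words-𝔸^ : ∀ {d} t (v : Permutation′ d → ℚ) → Respects v → ∀ π →
  ∑ (words (perms d) t) (λ τs → 𝟙 (VAll.all? isTransposition? τs) ⊗ v (π ∘ₚ Vec.foldr′ _∘ₚ_ Perm.id τs)) ≡ 𝔸^ t v π
words-𝔸^ zero    v resp π = trans (ℚ.+-identityʳ _) (trans (ℚ.*-identityˡ _) (resp _ _ (λ _ → refl)))
words-𝔸^ {d} (suc t) v resp π = begin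
  ∑ (words (perms d) (suc t)) _
    ≡⟨ ∑L-cartesianProductWith _∷_ (perms d) (words (perms d) t) _ ⟩
  ∑ (perms d) (λ τ → ∑ (words (perms d) t) (λ τs →
    𝟙 (VAll.all? isTransposition? (τ ∷ τs)) ⊗ v (π ∘ₚ (τ ∘ₚ Vec.foldr′ _∘ₚ_ Perm.id τs))))
    ≡⟨ ∑L-cong (perms d) (λ τ → trans (∑L-cong (words (perms d) t) (λ τs → trans
         (cong₂ _⊗_ (𝟙-all τ τs) (resp (π ∘ₚ (τ ∘ₚ Vec.foldr′ _∘ₚ_ Perm.id τs)) ((π ∘ₚ τ) ∘ₚ Vec.foldr′ _∘ₚ_ Perm.id τs) (λ _ → refl)))
         (ℚ.*-assoc (𝟙 (isTransposition? τ)) _ _)))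
         (sym (∑L-distribˡ (words (perms d) t) (𝟙 (isTransposition? τ)) _))) ⟩
  ∑ (perms d) (λ τ → 𝟙 (isTransposition? τ) ⊗ ∑ (words (perms d) t) (λ τs →
    𝟙 (VAll.all? isTransposition? τs) ⊗ v ((π ∘ₚ τ) ∘ₚ Vec.foldr′ _∘ₚ_ Perm.id τs)))
    ≡⟨ ∑L-cong (perms d) (λ τ → cong (𝟙 (isTransposition? τ) ⊗_) (words-𝔸^ t v resp (π ∘ₚ τ))) ⟩
  ∑ (perms d) (λ τ → 𝟙 (isTransposition? τ) ⊗ 𝔸^ t v (π ∘ₚ τ))
    ≡⟨ ∑-transpositions (λ τ → 𝔸^ t v (π ∘ₚ τ)) (λ τ τ′ p → 𝔸^-respects t resp _ _ (λ k → p (π ⟨$⟩ʳ k))) ⟩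
  𝔸^ (suc t) v π ∎
  where
  open ≡-Reasoning
  𝟙-all : ∀ (τ : Permutation′ d) {t} (τs : Vec (Permutation′ d) t) →
    𝟙 (VAll.all? isTransposition? (τ ∷ τs)) ≡ 𝟙 (isTransposition? τ) ⊗ 𝟙 (VAll.all? isTransposition? τs)
  𝟙-all τ τs = trans (𝟙-⇔ (VAll.all? isTransposition? (τ ∷ τs)) (isTransposition? τ ×-dec VAll.all? isTransposition? τs)
      (λ { (p ∷ ps) → p , ps }) (λ (p , ps) → p ∷ ps))
    (𝟙-× (isTransposition? τ) (VAll.all? isTransposition? τs))

-- The last factor of a factorisation of the identity is the inverse of the product of the others.
∑-inverse : ∀ {d} β (π : Permutation′ d) →
  ∑ (perms d) (λ σ → ofType β σ ⊗ 𝟙 (π ∘ₚ σ ≈? Perm.id)) ≡ ofType β (Perm.flip π)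
∑-inverse {d} β π = begin
  ∑ (perms d) (λ σ → ofType β σ ⊗ 𝟙 (π ∘ₚ σ ≈? Perm.id))
    ≡⟨ ∑L-cong (perms d) (λ σ → trans (ℚ.*-comm (ofType β σ) _) (cong (_⊗ ofType β σ)
         (𝟙-⇔ (π ∘ₚ σ ≈? Perm.id) (Perm.flip π ≈? σ)
           (λ p i → sym (trans (cong (σ ⟨$⟩ʳ_) (sym (Perm.inverseʳ π {i}))) (p (π ⟨$⟩ˡ i))))
           (λ p i → trans (sym (p (π ⟨$⟩ʳ i))) (Perm.inverseˡ π))))) ⟩
  ∑ (perms d) (λ σ → 𝟙 (Perm.flip π ≈? σ) ⊗ ofType β σ)
    ≡⟨ ∑-delta-perms (Perm.flip π) (ofType β) (ofType-respects β) ⟩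
  ofType β (Perm.flip π) ∎
  where open ≡-Reasoning

-- Summing out the last factor leaves `𝔸^ t` applied to the indicator of the class of β, an inverse
-- having the same cycle type. Self-adjointness moves the power to the indicator of the d-cycles,
-- where the cut-and-join recursion has a simple initial value.
factorisations-𝔸^ : ∀ d t β → fromℕ (factorisations d t β) ≡
  ∑ (perms d) (λ π → 𝔸^ t (ofType List.[ d ]) π ⊗ ofType β π)
factorisations-𝔸^ d t β = begin
  fromℕ (factorisations d t β)
    ≡⟨ length-filter (isFactorisation? β) (List.cartesianProduct (perms d) (List.cartesianProduct (words (perms d) t) (perms d))) ⟩
  ∑ (List.cartesianProduct (perms d) (List.cartesianProduct (words (perms d) t) (perms d))) (𝟙 ∘ isFactorisation? β)
    ≡⟨ trans (∑L-cartesianProductWith _,_ (perms d) _ _)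
         (∑L-cong (perms d) (λ σ₀ → ∑L-cartesianProductWith _,_ (words (perms d) t) (perms d) _)) ⟩
  ∑ (perms d) (λ σ₀ → ∑ (words (perms d) t) (λ τs → ∑ (perms d) (λ σ → 𝟙 (isFactorisation? β (σ₀ , τs , σ)))))
    ≡⟨ ∑L-cong (perms d) (λ σ₀ → trans (∑L-cong (words (perms d) t) (inner σ₀)) (sym (∑L-distribˡ (words (perms d) t) (δ σ₀) _))) ⟩
  ∑ (perms d) (λ σ₀ → δ σ₀ ⊗ ∑ (words (perms d) t) (λ τs → 𝟙 (VAll.all? isTransposition? τs) ⊗ v (σ₀ ∘ₚ comp τs)))
    ≡⟨ ∑L-cong (perms d) (λ σ₀ → cong (δ σ₀ ⊗_) (words-𝔸^ t v v-resp σ₀)) ⟩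
  ∑ (perms d) (λ σ₀ → δ σ₀ ⊗ 𝔸^ t v σ₀)
    ≡⟨ 𝔸^-adjoint t δ v (ofType-respects List.[ d ]) v-resp ⟩
  ∑ (perms d) (λ π → 𝔸^ t δ π ⊗ v π)
    ≡⟨ ∑L-cong (perms d) (λ π → cong (𝔸^ t δ π ⊗_) (ofType-↭ β (Perm.flip π) π (cycleLengths-flip π))) ⟩
  ∑ (perms d) (λ π → 𝔸^ t δ π ⊗ ofType β π) ∎
  where
  open ≡-Reasoning
  δ v : Permutation′ d → ℚ
  δ = ofType List.[ d ]
  v π = ofType β (Perm.flip π)
  comp : ∀ {t} → Vec (Permutation′ d) t → Permutation′ d
  comp = Vec.foldr′ _∘ₚ_ Perm.id
  flip-cong : ∀ (π ρ : Permutation′ d) → π Perm.≈ ρ → Perm.flip π Perm.≈ Perm.flip ρ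
  flip-cong π ρ p i = trans (cong (π ⟨$⟩ˡ_) (trans (sym (Perm.inverseʳ ρ {i})) (sym (p (ρ ⟨$⟩ˡ i))))) (Perm.inverseˡ π)
  v-resp : Respects v
  v-resp π ρ p = ofType-respects β (Perm.flip π) (Perm.flip ρ) (flip-cong π ρ p)
  inner : ∀ σ₀ τs → ∑ (perms d) (λ σ → 𝟙 (isFactorisation? β (σ₀ , τs , σ))) ≡
    δ σ₀ ⊗ (𝟙 (VAll.all? isTransposition? τs) ⊗ v (σ₀ ∘ₚ comp τs))
  inner σ₀ τs = begin
    ∑ (perms d) (λ σ → 𝟙 (isFactorisation? β (σ₀ , τs , σ)))
      ≡⟨ ∑L-cong (perms d) (λ σ →
           trans (𝟙-× (hasCycleType? σ₀ List.[ d ]) (all?τs ×-dec last? σ)) (trans (cong (δ σ₀ ⊗_) (trans (𝟙-× all?τs (last? σ))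
             (cong (𝟙 all?τs ⊗_) (𝟙-× (hasCycleType? σ β) (σ₀ ∘ₚ (comp τs ∘ₚ σ) ≈? Perm.id)))))
             (sym (ℚ.*-assoc (δ σ₀) (𝟙 all?τs) _)))) ⟩
    ∑ (perms d) (λ σ → δ σ₀ ⊗ 𝟙 all?τs ⊗ (ofType β σ ⊗ 𝟙 ((σ₀ ∘ₚ comp τs) ∘ₚ σ ≈? Perm.id)))
      ≡⟨ ∑L-distribˡ (perms d) (δ σ₀ ⊗ 𝟙 all?τs) _ ⟨
    δ σ₀ ⊗ 𝟙 all?τs ⊗ ∑ (perms d) (λ σ → ofType β σ ⊗ 𝟙 ((σ₀ ∘ₚ comp τs) ∘ₚ σ ≈? Perm.id))
      ≡⟨ cong (δ σ₀ ⊗ 𝟙 all?τs ⊗_) (∑-inverse β (σ₀ ∘ₚ comp τs)) ⟩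
    δ σ₀ ⊗ 𝟙 all?τs ⊗ v (σ₀ ∘ₚ comp τs)
      ≡⟨ ℚ.*-assoc (δ σ₀) (𝟙 all?τs) _ ⟩
    δ σ₀ ⊗ (𝟙 all?τs ⊗ v (σ₀ ∘ₚ comp τs)) ∎
    where
    all?τs = VAll.all? isTransposition? τs
    last? : ∀ σ → Dec (HasCycleType σ β × σ₀ ∘ₚ (comp τs ∘ₚ σ) Perm.≈ Perm.id)
    last? σ = hasCycleType? σ β ×-dec (σ₀ ∘ₚ (comp τs ∘ₚ σ) ≈? Perm.id)

ς-1 : ∀ b → ς b 1 ≡ fromℕ b
ς-1 b = lem (fromℕ b)
  where
  lem : ∀ b → (ℚ.½ ⊗ b) ⊗ 1ℚ ⊗ 1ℚ ⊕ (⊖ ((⊖ (ℚ.½ ⊗ b)) ⊗ 1ℚ ⊗ 1ℚ)) ≡ b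
  lem = RingSolver.solve-∀ ℚ-ring

T-singleton : ∀ m → T List.[ m ] 0 ≡ fromℕ m
T-singleton m = trans (ℚ.*-identityʳ _) (trans (𝕊.*-identityʳ (ς m) .at 1) (ς-1 m))

-- Each ς has order at least 1, so dividing two or more of them by ς(1) leaves no constant term.
-- With `T-singleton`, the constant term of `T` is d times the indicator of the d-cycles.
T-two : ∀ a b λs → T (a ∷ b ∷ λs) 0 ≡ 0ℚ
T-two a b λs = trans (cong (λ z → (0ℚ ⊗ ∏ς (b ∷ λs) 1 ⊕ ς a 1 ⊗ z) ⊗ 1ℚ) (∏ς₀ b λs)) (lem (∏ς (b ∷ λs) 1) (ς a 1))
  where
  lem : ∀ p s → (0ℚ ⊗ p ⊕ s ⊗ 0ℚ) ⊗ 1ℚ ≡ 0ℚ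
  lem = RingSolver.solve-∀ ℚ-ring

-- 𝔸^ t (ofType [ d ]) π counts the ways to write π as a d-cycle followed by t transpositions.
𝔸^-dCycle : ∀ {d} t (π : Permutation′ (suc d)) →
  fromℕ (suc d) ⊗ 𝔸^ t (ofType List.[ suc d ]) π ≡ fromℕ (suc d ^ t * t !) ⊗ T (cycleLengths π) t
𝔸^-dCycle {d} zero π = trans (by-type (cycleLengths π) refl (hasCycleType? π List.[ D ])) (sym (ℚ.*-identityˡ _))
  where
  D = suc d
  by-type : ∀ λs → cycleLengths π ≡ λs → Dec (HasCycleType π List.[ D ]) → fromℕ D ⊗ ofType List.[ D ] π ≡ T (cycleLengths π) 0
  by-type λs eq (yes hc) = trans (cong (fromℕ D ⊗_) (𝟙-yes (hasCycleType? π List.[ D ]) hc)) (trans (ℚ.*-identityʳ (fromℕ D)) (sym (trans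
    (T-↭ (hasCycleType⇒↭ π (s≤s z≤n ∷ []) (ℕ.+-identityʳ D) hc) .at 0) (T-singleton D))))
  by-type [] eq (no ¬hc) = contradiction (trans (sym (cycleLengths-sum π)) (cong sumᴸ eq)) λ ()
  by-type (m ∷ []) eq (no ¬hc) = contradiction (λ k → cong (multiplicity (suc (toℕ k))) (trans eq (cong List.[_] m≡D))) ¬hc
    where
    m≡D : m ≡ D
    m≡D = trans (sym (ℕ.+-identityʳ m)) (trans (cong sumᴸ (sym eq)) (cycleLengths-sum π))
  by-type (a ∷ b ∷ λs) eq (no ¬hc) = trans (cong (fromℕ D ⊗_) (𝟙-no (hasCycleType? π List.[ D ]) ¬hc))
    (trans (ℚ.*-zeroʳ (fromℕ D)) (sym (trans (cong (λ l → T l 0) eq) (T-two a b λs))))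
𝔸^-dCycle {d} (suc t) π = begin
  fromℕ D ⊗ 𝔸 (𝔸^ t δ) π
    ≡⟨ 𝔸-⊗ (fromℕ D) (𝔸^ t δ) π ⟩
  𝔸 (λ ρ → fromℕ D ⊗ 𝔸^ t δ ρ) π
    ≡⟨ 𝔸-cong (𝔸^-dCycle t) π ⟩
  𝔸 (λ ρ → K ⊗ T (cycleLengths ρ) t) π
    ≡⟨ 𝔸-⊗ K (λ ρ → T (cycleLengths ρ) t) π ⟨
  K ⊗ 𝔸 (λ ρ → T (cycleLengths ρ) t) π
    -- The cut-and-join sum is 2d(t + 1) times the next coefficient of `T`. The 2 cancels against ½,
    -- and d(t + 1) turns dᵗ t! into the same expression for t + 1.
    ≡⟨ cong (λ z → K ⊗ (ℚ.½ ⊗ z)) (trans (∑∑-transpose π (λ μs → T μs t) (λ p → T-↭ p .at t)) (cut-and-join (cycleLengths π) refl)) ⟩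
  K ⊗ (ℚ.½ ⊗ (fromℕ 2 ⊗ fromℕ D ⊗ (fromℕ (suc t) ⊗ T (cycleLengths π) (suc t))))
    ≡⟨ lem K (fromℕ D) (fromℕ (suc t)) (T (cycleLengths π) (suc t)) ⟩
  K ⊗ (fromℕ D ⊗ fromℕ (suc t)) ⊗ T (cycleLengths π) (suc t)
    ≡⟨ cong (_⊗ T (cycleLengths π) (suc t)) (sym (trans (cong fromℕ (arith D (D ^ t) (suc t) (t !)))
         (trans (fromℕ-* (D ^ t * t !) (D * suc t)) (cong (K ⊗_) (fromℕ-* D (suc t)))))) ⟩
  fromℕ (D ^ suc t * suc t !) ⊗ T (cycleLengths π) (suc t) ∎
  where
  open ≡-Reasoning
  D = suc d
  δ = ofType List.[ D ]
  K = fromℕ (D ^ t * t !)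
  lem : ∀ k d s x → k ⊗ (ℚ.½ ⊗ ((1ℚ ⊕ 1ℚ) ⊗ d ⊗ (s ⊗ x))) ≡ k ⊗ (d ⊗ s) ⊗ x
  lem = RingSolver.solve-∀ ℚ-ring
  arith : ∀ d p s f → d * p * (s * f) ≡ p * f * (d * s)
  arith = ℕSolver.solve-∀
  cut-and-join : ∀ λs → cycleLengths π ≡ λs → ∑ₚ (cycleLengths π) (λ m r → fromℕ m ⊗ cutJoin (λ μs → T μs t) m r) ≡
    fromℕ 2 ⊗ fromℕ D ⊗ (fromℕ (suc t) ⊗ T (cycleLengths π) (suc t))
  cut-and-join []       eq = contradiction (trans (sym (cycleLengths-sum π)) (cong sumᴸ eq)) λ ()
  cut-and-join (b ∷ λs) eq rewrite eq = trans
    (∑ₚ-cutJoin b λs (subst (All (1 ≤_)) eq (cycleLengths-positive π)) t)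
    (cong (λ s → fromℕ 2 ⊗ fromℕ s ⊗ (fromℕ (suc t) ⊗ T (b ∷ λs) (suc t))) (trans (cong sumᴸ (sym eq)) (cycleLengths-sum π)))

-- Sizes of conjugacy classes

-- The number of ways to match the positions of β with those of λs so that the entries agree.
matchings : List ℕ → List ℕ → ℚ
matchings []      []      = 1ℚ
matchings []      (_ ∷ _) = 0ℚ
matchings (b ∷ β) λs      = ∑ₚ λs (λ m r → 𝟙 (b ℕ.≟ m) ⊗ matchings β r)

matchings-↭ : ∀ β {λs μs} → λs ↭ μs → matchings β λs ≡ matchings β μs
matchings-↭ [] {[]}     {[]}     p = refl
matchings-↭ [] {[]}     {m ∷ μs} p = contradiction (↭-sym p) ↭.¬x∷xs↭[]
matchings-↭ [] {l ∷ λs} {[]}     p = contradiction p ↭.¬x∷xs↭[]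
matchings-↭ [] {l ∷ λs} {m ∷ μs} p = refl
matchings-↭ (b ∷ β) p = ∑ₚ-↭ (λ m r → 𝟙 (b ℕ.≟ m) ⊗ matchings β r) (λ m q → cong (𝟙 (b ℕ.≟ m) ⊗_) (matchings-↭ β q)) p

∑ₚ-distribˡ : ∀ {A : Set} (xs : List A) c f → c ⊗ ∑ₚ xs f ≡ ∑ₚ xs (λ y ys → c ⊗ f y ys)
∑ₚ-distribˡ xs c f = ∑L-distribˡ (picks xs) c _

∑ₚ-swap : ∀ {A B : Set} (xs : List A) (ys : List B) (f : A → List A → B → List B → ℚ) →
  ∑ₚ xs (λ x us → ∑ₚ ys (f x us)) ≡ ∑ₚ ys (λ y vs → ∑ₚ xs (λ x us → f x us y vs))
∑ₚ-swap xs ys f = ∑L-swap (picks xs) (picks ys) _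

-- The definition expands along the first list. Interchanging the order in which two positions are
-- matched gives the expansion along the second, where the cycle of the new element will stand
-- first.
matchings-∷ : ∀ β m λs → matchings β (m ∷ λs) ≡ ∑ₚ β (λ b r → 𝟙 (b ℕ.≟ m) ⊗ matchings r λs)
matchings-∷ []      m λs = refl
matchings-∷ (b ∷ β) m λs = begin
  matchings (b ∷ β) (m ∷ λs)
    ≡⟨ ∑ₚ-∷ m λs (λ m r → 𝟙 (b ℕ.≟ m) ⊗ matchings β r) ⟩
  𝟙 (b ℕ.≟ m) ⊗ matchings β λs ⊕ ∑ₚ λs (λ l r → 𝟙 (b ℕ.≟ l) ⊗ matchings β (m ∷ r))
    ≡⟨ cong (𝟙 (b ℕ.≟ m) ⊗ matchings β λs ⊕_) (begin
         ∑ₚ λs (λ l r → 𝟙 (b ℕ.≟ l) ⊗ matchings β (m ∷ r))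
           ≡⟨ ∑ₚ-cong λs (λ l r _ → trans (cong (𝟙 (b ℕ.≟ l) ⊗_) (matchings-∷ β m r))
                (∑ₚ-distribˡ β (𝟙 (b ℕ.≟ l)) (λ c r′ → 𝟙 (c ℕ.≟ m) ⊗ matchings r′ r))) ⟩
         ∑ₚ λs (λ l r → ∑ₚ β (λ c r′ → 𝟙 (b ℕ.≟ l) ⊗ (𝟙 (c ℕ.≟ m) ⊗ matchings r′ r)))
           ≡⟨ ∑ₚ-swap λs β (λ l r c r′ → 𝟙 (b ℕ.≟ l) ⊗ (𝟙 (c ℕ.≟ m) ⊗ matchings r′ r)) ⟩
         ∑ₚ β (λ c r′ → ∑ₚ λs (λ l r → 𝟙 (b ℕ.≟ l) ⊗ (𝟙 (c ℕ.≟ m) ⊗ matchings r′ r)))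
           ≡⟨ ∑ₚ-cong β (λ c r′ _ → trans
                (∑ₚ-cong λs (λ l r _ → lem (𝟙 (b ℕ.≟ l)) (𝟙 (c ℕ.≟ m)) (matchings r′ r)))
                (sym (∑ₚ-distribˡ λs (𝟙 (c ℕ.≟ m)) (λ l r → 𝟙 (b ℕ.≟ l) ⊗ matchings r′ r)))) ⟩
         ∑ₚ β (λ c r′ → 𝟙 (c ℕ.≟ m) ⊗ matchings (b ∷ r′) λs) ∎) ⟩
  𝟙 (b ℕ.≟ m) ⊗ matchings β λs ⊕ ∑ₚ β (λ c r′ → 𝟙 (c ℕ.≟ m) ⊗ matchings (b ∷ r′) λs)
    ≡⟨ ∑ₚ-∷ b β (λ c r → 𝟙 (c ℕ.≟ m) ⊗ matchings r λs) ⟨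
  ∑ₚ (b ∷ β) (λ c r → 𝟙 (c ℕ.≟ m) ⊗ matchings r λs) ∎
  where
  open ≡-Reasoning
  lem : ∀ a b c → a ⊗ (b ⊗ c) ≡ b ⊗ (a ⊗ c)
  lem = RingSolver.solve-∀ ℚ-ring

allFin-suc : ∀ d → allFin (suc d) ≡ Fin.zero ∷ List.map Fin.suc (allFin d)
allFin-suc d = cong (Fin.zero ∷_) (sym (List.map-tabulate id Fin.suc))

insert-lift₀ : ∀ {d} i (π : Permutation′ d) →
  insert Fin.zero i (π ∘ₚ remove Fin.zero (transpose Fin.zero i)) Perm.≈ lift₀ π ∘ₚ transpose Fin.zero i
insert-lift₀ i π Fin.zero    = refl
insert-lift₀ i π (Fin.suc k) = begin
  insert Fin.zero i (π ∘ₚ c) ⟨$⟩ʳ Fin.suc k              ≡⟨ Perm.insert-punchIn Fin.zero i (π ∘ₚ c) k ⟩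
  Fin.punchIn i (c ⟨$⟩ʳ (π ⟨$⟩ʳ k))                      ≡⟨ Perm.punchIn-permute (transpose Fin.zero i) Fin.zero (π ⟨$⟩ʳ k) ⟨
  PC.transpose Fin.zero i (Fin.suc (π ⟨$⟩ʳ k))           ∎
  where
  open ≡-Reasoning
  c = remove Fin.zero (transpose Fin.zero i)

module _ (h : List ℕ → ℚ) (h-↭ : ∀ {λs μs} → λs ↭ μs → h λs ≡ h μs) where

  -- A permutation of d + 1 elements arises from one of d elements by adding a fixed point or by
  -- inserting the new element in a cycle.
  ∑-perms-suc : ∀ d → ∑ (perms (suc d)) (λ σ → h (cycleLengths σ)) ≡
    ∑ (perms d) (λ π → h (1 ∷ cycleLengths π) ⊕ ∑ₚ (cycleLengths π) (λ m r → fromℕ m ⊗ h (suc m ∷ r)))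
  ∑-perms-suc d = begin
    ∑ (perms (suc d)) H
      ≡⟨ ∑L-cartesianProductWith (insert Fin.zero) (allFin (suc d)) (perms d) H ⟩
    ∑ (allFin (suc d)) (λ i → ∑ (perms d) (λ π → H (insert Fin.zero i π)))
      ≡⟨ ∑L-cong (allFin (suc d)) (λ i → trans
           (sym (∑-∘ₚ (remove Fin.zero (transpose Fin.zero i)) (λ π → H (insert Fin.zero i π))
             (λ π ρ p → H-resp (insert Fin.zero i π) (insert Fin.zero i ρ) (insert-cong i π ρ p))))
           (∑L-cong (perms d) (λ π → H-resp (insert Fin.zero i (π ∘ₚ remove Fin.zero (transpose Fin.zero i))) (lift₀ π ∘ₚ transpose Fin.zero i) (insert-lift₀ i π)))) ⟩
    ∑ (allFin (suc d)) (λ i → ∑ (perms d) (λ π → H (lift₀ π ∘ₚ transpose Fin.zero i)))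
      ≡⟨ ∑L-swap (allFin (suc d)) (perms d) _ ⟩
    ∑ (perms d) (λ π → ∑ (allFin (suc d)) (λ i → H (lift₀ π ∘ₚ transpose Fin.zero i)))
      ≡⟨ ∑L-cong (perms d) term ⟩
    ∑ (perms d) (λ π → h (1 ∷ cycleLengths π) ⊕ ∑ₚ (cycleLengths π) (λ m r → fromℕ m ⊗ h (suc m ∷ r))) ∎
    where
    open ≡-Reasoning
    H : ∀ {d} → Permutation′ d → ℚ
    H σ = h (cycleLengths σ)
    H-resp : ∀ {d} → Respects {d} H
    H-resp π ρ p = h-↭ (cycleLengths-resp π ρ p)
    insert-cong : ∀ i (π ρ : Permutation′ d) → π Perm.≈ ρ → insert Fin.zero i π Perm.≈ insert Fin.zero i ρ
    insert-cong i π ρ p Fin.zero    = refl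
    insert-cong i π ρ p (Fin.suc k) = trans (Perm.insert-punchIn Fin.zero i π k)
      (trans (cong (Fin.punchIn i) (p k)) (sym (Perm.insert-punchIn Fin.zero i ρ k)))
    lengths-suc : ∀ {d} (cs : List (List (Fin d))) → List.map length (List.map (List.map Fin.suc) cs) ≡ List.map length cs
    lengths-suc cs = trans (sym (List.map-∘ cs)) (List.map-cong (List.length-map Fin.suc) cs)
    term : ∀ π → ∑ (allFin (suc d)) (λ i → H (lift₀ π ∘ₚ transpose Fin.zero i)) ≡
      h (1 ∷ cycleLengths π) ⊕ ∑ₚ (cycleLengths π) (λ m r → fromℕ m ⊗ h (suc m ∷ r))
    term π with cs , C ← cycles-exist π = begin
      ∑ (allFin (suc d)) G
        ≡⟨ cong (λ l → ∑ l G) (allFin-suc d) ⟩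
      G Fin.zero ⊕ ∑ (List.map Fin.suc (allFin d)) G
        ≡⟨ cong₂ _⊕_ fixed (trans (∑L-map Fin.suc (allFin d) G) (sym (∑L-↭ (G ∘ Fin.suc) (partition C)))) ⟩
      h (1 ∷ cycleLengths π) ⊕ ∑ (concat cs) (G ∘ Fin.suc)
        ≡⟨ cong (h (1 ∷ cycleLengths π) ⊕_) (trans
             (∑-concat-cycles (G ∘ Fin.suc) (λ m r → h (suc m ∷ r)) [] cs C inserted)
             (sym (∑ₚ-↭ (λ m r → fromℕ m ⊗ h (suc m ∷ r)) (λ m p → cong (fromℕ m ⊗_) (h-↭ (prep (suc m) p))) (cycleLengths-↭ π C)))) ⟩
      h (1 ∷ cycleLengths π) ⊕ ∑ₚ (cycleLengths π) (λ m r → fromℕ m ⊗ h (suc m ∷ r)) ∎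
      where
      G : Fin (suc d) → ℚ
      G i = H (lift₀ π ∘ₚ transpose Fin.zero i)
      fixed : G Fin.zero ≡ h (1 ∷ cycleLengths π)
      fixed = h-↭ (↭-trans
        (cycleLengths-↭ (lift₀ π ∘ₚ transpose Fin.zero Fin.zero)
          (cycles-resp (λ i → sym (transpose-same Fin.zero (lift₀ π ⟨$⟩ʳ i))) (cycles-lift₀ π C)))
        (prep 1 (↭-trans (↭.↭-reflexive (lengths-suc cs)) (↭-sym (cycleLengths-↭ π C)))))
      inserted : ∀ {j xs rest} → Cycles (π ⟨$⟩ʳ_) ((j ∷ xs) ∷ rest) →
        G (Fin.suc j) ≡ h (suc (suc (length xs)) ∷ List.map length rest)
      inserted {j} {xs} {rest} C′ = trans
        (h-↭ (cycleLengths-↭ (lift₀ π ∘ₚ transpose Fin.zero (Fin.suc j))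
          (join Fin.zero (Fin.suc j) [] (List.map Fin.suc xs) (List.map (List.map Fin.suc) rest) (cycles-lift₀ π C′))))
        (cong₂ (λ m r → h (suc (suc m) ∷ r)) (List.length-map Fin.suc xs) (lengths-suc rest))

∑ₚ-sum : ∀ λs c → ∑ₚ λs (λ m _ → fromℕ m ⊗ c) ≡ fromℕ (sumᴸ λs) ⊗ c
∑ₚ-sum λs c = trans (sym (∑≡∑ₚ λs (λ m → fromℕ m ⊗ c))) (go λs)
  where
  go : ∀ λs → ∑ λs (λ m → fromℕ m ⊗ c) ≡ fromℕ (sumᴸ λs) ⊗ c
  go []       = sym (ℚ.*-zeroˡ c)
  go (b ∷ λs) = trans (cong (fromℕ b ⊗ c ⊕_) (go λs)) (trans (sym (ℚ.*-distribʳ-+ c (fromℕ b) (fromℕ (sumᴸ λs))))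
    (cong (_⊗ c) (sym (fromℕ-+ b (sumᴸ λs)))))

-- Induction by removing the new element. The position of β matched with its cycle has some entry b.
-- If b = 1 it disappears; otherwise it becomes b - 1 and the element could be inserted at b - 1
-- places. After multiplication by `product β` each position thus contributes b times the previous
-- factorial, and the entries b add up to the new size.
∑-matchings : ∀ d β → All (1 ≤_) β → sumᴸ β ≡ d →
  ∑ (perms d) (λ π → matchings β (cycleLengths π)) ⊗ fromℕ (product β) ≡ fromℕ (d !)
∑-matchings zero    []          pos eq = refl
∑-matchings zero    (zero ∷ β)  (() ∷ _) eq
∑-matchings (suc d) β pos eq = begin
  ∑ (perms (suc d)) (λ σ → matchings β (cycleLengths σ)) ⊗ fromℕ (product β)
    ≡⟨ cong (_⊗ fromℕ (product β)) (trans (∑-perms-suc (matchings β) (matchings-↭ β) d) (∑L-cong (perms d) (λ π → expand (cycleLengths π)))) ⟩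
  ∑ (perms d) (λ π → ∑ₚ β (λ b r → D b r (cycleLengths π))) ⊗ fromℕ (product β)
    ≡⟨ trans (ℚ.*-comm _ (fromℕ (product β))) (cong (fromℕ (product β) ⊗_) (∑L-swap (perms d) (picks β) _)) ⟩
  fromℕ (product β) ⊗ ∑ₚ β (λ b r → ∑ (perms d) (λ π → D b r (cycleLengths π)))
    ≡⟨ ∑ₚ-distribˡ β (fromℕ (product β)) (λ b r → ∑ (perms d) (λ π → D b r (cycleLengths π))) ⟩
  ∑ₚ β (λ b r → fromℕ (product β) ⊗ ∑ (perms d) (λ π → D b r (cycleLengths π)))
    ≡⟨ ∑ₚ-cong β term ⟩
  ∑ₚ β (λ b r → fromℕ b ⊗ fromℕ (d !))
    ≡⟨ ∑ₚ-sum β (fromℕ (d !)) ⟩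
  fromℕ (sumᴸ β) ⊗ fromℕ (d !)
    ≡⟨ trans (cong (λ s → fromℕ s ⊗ fromℕ (d !)) eq) (sym (fromℕ-* (suc d) (d !))) ⟩
  fromℕ (suc d !) ∎
  where
  open ≡-Reasoning
  D : ℕ → List ℕ → List ℕ → ℚ
  D b r λs = 𝟙 (b ℕ.≟ 1) ⊗ matchings r λs ⊕ ∑ₚ λs (λ m r′ → fromℕ m ⊗ (𝟙 (b ℕ.≟ suc m) ⊗ matchings r r′))
  expand : ∀ λs → matchings β (1 ∷ λs) ⊕ ∑ₚ λs (λ m r′ → fromℕ m ⊗ matchings β (suc m ∷ r′)) ≡ ∑ₚ β (λ b r → D b r λs)
  expand λs = trans (cong₂ _⊕_ (matchings-∷ β 1 λs) (trans
      (∑ₚ-cong λs (λ m r′ _ → trans (cong (fromℕ m ⊗_) (matchings-∷ β (suc m) r′))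
        (∑ₚ-distribˡ β (fromℕ m) (λ b r → 𝟙 (b ℕ.≟ suc m) ⊗ matchings r r′))))
      (∑ₚ-swap λs β (λ m r′ b r → fromℕ m ⊗ (𝟙 (b ℕ.≟ suc m) ⊗ matchings r r′)))))
    (sym (∑ₚ-⊕ β (λ b r → 𝟙 (b ℕ.≟ 1) ⊗ matchings r λs) (λ b r → ∑ₚ λs (λ m r′ → fromℕ m ⊗ (𝟙 (b ℕ.≟ suc m) ⊗ matchings r r′)))))
  D-one : ∀ r λs → D 1 r λs ≡ matchings r λs
  D-one r λs = trans (cong₂ _⊕_ (ℚ.*-identityˡ (matchings r λs)) (∑L-zero (picks λs) (λ (m , r′) _ → vanish m r′))) (ℚ.+-identityʳ _)
    where
    vanish : ∀ m r′ → fromℕ m ⊗ (𝟙 (1 ℕ.≟ suc m) ⊗ matchings r r′) ≡ 0ℚ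
    vanish zero    r′ = ℚ.*-zeroˡ (1ℚ ⊗ matchings r r′)
    vanish (suc m) r′ = trans (cong (fromℕ (suc m) ⊗_) (ℚ.*-zeroˡ (matchings r r′))) (ℚ.*-zeroʳ (fromℕ (suc m)))
  D-suc : ∀ c r λs → D (suc (suc c)) r λs ≡ fromℕ (suc c) ⊗ matchings (suc c ∷ r) λs
  D-suc c r λs = trans (cong₂ _⊕_ (ℚ.*-zeroˡ (matchings r λs)) (trans
      (∑ₚ-cong λs (λ m r′ _ → shift-𝟙 m (matchings r r′)))
      (sym (∑ₚ-distribˡ λs (fromℕ (suc c)) (λ m r′ → 𝟙 (suc c ℕ.≟ m) ⊗ matchings r r′)))))
    (ℚ.+-identityˡ _)
    where
    shift-𝟙 : ∀ m q → fromℕ m ⊗ (𝟙 (suc (suc c) ℕ.≟ suc m) ⊗ q) ≡ fromℕ (suc c) ⊗ (𝟙 (suc c ℕ.≟ m) ⊗ q)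
    shift-𝟙 m q = by-cases (suc c ℕ.≟ m)
      where
      by-cases : Dec (suc c ≡ m) → fromℕ m ⊗ (𝟙 (suc c ℕ.≟ m) ⊗ q) ≡ fromℕ (suc c) ⊗ (𝟙 (suc c ℕ.≟ m) ⊗ q)
      by-cases (yes refl) = refl
      by-cases (no ¬eq) rewrite 𝟙-no (suc c ℕ.≟ m) ¬eq | ℚ.*-zeroˡ q =
        trans (ℚ.*-zeroʳ (fromℕ m)) (sym (ℚ.*-zeroʳ (fromℕ (suc c))))
  term : ∀ b r → b ∷ r ↭ β → fromℕ (product β) ⊗ ∑ (perms d) (λ π → D b r (cycleLengths π)) ≡ fromℕ b ⊗ fromℕ (d !)
  term b r p with ↭.All-resp-↭ (↭-sym p) pos | trans (ℕ.sum-↭ p) eq | ℕ.product-↭ p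
  term zero                r p | () ∷ _   | _  | _
  term (suc zero)          r p | _ ∷ pos′ | eq′ | prod = begin
    fromℕ (product β) ⊗ ∑ (perms d) (λ π → D 1 r (cycleLengths π))
      ≡⟨ cong₂ _⊗_ (cong fromℕ (trans (sym prod) (ℕ.*-identityˡ (product r)))) (∑L-cong (perms d) (λ π → D-one r (cycleLengths π))) ⟩
    fromℕ (product r) ⊗ ∑ (perms d) (λ π → matchings r (cycleLengths π))
      ≡⟨ trans (ℚ.*-comm (fromℕ (product r)) _) (∑-matchings d r pos′ (ℕ.suc-injective eq′)) ⟩
    fromℕ (d !)
      ≡⟨ ℚ.*-identityˡ _ ⟨
    fromℕ 1 ⊗ fromℕ (d !) ∎
  term (suc (suc c)) r p | _ ∷ pos′ | eq′ | prod = begin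
    fromℕ (product β) ⊗ ∑ (perms d) (λ π → D (suc (suc c)) r (cycleLengths π))
      ≡⟨ cong₂ _⊗_ (trans (cong fromℕ (sym prod)) (fromℕ-* (suc (suc c)) (product r)))
           (trans (∑L-cong (perms d) (λ π → D-suc c r (cycleLengths π))) (sym (∑L-distribˡ (perms d) (fromℕ (suc c)) _))) ⟩
    fromℕ (suc (suc c)) ⊗ fromℕ (product r) ⊗ (fromℕ (suc c) ⊗ Σ₁)
      ≡⟨ lem (fromℕ (suc (suc c))) (fromℕ (product r)) (fromℕ (suc c)) Σ₁ ⟩
    fromℕ (suc (suc c)) ⊗ (Σ₁ ⊗ (fromℕ (suc c) ⊗ fromℕ (product r)))
      ≡⟨ cong (λ z → fromℕ (suc (suc c)) ⊗ (Σ₁ ⊗ z)) (fromℕ-* (suc c) (product r)) ⟨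
    fromℕ (suc (suc c)) ⊗ (Σ₁ ⊗ fromℕ (suc c * product r))
      ≡⟨ cong (fromℕ (suc (suc c)) ⊗_) (∑-matchings d (suc c ∷ r) (s≤s z≤n ∷ pos′) (ℕ.suc-injective eq′)) ⟩
    fromℕ (suc (suc c)) ⊗ fromℕ (d !) ∎
    where
    Σ₁ = ∑ (perms d) (λ π → matchings (suc c ∷ r) (cycleLengths π))
    lem : ∀ a b c s → a ⊗ b ⊗ (c ⊗ s) ≡ a ⊗ (s ⊗ (c ⊗ b))
    lem = RingSolver.solve-∀ ℚ-ring

-- `Aut` with a range independent of β, so that entries can be removed one at a time.
∏! : ℕ → List ℕ → ℕ
∏! M β = product (List.map (λ i → multiplicity (suc i) β !) (List.upTo M))

product-single : ∀ (f f′ : ℕ → ℕ) c {x} xs → Unique xs → x ∈ xs → f x ≡ c * f′ x → (∀ {y} → y ≢ x → f y ≡ f′ y) →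
  product (List.map f xs) ≡ c * product (List.map f′ xs)
product-single f f′ c (y ∷ xs) (y∉ ∷ u) (here refl) eq other = trans
  (cong₂ _*_ eq (cong product (List.map-cong-local (All.map (λ y≢ → other (y≢ ∘ sym)) y∉))))
  (ℕ.*-assoc c (f′ y) _)
product-single f f′ c (y ∷ xs) (y∉ ∷ u) (there x∈) eq other = trans
  (cong₂ _*_ (other (λ y≡x → All.lookup y∉ x∈ y≡x)) (product-single f f′ c xs u x∈ eq other))
  (arith (f′ y) c _)
  where
  arith : ∀ a b c → a * (b * c) ≡ b * (a * c)
  arith = ℕSolver.solve-∀

∏!-∷ : ∀ M b β → InRange M b → ∏! M (b ∷ β) ≡ multiplicity b (b ∷ β) * ∏! M β
∏!-∷ M (suc b) β (_ , b<M) = product-single _ _ (multiplicity (suc b) (suc b ∷ β)) (List.upTo M) (Unique.upTo⁺ M) (∈.∈-upTo⁺ b<M)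
  (trans (cong _! (multiplicity-self (suc b) β)) (cong (_* multiplicity (suc b) β !) (sym (multiplicity-self (suc b) β))))
  (λ y≢b → cong _! (multiplicity-other β (y≢b ∘ ℕ.suc-injective)))

𝟙-⊗-cong : ∀ {P : Set} (p : Dec P) {x y} → (P → x ≡ y) → 𝟙 p ⊗ x ≡ 𝟙 p ⊗ y
𝟙-⊗-cong (yes p)         eq = cong (1ℚ ⊗_) (eq p)
𝟙-⊗-cong (no _)  {x} {y} eq = trans (ℚ.*-zeroˡ x) (sym (ℚ.*-zeroˡ y))

matchings-no : ∀ β λs → ¬ (λs ↭ β) → matchings β λs ≡ 0ℚ
matchings-no []      []       ¬p = contradiction ↭-refl ¬p
matchings-no []      (l ∷ λs) ¬p = refl
matchings-no (b ∷ β) λs       ¬p = ∑L-zero (picks λs) (λ (m , r) m∈ → term m r (All.lookup (picks-↭ λs) m∈))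
  where
  term : ∀ m r → m ∷ r ↭ λs → 𝟙 (b ℕ.≟ m) ⊗ matchings β r ≡ 0ℚ
  term m r p = trans (𝟙-⊗-cong (b ℕ.≟ m) (λ { refl → matchings-no β r (λ q → ¬p (↭-trans (↭-sym p) (prep b q))) })) (ℚ.*-zeroʳ (𝟙 (b ℕ.≟ m)))

-- The first entry can be matched with any of the entries equal to it; these multiplicities,
-- decreasing as entries are removed, multiply to the factorials.
matchings-yes : ∀ M β → All (InRange M) β → ∀ λs → λs ↭ β → matchings β λs ≡ fromℕ (∏! M β)
matchings-yes M [] [] λs p rewrite ↭.↭-empty-inv p = cong fromℕ (sym (ones (List.upTo M)))
  where
  ones : ∀ (xs : List ℕ) → product (List.map (λ _ → 1) xs) ≡ 1
  ones []       = refl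
  ones (x ∷ xs) = trans (ℕ.+-identityʳ _) (ones xs)
matchings-yes M (b ∷ β) (rb ∷ rβ) λs p = begin
  matchings (b ∷ β) λs
    ≡⟨ matchings-↭ (b ∷ β) p ⟩
  ∑ₚ (b ∷ β) (λ m r → 𝟙 (b ℕ.≟ m) ⊗ matchings β r)
    ≡⟨ ∑ₚ-cong (b ∷ β) term ⟩
  ∑ₚ (b ∷ β) (λ m _ → A ⊗ 𝟙 (b ℕ.≟ m))
    ≡⟨ ∑≡∑ₚ (b ∷ β) (λ m → A ⊗ 𝟙 (b ℕ.≟ m)) ⟨
  ∑ (b ∷ β) (λ m → A ⊗ 𝟙 (b ℕ.≟ m))
    ≡⟨ ∑L-distribˡ (b ∷ β) A (λ m → 𝟙 (b ℕ.≟ m)) ⟨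
  A ⊗ ∑ (b ∷ β) (λ m → 𝟙 (b ℕ.≟ m))
    ≡⟨ cong (A ⊗_) (length-filter (b ℕ.≟_) (b ∷ β)) ⟨
  A ⊗ fromℕ (multiplicity b (b ∷ β))
    ≡⟨ trans (sym (fromℕ-* (∏! M β) (multiplicity b (b ∷ β)))) (cong fromℕ (trans (ℕ.*-comm (∏! M β) _) (sym (∏!-∷ M b β rb)))) ⟩
  fromℕ (∏! M (b ∷ β)) ∎
  where
  open ≡-Reasoning
  A = fromℕ (∏! M β)
  term : ∀ m r → m ∷ r ↭ b ∷ β → 𝟙 (b ℕ.≟ m) ⊗ matchings β r ≡ A ⊗ 𝟙 (b ℕ.≟ m)
  term m r q = trans (𝟙-⊗-cong (b ℕ.≟ m) (λ { refl → matchings-yes M β rβ r (↭.drop-∷ q) })) (ℚ.*-comm (𝟙 (b ℕ.≟ m)) A)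

module _ (β : List ℕ) (pos : All (1 ≤_) β) where
  private d = sumᴸ β

  -- `matchings β` is Aut(β) on the class of β and 0 elsewhere, so `∑-matchings` counts the class.
  class-size : fromℕ (∏! d β) ⊗ fromℕ (product β) ⊗ ∑ (perms d) (ofType β) ≡ fromℕ (d !)
  class-size = begin
    A ⊗ P ⊗ ∑ (perms d) (ofType β)
      ≡⟨ lem A P (∑ (perms d) (ofType β)) ⟩
    A ⊗ ∑ (perms d) (ofType β) ⊗ P
      ≡⟨ cong (_⊗ P) (trans (∑L-distribˡ (perms d) A (ofType β)) (∑L-cong (perms d) term)) ⟩
    ∑ (perms d) (λ π → matchings β (cycleLengths π)) ⊗ P
      ≡⟨ ∑-matchings d β pos refl ⟩
    fromℕ (d !) ∎
    where
    open ≡-Reasoning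
    A = fromℕ (∏! d β)
    P = fromℕ (product β)
    lem : ∀ a p s → a ⊗ p ⊗ s ≡ a ⊗ s ⊗ p
    lem = RingSolver.solve-∀ ℚ-ring
    term : ∀ (π : Permutation′ d) → A ⊗ ofType β π ≡ matchings β (cycleLengths π)
    term π = by-cases (hasCycleType? π β)
      where
      by-cases : Dec (HasCycleType π β) → A ⊗ ofType β π ≡ matchings β (cycleLengths π)
      by-cases (yes hc) = trans (cong (A ⊗_) (𝟙-yes (hasCycleType? π β) hc)) (trans (ℚ.*-identityʳ A)
        (sym (matchings-yes d β (inRange pos) (cycleLengths π) (hasCycleType⇒↭ π pos refl hc))))
      by-cases (no ¬hc) = trans (cong (A ⊗_) (𝟙-no (hasCycleType? π β) ¬hc)) (trans (ℚ.*-zeroʳ A)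
        (sym (matchings-no β (cycleLengths π) (λ p → ¬hc (λ m → multiplicity-↭ (suc (toℕ m)) p)))))

  factorisations-T : ∀ t → 1 ≤ d → fromℕ d ⊗ fromℕ (factorisations d t β) ≡
    fromℕ (d ^ t * t !) ⊗ T β t ⊗ ∑ (perms d) (ofType β)
  factorisations-T t 1≤d = begin
    fromℕ d ⊗ fromℕ (factorisations d t β)
      ≡⟨ cong (fromℕ d ⊗_) (factorisations-𝔸^ d t β) ⟩
    fromℕ d ⊗ ∑ (perms d) (λ π → 𝔸^ t (ofType List.[ d ]) π ⊗ ofType β π)
      ≡⟨ ∑L-distribˡ (perms d) (fromℕ d) _ ⟩
    ∑ (perms d) (λ π → fromℕ d ⊗ (𝔸^ t (ofType List.[ d ]) π ⊗ ofType β π))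
      ≡⟨ ∑L-cong (perms d) term ⟩
    ∑ (perms d) (λ π → fromℕ (d ^ t * t !) ⊗ T β t ⊗ ofType β π)
      ≡⟨ ∑L-distribˡ (perms d) (fromℕ (d ^ t * t !) ⊗ T β t) (ofType β) ⟨
    fromℕ (d ^ t * t !) ⊗ T β t ⊗ ∑ (perms d) (ofType β) ∎
    where
    open ≡-Reasoning
    dCycle : ∀ {d} → 1 ≤ d → (π : Permutation′ d) → fromℕ d ⊗ 𝔸^ t (ofType List.[ d ]) π ≡ fromℕ (d ^ t * t !) ⊗ T (cycleLengths π) t
    dCycle (s≤s _) = 𝔸^-dCycle t
    term : ∀ π → fromℕ d ⊗ (𝔸^ t (ofType List.[ d ]) π ⊗ ofType β π) ≡ fromℕ (d ^ t * t !) ⊗ T β t ⊗ ofType β π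
    term π = trans (sym (ℚ.*-assoc (fromℕ d) _ _)) (trans (cong (_⊗ ofType β π) (dCycle 1≤d π)) (by-cases (hasCycleType? π β)))
      where
      by-cases : Dec (HasCycleType π β) →
        fromℕ (d ^ t * t !) ⊗ T (cycleLengths π) t ⊗ ofType β π ≡ fromℕ (d ^ t * t !) ⊗ T β t ⊗ ofType β π
      by-cases (yes hc) = cong (λ z → fromℕ (d ^ t * t !) ⊗ z ⊗ ofType β π) (T-↭ (hasCycleType⇒↭ π pos refl hc) .at t)
      by-cases (no ¬hc) rewrite 𝟙-no (hasCycleType? π β) ¬hc =
        trans (ℚ.*-zeroʳ (fromℕ (d ^ t * t !) ⊗ T (cycleLengths π) t)) (sym (ℚ.*-zeroʳ (fromℕ (d ^ t * t !) ⊗ T β t)))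

-- Extracting the powers of x from T

^ℚ-+ : ∀ b i j → b ^ℚ (i + j) ≡ b ^ℚ i ⊗ b ^ℚ j
^ℚ-+ b zero    j = sym (ℚ.*-identityˡ (b ^ℚ j))
^ℚ-+ b (suc i) j = trans (cong (b ⊗_) (^ℚ-+ b i j)) (sym (ℚ.*-assoc b (b ^ℚ i) (b ^ℚ j)))

^ℚ-distrib-⊗ : ∀ a b k → (a ⊗ b) ^ℚ k ≡ a ^ℚ k ⊗ b ^ℚ k
^ℚ-distrib-⊗ a b zero    = refl
^ℚ-distrib-⊗ a b (suc k) = trans (cong (a ⊗ b ⊗_) (^ℚ-distrib-⊗ a b k)) (lem a b (a ^ℚ k) (b ^ℚ k))
  where
  lem : ∀ a b x y → a ⊗ b ⊗ (x ⊗ y) ≡ (a ⊗ x) ⊗ (b ⊗ y)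
  lem = RingSolver.solve-∀ ℚ-ring

-- Substitution of bx for x.
scale : ℚ → Series → Series
scale b s m = b ^ℚ m ⊗ s m

E-scale : ∀ a b → E (a ⊗ b) ≈ₛ scale b (E a)
E-scale a b .at m = trans (cong (_⊗ inv! m) (^ℚ-distrib-⊗ a b m)) (lem (a ^ℚ m) (b ^ℚ m) (inv! m))
  where
  lem : ∀ x y i → x ⊗ y ⊗ i ≡ y ⊗ (x ⊗ i)
  lem = RingSolver.solve-∀ ℚ-ring

ς-scale : ∀ b → ς b ≈ₛ scale (fromℕ b) (ς 1)
ς-scale b .at m = trans (cong₂ (λ x y → x ⊕ (⊖ y)) (E-scale ℚ.½ (fromℕ b) .at m)
    (trans (E-cong (lem₁ ℚ.½ (fromℕ b)) .at m) (E-scale (⊖ ℚ.½) (fromℕ b) .at m)))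
  (lem₂ (fromℕ b ^ℚ m) (E ℚ.½ m) (E (⊖ ℚ.½) m))
  where
  lem₁ : ∀ a b → ⊖ (a ⊗ b) ≡ (⊖ a) ⊗ b
  lem₁ = RingSolver.solve-∀ ℚ-ring
  lem₂ : ∀ p x y → p ⊗ x ⊕ (⊖ (p ⊗ y)) ≡ p ⊗ (x ⊕ (⊖ y))
  lem₂ = RingSolver.solve-∀ ℚ-ring

𝒮[_] : ℕ → Series
𝒮[ b ] = scale (fromℕ b) 𝒮

ς≈𝒮 : ∀ b → ς b ≈ₛ const (fromℕ b) *ₛ (X *ₛ 𝒮[ b ])
ς≈𝒮 b = 𝕊.trans eq (𝕊.trans (·≈const (fromℕ b) (shift 𝒮[ b ])) (*-congˡ (const (fromℕ b)) (𝕊.sym (X-*ₛ 𝒮[ b ]))))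
  where
  eq : ς b ≈ₛ fromℕ b · shift 𝒮[ b ]
  eq .at zero    = sym (ℚ.*-zeroʳ (fromℕ b))
  eq .at (suc m) = trans (ς-scale b .at (suc m)) (ℚ.*-assoc (fromℕ b) (fromℕ b ^ℚ m) (𝒮 m))

∏𝒮 : List ℕ → Series
∏𝒮 []      = 1ₛ
∏𝒮 (b ∷ β) = 𝒮[ b ] *ₛ ∏𝒮 β

∏ς≈∏𝒮 : ∀ β → ∏ς β ≈ₛ const (fromℕ (product β)) *ₛ (X ^ₛ length β *ₛ ∏𝒮 β)
∏ς≈∏𝒮 [] = 𝕊.sym (𝕊.trans (*-congʳ (1ₛ *ₛ 1ₛ) (𝕊.sym 1ₛ≈const)) (𝕊.trans (𝕊.*-identityˡ _) (𝕊.*-identityˡ 1ₛ)))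
∏ς≈∏𝒮 (b ∷ β) = begin
  ς b *ₛ ∏ς β
    ≈⟨ *ₛ-cong (ς≈𝒮 b) (∏ς≈∏𝒮 β) ⟩
  const (fromℕ b) *ₛ (X *ₛ 𝒮[ b ]) *ₛ (const (fromℕ (product β)) *ₛ (X ^ₛ length β *ₛ ∏𝒮 β))
    ≈⟨ solveₛ 6 (λ b x s p y t → b :* (x :* s) :* (p :* (y :* t)) := (b :* p) :* ((x :* y) :* (s :* t))) 𝕊.refl
         (const (fromℕ b)) X 𝒮[ b ] (const (fromℕ (product β))) (X ^ₛ length β) (∏𝒮 β) ⟩
  const (fromℕ b) *ₛ const (fromℕ (product β)) *ₛ (X ^ₛ length (b ∷ β) *ₛ ∏𝒮 (b ∷ β))
    ≈⟨ *-congʳ (X ^ₛ length (b ∷ β) *ₛ ∏𝒮 (b ∷ β)) (𝕊.trans (𝕊.sym (const-* (fromℕ b) (fromℕ (product β)))) (const-cong (sym (fromℕ-* b (product β))))) ⟩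
  const (fromℕ (product (b ∷ β))) *ₛ (X ^ₛ length (b ∷ β) *ₛ ∏𝒮 (b ∷ β)) ∎
  where open ≈ₛ-Reasoning

X^-*ₛ : ∀ k s m → (X ^ₛ k *ₛ s) (k + m) ≡ s m
X^-*ₛ zero    s m = 𝕊.*-identityˡ s .at m
X^-*ₛ (suc k) s m = trans (𝕊.*-assoc X (X ^ₛ k) s .at (suc k + m)) (trans (X-*ₛ (X ^ₛ k *ₛ s) .at (suc k + m)) (X^-*ₛ k s m))

-- ς(b) is bx times 𝒮(bx), so the numerator contains one more factor x than `length β`; the
-- denominator ς(1) = x𝒮 removes one. With t = n - 1 + 2g the remaining index is 2g.
T-coeff : ∀ b β k → T (b ∷ β) (length β + k) ≡ fromℕ (product (b ∷ β)) ⊗ (∏𝒮 (b ∷ β) *ₛ ρ) k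
T-coeff b β k = begin
  T (b ∷ β) (length β + k)
    ≡⟨ *-congʳ ρ tail≈ .at (length β + k) ⟩
  (const P *ₛ (X ^ₛ length β *ₛ ∏𝒮 (b ∷ β)) *ₛ ρ) (length β + k)
    ≡⟨ solveₛ 4 (λ p y s r → p :* (y :* s) :* r := p :* (y :* (s :* r))) 𝕊.refl (const P) (X ^ₛ length β) (∏𝒮 (b ∷ β)) ρ .at (length β + k) ⟩
  (const P *ₛ (X ^ₛ length β *ₛ (∏𝒮 (b ∷ β) *ₛ ρ))) (length β + k)
    ≡⟨ const-*ₛ P (X ^ₛ length β *ₛ (∏𝒮 (b ∷ β) *ₛ ρ)) .at (length β + k) ⟩
  P ⊗ (X ^ₛ length β *ₛ (∏𝒮 (b ∷ β) *ₛ ρ)) (length β + k)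
    ≡⟨ cong (P ⊗_) (X^-*ₛ (length β) (∏𝒮 (b ∷ β) *ₛ ρ) k) ⟩
  P ⊗ (∏𝒮 (b ∷ β) *ₛ ρ) k ∎
  where
  open ≡-Reasoning
  P = fromℕ (product (b ∷ β))
  tail≈ : tail (∏ς (b ∷ β)) ≈ₛ const P *ₛ (X ^ₛ length β *ₛ ∏𝒮 (b ∷ β))
  tail≈ = X-cancel {tail (∏ς (b ∷ β))} {const P *ₛ (X ^ₛ length β *ₛ ∏𝒮 (b ∷ β))} (𝕊.trans (𝕊.sym (X*tail (∏ς (b ∷ β)) (∏ς₀ b β))) (𝕊.trans (∏ς≈∏𝒮 (b ∷ β))
    (solveₛ 4 (λ p x y s → p :* ((x :* y) :* s) := x :* (p :* (y :* s))) 𝕊.refl (const P) X (X ^ₛ length β) (∏𝒮 (b ∷ β)))))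

-- Evaluation of the Hurwitz numbers

sum-toList : ∀ {n} (β : Vec ℕ n) → sumᴸ (Vec.toList β) ≡ sum β
sum-toList []      = refl
sum-toList (b ∷ β) = cong (b +_) (sum-toList β)

toList⁺ : ∀ {n} {β : Vec ℕ n} → VAll.All (0 <_) β → All (1 ≤_) (Vec.toList β)
toList⁺ []       = []
toList⁺ (p ∷ ps) = p ∷ toList⁺ ps

product-nonZero : ∀ {β} → All (1 ≤_) β → NonZero (product β)
product-nonZero []       = _
product-nonZero {b ∷ β} (p ∷ ps) = ℕ.m*n≢0 b (product β) {{ℕ.>-nonZero p}} {{product-nonZero ps}}

hurwitz-formula : ∀ g M {n} (β : Vec ℕ (suc n)) → VAll.All (0 <_) β → 2 * g + suc n ∸ 1 ≡ 2 + M →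
  hurwitz g β /ₙ ((2 * g + suc n ∸ 1) ! * sum β) ≡ fromℕ (sum β ^ M) ⊗ (∏𝒮 (Vec.toList β) *ₛ ρ) (2 * g)
-- The first factors of `K` clear the denominators d! and t! d; the extra d and P are absorbed by
-- `factorisations-T` and `class-size`. As t = M + 2, two of the powers of d cancel and dᴹ is left.
hurwitz-formula g M {n} (b ∷ βs) pos t≡ = fromℕ-cancel K {{K≢0}} (begin
  fromℕ K ⊗ (fromℕ (A * F) /ₙ (d !) /ₙ (t ! * d))
    ≡⟨ cong (fromℕ K ⊗_) (trans (/ₙ-inv (fromℕ (A * F) /ₙ (d !)) (t ! * d)) (cong (_⊗ inv (t ! * d)) (/ₙ-inv (fromℕ (A * F)) (d !)))) ⟩
  fromℕ (d ! * (t ! * d) * (d * P)) ⊗ (fromℕ (A * F) ⊗ inv (d !) ⊗ inv (t ! * d))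
    ≡⟨ cong₂ (λ k a → k ⊗ (a ⊗ inv (d !) ⊗ inv (t ! * d)))
         (trans (fromℕ-* (d ! * (t ! * d)) (d * P)) (cong₂ _⊗_ (fromℕ-* (d !) (t ! * d)) (fromℕ-* d P))) (fromℕ-* A F) ⟩
  fromℕ (d !) ⊗ fromℕ (t ! * d) ⊗ (fromℕ d ⊗ fromℕ P) ⊗ (fromℕ A ⊗ fromℕ F ⊗ inv (d !) ⊗ inv (t ! * d))
    ≡⟨ lem₁ (fromℕ (d !)) (fromℕ (t ! * d)) (fromℕ d) (fromℕ P) (fromℕ A) (fromℕ F) (inv (d !)) (inv (t ! * d)) ⟩
  (fromℕ (d !) ⊗ inv (d !)) ⊗ (fromℕ (t ! * d) ⊗ inv (t ! * d)) ⊗ (fromℕ A ⊗ fromℕ P ⊗ (fromℕ d ⊗ fromℕ F))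
    ≡⟨ cong₂ (λ x y → x ⊗ y ⊗ (fromℕ A ⊗ fromℕ P ⊗ (fromℕ d ⊗ fromℕ F))) (*-inv (d !) {{n!≢0 d}}) (*-inv (t ! * d) {{td≢0}}) ⟩
  1ℚ ⊗ 1ℚ ⊗ (fromℕ A ⊗ fromℕ P ⊗ (fromℕ d ⊗ fromℕ F))
    ≡⟨ cong (λ x → 1ℚ ⊗ 1ℚ ⊗ (fromℕ A ⊗ fromℕ P ⊗ x)) dF ⟩
  1ℚ ⊗ 1ℚ ⊗ (fromℕ A ⊗ fromℕ P ⊗ (fromℕ (d ^ t * t !) ⊗ T βL t ⊗ Cls))
    ≡⟨ lem₂ (fromℕ A) (fromℕ P) (fromℕ (d ^ t * t !)) (T βL t) Cls ⟩
  (fromℕ A ⊗ fromℕ P ⊗ Cls) ⊗ (fromℕ (d ^ t * t !) ⊗ T βL t)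
    ≡⟨ cong₂ (λ x y → x ⊗ (fromℕ (d ^ t * t !) ⊗ y)) class (trans (cong (T βL) t≡′) (T-coeff b (Vec.toList βs) (2 * g))) ⟩
  fromℕ (d !) ⊗ (fromℕ (d ^ t * t !) ⊗ (fromℕ P ⊗ V))
    ≡⟨ lem₃ (fromℕ (d !)) (fromℕ (d ^ t * t !)) (fromℕ P) V ⟩
  fromℕ (d !) ⊗ fromℕ (d ^ t * t !) ⊗ fromℕ P ⊗ V
    ≡⟨ cong (_⊗ V) (trans (sym (trans (fromℕ-* (d ! * (d ^ t * t !)) P) (cong (_⊗ fromℕ P) (fromℕ-* (d !) (d ^ t * t !)))))
         (trans (cong fromℕ arith) (fromℕ-* K (d ^ M)))) ⟩
  fromℕ K ⊗ fromℕ (d ^ M) ⊗ V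
    ≡⟨ ℚ.*-assoc (fromℕ K) (fromℕ (d ^ M)) V ⟩
  fromℕ K ⊗ (fromℕ (d ^ M) ⊗ V) ∎)
  where
  open ≡-Reasoning
  β  = b ∷ βs
  βL = Vec.toList β
  d  = sum β
  t  = 2 * g + suc n ∸ 1
  A  = Aut β
  F  = factorisations d t βL
  P  = product βL
  V  = (∏𝒮 βL *ₛ ρ) (2 * g)
  K  = d ! * (t ! * d) * (d * P)
  posL = toList⁺ pos
  Cls = ∑ (perms d) (ofType βL)
  1≤d : 1 ≤ d
  1≤d = ℕ.≤-trans (VAll.head pos) (ℕ.m≤m+n b (sum βs))
  d≢0 : NonZero d
  d≢0 = ℕ.>-nonZero 1≤d
  td≢0 : NonZero (t ! * d)
  td≢0 = ℕ.m*n≢0 (t !) d {{n!≢0 t}} {{d≢0}}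
  K≢0 : NonZero K
  K≢0 = ℕ.m*n≢0 (d ! * (t ! * d)) (d * P) {{ℕ.m*n≢0 (d !) (t ! * d) {{n!≢0 d}} {{td≢0}}}}
    {{ℕ.m*n≢0 d P {{d≢0}} {{product-nonZero posL}}}}
  class : fromℕ A ⊗ fromℕ P ⊗ Cls ≡ fromℕ (d !)
  class = subst (λ e → fromℕ (∏! e βL) ⊗ fromℕ P ⊗ ∑ (perms e) (ofType βL) ≡ fromℕ (e !)) (sum-toList β) (class-size βL posL)
  dF : fromℕ d ⊗ fromℕ F ≡ fromℕ (d ^ t * t !) ⊗ T βL t ⊗ Cls
  dF = subst (λ e → 1 ≤ e → fromℕ e ⊗ fromℕ (factorisations e t βL) ≡ fromℕ (e ^ t * t !) ⊗ T βL t ⊗ ∑ (perms e) (ofType βL))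
    (sum-toList β) (factorisations-T βL posL t) 1≤d
  length-toList : ∀ {n} (v : Vec ℕ n) → length (Vec.toList v) ≡ n
  length-toList []      = refl
  length-toList (x ∷ v) = cong suc (length-toList v)
  t≡′ : t ≡ length (Vec.toList βs) + 2 * g
  t≡′ = trans (cong (_∸ 1) (ℕ.+-suc (2 * g) n)) (trans (ℕ.+-comm (2 * g) n) (cong (_+ 2 * g) (sym (length-toList βs))))
  arith : d ! * (d ^ t * t !) * P ≡ K * d ^ M
  arith = trans (cong (λ s → d ! * (d ^ s * t !) * P) t≡) (go (d !) d (d ^ M) (t !) P)
    where
    go : ∀ f d p t P → f * (d * (d * p) * t) * P ≡ f * (t * d) * (d * P) * p
    go = ℕSolver.solve-∀
  lem₁ : ∀ f t d p a n i j → f ⊗ t ⊗ (d ⊗ p) ⊗ (a ⊗ n ⊗ i ⊗ j) ≡ (f ⊗ i) ⊗ (t ⊗ j) ⊗ (a ⊗ p ⊗ (d ⊗ n))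
  lem₁ = RingSolver.solve-∀ ℚ-ring
  lem₂ : ∀ a p k t c → 1ℚ ⊗ 1ℚ ⊗ (a ⊗ p ⊗ (k ⊗ t ⊗ c)) ≡ (a ⊗ p ⊗ c) ⊗ (k ⊗ t)
  lem₂ = RingSolver.solve-∀ ℚ-ring
  lem₃ : ∀ f k p v → f ⊗ (k ⊗ (p ⊗ v)) ≡ f ⊗ k ⊗ p ⊗ v
  lem₃ = RingSolver.solve-∀ ℚ-ring

-- Expansion of the Hurwitz formula into monomials

shift^ : ℕ → Series → Series
shift^ zero    s = s
shift^ (suc c) s = shift (shift^ c s)

shift^-cong : ∀ c {s u} → s ≈ₛ u → shift^ c s ≈ₛ shift^ c u
shift^-cong zero    p = p
shift^-cong (suc c) p = shift-cong (shift^-cong c p)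

shift^-*ₛ : ∀ c s u → shift^ c s *ₛ u ≈ₛ shift^ c (s *ₛ u)
shift^-*ₛ zero    s u = 𝕊.refl
shift^-*ₛ (suc c) s u = 𝕊.trans (shift-*ₛ (shift^ c s) u) (shift-cong (shift^-*ₛ c s u))

shift^-+ : ∀ c e s → shift^ (c + e) s ≈ₛ shift^ c (shift^ e s)
shift^-+ zero    e s = 𝕊.refl
shift^-+ (suc c) e s = shift-cong (shift^-+ c e s)

shift^-*ₛ-shift^ : ∀ c e s u → shift^ c s *ₛ shift^ e u ≈ₛ shift^ (c + e) (s *ₛ u)
shift^-*ₛ-shift^ c e s u = begin
  shift^ c s *ₛ shift^ e u       ≈⟨ shift^-*ₛ c s (shift^ e u) ⟩
  shift^ c (s *ₛ shift^ e u)     ≈⟨ shift^-cong c (𝕊.*-comm s (shift^ e u)) ⟩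
  shift^ c (shift^ e u *ₛ s)     ≈⟨ shift^-cong c (shift^-*ₛ e u s) ⟩
  shift^ c (shift^ e (u *ₛ s))   ≈⟨ shift^-cong c (shift^-cong e (𝕊.*-comm u s)) ⟩
  shift^ c (shift^ e (s *ₛ u))   ≈⟨ shift^-+ c e (s *ₛ u) ⟨
  shift^ (c + e) (s *ₛ u)        ∎
  where open ≈ₛ-Reasoning

shift^-low : ∀ c s {m} → m < c → shift^ c s m ≡ 0ℚ
shift^-low (suc c) s {zero}  _         = refl
shift^-low (suc c) s {suc m} (s≤s m<c) = shift^-low c s m<c

shift^-high : ∀ c s m → shift^ c s (c + m) ≡ s m
shift^-high zero    s m = refl
shift^-high (suc c) s m = shift^-high c s m

scale-shift^ : ∀ b c s m → b ^ℚ m ⊗ shift^ c s m ≡ b ^ℚ c ⊗ shift^ c (scale b s) m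
scale-shift^ b zero    s m       = sym (ℚ.*-identityˡ _)
scale-shift^ b (suc c) s zero    = trans (ℚ.*-zeroʳ (b ^ℚ 0)) (sym (ℚ.*-zeroʳ (b ^ℚ suc c)))
scale-shift^ b (suc c) s (suc m) = trans (ℚ.*-assoc b (b ^ℚ m) (shift^ c s m))
  (trans (cong (b ⊗_) (scale-shift^ b c s m)) (sym (ℚ.*-assoc b (b ^ℚ c) (shift^ c (scale b s) m))))

-- The square is summed along the antidiagonals i + j = m; `u` vanishes on those beyond D.
∑triangle : ∀ D (u : ℕ → ℚ) (f : ℕ → ℕ → ℚ) → (∀ m → D < m → u m ≡ 0ℚ) →
  ∑≤ D (λ i → ∑≤ D (λ j → u (i + j) ⊗ f i j)) ≡ ∑≤ D (λ m → u m ⊗ ∑≤ m (λ i → f i (m ∸ i)))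
∑triangle zero    u f u₀ = refl
∑triangle (suc D) u f u₀ = begin
  ∑≤ (suc D) (λ j → u j ⊗ f 0 j) ⊕ ∑≤ D (λ i → ∑≤ (suc D) (λ j → u (suc i + j) ⊗ f (suc i) j))
    ≡⟨ cong (∑≤ (suc D) (λ j → u j ⊗ f 0 j) ⊕_) (trans (∑-cong D (λ i _ → drop-last i)) (∑triangle D (u ∘ suc) (f ∘ suc) (λ m D<m → u₀ (suc m) (s≤s D<m)))) ⟩
  (u 0 ⊗ f 0 0 ⊕ ∑≤ D (λ m → u (suc m) ⊗ f 0 (suc m))) ⊕ ∑≤ D (λ m → u (suc m) ⊗ ∑≤ m (λ i → f (suc i) (m ∸ i)))
    ≡⟨ ℚ.+-assoc (u 0 ⊗ f 0 0) _ _ ⟩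
  u 0 ⊗ f 0 0 ⊕ (∑≤ D (λ m → u (suc m) ⊗ f 0 (suc m)) ⊕ ∑≤ D (λ m → u (suc m) ⊗ ∑≤ m (λ i → f (suc i) (m ∸ i))))
    ≡⟨ cong (u 0 ⊗ f 0 0 ⊕_) (trans (sym (∑-⊕ D _ _)) (∑-cong D (λ m _ → sym (ℚ.*-distribˡ-+ (u (suc m)) (f 0 (suc m)) _)))) ⟩
  u 0 ⊗ f 0 0 ⊕ ∑≤ D (λ m → u (suc m) ⊗ ∑≤ (suc m) (λ i → f i (suc m ∸ i))) ∎
  where
  open ≡-Reasoning
  drop-last : ∀ i → ∑≤ (suc D) (λ j → u (suc i + j) ⊗ f (suc i) j) ≡ ∑≤ D (λ j → u (suc (i + j)) ⊗ f (suc i) j)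
  drop-last i = trans (∑-last D (λ j → u (suc i + j) ⊗ f (suc i) j))
    (trans (cong (∑≤ D (λ j → u (suc (i + j)) ⊗ f (suc i) j) ⊕_) (trans (cong (_⊗ f (suc i) (suc D)) (u₀ (suc i + suc D) (s≤s (ℕ.m≤n+m (suc D) i))))
      (ℚ.*-zeroˡ (f (suc i) (suc D))))) (ℚ.+-identityʳ _))

-- The sum over the weak compositions of m into n parts.
∑comp : (n m : ℕ) → (Vec ℕ n → ℚ) → ℚ
∑comp zero    zero    f = f []
∑comp zero    (suc m) f = 0ℚ
∑comp (suc n) m       f = ∑≤ m (λ j → ∑comp n (m ∸ j) (λ b → f (j ∷ b)))

∑comp-cong : ∀ n m {f h : Vec ℕ n → ℚ} → (∀ b → f b ≡ h b) → ∑comp n m f ≡ ∑comp n m h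
∑comp-cong zero    zero    eq = eq []
∑comp-cong zero    (suc m) eq = refl
∑comp-cong (suc n) m       eq = ∑-cong m (λ j _ → ∑comp-cong n (m ∸ j) (λ b → eq (j ∷ b)))

∑comp-distribˡ : ∀ n m c f → ∑comp n m (λ b → c ⊗ f b) ≡ c ⊗ ∑comp n m f
∑comp-distribˡ zero    zero    c f = refl
∑comp-distribˡ zero    (suc m) c f = sym (ℚ.*-zeroʳ c)
∑comp-distribˡ (suc n) m       c f = trans (∑-cong m (λ j _ → ∑comp-distribˡ n (m ∸ j) c (λ b → f (j ∷ b)))) (sym (∑-distribˡ m c _))

∑comp-∑ : ∀ n m M (f : ℕ → Vec ℕ n → ℚ) → ∑comp n m (λ b → ∑≤ M (λ c → f c b)) ≡ ∑≤ M (λ c → ∑comp n m (f c))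
∑comp-∑ zero    zero    M f = refl
∑comp-∑ zero    (suc m) M f = sym (∑-zero M (λ _ _ → refl))
∑comp-∑ (suc n) m       M f = trans (∑-cong m (λ j _ → ∑comp-∑ n (m ∸ j) M (λ c b → f c (j ∷ b)))) (∑-swap m M _)

∑box≡∑comp : ∀ n D (u : ℕ → ℚ) F → (∀ m → D < m → u m ≡ 0ℚ) →
  ∑box n D (λ b → u (sum b) ⊗ F b) ≡ ∑≤ D (λ m → u m ⊗ ∑comp n m F)
∑box≡∑comp zero    zero    u F u₀ = refl
∑box≡∑comp zero    (suc D) u F u₀ = sym (trans (cong (u 0 ⊗ F [] ⊕_) (∑-zero D (λ m _ → ℚ.*-zeroʳ (u (suc m))))) (ℚ.+-identityʳ _))
∑box≡∑comp (suc n) D       u F u₀ = trans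
  (∑-cong D (λ j _ → ∑box≡∑comp n D (λ m → u (j + m)) (λ b → F (j ∷ b)) (λ m D<m → u₀ (j + m) (ℕ.≤-trans D<m (ℕ.m≤n+m m j)))))
  (∑triangle D u (λ j m → ∑comp n m (λ b → F (j ∷ b))) u₀)

-- `Φ b` is the coefficient of zᵇ in exp(zy) 𝒮(z), as a series in y: each y brings one z, whence the
-- shift by c.
Φ : ℕ → Series
Φ b c = inv! c ⊗ shift^ c 𝒮 b

∏Φ : ∀ {n} → Vec ℕ n → Series
∏Φ b = Vec.foldr′ _*ₛ_ 1ₛ (Vec.map Φ b)

-- The coefficient of zᵐ yᴹ in ∏ᵢ exp(βᵢzy) 𝒮(βᵢz), computed in two ways.
∑comp-∏Φ : ∀ {n} (β : Vec ℕ n) m M →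
  ∑comp n m (λ b → ∏Φ b M ⊗ fromℕ (monomial b β)) ≡ E (fromℕ (sum β)) M ⊗ shift^ M (∏𝒮 (Vec.toList β)) m
∑comp-∏Φ [] m M = trans (empty m M) (cong (_⊗ shift^ M 1ₛ m) (sym (E-0 .at M)))
  where
  empty : ∀ m M → ∑comp 0 m (λ b → ∏Φ b M ⊗ fromℕ (monomial b [])) ≡ 1ₛ M ⊗ shift^ M 1ₛ m
  empty zero    zero    = refl
  empty zero    (suc M) = refl
  empty (suc m) zero    = refl
  empty (suc m) (suc M) = sym (ℚ.*-zeroˡ (shift^ (suc M) 1ₛ (suc m)))
∑comp-∏Φ {suc n} (β₀ ∷ β) m M = begin
  ∑≤ m (λ j → ∑comp n (m ∸ j) (λ b → (Φ j *ₛ ∏Φ b) M ⊗ fromℕ (β₀ ^ j * monomial b β)))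
    ≡⟨ ∑-cong m (λ j _ → trans (∑comp-cong n (m ∸ j) (λ b → expand j b)) (∑comp-∑ n (m ∸ j) M (λ c b → e c j ⊗ (∏Φ b (M ∸ c) ⊗ fromℕ (monomial b β))))) ⟩
  ∑≤ m (λ j → ∑≤ M (λ c → ∑comp n (m ∸ j) (λ b → e c j ⊗ (∏Φ b (M ∸ c) ⊗ fromℕ (monomial b β)))))
    ≡⟨ ∑-cong m (λ j _ → ∑-cong M (λ c _ → trans (∑comp-distribˡ n (m ∸ j) (e c j) (λ b → ∏Φ b (M ∸ c) ⊗ fromℕ (monomial b β)))
         (trans (cong (e c j ⊗_) (∑comp-∏Φ β (m ∸ j) (M ∸ c))) (lem (E x c) (shift^ c 𝒮[ β₀ ] j) (E y (M ∸ c)) _)))) ⟩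
  ∑≤ m (λ j → ∑≤ M (λ c → (E x c ⊗ E y (M ∸ c)) ⊗ (shift^ c 𝒮[ β₀ ] j ⊗ shift^ (M ∸ c) Π (m ∸ j))))
    ≡⟨ ∑-swap m M _ ⟩
  ∑≤ M (λ c → ∑≤ m (λ j → (E x c ⊗ E y (M ∸ c)) ⊗ (shift^ c 𝒮[ β₀ ] j ⊗ shift^ (M ∸ c) Π (m ∸ j))))
    ≡⟨ ∑-cong M (λ c c≤M → trans (sym (∑-distribˡ m (E x c ⊗ E y (M ∸ c)) _)) (cong (E x c ⊗ E y (M ∸ c) ⊗_) (trans
         (shift^-*ₛ-shift^ c (M ∸ c) 𝒮[ β₀ ] Π .at m) (cong (λ k → shift^ k (𝒮[ β₀ ] *ₛ Π) m) (ℕ.m+[n∸m]≡n c≤M))))) ⟩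
  ∑≤ M (λ c → (E x c ⊗ E y (M ∸ c)) ⊗ shift^ M (𝒮[ β₀ ] *ₛ Π) m)
    ≡⟨ ∑-distribʳ M (shift^ M (𝒮[ β₀ ] *ₛ Π) m) (λ c → E x c ⊗ E y (M ∸ c)) ⟨
  (E x *ₛ E y) M ⊗ shift^ M (𝒮[ β₀ ] *ₛ Π) m
    ≡⟨ cong (_⊗ shift^ M (𝒮[ β₀ ] *ₛ Π) m) (trans (sym (E-+ x y .at M)) (cong (λ q → E q M) (sym (fromℕ-+ β₀ (sum β))))) ⟩
  E (fromℕ (β₀ + sum β)) M ⊗ shift^ M (𝒮[ β₀ ] *ₛ Π) m ∎
  where
  open ≡-Reasoning
  x = fromℕ β₀
  y = fromℕ (sum β)
  Π = ∏𝒮 (Vec.toList β)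
  e : ℕ → ℕ → ℚ
  e c j = E x c ⊗ shift^ c 𝒮[ β₀ ] j
  lem : ∀ a s b u → a ⊗ s ⊗ (b ⊗ u) ≡ (a ⊗ b) ⊗ (s ⊗ u)
  lem = RingSolver.solve-∀ ℚ-ring
  lem₁ : ∀ i s p x m → i ⊗ s ⊗ p ⊗ (x ⊗ m) ≡ i ⊗ (x ⊗ s) ⊗ (p ⊗ m)
  lem₁ = RingSolver.solve-∀ ℚ-ring
  lem₂ : ∀ i x s q → i ⊗ (x ⊗ s) ⊗ q ≡ x ⊗ i ⊗ s ⊗ q
  lem₂ = RingSolver.solve-∀ ℚ-ring
  expand : ∀ j b → (Φ j *ₛ ∏Φ b) M ⊗ fromℕ (β₀ ^ j * monomial b β) ≡ ∑≤ M (λ c → e c j ⊗ (∏Φ b (M ∸ c) ⊗ fromℕ (monomial b β)))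
  expand j b = trans (∑-distribʳ M (fromℕ (β₀ ^ j * monomial b β)) (λ c → Φ j c ⊗ ∏Φ b (M ∸ c))) (∑-cong M (λ c _ → begin
    inv! c ⊗ shift^ c 𝒮 j ⊗ p c ⊗ fromℕ (β₀ ^ j * μ)
      ≡⟨ cong (inv! c ⊗ shift^ c 𝒮 j ⊗ p c ⊗_) (trans (fromℕ-* (β₀ ^ j) μ) (cong (_⊗ fromℕ μ) (fromℕ-^ β₀ j))) ⟩
    inv! c ⊗ shift^ c 𝒮 j ⊗ p c ⊗ (x ^ℚ j ⊗ fromℕ μ)
      ≡⟨ lem₁ (inv! c) (shift^ c 𝒮 j) (p c) (x ^ℚ j) (fromℕ μ) ⟩
    inv! c ⊗ (x ^ℚ j ⊗ shift^ c 𝒮 j) ⊗ (p c ⊗ fromℕ μ)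
      ≡⟨ cong (λ z → inv! c ⊗ z ⊗ (p c ⊗ fromℕ μ)) (scale-shift^ x c 𝒮 j) ⟩
    inv! c ⊗ (x ^ℚ c ⊗ shift^ c 𝒮[ β₀ ] j) ⊗ (p c ⊗ fromℕ μ)
      ≡⟨ lem₂ (inv! c) (x ^ℚ c) (shift^ c 𝒮[ β₀ ] j) (p c ⊗ fromℕ μ) ⟩
    e c j ⊗ (p c ⊗ fromℕ μ) ∎))
    where
    μ = monomial b β
    p : ℕ → ℚ
    p c = ∏Φ b (M ∸ c)

-- The coefficients of (x/2)/sinh(x/2)

inverse-unique : ∀ s u v → s *ₛ u ≈ₛ 1ₛ → s *ₛ v ≈ₛ 1ₛ → u ≈ₛ v
inverse-unique s u v p q = begin
  u               ≈⟨ 𝕊.*-identityʳ u ⟨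
  u *ₛ 1ₛ         ≈⟨ *-congˡ u q ⟨
  u *ₛ (s *ₛ v)   ≈⟨ solveₛ 3 (λ u s v → u :* (s :* v) := (s :* u) :* v) 𝕊.refl u s v ⟩
  s *ₛ u *ₛ v     ≈⟨ *-congʳ v p ⟩
  1ₛ *ₛ v         ≈⟨ 𝕊.*-identityˡ v ⟩
  v               ∎
  where open ≈ₛ-Reasoning

1^ℚ : ∀ k → 1ℚ ^ℚ k ≡ 1ℚ
1^ℚ zero    = refl
1^ℚ (suc k) = trans (ℚ.*-identityˡ _) (1^ℚ k)

scale-*ₛ : ∀ b s u → scale b s *ₛ scale b u ≈ₛ scale b (s *ₛ u)
scale-*ₛ b s u .at m = sym (trans (∑-distribˡ m (b ^ℚ m) (λ j → s j ⊗ u (m ∸ j))) (∑-cong m (λ j j≤m →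
  trans (cong (λ k → b ^ℚ k ⊗ (s j ⊗ u (m ∸ j))) (sym (ℕ.m+[n∸m]≡n j≤m)))
    (trans (cong (_⊗ (s j ⊗ u (m ∸ j))) (^ℚ-+ b j (m ∸ j))) (lem (b ^ℚ j) (b ^ℚ (m ∸ j)) (s j) (u (m ∸ j)))))))
  where
  lem : ∀ x y s u → x ⊗ y ⊗ (s ⊗ u) ≡ (x ⊗ s) ⊗ (y ⊗ u)
  lem = RingSolver.solve-∀ ℚ-ring

scale-cong : ∀ b {s u} → s ≈ₛ u → scale b s ≈ₛ scale b u
scale-cong b p .at m = cong (b ^ℚ m ⊗_) (p .at m)

scale-1ₛ : ∀ b → scale b 1ₛ ≈ₛ 1ₛ
scale-1ₛ b .at zero    = refl
scale-1ₛ b .at (suc m) = ℚ.*-zeroʳ (b ^ℚ suc m)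

𝔅 : Series
𝔅 = recip expm1/x

expm1*𝔅 : expm1/x *ₛ 𝔅 ≈ₛ 1ₛ
expm1*𝔅 = coeffs (recip-inverse expm1/x refl)

X*expm1 : X *ₛ expm1/x ≈ₛ E 1ℚ +ₛ -ₛ 1ₛ
X*expm1 = 𝕊.trans (X-*ₛ expm1/x) eq
  where
  eq : shift expm1/x ≈ₛ E 1ℚ +ₛ -ₛ 1ₛ
  eq .at zero    = refl
  eq .at (suc m) = sym (trans (ℚ.+-identityʳ _) (trans (cong (_⊗ inv! (suc m)) (1^ℚ (suc m))) (ℚ.*-identityˡ _)))

E½² : E ℚ.½ *ₛ E ℚ.½ ≈ₛ E 1ℚ
E½² = 𝕊.sym (E-+ ℚ.½ ℚ.½)

E½*𝒮 : E ℚ.½ *ₛ 𝒮 ≈ₛ expm1/x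
E½*𝒮 = X-cancel {E ℚ.½ *ₛ 𝒮} {expm1/x} (begin
  X *ₛ (E ℚ.½ *ₛ 𝒮)
    ≈⟨ solveₛ 3 (λ x e s → x :* (e :* s) := e :* (x :* s)) 𝕊.refl X (E ℚ.½) 𝒮 ⟩
  E ℚ.½ *ₛ (X *ₛ 𝒮)
    ≈⟨ *-congˡ (E ℚ.½) (X*tail (ς 1) refl) ⟨
  E ℚ.½ *ₛ (E ℚ.½ +ₛ -ₛ E (⊖ ℚ.½))
    ≈⟨ solveₛ 2 (λ e f → e :* (e :+ :- f) := e :* e :+ :- (e :* f)) 𝕊.refl (E ℚ.½) (E (⊖ ℚ.½)) ⟩
  E ℚ.½ *ₛ E ℚ.½ +ₛ -ₛ (E ℚ.½ *ₛ E (⊖ ℚ.½))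
    ≈⟨ +-cong E½² (-‿cong (𝕊.trans (𝕊.sym (E-+ ℚ.½ (⊖ ℚ.½))) E-0)) ⟩
  E 1ℚ +ₛ -ₛ 1ₛ
    ≈⟨ X*expm1 ⟨
  X *ₛ expm1/x ∎)
  where open ≈ₛ-Reasoning

ρ≈E½*𝔅 : ρ ≈ₛ E ℚ.½ *ₛ 𝔅
ρ≈E½*𝔅 = inverse-unique 𝒮 ρ (E ℚ.½ *ₛ 𝔅) 𝒮ρ (𝕊.trans
  (solveₛ 3 (λ s e b → s :* (e :* b) := (e :* s) :* b) 𝕊.refl 𝒮 (E ℚ.½) 𝔅)
  (𝕊.trans (*-congʳ 𝔅 E½*𝒮) expm1*𝔅))

-- q/(q² - 1) = 1/(q - 1) - 1/(q² - 1) for q = e^{x/2}.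
ρ≈𝔅 : ρ ≈ₛ const (fromℕ 2) *ₛ scale ℚ.½ 𝔅 +ₛ -ₛ 𝔅
ρ≈𝔅 = begin
  ρ
    ≈⟨ ρ≈E½*𝔅 ⟩
  q *ₛ 𝔅
    ≈⟨ solveₛ 2 (λ q b → q :* b := con (fromℕ 2) :* (con ℚ.½ :* (q :+ con 1ℚ) :* b) :+ :- b) 𝕊.refl q 𝔅 ⟩
  const (fromℕ 2) *ₛ (const ℚ.½ *ₛ (q +ₛ const 1ℚ) *ₛ 𝔅) +ₛ -ₛ 𝔅
    -- Both (q + 1)/2 times `𝔅` and `𝔅½` invert (q - 1)/(x/2), the first because q² - 1 = (q - 1)(q
    -- + 1).
    ≈⟨ +-congʳ (-ₛ 𝔅) (*-congˡ (const (fromℕ 2)) (inverse-unique e½ (const ℚ.½ *ₛ (q +ₛ const 1ℚ) *ₛ 𝔅) 𝔅½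
         (𝕊.trans (solveₛ 3 (λ e q b → e :* (con ℚ.½ :* (q :+ con 1ℚ) :* b) := (con ℚ.½ :* e :* (q :+ con 1ℚ)) :* b) 𝕊.refl e½ q 𝔅)
           (𝕊.trans (*-congʳ 𝔅 (𝕊.sym expm1≈)) expm1*𝔅))
         (𝕊.trans (scale-*ₛ ℚ.½ expm1/x 𝔅) (𝕊.trans (scale-cong ℚ.½ expm1*𝔅) (scale-1ₛ ℚ.½))))) ⟩
  const (fromℕ 2) *ₛ 𝔅½ +ₛ -ₛ 𝔅 ∎
  where
  open ≈ₛ-Reasoning
  q  = E ℚ.½
  e½ = scale ℚ.½ expm1/x
  𝔅½ = scale ℚ.½ 𝔅
  X*e½ : X *ₛ (const ℚ.½ *ₛ e½) ≈ₛ q +ₛ -ₛ 1ₛ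
  X*e½ = 𝕊.trans (X-*ₛ (const ℚ.½ *ₛ e½)) (𝕊.trans (shift-cong (const-*ₛ ℚ.½ e½)) eq)
    where
    eq : shift (ℚ.½ · e½) ≈ₛ q +ₛ -ₛ 1ₛ
    eq .at zero    = refl
    eq .at (suc m) = sym (trans (ℚ.+-identityʳ _) (ℚ.*-assoc ℚ.½ (ℚ.½ ^ℚ m) (inv! (suc m))))
  expm1≈ : expm1/x ≈ₛ const ℚ.½ *ₛ e½ *ₛ (q +ₛ const 1ℚ)
  expm1≈ = X-cancel {expm1/x} {const ℚ.½ *ₛ e½ *ₛ (q +ₛ const 1ℚ)} (begin
    X *ₛ expm1/x
      ≈⟨ X*expm1 ⟩
    E 1ℚ +ₛ -ₛ 1ₛ
      ≈⟨ +-cong (𝕊.sym E½²) (-‿cong 1ₛ≈const) ⟩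
    q *ₛ q +ₛ -ₛ const 1ℚ
      ≈⟨ solveₛ 1 (λ q → q :* q :+ :- con 1ℚ := (q :+ :- con 1ℚ) :* (q :+ con 1ℚ)) 𝕊.refl q ⟩
    (q +ₛ -ₛ const 1ℚ) *ₛ (q +ₛ const 1ℚ)
      ≈⟨ *-congʳ (q +ₛ const 1ℚ) (𝕊.sym (𝕊.trans X*e½ (+-congˡ q (-‿cong 1ₛ≈const)))) ⟩
    X *ₛ (const ℚ.½ *ₛ e½) *ₛ (q +ₛ const 1ℚ)
      ≈⟨ 𝕊.*-assoc X (const ℚ.½ *ₛ e½) (q +ₛ const 1ℚ) ⟩
    X *ₛ (const ℚ.½ *ₛ e½ *ₛ (q +ₛ const 1ℚ)) ∎)

-- Reduces to two successors at a time, matching the recursion of `expand`.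
double : ℕ → ℕ
double zero    = zero
double (suc k) = suc (suc (double k))

double≡2* : ∀ k → double k ≡ 2 * k
double≡2* zero    = refl
double≡2* (suc k) = trans (cong (suc ∘ suc) (double≡2* k)) (sym (ℕ.*-suc 2 k))

-- Substitution of x² for x.
expand : Series → Series
expand s zero          = s 0
expand s (suc zero)    = 0ℚ
expand s (suc (suc m)) = expand (tail s) m

expand-double : ∀ s k → expand s (double k) ≡ s k
expand-double s zero    = refl
expand-double s (suc k) = expand-double (tail s) k

expand-odd : ∀ s k → expand s (suc (double k)) ≡ 0ℚ
expand-odd s zero    = refl
expand-odd s (suc k) = expand-odd (tail s) k

expand-cong : ∀ {s u} → s ≈ₛ u → expand s ≈ₛ expand u
expand-cong p .at zero          = p .at 0
expand-cong p .at (suc zero)    = refl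
expand-cong {s} {u} p .at (suc (suc m)) = expand-cong {tail s} {tail u} (coeffs λ k → p .at (suc k)) .at m

expand-injective : ∀ {s u} → expand s ≈ₛ expand u → s ≈ₛ u
expand-injective {s} {u} p .at k = trans (sym (expand-double s k)) (trans (p .at (double k)) (expand-double u k))

expand-+ : ∀ s u → expand (s +ₛ u) ≈ₛ expand s +ₛ expand u
expand-+ s u .at zero          = refl
expand-+ s u .at (suc zero)    = refl
expand-+ s u .at (suc (suc m)) = expand-+ (tail s) (tail u) .at m

expand-neg : ∀ s → expand (-ₛ s) ≈ₛ -ₛ expand s
expand-neg s .at zero          = refl
expand-neg s .at (suc zero)    = refl
expand-neg s .at (suc (suc m)) = expand-neg (tail s) .at m

expand-· : ∀ q s → expand (q · s) ≈ₛ q · expand s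
expand-· q s .at zero          = refl
expand-· q s .at (suc zero)    = sym (ℚ.*-zeroʳ q)
expand-· q s .at (suc (suc m)) = expand-· q (tail s) .at m

expand-*ₛ : ∀ s u → expand (s *ₛ u) ≈ₛ expand s *ₛ expand u
expand-*ₛ s u .at zero          = refl
expand-*ₛ s u .at (suc zero)    = sym (lem (s 0) (u 0))
  where
  lem : ∀ a b → a ⊗ 0ℚ ⊕ 0ℚ ⊗ b ≡ 0ℚ
  lem = RingSolver.solve-∀ ℚ-ring
expand-*ₛ s u .at (suc (suc m)) = begin
  expand (s 0 · tail u +ₛ tail s *ₛ u) m
    ≡⟨ expand-+ (s 0 · tail u) (tail s *ₛ u) .at m ⟩
  expand (s 0 · tail u) m ⊕ expand (tail s *ₛ u) m
    ≡⟨ cong₂ _⊕_ (expand-· (s 0) (tail u) .at m) (expand-*ₛ (tail s) u .at m) ⟩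
  s 0 ⊗ expand (tail u) m ⊕ (expand (tail s) *ₛ expand u) m
    ≡⟨ cong (s 0 ⊗ expand (tail u) m ⊕_) (sym (trans (cong (_⊕ (expand (tail s) *ₛ expand u) m) (ℚ.*-zeroˡ (expand u (suc m)))) (ℚ.+-identityˡ _))) ⟩
  s 0 ⊗ expand (tail u) m ⊕ (0ℚ ⊗ expand u (suc m) ⊕ (expand (tail s) *ₛ expand u) m) ∎
  where open ≡-Reasoning

expand-1ₛ : expand 1ₛ ≈ₛ 1ₛ
expand-1ₛ .at zero          = refl
expand-1ₛ .at (suc zero)    = refl
expand-1ₛ .at (suc (suc m)) = zeros m
  where
  zeros : ∀ m → expand (tail 1ₛ) m ≡ 0ℚ
  zeros zero          = refl
  zeros (suc zero)    = refl
  zeros (suc (suc m)) = zeros m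

evenPart : Series → Series
evenPart s k = s (double k)

expand-evenPart : ∀ s → (∀ k → s (suc (double k)) ≡ 0ℚ) → s ≈ₛ expand (evenPart s)
expand-evenPart s odd .at zero          = refl
expand-evenPart s odd .at (suc zero)    = odd 0
expand-evenPart s odd .at (suc (suc m)) = expand-evenPart (tail (tail s)) (odd ∘ suc) .at m

θ-expand : ∀ s → θ (expand s) ≈ₛ expand (fromℕ 2 · θ s)
θ-expand s = 𝕊.trans (expand-evenPart (θ (expand s)) (λ k → trans (cong (fromℕ (suc (double k)) ⊗_) (expand-odd s k)) (ℚ.*-zeroʳ (fromℕ (suc (double k))))))
  (expand-cong (coeffs λ k → trans (cong₂ _⊗_ (trans (cong fromℕ (double≡2* k)) (fromℕ-* 2 k)) (expand-double s k)) (ℚ.*-assoc (fromℕ 2) (fromℕ k) (s k))))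

neg-^-double : ∀ a k → (⊖ a) ^ℚ double k ≡ a ^ℚ double k
neg-^-double a zero    = refl
neg-^-double a (suc k) = trans (cong (λ z → (⊖ a) ⊗ ((⊖ a) ⊗ z)) (neg-^-double a k)) (lem a (a ^ℚ double k))
  where
  lem : ∀ a x → (⊖ a) ⊗ ((⊖ a) ⊗ x) ≡ a ⊗ (a ⊗ x)
  lem = RingSolver.solve-∀ ℚ-ring

𝒮-odd : ∀ k → 𝒮 (suc (double k)) ≡ 0ℚ
𝒮-odd k = trans (cong (λ z → ℚ.½ ^ℚ double (suc k) ⊗ i ⊕ (⊖ (z ⊗ i))) (neg-^-double ℚ.½ (suc k))) (ℚ.+-inverseʳ (ℚ.½ ^ℚ double (suc k) ⊗ i))
  where i = inv! (double (suc k))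

Ch : Series
Ch = const ℚ.½ *ₛ χ 1

Ch-odd : ∀ k → Ch (suc (double k)) ≡ 0ℚ
Ch-odd k = trans (const-*ₛ ℚ.½ (χ 1) .at (suc (double k))) (trans
  (cong (λ z → ℚ.½ ⊗ (ℚ.½ ^ℚ suc (double k) ⊗ i ⊕ (⊖ ℚ.½) ⊗ z ⊗ i)) (neg-^-double ℚ.½ k))
  (lem ℚ.½ (ℚ.½ ^ℚ double k) i))
  where
  i = inv! (suc (double k))
  lem : ∀ a x i → a ⊗ (a ⊗ x ⊗ i ⊕ (⊖ a) ⊗ x ⊗ i) ≡ 0ℚ
  lem = RingSolver.solve-∀ ℚ-ring

-- The even series 𝒮, ρ, cosh(x/2) and (x/2)coth(x/2) - 1, rewritten as series in the variable x².
𝒮♯ ρ♯ Ch♯ D♯ : Series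
𝒮♯  = evenPart 𝒮
ρ♯  = recip 𝒮♯
Ch♯ = evenPart Ch
D♯  = Ch♯ *ₛ ρ♯ +ₛ -ₛ 1ₛ

𝒮ρ♯ : 𝒮♯ *ₛ ρ♯ ≈ₛ 1ₛ
𝒮ρ♯ = coeffs (recip-inverse 𝒮♯ refl)

ρ≈expand : ρ ≈ₛ expand ρ♯
ρ≈expand = inverse-unique 𝒮 ρ (expand ρ♯) 𝒮ρ (𝕊.trans (*-congʳ (expand ρ♯) (expand-evenPart 𝒮 𝒮-odd))
  (𝕊.trans (𝕊.sym (expand-*ₛ 𝒮♯ ρ♯)) (𝕊.trans (expand-cong 𝒮ρ♯) expand-1ₛ)))

ρ-odd : ∀ k → ρ (suc (double k)) ≡ 0ℚ
ρ-odd k = trans (ρ≈expand .at (suc (double k))) (expand-odd ρ♯ k)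

ρ-even : ∀ k → ρ (double k) ≡ ρ♯ k
ρ-even k = trans (ρ≈expand .at (double k)) (expand-double ρ♯ k)

θ-X : θ X ≈ₛ X
θ-X .at zero          = refl
θ-X .at (suc zero)    = refl
θ-X .at (suc (suc m)) = ℚ.*-zeroʳ (fromℕ (suc (suc m)))

θ-const* : ∀ q s → θ (const q *ₛ s) ≈ₛ const q *ₛ θ s
θ-const* q s .at m = trans (cong (fromℕ m ⊗_) (const-*ₛ q s .at m)) (trans (lem (fromℕ m) q (s m)) (sym (const-*ₛ q (θ s) .at m)))
  where
  lem : ∀ a b c → a ⊗ (b ⊗ c) ≡ b ⊗ (a ⊗ c)
  lem = RingSolver.solve-∀ ℚ-ring

θ-cs : ∀ a → θ (cs a) ≈ₛ const a *ₛ (X *ₛ sn a)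
θ-cs a = begin
  θ (cs a)                     ≈⟨ θ-+ (E a) (E (⊖ a)) ⟩
  θ (E a) +ₛ θ (E (⊖ a))       ≈⟨ +-cong (θ-E a) (𝕊.trans (θ-E (⊖ a)) (*-congʳ (X *ₛ E (⊖ a)) (const-neg a))) ⟩
  const a *ₛ (X *ₛ E a) +ₛ -ₛ const a *ₛ (X *ₛ E (⊖ a))
    ≈⟨ solveₛ 4 (λ a x u v → a :* (x :* u) :+ :- a :* (x :* v) := a :* (x :* (u :+ :- v))) 𝕊.refl (const a) X (E a) (E (⊖ a)) ⟩
  const a *ₛ (X *ₛ sn a)       ∎
  where open ≈ₛ-Reasoning

ς₁≈X𝒮 : ς 1 ≈ₛ X *ₛ 𝒮
ς₁≈X𝒮 = X*tail (ς 1) refl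

θ𝒮 : θ 𝒮 ≈ₛ Ch +ₛ -ₛ 𝒮
θ𝒮 = X-cancel {θ 𝒮} {Ch +ₛ -ₛ 𝒮} (begin
  X *ₛ θ 𝒮
    ≈⟨ solveₛ 3 (λ x s t → x :* t := (x :* s :+ x :* t) :+ :- (x :* s)) 𝕊.refl X 𝒮 (θ 𝒮) ⟩
  (X *ₛ 𝒮 +ₛ X *ₛ θ 𝒮) +ₛ -ₛ (X *ₛ 𝒮)
    ≈⟨ +-congʳ (-ₛ (X *ₛ 𝒮)) (𝕊.sym (𝕊.trans (θ-cong ς₁≈X𝒮) (𝕊.trans (θ-*ₛ X 𝒮) (+-congʳ (X *ₛ θ 𝒮) (*-congʳ 𝒮 θ-X))))) ⟩
  θ (ς 1) +ₛ -ₛ (X *ₛ 𝒮)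
    ≈⟨ +-congʳ (-ₛ (X *ₛ 𝒮)) (θ-ς 1) ⟩
  const 1ℚ *ₛ (const ℚ.½ *ₛ (X *ₛ χ 1)) +ₛ -ₛ (X *ₛ 𝒮)
    ≈⟨ solveₛ 3 (λ x c s → con 1ℚ :* (con ℚ.½ :* (x :* c)) :+ :- (x :* s) := x :* (con ℚ.½ :* c :+ :- s)) 𝕊.refl X (χ 1) 𝒮 ⟩
  X *ₛ (Ch +ₛ -ₛ 𝒮) ∎)
  where open ≈ₛ-Reasoning

¼ : ℚ
¼ = ℚ.½ ⊗ ℚ.½

θCh : θ Ch ≈ₛ const ¼ *ₛ (X *ₛ X) *ₛ 𝒮
θCh = begin
  θ Ch
    ≈⟨ 𝕊.trans (θ-const* ℚ.½ (χ 1)) (*-congˡ (const ℚ.½) (θ-cs (half 1))) ⟩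
  const ℚ.½ *ₛ (const (half 1) *ₛ (X *ₛ ς 1))
    ≈⟨ *-congˡ (const ℚ.½) (*-congˡ (const (half 1)) (*-congˡ X ς₁≈X𝒮)) ⟩
  const ℚ.½ *ₛ (const (half 1) *ₛ (X *ₛ (X *ₛ 𝒮)))
    ≈⟨ solveₛ 2 (λ x s → con ℚ.½ :* (con (half 1) :* (x :* (x :* s))) := con ¼ :* (x :* x) :* s) 𝕊.refl X 𝒮 ⟩
  const ¼ *ₛ (X *ₛ X) *ₛ 𝒮 ∎
  where open ≈ₛ-Reasoning

-- (x/2)coth(x/2) - 1, which is the negative of the logarithmic derivative θρ/ρ.
D : Series
D = Ch *ₛ ρ +ₛ -ₛ 1ₛ

θρ : θ ρ ≈ₛ -ₛ (D *ₛ ρ)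
θρ = begin
  θ ρ
    ≈⟨ 𝕊.*-identityˡ (θ ρ) ⟨
  1ₛ *ₛ θ ρ
    ≈⟨ *-congʳ (θ ρ) 𝒮ρ ⟨
  𝒮 *ₛ ρ *ₛ θ ρ
    ≈⟨ solveₛ 4 (λ s r t u → s :* r :* t := r :* (u :* r :+ s :* t) :+ :- (r :* (u :* r))) 𝕊.refl 𝒮 ρ (θ ρ) (θ 𝒮) ⟩
  ρ *ₛ (θ 𝒮 *ₛ ρ +ₛ 𝒮 *ₛ θ ρ) +ₛ -ₛ (ρ *ₛ (θ 𝒮 *ₛ ρ))
    ≈⟨ +-cong (*-congˡ ρ (𝕊.trans (𝕊.sym (θ-*ₛ 𝒮 ρ)) (𝕊.trans (θ-cong 𝒮ρ) θ-1ₛ))) (-‿cong (*-congˡ ρ (*-congʳ ρ θ𝒮))) ⟩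
  ρ *ₛ 0ₛ +ₛ -ₛ (ρ *ₛ ((Ch +ₛ -ₛ 𝒮) *ₛ ρ))
    ≈⟨ 𝕊.trans (+-congʳ _ (𝕊.zeroʳ ρ)) (𝕊.+-identityˡ _) ⟩
  -ₛ (ρ *ₛ ((Ch +ₛ -ₛ 𝒮) *ₛ ρ))
    ≈⟨ solveₛ 3 (λ r c s → :- (r :* ((c :+ :- s) :* r)) := :- ((c :* r :+ :- (s :* r)) :* r)) 𝕊.refl ρ Ch 𝒮 ⟩
  -ₛ ((Ch *ₛ ρ +ₛ -ₛ (𝒮 *ₛ ρ)) *ₛ ρ)
    ≈⟨ -‿cong (*-congʳ ρ (+-congˡ (Ch *ₛ ρ) (-‿cong 𝒮ρ))) ⟩
  -ₛ (D *ₛ ρ) ∎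
  where open ≈ₛ-Reasoning

-- The Riccati equation for `D`. The term x²/4 comes from differentiating cosh(x/2), and the square
-- from θρ = -Dρ.
θD : θ D +ₛ D ≈ₛ const ¼ *ₛ (X *ₛ X) +ₛ -ₛ (D *ₛ D)
θD = begin
  θ D +ₛ D
    ≈⟨ +-congʳ D (𝕊.trans (θ-+ (Ch *ₛ ρ) (-ₛ 1ₛ)) (𝕊.trans (+-cong (θ-*ₛ Ch ρ) (𝕊.trans (θ-neg 1ₛ) (-‿cong θ-1ₛ))) (𝕊.trans
         (+-congˡ (θ Ch *ₛ ρ +ₛ Ch *ₛ θ ρ) (coeffs λ _ → refl)) (𝕊.+-identityʳ (θ Ch *ₛ ρ +ₛ Ch *ₛ θ ρ))))) ⟩
  θ Ch *ₛ ρ +ₛ Ch *ₛ θ ρ +ₛ D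
    ≈⟨ +-congʳ D (+-cong (*-congʳ ρ θCh) (*-congˡ Ch θρ)) ⟩
  const ¼ *ₛ (X *ₛ X) *ₛ 𝒮 *ₛ ρ +ₛ Ch *ₛ -ₛ (D *ₛ ρ) +ₛ D
    ≈⟨ solveₛ 5 (λ y s r c d → y :* s :* r :+ c :* :- (d :* r) :+ d
          := y :* (s :* r) :+ :- (d :* (c :* r :+ :- con 1ℚ))) 𝕊.refl (const ¼ *ₛ (X *ₛ X)) 𝒮 ρ Ch D ⟩
  const ¼ *ₛ (X *ₛ X) *ₛ (𝒮 *ₛ ρ) +ₛ -ₛ (D *ₛ (Ch *ₛ ρ +ₛ -ₛ const 1ℚ))
    ≈⟨ +-cong (𝕊.trans (*-congˡ (const ¼ *ₛ (X *ₛ X)) 𝒮ρ) (𝕊.*-identityʳ (const ¼ *ₛ (X *ₛ X)))) (-‿cong (*-congˡ D (+-congˡ (Ch *ₛ ρ) (-‿cong (𝕊.sym 1ₛ≈const))))) ⟩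
  const ¼ *ₛ (X *ₛ X) +ₛ -ₛ (D *ₛ D) ∎
  where open ≈ₛ-Reasoning

D≈expand : D ≈ₛ expand D♯
D≈expand = begin
  Ch *ₛ ρ +ₛ -ₛ 1ₛ
    ≈⟨ +-cong (*ₛ-cong (expand-evenPart Ch Ch-odd) ρ≈expand) (-‿cong (𝕊.sym expand-1ₛ)) ⟩
  expand Ch♯ *ₛ expand ρ♯ +ₛ -ₛ expand 1ₛ
    ≈⟨ +-cong (expand-*ₛ Ch♯ ρ♯) (expand-neg 1ₛ) ⟨
  expand (Ch♯ *ₛ ρ♯) +ₛ expand (-ₛ 1ₛ)
    ≈⟨ expand-+ (Ch♯ *ₛ ρ♯) (-ₛ 1ₛ) ⟨
  expand D♯ ∎
  where open ≈ₛ-Reasoning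

X²≈expand : X *ₛ X ≈ₛ expand X
X²≈expand = 𝕊.trans (X-*ₛ X) eq
  where
  eq : shift X ≈ₛ expand X
  eq .at zero          = refl
  eq .at (suc zero)    = refl
  eq .at (suc (suc m)) = sym (expand-1ₛ .at m)

θρ♯ : fromℕ 2 · θ ρ♯ ≈ₛ -ₛ (D♯ *ₛ ρ♯)
θρ♯ = expand-injective {fromℕ 2 · θ ρ♯} { -ₛ (D♯ *ₛ ρ♯)} (begin
  expand (fromℕ 2 · θ ρ♯)     ≈⟨ θ-expand ρ♯ ⟨
  θ (expand ρ♯)               ≈⟨ θ-cong ρ≈expand ⟨
  θ ρ                         ≈⟨ θρ ⟩
  -ₛ (D *ₛ ρ)                 ≈⟨ -‿cong (*ₛ-cong D≈expand ρ≈expand) ⟩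
  -ₛ (expand D♯ *ₛ expand ρ♯) ≈⟨ -‿cong (expand-*ₛ D♯ ρ♯) ⟨
  -ₛ expand (D♯ *ₛ ρ♯)        ≈⟨ expand-neg (D♯ *ₛ ρ♯) ⟨
  expand (-ₛ (D♯ *ₛ ρ♯))      ∎)
  where open ≈ₛ-Reasoning

θD♯ : fromℕ 2 · θ D♯ +ₛ D♯ ≈ₛ ¼ · X +ₛ -ₛ (D♯ *ₛ D♯)
θD♯ = expand-injective {fromℕ 2 · θ D♯ +ₛ D♯} {¼ · X +ₛ -ₛ (D♯ *ₛ D♯)} (begin
  expand (fromℕ 2 · θ D♯ +ₛ D♯)
    ≈⟨ expand-+ (fromℕ 2 · θ D♯) D♯ ⟩
  expand (fromℕ 2 · θ D♯) +ₛ expand D♯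
    ≈⟨ +-congʳ (expand D♯) (𝕊.sym (θ-expand D♯)) ⟩
  θ (expand D♯) +ₛ expand D♯
    ≈⟨ +-cong (θ-cong D≈expand) D≈expand ⟨
  θ D +ₛ D
    ≈⟨ θD ⟩
  const ¼ *ₛ (X *ₛ X) +ₛ -ₛ (D *ₛ D)
    ≈⟨ +-cong (𝕊.trans (*-congˡ (const ¼) X²≈expand) (const-*ₛ ¼ (expand X))) (-‿cong (*ₛ-cong D≈expand D≈expand)) ⟩
  ¼ · expand X +ₛ -ₛ (expand D♯ *ₛ expand D♯)
    ≈⟨ +-cong (expand-· ¼ X) (𝕊.trans (expand-neg (D♯ *ₛ D♯)) (-‿cong (expand-*ₛ D♯ D♯))) ⟨
  expand (¼ · X) +ₛ expand (-ₛ (D♯ *ₛ D♯))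
    ≈⟨ expand-+ (¼ · X) (-ₛ (D♯ *ₛ D♯)) ⟨
  expand (¼ · X +ₛ -ₛ (D♯ *ₛ D♯)) ∎)
  where open ≈ₛ-Reasoning

-- Substituting -x for x² makes all coefficients of 1 - (x/2)coth(x/2) and of (x/2)/sinh(x/2) nonnegative.
Dˢ ρˢ : Series
Dˢ k = ⊖ ((⊖ 1ℚ) ^ℚ k ⊗ D♯ k)
ρˢ k = (⊖ 1ℚ) ^ℚ k ⊗ ρ♯ k

ρˢ-rec : ∀ k → fromℕ 2 ⊗ (fromℕ k ⊗ ρˢ k) ≡ (Dˢ *ₛ ρˢ) k
ρˢ-rec k = begin
  fromℕ 2 ⊗ (fromℕ k ⊗ (ε ⊗ ρ♯ k))
    ≡⟨ lem₁ (fromℕ 2) (fromℕ k) ε (ρ♯ k) ⟩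
  ε ⊗ (fromℕ 2 ⊗ (fromℕ k ⊗ ρ♯ k))
    ≡⟨ cong (ε ⊗_) (θρ♯ .at k) ⟩
  ε ⊗ (⊖ (D♯ *ₛ ρ♯) k)
    ≡⟨ lem₂ ε ((D♯ *ₛ ρ♯) k) ⟩
  ⊖ (ε ⊗ (D♯ *ₛ ρ♯) k)
    ≡⟨ cong ⊖_ (scale-*ₛ (⊖ 1ℚ) D♯ ρ♯ .at k) ⟨
  ⊖ (scale (⊖ 1ℚ) D♯ *ₛ ρˢ) k
    ≡⟨ solveₛ 2 (λ d r → :- (d :* r) := (:- d) :* r) 𝕊.refl (scale (⊖ 1ℚ) D♯) ρˢ .at k ⟩
  (Dˢ *ₛ ρˢ) k ∎
  where
  open ≡-Reasoning
  ε = (⊖ 1ℚ) ^ℚ k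
  lem₁ : ∀ a b c d → a ⊗ (b ⊗ (c ⊗ d)) ≡ c ⊗ (a ⊗ (b ⊗ d))
  lem₁ = RingSolver.solve-∀ ℚ-ring
  lem₂ : ∀ a b → a ⊗ (⊖ b) ≡ ⊖ (a ⊗ b)
  lem₂ = RingSolver.solve-∀ ℚ-ring

-- With the alternating sign built in, every term on the right carries a plus sign, so nonnegativity
-- passes from smaller indices to larger ones.
Dˢ-rec : ∀ k → fromℕ (suc (2 * k)) ⊗ Dˢ k ≡ ¼ ⊗ X k ⊕ (Dˢ *ₛ Dˢ) k
Dˢ-rec k = begin
  fromℕ (1 + 2 * k) ⊗ (⊖ (ε ⊗ D♯ k))
    ≡⟨ cong (_⊗ (⊖ (ε ⊗ D♯ k))) (trans (fromℕ-+ 1 (2 * k)) (cong (1ℚ ⊕_) (fromℕ-* 2 k))) ⟩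
  (1ℚ ⊕ fromℕ 2 ⊗ fromℕ k) ⊗ (⊖ (ε ⊗ D♯ k))
    ≡⟨ lem₁ (fromℕ 2) (fromℕ k) ε (D♯ k) ⟩
  ⊖ (ε ⊗ (fromℕ 2 ⊗ (fromℕ k ⊗ D♯ k) ⊕ D♯ k))
    ≡⟨ cong (λ z → ⊖ (ε ⊗ z)) (θD♯ .at k) ⟩
  ⊖ (ε ⊗ (¼ ⊗ X k ⊕ (⊖ (D♯ *ₛ D♯) k)))
    ≡⟨ lem₂ ε (X k) ((D♯ *ₛ D♯) k) ⟩
  ¼ ⊗ (⊖ (ε ⊗ X k)) ⊕ ε ⊗ (D♯ *ₛ D♯) k
    ≡⟨ cong₂ (λ a b → ¼ ⊗ a ⊕ b) (signX k) (trans (sym (scale-*ₛ (⊖ 1ℚ) D♯ D♯ .at k))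
         (solveₛ 1 (λ d → d :* d := (:- d) :* (:- d)) 𝕊.refl (scale (⊖ 1ℚ) D♯) .at k)) ⟩
  ¼ ⊗ X k ⊕ (Dˢ *ₛ Dˢ) k ∎
  where
  open ≡-Reasoning
  ε = (⊖ 1ℚ) ^ℚ k
  signX : ∀ k → ⊖ ((⊖ 1ℚ) ^ℚ k ⊗ X k) ≡ X k
  signX zero          = refl
  signX (suc zero)    = refl
  signX (suc (suc k)) = cong ⊖_ (ℚ.*-zeroʳ ((⊖ 1ℚ) ^ℚ suc (suc k)))
  lem₁ : ∀ a k e d → (1ℚ ⊕ a ⊗ k) ⊗ (⊖ (e ⊗ d)) ≡ ⊖ (e ⊗ (a ⊗ (k ⊗ d) ⊕ d))
  lem₁ = RingSolver.solve-∀ ℚ-ring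
  lem₂ : ∀ e x d → ⊖ (e ⊗ (¼ ⊗ x ⊕ (⊖ d))) ≡ ¼ ⊗ (⊖ (e ⊗ x)) ⊕ e ⊗ d
  lem₂ e x d = lem₃ ¼ e x d
    where
    lem₃ : ∀ q e x d → ⊖ (e ⊗ (q ⊗ x ⊕ (⊖ d))) ≡ q ⊗ (⊖ (e ⊗ x)) ⊕ e ⊗ d
    lem₃ = RingSolver.solve-∀ ℚ-ring

⊗-nonneg : ∀ {x y} → 0ℚ ℚ.≤ x → 0ℚ ℚ.≤ y → 0ℚ ℚ.≤ x ⊗ y
⊗-nonneg {x} {y} p q = ℚ.nonNegative⁻¹ (x ⊗ y) {{ℚ.nonNeg*nonNeg⇒nonNeg x {{ℚ.nonNegative p}} y {{ℚ.nonNegative q}}}}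

⊗-pos : ∀ {x y} → 0ℚ ℚ.< x → 0ℚ ℚ.< y → 0ℚ ℚ.< x ⊗ y
⊗-pos {x} {y} p q = ℚ.positive⁻¹ (x ⊗ y) {{ℚ.pos*pos⇒pos x {{ℚ.positive p}} y {{ℚ.positive q}}}}

∑-nonneg : ∀ m {f : ℕ → ℚ} → (∀ j → j ≤ m → 0ℚ ℚ.≤ f j) → 0ℚ ℚ.≤ ∑≤ m f
∑-nonneg zero    p = p 0 z≤n
∑-nonneg (suc m) p = ℚ.+-mono-≤ (p 0 z≤n) (∑-nonneg m (λ j j≤m → p (suc j) (s≤s j≤m)))

inv-positive : ∀ m → 0ℚ ℚ.< inv (suc m)
inv-positive m = subst (0ℚ ℚ.<_) (sym (ℚ.*-identityˡ _)) (ℚ.positive⁻¹ (ℤ.+ 1 ℚ./ suc m) {{ℚ.normalize-pos 1 (suc m)}})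

fromℕ-cancel-nonneg : ∀ m {x} → 0ℚ ℚ.≤ fromℕ (suc m) ⊗ x → 0ℚ ℚ.≤ x
fromℕ-cancel-nonneg m {x} p = subst (0ℚ ℚ.≤_) (*-inv-cancel (suc m) x) (⊗-nonneg (ℚ.<⇒≤ (inv-positive m)) p)

fromℕ-cancel-pos : ∀ m {x} → 0ℚ ℚ.< fromℕ (suc m) ⊗ x → 0ℚ ℚ.< x
fromℕ-cancel-pos m {x} p = subst (0ℚ ℚ.<_) (*-inv-cancel (suc m) x) (⊗-pos (inv-positive m) p)

Dˢ-nonneg : ∀ k j → j ≤ k → 0ℚ ℚ.≤ Dˢ j
Dˢ-nonneg zero    zero _ = ℚ.≤-refl
Dˢ-nonneg (suc k) j j≤sk with ℕ.m≤n⇒m<n∨m≡n j≤sk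
... | inj₁ (s≤s j≤k) = Dˢ-nonneg k j j≤k
... | inj₂ refl = fromℕ-cancel-nonneg (2 * suc k) (subst (0ℚ ℚ.≤_) (sym (Dˢ-rec (suc k)))
      (ℚ.+-mono-≤ (⊗-nonneg {¼} (ℚ.nonNegative⁻¹ ¼) (X-nonneg (suc k))) (∑-nonneg (suc k) term)))
  where
  X-nonneg : ∀ m → 0ℚ ℚ.≤ X m
  X-nonneg zero          = ℚ.≤-refl
  X-nonneg (suc zero)    = ℚ.nonNegative⁻¹ 1ℚ
  X-nonneg (suc (suc m)) = ℚ.≤-refl
  term : ∀ i → i ≤ suc k → 0ℚ ℚ.≤ Dˢ i ⊗ Dˢ (suc k ∸ i)
  -- Both end terms of the convolution involve `Dˢ (suc k)` itself, but their other factor `Dˢ 0` is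
  -- zero.
  term zero    _ = ℚ.≤-reflexive (sym (ℚ.*-zeroˡ (Dˢ (suc k))))
  term (suc i) (s≤s i≤k) with ℕ.m≤n⇒m<n∨m≡n i≤k
  ... | inj₁ i<k  = ⊗-nonneg (Dˢ-nonneg k (suc i) i<k) (Dˢ-nonneg k (k ∸ i) (ℕ.m∸n≤m k i))
  ... | inj₂ refl = ℚ.≤-reflexive (sym (trans (cong (λ m → Dˢ (suc k) ⊗ Dˢ m) (ℕ.n∸n≡0 k)) (ℚ.*-zeroʳ (Dˢ (suc k)))))

Dˢ-1 : 0ℚ ℚ.< Dˢ 1
Dˢ-1 = fromℕ-cancel-pos 2 (subst (0ℚ ℚ.<_) (sym (trans (Dˢ-rec 1) (trans (cong (¼ ⊗ 1ℚ ⊕_)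
    (trans (cong₂ _⊕_ (ℚ.*-zeroˡ (Dˢ 1)) (ℚ.*-zeroʳ (Dˢ 1))) (ℚ.+-identityˡ 0ℚ))) (ℚ.+-identityʳ (¼ ⊗ 1ℚ)))))
  (ℚ.positive⁻¹ (¼ ⊗ 1ℚ)))

-- In `ρˢ-rec` the first term has the factor `Dˢ 0`, which is zero, so only earlier values of `ρˢ`
-- matter. Among the others the one with `Dˢ 1` is strictly positive, and none is negative.
ρˢ-pos : ∀ k j → j ≤ k → 0ℚ ℚ.< ρˢ j
ρˢ-pos zero    zero _ = ℚ.positive⁻¹ 1ℚ
ρˢ-pos (suc k) j j≤sk with ℕ.m≤n⇒m<n∨m≡n j≤sk
... | inj₁ (s≤s j≤k) = ρˢ-pos k j j≤k
... | inj₂ refl = fromℕ-cancel-pos k (fromℕ-cancel-pos 1 (subst (0ℚ ℚ.<_) (sym (ρˢ-rec (suc k)))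
      (subst (0ℚ ℚ.<_) (sym (trans (cong (_⊕ ∑≤ k (λ i → Dˢ (suc i) ⊗ ρˢ (k ∸ i))) (ℚ.*-zeroˡ (ρˢ (suc k)))) (ℚ.+-identityˡ _))) (tail-pos k (λ i i≤k → ρˢ-pos k i i≤k)))))
  where
  tail-pos : ∀ k → (∀ i → i ≤ k → 0ℚ ℚ.< ρˢ i) → 0ℚ ℚ.< ∑≤ k (λ i → Dˢ (suc i) ⊗ ρˢ (k ∸ i))
  tail-pos zero    pos = ⊗-pos Dˢ-1 (pos 0 z≤n)
  tail-pos (suc k) pos = ℚ.+-mono-<-≤ (⊗-pos Dˢ-1 (pos (suc k) ℕ.≤-refl))
    (∑-nonneg k (λ i i≤k → ⊗-nonneg (Dˢ-nonneg (suc (suc i)) (suc (suc i)) ℕ.≤-refl) (ℚ.<⇒≤ (pos (k ∸ i) (ℕ.≤-trans (ℕ.m∸n≤m k i) (ℕ.n≤1+n k))))))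

ρ-even≢0 : ∀ k → ρ (double k) ≢ 0ℚ
ρ-even≢0 k eq = ℚ.<-irrefl (sym (trans (cong ((⊖ 1ℚ) ^ℚ k ⊗_) (trans (sym (ρ-even k)) eq)) (ℚ.*-zeroʳ ((⊖ 1ℚ) ^ℚ k)))) (ρˢ-pos k k ℕ.≤-refl)

-- Polynomials are determined by their values

horner : ℕ → (ℕ → ℚ) → ℚ → ℚ
horner D a x = ∑≤ D (λ j → a j ⊗ x ^ℚ j)

horner-suc : ∀ D a x → horner (suc D) a x ≡ a 0 ⊕ x ⊗ horner D (a ∘ suc) x
horner-suc D a x = cong₂ _⊕_ (ℚ.*-identityʳ (a 0))
  (trans (∑-cong D (λ j _ → lem (a (suc j)) x (x ^ℚ j))) (sym (∑-distribˡ D x _)))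
  where
  lem : ∀ a x p → a ⊗ (x ⊗ p) ≡ x ⊗ (a ⊗ p)
  lem = RingSolver.solve-∀ ℚ-ring

-- The coefficients of (p(x) - p(k))/(x - k), for p of degree at most D + 1.
quotient : ℚ → ℕ → (ℕ → ℚ) → ℕ → ℚ
quotient k D       a zero    = horner D (a ∘ suc) k
quotient k zero    a (suc j) = 0ℚ
quotient k (suc D) a (suc j) = quotient k D (a ∘ suc) j

horner-quotient : ∀ k D a x → horner (suc D) a x ≡ horner (suc D) a k ⊕ (x ⊝ k) ⊗ horner D (quotient k D a) x
horner-quotient k zero a x = lem (a 0) (a 1) x k
  where
  lem : ∀ a b x k → a ⊗ 1ℚ ⊕ b ⊗ (x ⊗ 1ℚ) ≡ (a ⊗ 1ℚ ⊕ b ⊗ (k ⊗ 1ℚ)) ⊕ (x ⊕ (⊖ k)) ⊗ ((b ⊗ 1ℚ) ⊗ 1ℚ)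
  lem = RingSolver.solve-∀ ℚ-ring
horner-quotient k (suc D) a x = begin
  horner (suc (suc D)) a x
    ≡⟨ trans (horner-suc (suc D) a x) (cong (λ z → a 0 ⊕ x ⊗ z) (horner-quotient k D (a ∘ suc) x)) ⟩
  a 0 ⊕ x ⊗ (Pk ⊕ (x ⊝ k) ⊗ Q)
    ≡⟨ lem (a 0) x k Pk Q ⟩
  (a 0 ⊕ k ⊗ Pk) ⊕ (x ⊝ k) ⊗ (Pk ⊕ x ⊗ Q)
    ≡⟨ cong₂ (λ u v → u ⊕ (x ⊝ k) ⊗ v) (horner-suc (suc D) a k) (horner-suc D (quotient k (suc D) a) x) ⟨
  horner (suc (suc D)) a k ⊕ (x ⊝ k) ⊗ horner (suc D) (quotient k (suc D) a) x ∎
  where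
  open ≡-Reasoning
  Pk = horner (suc D) (a ∘ suc) k
  Q  = horner D (quotient k D (a ∘ suc)) x
  lem : ∀ a x k p q → a ⊕ x ⊗ (p ⊕ (x ⊕ (⊖ k)) ⊗ q) ≡ (a ⊕ k ⊗ p) ⊕ (x ⊕ (⊖ k)) ⊗ (p ⊕ x ⊗ q)
  lem = RingSolver.solve-∀ ℚ-ring

quotient-zero : ∀ k D a → (∀ j → j ≤ D → quotient k D a j ≡ 0ℚ) → ∀ j → j ≤ D → a (suc j) ≡ 0ℚ
quotient-zero k zero    a q≡0 zero _ = trans (sym (ℚ.*-identityʳ (a 1))) (q≡0 0 z≤n)
quotient-zero k (suc D) a q≡0 (suc j) (s≤s j≤D) = quotient-zero k D (a ∘ suc) (λ i i≤D → q≡0 (suc i) (s≤s i≤D)) j j≤D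
quotient-zero k (suc D) a q≡0 zero _ = trans (sym (trans (cong (a 1 ⊗ 1ℚ ⊕_)
    (∑-zero D (λ j j≤D → trans (cong (_⊗ k ^ℚ suc j) (quotient-zero k D (a ∘ suc) (λ i i≤D → q≡0 (suc i) (s≤s i≤D)) j j≤D)) (ℚ.*-zeroˡ (k ^ℚ suc j)))))
    (trans (ℚ.+-identityʳ _) (ℚ.*-identityʳ (a 1))))) (q≡0 0 z≤n)

-- Dividing by x - k lowers the degree. For integers x > k the divisor is a positive natural number,
-- so the quotient vanishes from k + 1 on, which is why the starting point is a parameter of the
-- induction.
horner-zero : ∀ D k a → (∀ x → k ≤ x → horner D a (fromℕ x) ≡ 0ℚ) → ∀ j → j ≤ D → a j ≡ 0ℚ
horner-zero zero    k a p≡0 zero _ = trans (sym (ℚ.*-identityʳ (a 0))) (p≡0 k ℕ.≤-refl)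
horner-zero (suc D) k a p≡0 = coefficients
  where
  open ≡-Reasoning
  κ = fromℕ k
  q≡0 : ∀ j → j ≤ D → quotient κ D a j ≡ 0ℚ
  q≡0 = horner-zero D (suc k) (quotient κ D a) (λ x k<x → root x k<x)
    where
    root : ∀ x → suc k ≤ x → horner D (quotient κ D a) (fromℕ x) ≡ 0ℚ
    root x k<x with y , refl ← ℕ.m≤n⇒∃[o]m+o≡n k<x = fromℕ-cancel (suc y) (begin
      fromℕ (suc y) ⊗ Q
        ≡⟨ cong (_⊗ Q) (sym (trans (cong (_⊝ κ) (trans (cong fromℕ (sym (ℕ.+-suc k y))) (fromℕ-+ k (suc y)))) (lem κ (fromℕ (suc y))))) ⟩
      (fromℕ (suc k + y) ⊝ κ) ⊗ Q
        ≡⟨ ℚ.+-identityˡ _ ⟨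
      0ℚ ⊕ (fromℕ (suc k + y) ⊝ κ) ⊗ Q
        ≡⟨ cong (_⊕ (fromℕ (suc k + y) ⊝ κ) ⊗ Q) (p≡0 k ℕ.≤-refl) ⟨
      horner (suc D) a κ ⊕ (fromℕ (suc k + y) ⊝ κ) ⊗ Q
        ≡⟨ horner-quotient κ D a (fromℕ (suc k + y)) ⟨
      horner (suc D) a (fromℕ (suc k + y))
        ≡⟨ p≡0 (suc k + y) (ℕ.≤-trans (ℕ.n≤1+n k) (ℕ.m≤m+n (suc k) y)) ⟩
      0ℚ
        ≡⟨ ℚ.*-zeroʳ (fromℕ (suc y)) ⟨
      fromℕ (suc y) ⊗ 0ℚ ∎)
      where
      Q = horner D (quotient κ D a) (fromℕ (suc k + y))
      lem : ∀ a b → a ⊕ b ⊕ (⊖ a) ≡ b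
      lem = RingSolver.solve-∀ ℚ-ring
  coefficients : ∀ j → j ≤ suc D → a j ≡ 0ℚ
  coefficients (suc j) (s≤s j≤D) = quotient-zero κ D a q≡0 j j≤D
  coefficients zero    _ = begin
    a 0                                           ≡⟨ ℚ.+-identityʳ (a 0) ⟨
    a 0 ⊕ 0ℚ                                      ≡⟨ cong (a 0 ⊕_) (ℚ.*-zeroʳ κ) ⟨
    a 0 ⊕ κ ⊗ 0ℚ                                  ≡⟨ cong (λ z → a 0 ⊕ κ ⊗ z) (q≡0 0 z≤n) ⟨
    a 0 ⊕ κ ⊗ horner D (a ∘ suc) κ                ≡⟨ horner-suc D a κ ⟨
    horner (suc D) a κ                            ≡⟨ p≡0 k ℕ.≤-refl ⟩
    0ℚ                                            ∎

∑box-cong : ∀ n D {f h : Vec ℕ n → ℚ} → (∀ b → f b ≡ h b) → ∑box n D f ≡ ∑box n D h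
∑box-cong zero    D eq = eq []
∑box-cong (suc n) D eq = ∑-cong D (λ j _ → ∑box-cong n D (λ b → eq (j ∷ b)))

∑box-distribˡ : ∀ n D c f → ∑box n D (λ b → c ⊗ f b) ≡ c ⊗ ∑box n D f
∑box-distribˡ zero    D c f = refl
∑box-distribˡ (suc n) D c f = trans (∑-cong D (λ j _ → ∑box-distribˡ n D c (λ b → f (j ∷ b)))) (sym (∑-distribˡ D c _))

∑box-⊕ : ∀ n D f h → ∑box n D (λ b → f b ⊕ h b) ≡ ∑box n D f ⊕ ∑box n D h
∑box-⊕ zero    D f h = refl
∑box-⊕ (suc n) D f h = trans (∑-cong D (λ j _ → ∑box-⊕ n D (λ b → f (j ∷ b)) (λ b → h (j ∷ b)))) (∑-⊕ D _ _)

∑box-zero : ∀ n D {f : Vec ℕ n → ℚ} → (∀ b → f b ≡ 0ℚ) → ∑box n D f ≡ 0ℚ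
∑box-zero zero    D eq = eq []
∑box-zero (suc n) D eq = ∑-zero D (λ j _ → ∑box-zero n D (λ b → eq (j ∷ b)))

∑-extend : ∀ {D D′} f → D ≤ D′ → (∀ j → D < j → f j ≡ 0ℚ) → ∑≤ D′ f ≡ ∑≤ D f
∑-extend {zero}  {zero}   f _ f₀ = refl
∑-extend {zero}  {suc D′} f _ f₀ = trans (cong (f 0 ⊕_) (∑-zero D′ (λ j _ → f₀ (suc j) (s≤s z≤n)))) (ℚ.+-identityʳ (f 0))
∑-extend {suc D} {suc D′} f (s≤s D≤D′) f₀ = cong (f 0 ⊕_) (∑-extend (f ∘ suc) D≤D′ (λ j D<j → f₀ (suc j) (s≤s D<j)))

∑box-extend : ∀ n {D D′} f → D ≤ D′ → (∀ b → ¬ VAll.All (_≤ D) b → f b ≡ 0ℚ) → ∑box n D′ f ≡ ∑box n D f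
∑box-extend zero    f D≤D′ f₀ = refl
∑box-extend (suc n) {D} {D′} f D≤D′ f₀ = trans
  (∑-extend (λ j → ∑box n D′ (λ b → f (j ∷ b))) D≤D′ (λ j D<j → ∑box-zero n D′ (λ b → f₀ (j ∷ b) (λ { (j≤D ∷ _) → ℕ.<⇒≱ D<j j≤D }))))
  (∑-cong D (λ j j≤D → ∑box-extend n (λ b → f (j ∷ b)) D≤D′ (λ b ¬p → f₀ (j ∷ b) (λ { (_ ∷ p) → ¬p p }))))

-- For fixed positive values of the other variables the sum is a polynomial in the first one that
-- vanishes at all x ≥ 1. Its coefficients, again polynomials in the other variables, therefore
-- vanish at all positive points.
box-zero : ∀ n D (c : Vec ℕ n → ℚ) →
  (∀ β → VAll.All (0 <_) β → ∑box n D (λ b → c b ⊗ fromℕ (monomial b β)) ≡ 0ℚ) →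
  ∀ b → VAll.All (_≤ D) b → c b ≡ 0ℚ
box-zero zero    D c p≡0 [] _ = trans (sym (ℚ.*-identityʳ (c []))) (p≡0 [] [])
box-zero (suc n) D c p≡0 (j ∷ b) (j≤D ∷ b≤D) = box-zero n D (λ b → c (j ∷ b)) slice b b≤D
  where
  slice : ∀ β → VAll.All (0 <_) β → ∑box n D (λ b → c (j ∷ b) ⊗ fromℕ (monomial b β)) ≡ 0ℚ
  slice β pos = horner-zero D 1 (λ i → ∑box n D (λ b → c (i ∷ b) ⊗ fromℕ (monomial b β))) (λ x 1≤x → trans
    (∑-cong D (λ i _ → trans (ℚ.*-comm _ (fromℕ x ^ℚ i)) (trans (sym (∑box-distribˡ n D (fromℕ x ^ℚ i) _)) (∑box-cong n D (λ b → trans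
      (lem (fromℕ x ^ℚ i) (c (i ∷ b)) (fromℕ (monomial b β)))
      (cong (c (i ∷ b) ⊗_) (sym (trans (fromℕ-* (x ^ i) (monomial b β)) (cong (_⊗ fromℕ (monomial b β)) (fromℕ-^ x i))))))))))
    (p≡0 (x ∷ β) (1≤x ∷ pos))) j j≤D
    where
    lem : ∀ x c m → x ⊗ (c ⊗ m) ≡ c ⊗ (x ⊗ m)
    lem = RingSolver.solve-∀ ℚ-ring

module _ {n} (P Q : Polynomial n) where

  coeff-outside : ∀ (P : Polynomial n) b → ¬ VAll.All (_≤ bound P) b → coeff P b ≡ 0ℚ
  coeff-outside P b ¬b≤ with coeff P b ℚ.≟ 0ℚ
  ... | yes c≡0 = c≡0
  ... | no  c≢0 = contradiction (bounded P b c≢0) ¬b≤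

  -- The two bounds may differ, so both sums are extended to a box of the larger side before
  -- `box-zero` is applied to the difference.
  coeff-unique : (∀ β → VAll.All (0 <_) β → evaluate P β ≡ evaluate Q β) → ∀ b → coeff P b ≡ coeff Q b
  coeff-unique agree b with VAll.all? (ℕ._≤? (bound P ℕ.⊔ bound Q)) b
  ... | no  ¬b≤ = trans (coeff-outside P b (λ p → ¬b≤ (VAll.map (λ q → ℕ.≤-trans q (ℕ.m≤m⊔n (bound P) (bound Q))) p)))
                 (sym (coeff-outside Q b (λ p → ¬b≤ (VAll.map (λ q → ℕ.≤-trans q (ℕ.m≤n⊔m (bound P) (bound Q))) p))))
  ... | yes b≤ = difference (box-zero n N (λ b → coeff P b ⊝ coeff Q b) vanish b b≤)
    where
    open ≡-Reasoning
    N = bound P ℕ.⊔ bound Q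
    difference : ∀ {p q} → p ⊝ q ≡ 0ℚ → p ≡ q
    difference {p} {q} eq = trans (sym (lem p q)) (trans (cong (_⊕ q) eq) (ℚ.+-identityˡ q))
      where
      lem : ∀ p q → (p ⊕ (⊖ q)) ⊕ q ≡ p
      lem = RingSolver.solve-∀ ℚ-ring
    extended : ∀ (R : Polynomial n) β → bound R ≤ N → ∑box n N (λ b → coeff R b ⊗ fromℕ (monomial b β)) ≡ evaluate R β
    extended R β R≤N = ∑box-extend n _ R≤N (λ b ¬b≤ → trans (cong (_⊗ fromℕ (monomial b β)) (coeff-outside R b ¬b≤)) (ℚ.*-zeroˡ (fromℕ (monomial b β))))
    vanish : ∀ β → VAll.All (0 <_) β → ∑box n N (λ b → (coeff P b ⊝ coeff Q b) ⊗ fromℕ (monomial b β)) ≡ 0ℚ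
    vanish β pos = begin
      ∑box n N (λ b → (coeff P b ⊝ coeff Q b) ⊗ fromℕ (monomial b β))
        ≡⟨ ∑box-cong n N (λ b → lem₁ (coeff P b) (coeff Q b) (fromℕ (monomial b β))) ⟩
      ∑box n N (λ b → coeff P b ⊗ fromℕ (monomial b β) ⊕ (⊖ 1ℚ) ⊗ (coeff Q b ⊗ fromℕ (monomial b β)))
        ≡⟨ trans (∑box-⊕ n N _ _) (cong (∑box n N (λ b → coeff P b ⊗ fromℕ (monomial b β)) ⊕_) (∑box-distribˡ n N (⊖ 1ℚ) _)) ⟩
      ∑box n N (λ b → coeff P b ⊗ fromℕ (monomial b β)) ⊕ (⊖ 1ℚ) ⊗ ∑box n N (λ b → coeff Q b ⊗ fromℕ (monomial b β))
        ≡⟨ cong₂ (λ x y → x ⊕ (⊖ 1ℚ) ⊗ y) (trans (extended P β (ℕ.m≤m⊔n (bound P) (bound Q))) (agree β pos)) (extended Q β (ℕ.m≤n⊔m (bound P) (bound Q))) ⟩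
      evaluate Q β ⊕ (⊖ 1ℚ) ⊗ evaluate Q β
        ≡⟨ lem₂ (evaluate Q β) ⟩
      0ℚ ∎
      where
      lem₁ : ∀ p q m → (p ⊕ (⊖ q)) ⊗ m ≡ p ⊗ m ⊕ (⊖ 1ℚ) ⊗ (q ⊗ m)
      lem₁ = RingSolver.solve-∀ ℚ-ring
      lem₂ : ∀ q → q ⊕ (⊖ 1ℚ) ⊗ q ≡ 0ℚ
      lem₂ = RingSolver.solve-∀ ℚ-ring

-- The Hurwitz polynomial and its coefficients

module _ (g M : ℕ) where
  private h = M + 2 * g

  -- The test guards against truncated subtraction, which would produce `ρ 0`, that is 1, in every
  -- degree above `h`.
  ρ-cofactor : ℕ → ℚ
  ρ-cofactor m = if does (m ℕ.≤? h) then ρ (h ∸ m) else 0ℚ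

  ρ-cofactor-≤ : ∀ {m} → m ≤ h → ρ-cofactor m ≡ ρ (h ∸ m)
  ρ-cofactor-≤ {m} m≤h rewrite dec-true (m ℕ.≤? h) m≤h = refl

  ρ-cofactor-> : ∀ {m} → h < m → ρ-cofactor m ≡ 0ℚ
  ρ-cofactor-> {m} h<m rewrite dec-false (m ℕ.≤? h) (ℕ.<⇒≱ h<m) = refl

  hurwitzCoeff : ∀ {n} → Vec ℕ n → ℚ
  hurwitzCoeff b = ρ-cofactor (sum b) ⊗ (fromℕ (M !) ⊗ ∏Φ b M)

  hurwitzCoeff-≤ : ∀ {n} (b : Vec ℕ n) → hurwitzCoeff b ≢ 0ℚ → sum b ≤ h
  hurwitzCoeff-≤ b c≢0 with sum b ℕ.≤? h
  ... | yes p = p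
  ... | no ¬p = contradiction (trans (cong (_⊗ (fromℕ (M !) ⊗ ∏Φ b M)) (ρ-cofactor-> (ℕ.≰⇒> ¬p))) (ℚ.*-zeroˡ (fromℕ (M !) ⊗ ∏Φ b M))) c≢0

  sum-bounds : ∀ {n} (b : Vec ℕ n) {k} → sum b ≤ k → VAll.All (_≤ k) b
  sum-bounds []      p = []
  sum-bounds (j ∷ b) p = ℕ.≤-trans (ℕ.m≤m+n j (sum b)) p ∷ sum-bounds b (ℕ.≤-trans (ℕ.m≤n+m (sum b) j) p)

  hurwitzPolynomial : ∀ n → Polynomial n
  hurwitzPolynomial n = record
    { coeff   = hurwitzCoeff
    ; bound   = h
    ; bounded = λ b c≢0 → sum-bounds b (hurwitzCoeff-≤ b c≢0)
    }

  -- Grouped by total degree m, the monomials yield the coefficient of zᵐ in zᴹ dᴹ/M! ∏𝒮(βᵢz), and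
  -- the cofactor completes this to a convolution with ρ at h = M + 2g. The power zᴹ lowers the
  -- index to 2g.
  evaluate-hurwitz : ∀ {n} (β : Vec ℕ n) →
    evaluate (hurwitzPolynomial n) β ≡ fromℕ (sum β ^ M) ⊗ (∏𝒮 (Vec.toList β) *ₛ ρ) (2 * g)
  evaluate-hurwitz {n} β = begin
    ∑box n h (λ b → ρ-cofactor (sum b) ⊗ (fromℕ (M !) ⊗ ∏Φ b M) ⊗ fromℕ (monomial b β))
      ≡⟨ ∑box-cong n h (λ b → lem₁ (ρ-cofactor (sum b)) (fromℕ (M !)) (∏Φ b M) (fromℕ (monomial b β))) ⟩
    ∑box n h (λ b → fromℕ (M !) ⊗ (ρ-cofactor (sum b) ⊗ (∏Φ b M ⊗ fromℕ (monomial b β))))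
      ≡⟨ ∑box-distribˡ n h (fromℕ (M !)) _ ⟩
    fromℕ (M !) ⊗ ∑box n h (λ b → ρ-cofactor (sum b) ⊗ (∏Φ b M ⊗ fromℕ (monomial b β)))
      ≡⟨ cong (fromℕ (M !) ⊗_) (∑box≡∑comp n h ρ-cofactor (λ b → ∏Φ b M ⊗ fromℕ (monomial b β)) (λ m → ρ-cofactor->)) ⟩
    fromℕ (M !) ⊗ ∑≤ h (λ m → ρ-cofactor m ⊗ ∑comp n m (λ b → ∏Φ b M ⊗ fromℕ (monomial b β)))
      ≡⟨ cong (fromℕ (M !) ⊗_) (∑-cong h (λ m m≤h → trans (cong₂ _⊗_ (ρ-cofactor-≤ m≤h) (∑comp-∏Φ β m M))
           (lem₂ (ρ (h ∸ m)) (E (fromℕ (sum β)) M) (shift^ M Π m)))) ⟩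
    fromℕ (M !) ⊗ ∑≤ h (λ m → E (fromℕ (sum β)) M ⊗ (shift^ M Π m ⊗ ρ (h ∸ m)))
      ≡⟨ cong (fromℕ (M !) ⊗_) (∑-distribˡ h (E (fromℕ (sum β)) M) (λ m → shift^ M Π m ⊗ ρ (h ∸ m))) ⟨
    fromℕ (M !) ⊗ (E (fromℕ (sum β)) M ⊗ (shift^ M Π *ₛ ρ) h)
      ≡⟨ cong (λ z → fromℕ (M !) ⊗ (E (fromℕ (sum β)) M ⊗ z)) (trans (shift^-*ₛ M Π ρ .at h) (shift^-high M (Π *ₛ ρ) (2 * g))) ⟩
    fromℕ (M !) ⊗ (fromℕ (sum β) ^ℚ M ⊗ inv! M ⊗ (Π *ₛ ρ) (2 * g))
      ≡⟨ lem₃ (fromℕ (M !)) (fromℕ (sum β) ^ℚ M) (inv! M) ((Π *ₛ ρ) (2 * g)) ⟩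
    fromℕ (M !) ⊗ inv! M ⊗ (fromℕ (sum β) ^ℚ M ⊗ (Π *ₛ ρ) (2 * g))
      ≡⟨ trans (cong₂ (λ x y → x ⊗ (y ⊗ (Π *ₛ ρ) (2 * g))) (*-inv (M !) {{n!≢0 M}}) (sym (fromℕ-^ (sum β) M))) (ℚ.*-identityˡ _) ⟩
    fromℕ (sum β ^ M) ⊗ (Π *ₛ ρ) (2 * g) ∎
    where
    open ≡-Reasoning
    Π = ∏𝒮 (Vec.toList β)
    lem₁ : ∀ r f p m → r ⊗ (f ⊗ p) ⊗ m ≡ f ⊗ (r ⊗ (p ⊗ m))
    lem₁ = RingSolver.solve-∀ ℚ-ring
    lem₂ : ∀ r e s → r ⊗ (e ⊗ s) ≡ e ⊗ (s ⊗ r)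
    lem₂ = RingSolver.solve-∀ ℚ-ring
    lem₃ : ∀ f x i v → f ⊗ (x ⊗ i ⊗ v) ≡ f ⊗ i ⊗ (x ⊗ v)
    lem₃ = RingSolver.solve-∀ ℚ-ring

Φ-low : ∀ {b c} → b < c → Φ b c ≡ 0ℚ
Φ-low {b} {c} b<c = trans (cong (inv! c ⊗_) (shift^-low c 𝒮 b<c)) (ℚ.*-zeroʳ (inv! c))

Φ-top : ∀ b → Φ b b ≡ inv! b
Φ-top b = trans (cong (inv! b ⊗_) (trans (cong (shift^ b 𝒮) (sym (ℕ.+-identityʳ b))) (shift^-high b 𝒮 0))) (ℚ.*-identityʳ (inv! b))

Φ₀ : Φ 0 ≈ₛ 1ₛ
Φ₀ .at zero    = Φ-top 0
Φ₀ .at (suc c) = Φ-low {0} {suc c} (s≤s z≤n)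

-- In exp(zy) no power of y exceeds that of z. This is the source of the lower bound M on the
-- degree.
∏Φ-low : ∀ {n} (b : Vec ℕ n) {c} → sum b < c → ∏Φ b c ≡ 0ℚ
∏Φ-low []      {suc c} _ = refl
∏Φ-low (j ∷ b) {c} lt = ∑-zero c term
  where
  term : ∀ i → i ≤ c → Φ j i ⊗ ∏Φ b (c ∸ i) ≡ 0ℚ
  term i i≤c with i ℕ.≤? j
  ... | no  i≰j = trans (cong (_⊗ ∏Φ b (c ∸ i)) (Φ-low (ℕ.≰⇒> i≰j))) (ℚ.*-zeroˡ (∏Φ b (c ∸ i)))
  ... | yes i≤j = trans (cong (Φ j i ⊗_) (∏Φ-low b (ℕ.+-cancelˡ-< i (sum b) (c ∸ i)
        (subst (i + sum b <_) (sym (ℕ.m+[n∸m]≡n i≤c)) (ℕ.≤-<-trans (ℕ.+-monoˡ-≤ (sum b) i≤j) lt))))) (ℚ.*-zeroʳ (Φ j i))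

∑-single : ∀ m j (f : ℕ → ℚ) → j ≤ m → (∀ i → i ≤ m → i ≢ j → f i ≡ 0ℚ) → ∑≤ m f ≡ f j
∑-single zero    zero    f _         f₀ = refl
∑-single (suc m) zero    f _         f₀ = trans (cong (f 0 ⊕_) (∑-zero m (λ i i≤m → f₀ (suc i) (s≤s i≤m) λ ()))) (ℚ.+-identityʳ (f 0))
∑-single (suc m) (suc j) f (s≤s j≤m) f₀ = trans (cong₂ _⊕_ (f₀ 0 z≤n λ ())
  (∑-single m j (f ∘ suc) j≤m (λ i i≤m i≢j → f₀ (suc i) (s≤s i≤m) (i≢j ∘ ℕ.suc-injective)))) (ℚ.+-identityˡ (f (suc j)))

-- When the degree in y equals the sum of the bᵢ, each factor must take its extreme value cᵢ = bᵢ,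
-- whose coefficient is 1/bᵢ!.
∏Φ-top : ∀ {n} (b : Vec ℕ n) → ∏Φ b (sum b) ≡ inv (Vec.foldr′ _*_ 1 (Vec.map _! b))
∏Φ-top []      = refl
∏Φ-top (j ∷ b) = begin
  ∑≤ (j + sum b) (λ i → Φ j i ⊗ ∏Φ b (j + sum b ∸ i))
    ≡⟨ ∑-single (j + sum b) j _ (ℕ.m≤m+n j (sum b)) other ⟩
  Φ j j ⊗ ∏Φ b (j + sum b ∸ j)
    ≡⟨ cong₂ _⊗_ (Φ-top j) (trans (cong (∏Φ b) (ℕ.m+n∸m≡n j (sum b))) (∏Φ-top b)) ⟩
  inv! j ⊗ inv (Vec.foldr′ _*_ 1 (Vec.map _! b))
    ≡⟨ inv-* (j !) (Vec.foldr′ _*_ 1 (Vec.map _! b)) ⟨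
  inv (j ! * Vec.foldr′ _*_ 1 (Vec.map _! b)) ∎
  where
  open ≡-Reasoning
  other : ∀ i → i ≤ j + sum b → i ≢ j → Φ j i ⊗ ∏Φ b (j + sum b ∸ i) ≡ 0ℚ
  other i i≤ i≢j with ℕ.<-cmp i j
  ... | tri≈ _ i≡j _ = contradiction i≡j i≢j
  ... | tri> _ _ j<i = trans (cong (_⊗ ∏Φ b (j + sum b ∸ i)) (Φ-low j<i)) (ℚ.*-zeroˡ (∏Φ b (j + sum b ∸ i)))
  ... | tri< i<j _ _ = trans (cong (Φ j i ⊗_) (∏Φ-low b (ℕ.+-cancelˡ-< i (sum b) (j + sum b ∸ i)
        (subst (i + sum b <_) (sym (ℕ.m+[n∸m]≡n i≤)) (ℕ.+-monoˡ-< (sum b) i<j))))) (ℚ.*-zeroʳ (Φ j i))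

-- The exponent of a power of the first variable, the witness for both degrees; as Φ(0) = 1, only
-- one factor of `∏Φ` remains there.
axis : ∀ n → ℕ → Vec ℕ (suc n)
axis n m = m ∷ Vec.replicate n 0

sum-zeros : ∀ n → sum (Vec.replicate n 0) ≡ 0
sum-zeros zero    = refl
sum-zeros (suc n) = sum-zeros n

sum-axis : ∀ n m → sum (axis n m) ≡ m
sum-axis n m = trans (cong (m +_) (sum-zeros n)) (ℕ.+-identityʳ m)

∏Φ-zeros : ∀ n → ∏Φ (Vec.replicate n 0) ≈ₛ 1ₛ
∏Φ-zeros zero    = 𝕊.refl
∏Φ-zeros (suc n) = 𝕊.trans (*ₛ-cong Φ₀ (∏Φ-zeros n)) (𝕊.*-identityˡ 1ₛ)

∏Φ-axis : ∀ n m → ∏Φ (axis n m) ≈ₛ Φ m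
∏Φ-axis n m = 𝕊.trans (*-congˡ (Φ m) (∏Φ-zeros n)) (𝕊.*-identityʳ (Φ m))

foldr-lookup : ∀ {n} (b : Vec ℕ n) → sum b ≡ CommutativeMonoidSum.sum ℕ.+-0-commutativeMonoid (Vec.lookup b)
foldr-lookup []      = refl
foldr-lookup (j ∷ b) = cong (j +_) (foldr-lookup b)

∏Φ-lookup : ∀ {n} (b : Vec ℕ n) → ∏Φ b ≈ₛ CommutativeMonoidSum.sum 𝕊.*-commutativeMonoid (Φ ∘ Vec.lookup b)
∏Φ-lookup []      = 𝕊.refl
∏Φ-lookup (j ∷ b) = *-congˡ (Φ j) (∏Φ-lookup b)

permute : ∀ {n} → Permutation′ n → Vec ℕ n → Vec ℕ n
permute π b = Vec.tabulate (λ i → Vec.lookup b (π ⟨$⟩ʳ i))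

sum-tabulate : ∀ {n} (f : Fin n → ℕ) → sum (Vec.tabulate f) ≡ CommutativeMonoidSum.sum ℕ.+-0-commutativeMonoid f
sum-tabulate {zero}  f = refl
sum-tabulate {suc n} f = cong (f Fin.zero +_) (sum-tabulate (f ∘ Fin.suc))

∏Φ-tabulate : ∀ {n} (f : Fin n → ℕ) → ∏Φ (Vec.tabulate f) ≈ₛ CommutativeMonoidSum.sum 𝕊.*-commutativeMonoid (Φ ∘ f)
∏Φ-tabulate {zero}  f = 𝕊.refl
∏Φ-tabulate {suc n} f = *-congˡ (Φ (f Fin.zero)) (∏Φ-tabulate (f ∘ Fin.suc))

sum-permute : ∀ {n} (π : Permutation′ n) b → sum (permute π b) ≡ sum b
sum-permute π b = trans (sum-tabulate (λ i → Vec.lookup b (π ⟨$⟩ʳ i)))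
  (trans (sym (CommutativeMonoidSum.sum-permute ℕ.+-0-commutativeMonoid (Vec.lookup b) π)) (sym (foldr-lookup b)))

∏Φ-permute : ∀ {n} (π : Permutation′ n) b → ∏Φ (permute π b) ≈ₛ ∏Φ b
∏Φ-permute π b = 𝕊.trans (∏Φ-tabulate (λ i → Vec.lookup b (π ⟨$⟩ʳ i)))
  (𝕊.trans (𝕊.sym (CommutativeMonoidSum.sum-permute 𝕊.*-commutativeMonoid (Φ ∘ Vec.lookup b) π)) (𝕊.sym (∏Φ-lookup b)))

-- Comparison of the products of Φ with Ĉ

θ-shift^ : ∀ j s m → fromℕ m ⊗ shift^ j s m ≡ fromℕ j ⊗ shift^ j s m ⊕ shift^ j (θ s) m
θ-shift^ zero    s m       = sym (trans (cong (_⊕ θ s m) (ℚ.*-zeroˡ (s m))) (ℚ.+-identityˡ (θ s m)))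
θ-shift^ (suc j) s zero    = sym (trans (ℚ.+-identityʳ _) (trans (ℚ.*-zeroʳ (fromℕ (suc j))) (sym (ℚ.*-zeroʳ (fromℕ 0)))))
θ-shift^ (suc j) s (suc m) = begin
  fromℕ (suc m) ⊗ v                             ≡⟨ cong (_⊗ v) (fromℕ-+ 1 m) ⟩
  (1ℚ ⊕ fromℕ m) ⊗ v                            ≡⟨ lem₁ (fromℕ m) v ⟩
  v ⊕ fromℕ m ⊗ v                               ≡⟨ cong (v ⊕_) (θ-shift^ j s m) ⟩
  v ⊕ (fromℕ j ⊗ v ⊕ shift^ j (θ s) m)          ≡⟨ lem₂ (fromℕ j) v (shift^ j (θ s) m) ⟩
  (1ℚ ⊕ fromℕ j) ⊗ v ⊕ shift^ j (θ s) m         ≡⟨ cong (λ z → z ⊗ v ⊕ shift^ j (θ s) m) (fromℕ-+ 1 j) ⟨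
  fromℕ (suc j) ⊗ v ⊕ shift^ j (θ s) m          ∎
  where
  open ≡-Reasoning
  v = shift^ j s m
  lem₁ : ∀ m v → (1ℚ ⊕ m) ⊗ v ≡ v ⊕ m ⊗ v
  lem₁ = RingSolver.solve-∀ ℚ-ring
  lem₂ : ∀ j v w → v ⊕ (j ⊗ v ⊕ w) ≡ (1ℚ ⊕ j) ⊗ v ⊕ w
  lem₂ = RingSolver.solve-∀ ℚ-ring

shift^-· : ∀ j q s m → shift^ j (q · s) m ≡ q ⊗ shift^ j s m
shift^-· zero    q s m       = refl
shift^-· (suc j) q s zero    = sym (ℚ.*-zeroʳ q)
shift^-· (suc j) q s (suc m) = shift^-· j q s m

shift^-shift : ∀ j s → shift^ j (shift s) ≈ₛ shift (shift^ j s)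
shift^-shift zero    s = 𝕊.refl
shift^-shift (suc j) s = shift-cong (shift^-shift j s)

θE≈ : ∀ a → θ (E a) ≈ₛ a · shift (E a)
θE≈ a = 𝕊.trans (θ-E a) (𝕊.trans (*-congˡ (const a) (X-*ₛ (E a))) (𝕊.sym (·≈const a (shift (E a)))))

x+-*ₛ : ∀ a s → (x+ a) *ₛ s ≈ₛ a · s +ₛ shift s
x+-*ₛ a s .at zero    = sym (ℚ.+-identityʳ (a ⊗ s 0))
x+-*ₛ a s .at (suc m) = cong (a ⊗ s (suc m) ⊕_) (trans (*-congʳ s tail≈ .at m) (𝕊.*-identityˡ s .at m))
  where
  tail≈ : tail (x+ a) ≈ₛ 1ₛ
  tail≈ .at zero    = refl
  tail≈ .at (suc m) = refl

-- (x + a)ᵏ/k! = ∑ⱼ xʲ/j! aᵏ⁻ʲ/(k - j)!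
x+-^ₛ : ∀ a k j → ((x+ a) ^ₛ k) j ≡ fromℕ (k !) ⊗ (inv! j ⊗ shift^ j (E a) k)
x+-^ₛ a zero    zero    = refl
x+-^ₛ a zero    (suc j) = sym (trans (cong (1ℚ ⊗_) (ℚ.*-zeroʳ (inv! (suc j)))) (ℚ.*-zeroʳ 1ℚ))
x+-^ₛ a (suc k) j = trans (x+-*ₛ a ((x+ a) ^ₛ k) .at j) (trans (step j) (cong (_⊗ (inv! j ⊗ shift^ j (E a) (suc k))) (sym (trans (fromℕ-* (suc k) (k !)) (ℚ.*-comm (fromℕ (suc k)) f)))))
  where
  open ≡-Reasoning
  f = fromℕ (k !)
  step : ∀ j → a ⊗ ((x+ a) ^ₛ k) j ⊕ shift ((x+ a) ^ₛ k) j ≡ f ⊗ fromℕ (suc k) ⊗ (inv! j ⊗ shift^ j (E a) (suc k))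
  step zero = begin
    a ⊗ ((x+ a) ^ₛ k) 0 ⊕ 0ℚ
      ≡⟨ cong (λ z → a ⊗ z ⊕ 0ℚ) (x+-^ₛ a k 0) ⟩
    a ⊗ (f ⊗ (1ℚ ⊗ E a k)) ⊕ 0ℚ
      ≡⟨ lem₁ a f (E a k) ⟩
    f ⊗ (a ⊗ E a k)
      ≡⟨ cong (f ⊗_) (θE≈ a .at (suc k)) ⟨
    f ⊗ (fromℕ (suc k) ⊗ E a (suc k))
      ≡⟨ lem₂ f (fromℕ (suc k)) (E a (suc k)) ⟩
    f ⊗ fromℕ (suc k) ⊗ (1ℚ ⊗ E a (suc k)) ∎
    where
    lem₁ : ∀ a f e → a ⊗ (f ⊗ (1ℚ ⊗ e)) ⊕ 0ℚ ≡ f ⊗ (a ⊗ e)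
    lem₁ = RingSolver.solve-∀ ℚ-ring
    lem₂ : ∀ f k e → f ⊗ (k ⊗ e) ≡ f ⊗ k ⊗ (1ℚ ⊗ e)
    lem₂ = RingSolver.solve-∀ ℚ-ring
  step (suc j) = begin
    a ⊗ ((x+ a) ^ₛ k) (suc j) ⊕ ((x+ a) ^ₛ k) j
      ≡⟨ cong₂ (λ y z → a ⊗ y ⊕ z) (x+-^ₛ a k (suc j)) (x+-^ₛ a k j) ⟩
    a ⊗ (f ⊗ (i′ ⊗ w)) ⊕ f ⊗ (inv! j ⊗ v)
      ≡⟨ cong (λ z → a ⊗ (f ⊗ (i′ ⊗ w)) ⊕ f ⊗ (z ⊗ v)) (sym (inv!-suc j)) ⟩
    a ⊗ (f ⊗ (i′ ⊗ w)) ⊕ f ⊗ (fromℕ (suc j) ⊗ i′ ⊗ v)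
      ≡⟨ lem₁ a f i′ w (fromℕ (suc j)) v ⟩
    f ⊗ (i′ ⊗ (fromℕ (suc j) ⊗ v ⊕ a ⊗ w))
      ≡⟨ cong (λ z → f ⊗ (i′ ⊗ (fromℕ (suc j) ⊗ v ⊕ z))) (sym (trans (shift^-cong (suc j) (θE≈ a) .at (suc k))
           (trans (shift^-· (suc j) a (shift (E a)) (suc k)) (cong (a ⊗_) (shift^-shift j (E a) .at k))))) ⟩
    f ⊗ (i′ ⊗ (fromℕ (suc j) ⊗ shift^ (suc j) (E a) (suc k) ⊕ shift^ (suc j) (θ (E a)) (suc k)))
      ≡⟨ cong (λ z → f ⊗ (i′ ⊗ z)) (θ-shift^ (suc j) (E a) (suc k)) ⟨
    f ⊗ (i′ ⊗ (fromℕ (suc k) ⊗ v))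
      ≡⟨ lem₂ f i′ (fromℕ (suc k)) v ⟩
    f ⊗ fromℕ (suc k) ⊗ (i′ ⊗ v) ∎
    where
    i′ = inv! (suc j)
    v  = shift^ j (E a) k
    w  = shift^ (suc j) (E a) k
    lem₁ : ∀ a f i w j v → a ⊗ (f ⊗ (i ⊗ w)) ⊕ f ⊗ (j ⊗ i ⊗ v) ≡ f ⊗ (i ⊗ (j ⊗ v ⊕ a ⊗ w))
    lem₁ = RingSolver.solve-∀ ℚ-ring
    lem₂ : ∀ f i k v → f ⊗ (i ⊗ (k ⊗ v)) ≡ f ⊗ k ⊗ (i ⊗ v)
    lem₂ = RingSolver.solve-∀ ℚ-ring

shift^-+ₛ : ∀ j s u m → shift^ j (s +ₛ u) m ≡ shift^ j s m ⊕ shift^ j u m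
shift^-+ₛ zero    s u m       = refl
shift^-+ₛ (suc j) s u zero    = refl
shift^-+ₛ (suc j) s u (suc m) = shift^-+ₛ j s u m

shift^-neg : ∀ j s m → shift^ j (-ₛ s) m ≡ ⊖ shift^ j s m
shift^-neg zero    s m       = refl
shift^-neg (suc j) s zero    = refl
shift^-neg (suc j) s (suc m) = shift^-neg j s m

2ℚ : ℚ
2ℚ = fromℕ 2

-- `factor b` is the coefficient of z^(b+1) in exp(xz) 2 sinh(z), and `Φ b` is that of z^(b+1) in
-- exp(yz) 2 sinh(z/2). Putting x = 2y and rescaling z by 2 identifies them up to 2^(b+1).
factor-Φ : ∀ b → scale 2ℚ (factor b) ≈ₛ 2ℚ ^ℚ suc b · Φ b
factor-Φ b .at j = begin
  2ℚ ^ℚ j ⊗ ((((x+ 1ℚ) ^ₛ suc b) j ⊝ ((x+ (⊖ 1ℚ)) ^ₛ suc b) j) /ₙ (suc b !))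
    ≡⟨ cong (2ℚ ^ℚ j ⊗_) (trans (/ₙ-inv _ (suc b !)) (cong (_⊗ inv! (suc b)) (cong₂ _⊝_ (x+-^ₛ 1ℚ (suc b) j) (x+-^ₛ (⊖ 1ℚ) (suc b) j)))) ⟩
  2ℚ ^ℚ j ⊗ ((f ⊗ (inv! j ⊗ p) ⊝ f ⊗ (inv! j ⊗ n)) ⊗ inv! (suc b))
    ≡⟨ lem₁ (2ℚ ^ℚ j) f (inv! j) p n (inv! (suc b)) ⟩
  (f ⊗ inv! (suc b)) ⊗ (inv! j ⊗ (2ℚ ^ℚ j ⊗ (p ⊕ (⊖ n))))
    ≡⟨ trans (cong (_⊗ (inv! j ⊗ (2ℚ ^ℚ j ⊗ (p ⊕ (⊖ n))))) (*-inv (suc b !) {{n!≢0 (suc b)}})) (ℚ.*-identityˡ _) ⟩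
  inv! j ⊗ (2ℚ ^ℚ j ⊗ (p ⊕ (⊖ n)))
    ≡⟨ cong (λ z → inv! j ⊗ (2ℚ ^ℚ j ⊗ z)) (trans (cong (p ⊕_) (sym (shift^-neg j (E (⊖ 1ℚ)) (suc b))))
         (trans (sym (shift^-+ₛ j (E 1ℚ) (-ₛ E (⊖ 1ℚ)) (suc b))) (shift^-cong j (ς-scale 2) .at (suc b)))) ⟩
  inv! j ⊗ (2ℚ ^ℚ j ⊗ shift^ j (scale 2ℚ (ς 1)) (suc b))
    ≡⟨ cong (inv! j ⊗_) (scale-shift^ 2ℚ j (ς 1) (suc b)) ⟨
  inv! j ⊗ (2ℚ ^ℚ suc b ⊗ shift^ j (ς 1) (suc b))
    ≡⟨ cong (λ z → inv! j ⊗ (2ℚ ^ℚ suc b ⊗ z)) (trans (shift^-cong j (𝕊.trans ς₁≈X𝒮 (X-*ₛ 𝒮)) .at (suc b)) (shift^-shift j 𝒮 .at (suc b))) ⟩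
  inv! j ⊗ (2ℚ ^ℚ suc b ⊗ shift^ j 𝒮 b)
    ≡⟨ lem₂ (inv! j) (2ℚ ^ℚ suc b) (shift^ j 𝒮 b) ⟩
  2ℚ ^ℚ suc b ⊗ Φ b j ∎
  where
  open ≡-Reasoning
  f = fromℕ (suc b !)
  p = shift^ j (E 1ℚ) (suc b)
  n = shift^ j (E (⊖ 1ℚ)) (suc b)
  lem₁ : ∀ t f i p n k → t ⊗ ((f ⊗ (i ⊗ p) ⊕ (⊖ (f ⊗ (i ⊗ n)))) ⊗ k) ≡ (f ⊗ k) ⊗ (i ⊗ (t ⊗ (p ⊕ (⊖ n))))
  lem₁ = RingSolver.solve-∀ ℚ-ring
  lem₂ : ∀ i t s → i ⊗ (t ⊗ s) ≡ t ⊗ (i ⊗ s)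
  lem₂ = RingSolver.solve-∀ ℚ-ring

∏factor : ∀ {n} → Vec ℕ n → Series
∏factor b = Vec.foldr′ _*ₛ_ 1ₛ (Vec.map factor b)

∏factor-∏Φ : ∀ {n} (b : Vec ℕ n) → scale 2ℚ (∏factor b) ≈ₛ const (2ℚ ^ℚ (sum b + n)) *ₛ ∏Φ b
∏factor-∏Φ [] = 𝕊.trans (scale-1ₛ 2ℚ) (𝕊.sym (𝕊.trans (*-congʳ 1ₛ (𝕊.sym 1ₛ≈const)) (𝕊.*-identityˡ 1ₛ)))
∏factor-∏Φ {suc n} (j ∷ b) = begin
  scale 2ℚ (factor j *ₛ ∏factor b)
    ≈⟨ scale-*ₛ 2ℚ (factor j) (∏factor b) ⟨
  scale 2ℚ (factor j) *ₛ scale 2ℚ (∏factor b)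
    ≈⟨ *ₛ-cong (𝕊.trans (factor-Φ j) (·≈const (2ℚ ^ℚ suc j) (Φ j))) (∏factor-∏Φ b) ⟩
  const (2ℚ ^ℚ suc j) *ₛ Φ j *ₛ (const (2ℚ ^ℚ (sum b + n)) *ₛ ∏Φ b)
    ≈⟨ solveₛ 4 (λ a f c p → a :* f :* (c :* p) := (a :* c) :* (f :* p)) 𝕊.refl (const (2ℚ ^ℚ suc j)) (Φ j) (const (2ℚ ^ℚ (sum b + n))) (∏Φ b) ⟩
  const (2ℚ ^ℚ suc j) *ₛ const (2ℚ ^ℚ (sum b + n)) *ₛ (Φ j *ₛ ∏Φ b)
    ≈⟨ *-congʳ (Φ j *ₛ ∏Φ b) (𝕊.trans (𝕊.sym (const-* (2ℚ ^ℚ suc j) (2ℚ ^ℚ (sum b + n)))) (const-cong (trans (sym (^ℚ-+ 2ℚ (suc j) (sum b + n))) (cong (2ℚ ^ℚ_) (arith j (sum b) n))))) ⟩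
  const (2ℚ ^ℚ (j + sum b + suc n)) *ₛ (Φ j *ₛ ∏Φ b) ∎
  where
  open ≈ₛ-Reasoning
  arith : ∀ j s n → suc j + (s + n) ≡ j + s + suc n
  arith = ℕSolver.solve-∀

½^-2^ : ∀ e → ℚ.½ ^ℚ e ⊗ 2ℚ ^ℚ e ≡ 1ℚ
½^-2^ e = trans (sym (^ℚ-distrib-⊗ ℚ.½ 2ℚ e)) (1^ℚ e)

-- The rescalings contribute 2^(sum b + n), and evaluating at 2x takes back 2ᴹ; the excess is 2ᵉ.
∏factor-coeff : ∀ {n} (b : Vec ℕ n) e M → sum b + n ≡ e + M → ℚ.½ ^ℚ e ⊗ ∏factor b M ≡ ∏Φ b M
∏factor-coeff {n} b e M eq = begin
  ℚ.½ ^ℚ e ⊗ F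
    ≡⟨ ℚ.*-identityʳ (ℚ.½ ^ℚ e ⊗ F) ⟨
  ℚ.½ ^ℚ e ⊗ F ⊗ 1ℚ
    ≡⟨ cong (ℚ.½ ^ℚ e ⊗ F ⊗_) (½^-2^ M) ⟨
  ℚ.½ ^ℚ e ⊗ F ⊗ (ℚ.½ ^ℚ M ⊗ 2ℚ ^ℚ M)
    ≡⟨ lem₁ (ℚ.½ ^ℚ e) F (ℚ.½ ^ℚ M) (2ℚ ^ℚ M) ⟩
  ℚ.½ ^ℚ e ⊗ ℚ.½ ^ℚ M ⊗ (2ℚ ^ℚ M ⊗ F)
    ≡⟨ cong (ℚ.½ ^ℚ e ⊗ ℚ.½ ^ℚ M ⊗_) (trans (∏factor-∏Φ b .at M) (trans (const-*ₛ (2ℚ ^ℚ (sum b + n)) (∏Φ b) .at M)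
         (cong (_⊗ ∏Φ b M) (trans (cong (2ℚ ^ℚ_) eq) (^ℚ-+ 2ℚ e M))))) ⟩
  ℚ.½ ^ℚ e ⊗ ℚ.½ ^ℚ M ⊗ (2ℚ ^ℚ e ⊗ 2ℚ ^ℚ M ⊗ ∏Φ b M)
    ≡⟨ lem₂ (ℚ.½ ^ℚ e) (ℚ.½ ^ℚ M) (2ℚ ^ℚ e) (2ℚ ^ℚ M) (∏Φ b M) ⟩
  (ℚ.½ ^ℚ e ⊗ 2ℚ ^ℚ e) ⊗ (ℚ.½ ^ℚ M ⊗ 2ℚ ^ℚ M) ⊗ ∏Φ b M
    ≡⟨ trans (cong₂ (λ x y → x ⊗ y ⊗ ∏Φ b M) (½^-2^ e) (½^-2^ M)) (trans (cong (_⊗ ∏Φ b M) (ℚ.*-identityˡ 1ℚ)) (ℚ.*-identityˡ (∏Φ b M))) ⟩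
  ∏Φ b M ∎
  where
  open ≡-Reasoning
  F = ∏factor b M
  lem₁ : ∀ a f h t → a ⊗ f ⊗ (h ⊗ t) ≡ a ⊗ h ⊗ (t ⊗ f)
  lem₁ = RingSolver.solve-∀ ℚ-ring
  lem₂ : ∀ a h c t p → a ⊗ h ⊗ (c ⊗ t ⊗ p) ≡ (a ⊗ c) ⊗ (h ⊗ t) ⊗ p
  lem₂ = RingSolver.solve-∀ ℚ-ring

-- Signs, parity, and the Bernoulli sum in 𝐂

private
  if-yes : ∀ {A : Set} (d : Dec A) {x y : ℚ} → A → (if ⌊ d ⌋ then x else y) ≡ x
  if-yes (yes _) _ = refl
  if-yes (no ¬a) a = contradiction a ¬a

bracket-≡ : ∀ {n} g (P : Polynomial n) b k → sum b + 2 * k ≡ 4 * g + n ∸ 3 → bracket g P b k ≡ (-1^ k) ⊗ coeff P b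
bracket-≡ {n} g P b k = if-yes (sum b + 2 * k ℕ.≟ 4 * g + n ∸ 3)

bracket-zero : ∀ {n} g (P : Polynomial n) b k → coeff P b ≡ 0ℚ → bracket g P b k ≡ 0ℚ
bracket-zero {n} g P b k c≡0 = go (sum b + 2 * k ℕ.≟ 4 * g + n ∸ 3)
  where
  go : ∀ {A : Set} (d : Dec A) → (if ⌊ d ⌋ then (-1^ k) ⊗ coeff P b else 0ℚ) ≡ 0ℚ
  go (yes _) = trans (cong ((-1^ k) ⊗_) c≡0) (ℚ.*-zeroʳ (-1^ k))
  go (no _)  = refl

-1^-square : ∀ k → (-1^ k) ⊗ (-1^ k) ≡ 1ℚ
-1^-square k = trans (sym (^ℚ-distrib-⊗ (⊖ 1ℚ) (⊖ 1ℚ) k)) (1^ℚ k)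

parity : ∀ w → ∃ λ k → w ≡ double k ⊎ w ≡ suc (double k)
parity zero    = 0 , inj₁ refl
parity (suc w) with parity w
... | k , inj₁ eq = k , inj₂ (cong suc eq)
... | k , inj₂ eq = suc k , inj₁ (cong suc eq)

⊗≡1⇒≢0 : ∀ {x y} → x ⊗ y ≡ 1ℚ → x ≢ 0ℚ
⊗≡1⇒≢0 {x} {y} eq refl = contradiction (trans (sym eq) (ℚ.*-zeroˡ y)) λ ()

-- The coefficient is 1/(4ᵏ (2k + 1)!), and its inverse is exhibited.
𝒮-double≢0 : ∀ k → 𝒮 (double k) ≢ 0ℚ
𝒮-double≢0 k = ⊗≡1⇒≢0 {y = 2ℚ ^ℚ double k ⊗ fromℕ (suc (double k) !)} (begin
  (h ⊗ p ⊗ i ⊕ (⊖ ((⊖ h) ⊗ (⊖ h) ^ℚ double k ⊗ i))) ⊗ (t ⊗ f)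
    ≡⟨ cong (λ z → (h ⊗ p ⊗ i ⊕ (⊖ ((⊖ h) ⊗ z ⊗ i))) ⊗ (t ⊗ f)) (neg-^-double h k) ⟩
  (h ⊗ p ⊗ i ⊕ (⊖ ((⊖ h) ⊗ p ⊗ i))) ⊗ (t ⊗ f)
    ≡⟨ lem h p i t f ⟩
  (h ⊕ h) ⊗ ((p ⊗ t) ⊗ (f ⊗ i))
    ≡⟨ cong₂ (λ x y → (h ⊕ h) ⊗ (x ⊗ y)) (½^-2^ (double k)) (*-inv (suc (double k) !) {{n!≢0 (suc (double k))}}) ⟩
  1ℚ ∎)
  where
  open ≡-Reasoning
  h = ℚ.½
  p = ℚ.½ ^ℚ double k
  i = inv! (suc (double k))
  t = 2ℚ ^ℚ double k
  f = fromℕ (suc (double k) !)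
  lem : ∀ h p i t f → (h ⊗ p ⊗ i ⊕ (⊖ ((⊖ h) ⊗ p ⊗ i))) ⊗ (t ⊗ f) ≡ (h ⊕ h) ⊗ ((p ⊗ t) ⊗ (f ⊗ i))
  lem = RingSolver.solve-∀ ℚ-ring

-- Up to 2⁻ᵉ the left side is the coefficient of xᵏ in xᵉ exp(x/2). The convention 1/r! = 0 for r <
-- 0 corresponds to the vanishing coefficients below xᵉ.
1/⊖! : ∀ e k → 1/ (k ℤ.⊖ e) ! ⊗ ℚ.½ ^ℚ k ≡ ℚ.½ ^ℚ e ⊗ shift^ e (E ℚ.½) k
1/⊖! e k with e ℕ.≤? k
... | yes e≤k with j , refl ← ℕ.m≤n⇒∃[o]m+o≡n e≤k = begin
  1/ (e + j ℤ.⊖ e) ! ⊗ ℚ.½ ^ℚ (e + j)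
    ≡⟨ cong₂ (λ z w → 1/ z ! ⊗ w) (trans (ℤ.⊖-≥ e≤k) (cong ℤ.+_ (ℕ.m+n∸m≡n e j))) (^ℚ-+ ℚ.½ e j) ⟩
  inv! j ⊗ (ℚ.½ ^ℚ e ⊗ ℚ.½ ^ℚ j)
    ≡⟨ lem (inv! j) (ℚ.½ ^ℚ e) (ℚ.½ ^ℚ j) ⟩
  ℚ.½ ^ℚ e ⊗ E ℚ.½ j
    ≡⟨ cong (ℚ.½ ^ℚ e ⊗_) (shift^-high e (E ℚ.½) j) ⟨
  ℚ.½ ^ℚ e ⊗ shift^ e (E ℚ.½) (e + j) ∎
  where
  open ≡-Reasoning
  lem : ∀ i x y → i ⊗ (x ⊗ y) ≡ x ⊗ (y ⊗ i)
  lem = RingSolver.solve-∀ ℚ-ring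
... | no e≰k = trans (cong (_⊗ ℚ.½ ^ℚ k) negative) (trans (ℚ.*-zeroˡ (ℚ.½ ^ℚ k))
    (sym (trans (cong (ℚ.½ ^ℚ e ⊗_) (shift^-low e (E ℚ.½) (ℕ.≰⇒> e≰k))) (ℚ.*-zeroʳ (ℚ.½ ^ℚ e)))))
  where
  negative : 1/ (k ℤ.⊖ e) ! ≡ 0ℚ
  negative with j , refl ← ℕ.m≤n⇒∃[o]m+o≡n (ℕ.≰⇒> e≰k) =
    cong (λ z → 1/ z !) (trans (ℤ.⊖-< (ℕ.≰⇒> e≰k)) (cong (λ w → ℤ.- (ℤ.+ w)) (trans (cong (_∸ k) (sym (ℕ.+-suc k j))) (ℕ.m+n∸m≡n k (suc j)))))

bernoulli-/ₙ : ∀ r k → bernoulli r /ₙ (r ! * 2 ^ k) ≡ ℚ.½ ^ℚ k ⊗ 𝔅 r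
bernoulli-/ₙ r k = begin
  fromℕ (r !) ⊗ 𝔅 r /ₙ (r ! * 2 ^ k)
    ≡⟨ trans (/ₙ-inv (fromℕ (r !) ⊗ 𝔅 r) (r ! * 2 ^ k)) (cong (fromℕ (r !) ⊗ 𝔅 r ⊗_) (trans (inv-* (r !) (2 ^ k)) (cong (inv! r ⊗_) (inv-^ 2 k)))) ⟩
  fromℕ (r !) ⊗ 𝔅 r ⊗ (inv! r ⊗ ℚ.½ ^ℚ k)
    ≡⟨ lem (fromℕ (r !)) (𝔅 r) (inv! r) (ℚ.½ ^ℚ k) ⟩
  fromℕ (r !) ⊗ inv! r ⊗ (ℚ.½ ^ℚ k ⊗ 𝔅 r)
    ≡⟨ trans (cong (_⊗ (ℚ.½ ^ℚ k ⊗ 𝔅 r)) (*-inv (r !) {{n!≢0 r}})) (ℚ.*-identityˡ _) ⟩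
  ℚ.½ ^ℚ k ⊗ 𝔅 r ∎
  where
  open ≡-Reasoning
  lem : ∀ f b i h → f ⊗ b ⊗ (i ⊗ h) ≡ f ⊗ i ⊗ (h ⊗ b)
  lem = RingSolver.solve-∀ ℚ-ring

1/_!-arguments : ∀ b g e → b + 3 ≡ e + 2 * g →
    ℤ.+ b ℤ.+ ℤ.+ 3 ℤ.- ℤ.+ (2 * g) ≡ ℤ.+ e
  × (∀ k → ℤ.+ (k + 2 * g) ℤ.- ℤ.+ b ℤ.- ℤ.+ 3 ≡ k ℤ.⊖ e)
1/_!-arguments b g e b+3≡ = first , second
  where
  open ≡-Reasoning
  first : ℤ.+ b ℤ.+ ℤ.+ 3 ℤ.- ℤ.+ (2 * g) ≡ ℤ.+ e
  first = trans (ℤ.m-n≡m⊖n (b + 3) (2 * g)) (trans (cong (ℤ._⊖ (2 * g)) b+3≡) (trans (ℤ.⊖-≥ (ℕ.m≤n+m (2 * g) e)) (cong ℤ.+_ (ℕ.m+n∸n≡m e (2 * g)))))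
  second : ∀ k → ℤ.+ (k + 2 * g) ℤ.- ℤ.+ b ℤ.- ℤ.+ 3 ≡ k ℤ.⊖ e
  second k = begin
    ℤ.+ (k + 2 * g) ℤ.- ℤ.+ b ℤ.- ℤ.+ 3
      ≡⟨ ℤ.+-assoc (ℤ.+ (k + 2 * g)) (ℤ.- ℤ.+ b) (ℤ.- ℤ.+ 3) ⟩
    ℤ.+ (k + 2 * g) ℤ.+ (ℤ.- ℤ.+ b ℤ.+ ℤ.- ℤ.+ 3)
      ≡⟨ cong (λ z → ℤ.+ (k + 2 * g) ℤ.+ z) (ℤ.neg-distrib-+ (ℤ.+ b) (ℤ.+ 3)) ⟨
    ℤ.+ (k + 2 * g) ℤ.- ℤ.+ (b + 3)
      ≡⟨ ℤ.m-n≡m⊖n (k + 2 * g) (b + 3) ⟩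
    (k + 2 * g) ℤ.⊖ (b + 3)
      ≡⟨ cong₂ ℤ._⊖_ (ℕ.+-comm k (2 * g)) (trans b+3≡ (ℕ.+-comm e (2 * g))) ⟩
    (2 * g + k) ℤ.⊖ (2 * g + e)
      ≡⟨ ℤ.+-cancelˡ-⊖ (2 * g) k e ⟩
    k ℤ.⊖ e ∎

-- The sum is a convolution of xᵉ exp(x/2) with x/(eˣ - 1), whose product is xᵉ ρ.
∑-bernoulli : ∀ (a : ℕ → ℤ.ℤ) e w N → (∀ k → a k ≡ k ℤ.⊖ e) → N ≡ e + w →
  ∑≤ N (λ k → 1/ (a k) ! ⊗ (bernoulli (N ∸ k) /ₙ ((N ∸ k) ! * 2 ^ k))) ≡ ℚ.½ ^ℚ e ⊗ ρ w
∑-bernoulli a e w N a≡ N≡ = begin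
  ∑≤ N (λ k → 1/ (a k) ! ⊗ (bernoulli (N ∸ k) /ₙ ((N ∸ k) ! * 2 ^ k)))
    ≡⟨ ∑-cong N (λ k _ → term k) ⟩
  ∑≤ N (λ k → ℚ.½ ^ℚ e ⊗ (shift^ e (E ℚ.½) k ⊗ 𝔅 (N ∸ k)))
    ≡⟨ ∑-distribˡ N (ℚ.½ ^ℚ e) (λ k → shift^ e (E ℚ.½) k ⊗ 𝔅 (N ∸ k)) ⟨
  ℚ.½ ^ℚ e ⊗ (shift^ e (E ℚ.½) *ₛ 𝔅) N
    ≡⟨ cong (ℚ.½ ^ℚ e ⊗_) coefficient ⟩
  ℚ.½ ^ℚ e ⊗ ρ w ∎
  where
  open ≡-Reasoning
  term : ∀ k → 1/ (a k) ! ⊗ (bernoulli (N ∸ k) /ₙ ((N ∸ k) ! * 2 ^ k)) ≡ ℚ.½ ^ℚ e ⊗ (shift^ e (E ℚ.½) k ⊗ 𝔅 (N ∸ k))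
  term k = begin
    1/ (a k) ! ⊗ (bernoulli (N ∸ k) /ₙ ((N ∸ k) ! * 2 ^ k))
      ≡⟨ cong₂ _⊗_ (cong 1/_! (a≡ k)) (bernoulli-/ₙ (N ∸ k) k) ⟩
    1/ (k ℤ.⊖ e) ! ⊗ (ℚ.½ ^ℚ k ⊗ 𝔅 (N ∸ k))
      ≡⟨ ℚ.*-assoc (1/ (k ℤ.⊖ e) !) (ℚ.½ ^ℚ k) (𝔅 (N ∸ k)) ⟨
    1/ (k ℤ.⊖ e) ! ⊗ ℚ.½ ^ℚ k ⊗ 𝔅 (N ∸ k)
      ≡⟨ cong (_⊗ 𝔅 (N ∸ k)) (1/⊖! e k) ⟩
    ℚ.½ ^ℚ e ⊗ shift^ e (E ℚ.½) k ⊗ 𝔅 (N ∸ k)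
      ≡⟨ ℚ.*-assoc (ℚ.½ ^ℚ e) (shift^ e (E ℚ.½) k) (𝔅 (N ∸ k)) ⟩
    ℚ.½ ^ℚ e ⊗ (shift^ e (E ℚ.½) k ⊗ 𝔅 (N ∸ k)) ∎
  coefficient : (shift^ e (E ℚ.½) *ₛ 𝔅) N ≡ ρ w
  coefficient = begin
    (shift^ e (E ℚ.½) *ₛ 𝔅) N          ≡⟨ shift^-*ₛ e (E ℚ.½) 𝔅 .at N ⟩
    shift^ e (E ℚ.½ *ₛ 𝔅) N            ≡⟨ cong (shift^ e (E ℚ.½ *ₛ 𝔅)) N≡ ⟩
    shift^ e (E ℚ.½ *ₛ 𝔅) (e + w)      ≡⟨ shift^-high e (E ℚ.½ *ₛ 𝔅) w ⟩
    (E ℚ.½ *ₛ 𝔅) w                     ≡⟨ ρ≈E½*𝔅 .at w ⟨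
    ρ w                                ∎

𝐂-formula : ∀ b g n e w → b + 3 ≡ e + 2 * g → 2 * g + n ≡ e + w → 𝐂 b g n ≡ inv! e ⊗ (ℚ.½ ^ℚ e ⊗ ρ w)
𝐂-formula b g n e w b+3≡ N≡ with first , second ← 1/_!-arguments b g e b+3≡ =
  cong₂ _⊗_ (cong 1/_! first)
    (∑-bernoulli (λ k → ℤ.+ (k + 2 * g) ℤ.- ℤ.+ b ℤ.- ℤ.+ 3) e w (2 * g + n) second N≡)

-- Were `w` even, the equations would combine to an even number exceeding another even number by 3.
codegree-odd : ∀ g N M s q w → 2 * g + N ≡ 3 + M → s + N ≡ q * 2 → s + w ≡ M + 2 * g → ∃ λ k → w ≡ suc (double k)
codegree-odd g N M s q w 2g+N≡ s+N≡ s+w≡ with parity w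
... | k , inj₂ odd  = k , odd
... | k , inj₁ even = contradiction
    (∣m+n∣m⇒∣n {2} {2 * (k + s)} {3} (subst (2 ∣_) twice (m∣m*n (2 * g + q))) (m∣m*n (k + s))) (from-no (2 ∣? 3))
  where
  open ≡-Reasoning
  arith₁ : ∀ g q → 2 * (2 * g + q) ≡ 2 * g + (2 * g + q * 2)
  arith₁ = ℕSolver.solve-∀
  arith₂ : ∀ g s n → g + (g + (s + n)) ≡ g + n + g + s
  arith₂ = ℕSolver.solve-∀
  arith₃ : ∀ s k → 3 + (s + 2 * k) + s ≡ 2 * (k + s) + 3
  arith₃ = ℕSolver.solve-∀
  twice : 2 * (2 * g + q) ≡ 2 * (k + s) + 3
  twice = begin
    2 * (2 * g + q)                        ≡⟨ arith₁ g q ⟩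
    2 * g + (2 * g + q * 2)                ≡⟨ cong (λ z → 2 * g + (2 * g + z)) s+N≡ ⟨
    2 * g + (2 * g + (s + N))              ≡⟨ arith₂ (2 * g) s N ⟩
    2 * g + N + 2 * g + s                  ≡⟨ cong (λ z → z + 2 * g + s) 2g+N≡ ⟩
    3 + (M + 2 * g) + s                    ≡⟨ cong (λ z → 3 + z + s) (trans (sym s+w≡) (cong (s +_) (trans even (double≡2* k)))) ⟩
    3 + (s + 2 * k) + s                    ≡⟨ arith₃ s k ⟩
    2 * (k + s) + 3                        ∎

-- The claims for an arbitrary polynomial with the Hurwitz values

module _ (g n M : ℕ) (1≤g : 1 ≤ g) (2g+N≡ : 2 * g + suc n ≡ 3 + M) where
  private
    t≡ : 2 * g + suc n ∸ 1 ≡ 2 + M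
    t≡ = cong (_∸ 1) 2g+N≡

    h≡ : 4 * g + suc n ∸ 3 ≡ M + 2 * g
    h≡ = cong (_∸ 3) (trans (arith g (suc n)) (cong (_+ 2 * g) 2g+N≡))
      where
      arith : ∀ g N → 4 * g + N ≡ 2 * g + N + 2 * g
      arith = ℕSolver.solve-∀

    c : Vec ℕ (suc n) → ℚ
    c = hurwitzCoeff g M

  hurwitzPolynomial-correct : IsHurwitzPolynomial g (hurwitzPolynomial g M (suc n))
  hurwitzPolynomial-correct β@(_ ∷ _) pos = trans (evaluate-hurwitz g M β) (sym (hurwitz-formula g M β pos t≡))

  hurwitz-symmetric : ∀ π b → c (permute π b) ≡ c b
  hurwitz-symmetric π b = cong₂ (λ s p → ρ-cofactor g M s ⊗ (fromℕ (M !) ⊗ p)) (sum-permute π b) (∏Φ-permute π b .at M)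

  -- At the top power of the first variable the cofactor is `ρ 0`, which is 1, the factorials
  -- cancel, and the coefficient is `𝒮 (2 * g)`.
  hurwitz-highest : ∃ λ (b : Vec ℕ (suc n)) → sum b ≡ M + 2 * g × c b ≢ 0ℚ
  hurwitz-highest = axis n (M + 2 * g) , sum-axis n (M + 2 * g) , λ c≡0 → 𝒮-double≢0 g (begin
    𝒮 (double g)
      ≡⟨ cong 𝒮 (double≡2* g) ⟩
    𝒮 (2 * g)
      ≡⟨ trans (sym (*-inv-cancel (M !) {{n!≢0 M}} (𝒮 (2 * g)))) (lem (inv! M) (fromℕ (M !)) (𝒮 (2 * g))) ⟩
    1ℚ ⊗ (fromℕ (M !) ⊗ (inv! M ⊗ 𝒮 (2 * g)))
      ≡⟨ cong₂ (λ x y → x ⊗ (fromℕ (M !) ⊗ (inv! M ⊗ y))) cofactor (shift^-high M 𝒮 (2 * g)) ⟨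
    ρ-cofactor g M (sum (axis n (M + 2 * g))) ⊗ (fromℕ (M !) ⊗ Φ (M + 2 * g) M)
      ≡⟨ cong (λ z → ρ-cofactor g M (sum (axis n (M + 2 * g))) ⊗ (fromℕ (M !) ⊗ z)) (∏Φ-axis n (M + 2 * g) .at M) ⟨
    c (axis n (M + 2 * g))
      ≡⟨ c≡0 ⟩
    0ℚ ∎)
    where
    open ≡-Reasoning
    cofactor : ρ-cofactor g M (sum (axis n (M + 2 * g))) ≡ 1ℚ
    cofactor = trans (cong (ρ-cofactor g M) (sum-axis n (M + 2 * g))) (trans (ρ-cofactor-≤ g M ℕ.≤-refl) (cong ρ (ℕ.n∸n≡0 (M + 2 * g))))
    lem : ∀ i f s → i ⊗ (f ⊗ s) ≡ 1ℚ ⊗ (f ⊗ (i ⊗ s))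
    lem = RingSolver.solve-∀ ℚ-ring

  coeff-lowest : ∀ b → c b ≢ 0ℚ → M ≤ sum b
  coeff-lowest b c≢0 = by-cases (M ℕ.≤? sum b)
    where
    by-cases : Dec (M ≤ sum b) → M ≤ sum b
    by-cases (yes p) = p
    by-cases (no ¬p) = contradiction (trans (cong (λ z → ρ-cofactor g M (sum b) ⊗ (fromℕ (M !) ⊗ z)) (∏Φ-low b (ℕ.≰⇒> ¬p)))
      (trans (cong (ρ-cofactor g M (sum b) ⊗_) (ℚ.*-zeroʳ (fromℕ (M !)))) (ℚ.*-zeroʳ (ρ-cofactor g M (sum b))))) c≢0

  coeff-lowest-≡ : ∀ b → sum b ≡ M → c b ≡ multinomial M b ⊗ ρ (2 * g)
  coeff-lowest-≡ b sum≡ = begin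
    ρ-cofactor g M (sum b) ⊗ (fromℕ (M !) ⊗ ∏Φ b M)
      ≡⟨ cong₂ (λ x y → x ⊗ (fromℕ (M !) ⊗ y)) cofactor (trans (cong (∏Φ b) (sym sum≡)) (∏Φ-top b)) ⟩
    ρ (2 * g) ⊗ (fromℕ (M !) ⊗ inv (Vec.foldr′ _*_ 1 (Vec.map _! b)))
      ≡⟨ trans (cong (ρ (2 * g) ⊗_) (sym (/ₙ-inv (fromℕ (M !)) (Vec.foldr′ _*_ 1 (Vec.map _! b))))) (ℚ.*-comm (ρ (2 * g)) (multinomial M b)) ⟩
    multinomial M b ⊗ ρ (2 * g) ∎
    where
    open ≡-Reasoning
    cofactor : ρ-cofactor g M (sum b) ≡ ρ (2 * g)
    cofactor = trans (cong (ρ-cofactor g M) sum≡) (trans (ρ-cofactor-≤ g M (ℕ.m≤m+n M (2 * g))) (cong ρ (ℕ.m+n∸m≡n M (2 * g))))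

  -- The coefficient of the M-th power of the first variable is `ρ (2 * g)`, nonzero by the
  -- positivity of `ρˢ`.
  hurwitz-lowest : ∃ λ (b : Vec ℕ (suc n)) → sum b ≡ M × c b ≢ 0ℚ
  hurwitz-lowest = axis n M , sum-axis n M , λ c≡0 → ρ-even≢0 g (begin
    ρ (double g)
      ≡⟨ cong ρ (double≡2* g) ⟩
    ρ (2 * g)
      ≡⟨ trans (sym (*-inv-cancel (M !) {{n!≢0 M}} (ρ (2 * g)))) (lem (inv! M) (fromℕ (M !)) (ρ (2 * g))) ⟩
    ρ (2 * g) ⊗ (fromℕ (M !) ⊗ inv! M)
      ≡⟨ cong₂ (λ x y → x ⊗ (fromℕ (M !) ⊗ y)) cofactor (trans (∏Φ-axis n M .at M) (Φ-top M)) ⟨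
    c (axis n M)
      ≡⟨ c≡0 ⟩
    0ℚ ∎)
    where
    open ≡-Reasoning
    cofactor : ρ-cofactor g M (sum (axis n M)) ≡ ρ (2 * g)
    cofactor = trans (cong (ρ-cofactor g M) (sum-axis n M)) (trans (ρ-cofactor-≤ g M (ℕ.m≤m+n M (2 * g))) (cong ρ (ℕ.m+n∸m≡n M (2 * g))))
    lem : ∀ i f s → i ⊗ (f ⊗ s) ≡ s ⊗ (f ⊗ i)
    lem = RingSolver.solve-∀ ℚ-ring

  coeff-𝐂Ĉ : ∀ b k → 2 * g ≤ sum b + 3 → sum b + 2 * k ≡ M + 2 * g → c b ≡ 𝐂 (sum b) g (suc n) ⊗ Ĉ g b
  coeff-𝐂Ĉ b k 2g≤ sum≡ = begin
    ρ-cofactor g M (sum b) ⊗ (fromℕ (M !) ⊗ ∏Φ b M)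
      ≡⟨ cong₂ (λ x y → x ⊗ (fromℕ (M !) ⊗ y)) cofactor (sym (∏factor-coeff b e M total)) ⟩
    ρ (2 * k) ⊗ (fromℕ (M !) ⊗ (ℚ.½ ^ℚ e ⊗ ∏factor b M))
      -- A factor e!/e! is inserted: `𝐂` takes 1/e! and `Ĉ` takes e!. The power 2⁻ᵉ, left over from
      -- the comparison of `∏Φ` with `∏factor`, belongs to the Bernoulli sum.
      ≡⟨ ℚ.*-identityˡ _ ⟨
    1ℚ ⊗ (ρ (2 * k) ⊗ (fromℕ (M !) ⊗ (ℚ.½ ^ℚ e ⊗ ∏factor b M)))
      ≡⟨ cong (_⊗ (ρ (2 * k) ⊗ (fromℕ (M !) ⊗ (ℚ.½ ^ℚ e ⊗ ∏factor b M)))) (*-inv (e !) {{n!≢0 e}}) ⟨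
    fromℕ (e !) ⊗ inv! e ⊗ (ρ (2 * k) ⊗ (fromℕ (M !) ⊗ (ℚ.½ ^ℚ e ⊗ ∏factor b M)))
      ≡⟨ lem (fromℕ (e !)) (inv! e) (ρ (2 * k)) (fromℕ (M !)) (ℚ.½ ^ℚ e) (∏factor b M) ⟩
    inv! e ⊗ (ℚ.½ ^ℚ e ⊗ ρ (2 * k)) ⊗ (fromℕ (M !) ⊗ fromℕ (e !) ⊗ ∏factor b M)
      ≡⟨ cong₂ (λ x y → x ⊗ (y ⊗ ∏factor b M)) (𝐂-formula (sum b) g (suc n) e (2 * k) e≡ w≡) (fromℕ-* (M !) (e !)) ⟨
    𝐂 (sum b) g (suc n) ⊗ (fromℕ (M ! * e !) ⊗ ∏factor b M)
      ≡⟨ cong (λ m → 𝐂 (sum b) g (suc n) ⊗ (fromℕ (m ! * e !) ⊗ ∏factor b m)) (cong (_∸ 3) 2g+N≡) ⟨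
    𝐂 (sum b) g (suc n) ⊗ Ĉ g b ∎
    where
    open ≡-Reasoning
    e = sum b + 3 ∸ 2 * g
    e≡ : sum b + 3 ≡ e + 2 * g
    e≡ = sym (ℕ.m∸n+n≡m 2g≤)
    w≡ : 2 * g + suc n ≡ e + 2 * k
    w≡ = ℕ.+-cancelʳ-≡ (2 * g) _ _ (begin
      2 * g + suc n + 2 * g      ≡⟨ cong (_+ 2 * g) 2g+N≡ ⟩
      3 + M + 2 * g          ≡⟨ cong (3 +_) sum≡ ⟨
      3 + (sum b + 2 * k)    ≡⟨ arith₁ (sum b) (2 * k) ⟩
      sum b + 3 + 2 * k      ≡⟨ cong (_+ 2 * k) e≡ ⟩
      e + 2 * g + 2 * k      ≡⟨ arith₂ e (2 * g) (2 * k) ⟩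
      e + 2 * k + 2 * g      ∎)
      where
      arith₁ : ∀ s k → 3 + (s + k) ≡ s + 3 + k
      arith₁ = ℕSolver.solve-∀
      arith₂ : ∀ a b c → a + b + c ≡ a + c + b
      arith₂ = ℕSolver.solve-∀
    total : sum b + suc n ≡ e + M
    total = ℕ.+-cancelʳ-≡ (3 + 2 * g) _ _ (begin
      sum b + suc n + (3 + 2 * g)      ≡⟨ arith₁ (sum b) (suc n) (2 * g) ⟩
      sum b + 3 + (2 * g + suc n)      ≡⟨ cong₂ _+_ e≡ 2g+N≡ ⟩
      e + 2 * g + (3 + M)          ≡⟨ arith₂ e (2 * g) M ⟩
      e + M + (3 + 2 * g)          ∎)
      where
      arith₁ : ∀ s n g → s + n + (3 + g) ≡ s + 3 + (g + n)
      arith₁ = ℕSolver.solve-∀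
      arith₂ : ∀ e g m → e + g + (3 + m) ≡ e + m + (3 + g)
      arith₂ = ℕSolver.solve-∀
    cofactor : ρ-cofactor g M (sum b) ≡ ρ (2 * k)
    cofactor = trans (ρ-cofactor-≤ g M (subst (sum b ≤_) sum≡ (ℕ.m≤m+n (sum b) (2 * k))))
      (cong ρ (trans (cong (_∸ sum b) (sym sum≡)) (ℕ.m+n∸m≡n (sum b) (2 * k))))
    lem : ∀ f i r m p q → f ⊗ i ⊗ (r ⊗ (m ⊗ (p ⊗ q))) ≡ i ⊗ (p ⊗ r) ⊗ (m ⊗ f ⊗ q)
    lem = RingSolver.solve-∀ ℚ-ring

  -- An even sum b + n makes the codegree odd, and ρ is an even series.
  coeff-parity : ∀ b → 2 ∣ sum b + suc n → c b ≡ 0ℚ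
  coeff-parity b (divides q sum+N≡) = by-cases (sum b ℕ.≤? M + 2 * g)
    where
    vanish : ρ-cofactor g M (sum b) ≡ 0ℚ → c b ≡ 0ℚ
    vanish eq = trans (cong (_⊗ (fromℕ (M !) ⊗ ∏Φ b M)) eq) (ℚ.*-zeroˡ (fromℕ (M !) ⊗ ∏Φ b M))
    odd : sum b ≤ M + 2 * g → ∃ λ k → M + 2 * g ∸ sum b ≡ suc (double k)
    odd p = codegree-odd g (suc n) M (sum b) q (M + 2 * g ∸ sum b) 2g+N≡ sum+N≡ (ℕ.m+[n∸m]≡n p)
    by-cases : Dec (sum b ≤ M + 2 * g) → c b ≡ 0ℚ
    by-cases (no ¬p) = vanish (ρ-cofactor-> g M (ℕ.≰⇒> ¬p))
    by-cases (yes p) = vanish (trans (ρ-cofactor-≤ g M p) (trans (cong ρ (proj₂ (odd p))) (ρ-odd (proj₁ (odd p)))))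

  -- The coefficient of x²ᵍ in 2𝔅(x/2) - 𝔅(x) has the factor 2/2²ᵍ - 1. Since g ≥ 1, `2 * g ∸ 1` is
  -- a true predecessor, and the factor becomes the stated fraction.
  ρ-bernoulli : ρ (2 * g) ≡ ((1ℚ ⊝ fromℕ (2 ^ (2 * g ∸ 1))) /ₙ (2 ^ (2 * g ∸ 1) * (2 * g) !)) ⊗ bernoulli (2 * g)
  ρ-bernoulli = sym (begin
    ((1ℚ ⊝ p) /ₙ (2 ^ (2 * g ∸ 1) * (2 * g) !)) ⊗ (f ⊗ B)
      ≡⟨ cong (_⊗ (f ⊗ B)) (trans (/ₙ-inv (1ℚ ⊝ p) (2 ^ (2 * g ∸ 1) * (2 * g) !)) (cong ((1ℚ ⊝ p) ⊗_) (inv-* (2 ^ (2 * g ∸ 1)) ((2 * g) !)))) ⟩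
    (1ℚ ⊝ p) ⊗ (i ⊗ inv! (2 * g)) ⊗ (f ⊗ B)
      ≡⟨ lem₁ p i (inv! (2 * g)) f B ⟩
    (f ⊗ inv! (2 * g)) ⊗ ((i ⊕ (⊖ (p ⊗ i))) ⊗ B)
      ≡⟨ cong₂ (λ x y → x ⊗ ((i ⊕ (⊖ y)) ⊗ B)) (*-inv ((2 * g) !) {{n!≢0 (2 * g)}}) (*-inv (2 ^ (2 * g ∸ 1)) {{ℕ.m^n≢0 2 (2 * g ∸ 1)}}) ⟩
    1ℚ ⊗ ((i ⊕ (⊖ 1ℚ)) ⊗ B)
      ≡⟨ cong (λ z → 1ℚ ⊗ ((z ⊕ (⊖ 1ℚ)) ⊗ B)) (trans (inv-^ 2 (2 * g ∸ 1)) halves) ⟩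
    1ℚ ⊗ ((2ℚ ⊗ ℚ.½ ^ℚ (2 * g) ⊕ (⊖ 1ℚ)) ⊗ B)
      ≡⟨ lem₂ 2ℚ (ℚ.½ ^ℚ (2 * g)) B ⟩
    2ℚ ⊗ (ℚ.½ ^ℚ (2 * g) ⊗ B) ⊕ (⊖ B)
      ≡⟨ cong (_⊕ (⊖ B)) (const-*ₛ 2ℚ (scale ℚ.½ 𝔅) .at (2 * g)) ⟨
    (const 2ℚ *ₛ scale ℚ.½ 𝔅) (2 * g) ⊕ (⊖ B)
      ≡⟨ ρ≈𝔅 .at (2 * g) ⟨
    ρ (2 * g) ∎)
    where
    open ≡-Reasoning
    p = fromℕ (2 ^ (2 * g ∸ 1))
    i = inv (2 ^ (2 * g ∸ 1))
    f = fromℕ ((2 * g) !)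
    B = 𝔅 (2 * g)
    halves : ℚ.½ ^ℚ (2 * g ∸ 1) ≡ 2ℚ ⊗ ℚ.½ ^ℚ (2 * g)
    halves = trans (lem₃ (ℚ.½ ^ℚ (2 * g ∸ 1))) (cong (λ k → 2ℚ ⊗ ℚ.½ ^ℚ k) (ℕ.m+[n∸m]≡n {1} {2 * g} (ℕ.≤-trans 1≤g (ℕ.m≤m+n g (g + 0)))))
      where
      lem₃ : ∀ x → x ≡ (1ℚ ⊕ 1ℚ) ⊗ (ℚ.½ ⊗ x)
      lem₃ = RingSolver.solve-∀ ℚ-ring
    lem₁ : ∀ p i j f b → (1ℚ ⊕ (⊖ p)) ⊗ (i ⊗ j) ⊗ (f ⊗ b) ≡ (f ⊗ j) ⊗ ((i ⊕ (⊖ (p ⊗ i))) ⊗ b)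
    lem₁ = RingSolver.solve-∀ ℚ-ring
    lem₂ : ∀ t h b → 1ℚ ⊗ ((t ⊗ h ⊕ (⊖ 1ℚ)) ⊗ b) ≡ t ⊗ (h ⊗ b) ⊕ (⊖ b)
    lem₂ = RingSolver.solve-∀ ℚ-ring

  module _ (P : Polynomial (suc n)) (hyp : IsHurwitzPolynomial g P) where

    coeff≡ : ∀ b → coeff P b ≡ c b
    coeff≡ = coeff-unique P (hurwitzPolynomial g M (suc n)) (λ β pos → trans (hyp β pos) (sym (hurwitzPolynomial-correct β pos)))

    private
      ≢0 : ∀ b → coeff P b ≢ 0ℚ → c b ≢ 0ℚ
      ≢0 b p q = p (trans (coeff≡ b) q)
      c≢0 : ∀ b → c b ≢ 0ℚ → coeff P b ≢ 0ℚ
      c≢0 b p q = p (trans (sym (coeff≡ b)) q)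

    symmetric : Symmetric P
    symmetric π b = trans (coeff≡ (permute π b)) (trans (hurwitz-symmetric π b) (sym (coeff≡ b)))

    highest : HasHighestDegree P (4 * g + suc n ∸ 3)
    highest = let b , sum≡ , c≢ = hurwitz-highest in
      (λ b p → subst (sum b ≤_) (sym h≡) (hurwitzCoeff-≤ g M b (≢0 b p))) , b , trans sum≡ (sym h≡) , c≢0 b c≢

    lowest : HasLowestDegree P M
    lowest = let b , sum≡ , c≢ = hurwitz-lowest in (λ b p → coeff-lowest b (≢0 b p)) , b , sum≡ , c≢0 b c≢

    bracket-𝐂Ĉ : ∀ b k → 2 * g ≤ sum b + 3 → sum b + 2 * k ≡ 4 * g + suc n ∸ 3 →
      (-1^ ((4 * g + suc n ∸ 3 ∸ sum b) / 2)) ⊗ bracket g P b k ≡ 𝐂 (sum b) g (suc n) ⊗ Ĉ g b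
    bracket-𝐂Ĉ b k 2g≤ sum≡ = begin
      (-1^ ((4 * g + suc n ∸ 3 ∸ sum b) / 2)) ⊗ bracket g P b k
        ≡⟨ cong₂ (λ j x → (-1^ j) ⊗ x) quotient≡k (trans (bracket-≡ g P b k sum≡) (cong ((-1^ k) ⊗_) (coeff≡ b))) ⟩
      -- The sign in front has exponent exactly `k` and cancels the one built into `bracket`.
      (-1^ k) ⊗ ((-1^ k) ⊗ c b)
        ≡⟨ trans (sym (ℚ.*-assoc (-1^ k) (-1^ k) (c b))) (trans (cong (_⊗ c b) (-1^-square k)) (ℚ.*-identityˡ (c b))) ⟩
      c b
        ≡⟨ coeff-𝐂Ĉ b k 2g≤ (trans sum≡ h≡) ⟩
      𝐂 (sum b) g (suc n) ⊗ Ĉ g b ∎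
      where
      open ≡-Reasoning
      quotient≡k : (4 * g + suc n ∸ 3 ∸ sum b) / 2 ≡ k
      quotient≡k = trans (cong (λ z → (z ∸ sum b) / 2) (sym sum≡)) (trans (cong (_/ 2) (trans (ℕ.m+n∸m≡n (sum b) (2 * k)) (ℕ.*-comm 2 k))) (ℕ.m*n/n≡m k 2))

    bracket-parity : ∀ b → 2 ∣ sum b + suc n → coeff P b ≡ 0ℚ × (∀ k → bracket g P b k ≡ 0ℚ)
    bracket-parity b even = zero-coeff , λ k → bracket-zero g P b k zero-coeff
      where
      zero-coeff : coeff P b ≡ 0ℚ
      zero-coeff = trans (coeff≡ b) (coeff-parity b even)

    bracket-lowest : ∀ b → sum b ≡ M → bracket g P b g ≡
      (-1^ g) ⊗ multinomial M b ⊗ ((1ℚ ⊝ fromℕ (2 ^ (2 * g ∸ 1))) /ₙ (2 ^ (2 * g ∸ 1) * (2 * g) !)) ⊗ bernoulli (2 * g)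
    bracket-lowest b sum≡ = trans (bracket-≡ g P b g (trans (cong (_+ 2 * g) sum≡) (sym h≡))) (trans
      (cong ((-1^ g) ⊗_) (trans (coeff≡ b) (trans (coeff-lowest-≡ b sum≡) (cong (multinomial M b ⊗_) ρ-bernoulli))))
      (lem (-1^ g) (multinomial M b) ((1ℚ ⊝ fromℕ (2 ^ (2 * g ∸ 1))) /ₙ (2 ^ (2 * g ∸ 1) * (2 * g) !)) (bernoulli (2 * g))))
      where
      lem : ∀ a m q b → a ⊗ (m ⊗ (q ⊗ b)) ≡ a ⊗ m ⊗ q ⊗ b
      lem = RingSolver.solve-∀ ℚ-ring

-- From g ≥ 1 and at least one variable, 2g + n is at least 3, so the truncated difference M = 2g +
-- n - 3 is exact.
M-spec : ∀ g n → 1 ≤ g → 2 * g + suc n ≡ 3 + (2 * g + suc n ∸ 3)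
M-spec g n 1≤g = sym (ℕ.m+[n∸m]≡n {3} {2 * g + suc n} (ℕ.+-mono-≤ (ℕ.*-monoʳ-≤ 2 1≤g) (s≤s (z≤n {n}))))

theorem3p8 : ∀ (g n : ℕ) → 1 ≤ g → 1 ≤ n →
    (∃ λ (P : Polynomial n) → IsHurwitzPolynomial g P)
    × (∀ (P : Polynomial n) → IsHurwitzPolynomial g P →
    Symmetric P
    × HasHighestDegree P (4 * g + n ∸ 3)
    × HasLowestDegree P (2 * g + n ∸ 3)
    × (∀ (b : Vec ℕ n) (k : ℕ) →
    2 * g ≤ sum b + 3 → sum b + 2 * k ≡ 4 * g + n ∸ 3 →
    (-1^ ((4 * g + n ∸ 3 ∸ sum b) / 2)) ℚ.* bracket g P b k
    ≡ 𝐂 (sum b) g n ℚ.* Ĉ g b)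
    × (∀ (b : Vec ℕ n) → 2 ∣ sum b + n →
    coeff P b ≡ 0ℚ × (∀ (k : ℕ) → bracket g P b k ≡ 0ℚ))
    × (∀ (b : Vec ℕ n) → sum b ≡ 2 * g + n ∸ 3 →
    bracket g P b g
    ≡ (-1^ g) ℚ.* multinomial (2 * g + n ∸ 3) b
    ℚ.* ((1ℚ ℚ.- fromℕ (2 ^ (2 * g ∸ 1))) /ₙ (2 ^ (2 * g ∸ 1) * (2 * g) !))
    ℚ.* bernoulli (2 * g)))
theorem3p8 g (suc n) 1≤g _ =
    (hurwitzPolynomial g (2 * g + suc n ∸ 3) (suc n) , hurwitzPolynomial-correct g n (2 * g + suc n ∸ 3) 1≤g (M-spec g n 1≤g))
  , λ P hyp →
      symmetric g n (2 * g + suc n ∸ 3) 1≤g (M-spec g n 1≤g) P hyp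
    , highest g n (2 * g + suc n ∸ 3) 1≤g (M-spec g n 1≤g) P hyp
    , lowest g n (2 * g + suc n ∸ 3) 1≤g (M-spec g n 1≤g) P hyp
    , bracket-𝐂Ĉ g n (2 * g + suc n ∸ 3) 1≤g (M-spec g n 1≤g) P hyp
    , bracket-parity g n (2 * g + suc n ∸ 3) 1≤g (M-spec g n 1≤g) P hyp
    , bracket-lowest g n (2 * g + suc n ∸ 3) 1≤g (M-spec g n 1≤g) P hyp
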